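{- Let $\mathcal{P}$ be a non-trivial hereditary property of binary matroids with $\chi_c(\mathcal{P})=k$. Then there exists a thin hereditary property $\mathcal{T}$ such that almost every matroid in $\mathcal{P}$ belongs to $\mathrm{Ext}^k(\mathcal{T})$, i.e. $\lim_{n\to\infty}|\mathcal{P}^n\cap \mathrm{Ext}^k(\mathcal{T})|/|\mathcal{P}^n|=1$.
   Context: A binary projective space is a set $V=W\setminus\{0\}$ where $W$ is a finite-dimensional $\mathbb{F}_2$-vector space; its dimension $\dim(V)$ is $\dim_{\mathbb{F}_2}(W)$. A subspace of $V$ is a set $U\setminus\{0\}$ with $U$ a linear subspace of $W$; codimension is $\dim(V)-\dim(U)$. A (simple binary) matroid is a function $M:V(M)\to\{0,1\}$ with $V(M)$ a binary projective space, $\dim(M)=\dim(V(M))$; $M[U]$ is the restriction to a subspace $U$. Matroids $M_1,M_2$ are isomorphic if $M_1=M_2\circ\phi$ for an invertible linear map $\phi$. A matroid property is a set of matroids closed under isomorphism; hereditary if closed under restriction to subspaces; non-trivial if it contains matroids of arbitrarily large dimension. $\mathcal{P}^n$ is the set of matroids in $\mathcal{P}$ on $\mathbb{F}_2^n\setminus\{0\}$. For $k\ge0$, $\mathrm{Ext}^k(M)$ is the set of matroids $M'$ with $\dim(M')\le\dim(M)+k$ such that $M$ is (isomorphic to) the restriction of $M'$ to a subspace of codimension at most $k$ in $V(M')$; $\mathrm{Ext}^k(\mathcal{P})=\bigcup_{M\in\mathcal{P}}\mathrm{Ext}^k(M)$. Let $\mathcal{O}$ (resp. $\mathcal{I}$)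 be the property of all identically $0$ (resp. $1$) matroids; $\mathcal{M}(k,0)=\mathrm{Ext}^k(\mathcal{O})$, $\mathcal{M}(k,1)=\mathrm{Ext}^k(\mathcal{I})$. The critical number $\chi_c(\mathcal{P})$ of a non-trivial hereditary property $\mathcal{P}$ is the maximum integer $k\ge0$ with $\mathcal{M}(k,i)\subseteq\mathcal{P}$ for some $i\in\{0,1\}$. A non-trivial hereditary property is thin if its critical number is $0$. -}

module Defs where

open import Data.Bool using (Bool; true; false; _∧_; _xor_; if_then_else_)
open import Data.Bool.Properties using () renaming (_≟_ to _≟B_)
open import Data.Nat using (ℕ; zero; suc; _+_; _*_; _∸_; _≤_)
open import Data.Vec using (Vec; []; _∷_; replicate; zipWith; foldr; map)
open import Data.Vec.Properties using (≡-dec)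
open import Data.List using (List; []; _∷_; [_]; _++_; concatMap; filter)
import Data.List as L
open import Data.Product using (Σ; ∃; _×_; _,_)
open import Relation.Binary.PropositionalEquality using (_≡_; _≢_)
open import Relation.Nullary using (¬_; ¬?; does)
open import Level using () renaming (suc to lsuc; zero to lzero)

F2^ : ℕ → Set
F2^ n = Vec Bool n

zeros : ∀ {n} → F2^ n
zeros {n} = replicate n false

_≟V_ : ∀ {n} (u v : F2^ n) → Relation.Nullary.Dec (u ≡ v)
_≟V_ = ≡-dec _≟B_

NonZero : ∀ {n} → F2^ n → Set
NonZero v = v ≢ zeros

dot : ∀ {n} → F2^ n → F2^ n → Bool
dot u v = foldr (λ _ → Bool) _xor_ false (zipWith _∧_ u v)

LinMap : ℕ → ℕ → Set
LinMap m n = Vec (F2^ m) n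

apply : ∀ {m n} → LinMap m n → F2^ m → F2^ n
apply A v = map (λ row → dot row v) A

Injective : ∀ {m n} → LinMap m n → Set
Injective {m} A = ∀ (v : F2^ m) → apply A v ≡ zeros → v ≡ zeros

Invertible : ∀ {n} → LinMap n n → Set
Invertible {n} A = Σ (LinMap n n) λ B →
  (∀ (v : F2^ n) → apply B (apply A v) ≡ v) × (∀ (v : F2^ n) → apply A (apply B v) ≡ v)

-- A matroid of dimension n is a function on F₂ⁿ; only its values on
-- nonzero vectors (the projective space F₂ⁿ ∖ {0}) are meaningful.
Matroid : ℕ → Set
Matroid n = F2^ n → Bool

Property : Set₁
Property = (n : ℕ) → Matroid n → Set

IsProperty : Property → Set
IsProperty P = ∀ n (M₁ M₂ : Matroid n) (φ : LinMap n n) → Invertible φ →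
  (∀ v → NonZero v → M₁ v ≡ M₂ (apply φ v)) → P n M₂ → P n M₁

-- hereditary: closed under restriction to subspaces.  The restriction of
-- M to the subspace Im(ψ) (ψ injective linear F₂ᵐ → F₂ⁿ) is, up to
-- isomorphism, the matroid M ∘ ψ of dimension m.
Hereditary : Property → Set
Hereditary P = ∀ m n (M : Matroid n) (ψ : LinMap m n) → Injective ψ →
  P n M → P m (λ v → M (apply ψ v))

NonTrivial : Property → Set
NonTrivial P = ∀ d → Σ ℕ λ n → d ≤ n × Σ (Matroid n) λ M → P n M

-- M' ∈ Ext^k(M): dim M' ≤ dim M + k and M is isomorphic to the restriction
-- of M' to a subspace of codimension ≤ k, i.e. M = M' ∘ ψ on nonzero
-- vectors for some injective linear ψ : F₂^{dim M} → F₂^{dim M'}.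
InExtOf : (k : ℕ) → ∀ {m n} → Matroid m → Matroid n → Set
InExtOf k {m} {n} M M' = n ≤ m + k × Σ (LinMap m n) λ ψ →
  Injective ψ × (∀ v → NonZero v → M v ≡ M' (apply ψ v))

Ext : ℕ → Property → Property
Ext k T n M' = Σ ℕ λ m → Σ (Matroid m) λ M → T m M × InExtOf k M M'

Const : Bool → Property
Const i n M = ∀ v → NonZero v → M v ≡ i

𝓜 : ℕ → Bool → Property
𝓜 k i = Ext k (Const i)

_⊆P_ : Property → Property → Set
P ⊆P Q = ∀ n M → P n M → Q n M

CriticalNumber : Property → ℕ → Set
CriticalNumber P k = (Σ Bool λ i → 𝓜 k i ⊆P P) ×
  (∀ k' (i : Bool) → 𝓜 k' i ⊆P P → k' ≤ k)

Thin : Property → Set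
Thin T = Hereditary T × NonTrivial T × CriticalNumber T 0

allVecs : ∀ n → List (F2^ n)
allVecs zero = [ [] ]
allVecs (suc n) = L.map (false ∷_) (allVecs n) ++ L.map (true ∷_) (allVecs n)

nonzeroVecs : ∀ n → List (F2^ n)
nonzeroVecs n = filter (λ v → ¬? (v ≟V zeros)) (allVecs n)

update : ∀ {n} → F2^ n → Bool → Matroid n → Matroid n
update a b f x = if does (x ≟V a) then b else f x

-- all Bool-valued functions on the given (duplicate-free) list of points,
-- taking value false outside it
funsOn : ∀ {n} → List (F2^ n) → List (Matroid n)
funsOn [] = [ (λ _ → false) ]
funsOn (a ∷ as) = concatMap (λ f → update a false f ∷ update a true f ∷ []) (funsOn as)

-- the list of all matroids of dimension n, each exactly once
-- (one representative per function on F₂ⁿ ∖ {0}); 2^(2ⁿ-1) entries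
allMatroids : ∀ n → List (Matroid n)
allMatroids n = funsOn (nonzeroVecs n)

data Count {A : Set} (Q : A → Set) : List A → ℕ → Set where
  cnil  : Count Q [] 0
  cyes  : ∀ {a as c} → Q a → Count Q as c → Count Q (a ∷ as) (suc c)
  cno   : ∀ {a as c} → ¬ Q a → Count Q as c → Count Q (a ∷ as) c

-- |𝒫ⁿ ∩ Ext^k(𝒯)| / |𝒫ⁿ| → 1 as n → ∞:
-- for every j, eventually (j+1)·(|𝒫ⁿ| − |𝒫ⁿ ∩ Ext^k 𝒯|) ≤ |𝒫ⁿ|.
RatioTendsToOne : Property → Property → Set
RatioTendsToOne P Q = ∀ (j : ℕ) → Σ ℕ λ N → ∀ n → N ≤ n → ∀ a b →
  Count (P n) (allMatroids n) a →
  Count (λ M → P n M × Q n M) (allMatroids n) b →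
  suc j * (a ∸ b) ≤ a

{-# OPTIONS --safe #-}
module Submission where

-- By Pajor's lemma a family of matroids has at most as many members as it shatters
-- sets, so it suffices to count the sets S ⊆ F₂ⁿ shattered by 𝓑 = 𝒫ⁿ ∖ Ext^k(𝒯).
-- Let κ ≥ k be the largest number for which 𝓜(κ,0) or 𝓜(κ,1) lies in 𝒫 at dimension n;
-- then |𝒫ⁿ| ≥ 2^(2ⁿ − 2^(n−κ)), and 𝒫 omits some X₀ ∈ 𝓜(κ+1,0) and X₁ ∈ 𝓜(κ+1,1).
-- If S contained a large Bose–Burton configuration (the complement of a subspace of
-- codimension κ+1), the many disjoint copies of the Xᵢ inside it could not all be
-- avoided by matroids in 𝒫, since a Ramsey argument makes the centre constant. Hence S
-- contains no such configuration, and a container theorem, proved by induction on the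
-- codimension from fingerprints of dense bipartite graphs, puts S into one of few sets
-- of size about 2ⁿ − 2^(n−κ). Containers that are not close to the complement of a
-- subspace B of codimension κ admit negligibly many S. For the others the definition of
-- 𝒯 enters: a matroid outside Ext^k(𝒯) has on B a small restriction N with an extension
-- in Ext^κ(N) omitted by 𝒫, so again the disjoint copies of this pattern across B make
-- S miss so many points that fewer than 2^(2ⁿ − 2^(n−κ) − n) sets remain.
-- 𝒯 consists of the matroids N all of whose restrictions of dimension D+1, where
-- f D ≤ dim N for a fast growing f, have all their k-extensions in 𝒫.

open import Defs
open import Data.Bool using (Bool; true; false; _∧_; _∨_; _xor_; not; if_then_else_)
open import Data.Bool.Properties using (xor-comm; xor-assoc; xor-same; xor-identityʳ; ∧-zeroʳ; ∧-identityʳ; not-involutive) renaming (_≟_ to _≟B_)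
open import Data.Nat using (ℕ; zero; suc; _+_; _*_; _∸_; _^_; _≤_; _<_; z≤n; s≤s; _≤?_; _<?_)
open import Data.Nat.Properties
open import Data.Nat.Induction using (<-rec)
open import Data.Nat.Solver using (module +-*-Solver)
open import Data.Fin using (Fin; zero; suc)
import Data.Fin.Properties as FinP
open import Data.Vec using (Vec; []; _∷_; replicate; zipWith; map; head; tail; lookup) renaming (_++_ to _++ᵛ_)
open import Data.List using (List; []; _∷_; _++_; length)
import Data.List as L
open import Data.Nat.ListAction using (sum)
import Data.Vec as V
open import Data.List.Properties using (length-map; length-++; length-upTo)
open import Data.List.Membership.Propositional using (_∈_; _∉_; lose; find)
open import Data.List.Membership.Propositional.Properties using (∈-map⁺; ∈-++⁺ˡ; ∈-++⁺ʳ; ∈-concatMap⁺; ∈-upTo⁺)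
open import Data.List.Relation.Unary.Any using (Any; here; there; any?)
import Data.List.Relation.Unary.Any as Any
import Data.List.Relation.Unary.Any.Properties as AnyP
open import Data.Product using (Σ; ∃; _×_; _,_; proj₁; proj₂; ∃₂)
open import Data.Sum using (_⊎_; inj₁; inj₂; [_,_]′)
open import Data.Empty using (⊥; ⊥-elim)
open import Data.Unit using (⊤; tt)
open import Function using (_∘_; id; case_of_)
open import Relation.Binary.PropositionalEquality
open import Relation.Nullary using (¬_; Dec; yes; no; does; ¬?; contradiction)
open import Relation.Nullary.Decidable using (_×-dec_; _⊎-dec_; _→-dec_; decidable-stable)


-- The vector space F₂ⁿ

-- The ratio statement asks for an explicit `N`, although `P` is arbitrary, without decision
-- procedure and without a bound on the dimension at which its behaviour sets in; the `κ` of
-- dimension `n` may exceed `k` for arbitrarily long. So no threshold is chosen in advance. The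
-- requirement that `T` makes on restrictions of dimension `D + 1` only starts at dimension `f D`; a
-- matroid outside `Ext k T` therefore certifies by its mere existence that `n` exceeds every
-- threshold depending on `D`, and if no such matroid exists there is nothing to prove. `Escape`
-- plays the same part for the least size `d` of the omitted `X₀` and `X₁`. With the thresholds
-- absorbed into `T`, the bad matroids form at most a 2^-n fraction of those of `P` in every
-- dimension `n`, and `N = j + 1` suffices. Witnesses against `P` are available only up to double
-- negation. This is enough, because membership in a finite list up to pointwise equality and the
-- final inequality are decidable. For `k = 0` the property `P` is thin itself and `T = P`.

infixl 6 _⊕_
_⊕_ : ∀ {n} → F2^ n → F2^ n → F2^ n
_⊕_ = zipWith _xor_

⊕-comm : ∀ {n} (u v : F2^ n) → u ⊕ v ≡ v ⊕ u
⊕-comm [] [] = refl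
⊕-comm (a ∷ u) (b ∷ v) = cong₂ _∷_ (xor-comm a b) (⊕-comm u v)

⊕-assoc : ∀ {n} (u v w : F2^ n) → (u ⊕ v) ⊕ w ≡ u ⊕ (v ⊕ w)
⊕-assoc [] [] [] = refl
⊕-assoc (a ∷ u) (b ∷ v) (c ∷ w) = cong₂ _∷_ (xor-assoc a b c) (⊕-assoc u v w)

⊕-self : ∀ {n} (u : F2^ n) → u ⊕ u ≡ zeros
⊕-self [] = refl
⊕-self (a ∷ u) = cong₂ _∷_ (xor-same a) (⊕-self u)

⊕-idʳ : ∀ {n} (u : F2^ n) → u ⊕ zeros ≡ u
⊕-idʳ [] = refl
⊕-idʳ (a ∷ u) = cong₂ _∷_ (xor-identityʳ a) (⊕-idʳ u)

⊕-idˡ : ∀ {n} (u : F2^ n) → zeros ⊕ u ≡ u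
⊕-idˡ [] = refl
⊕-idˡ (a ∷ u) = cong (a ∷_) (⊕-idˡ u)

⊕-interchange : ∀ {n} (a b c d : F2^ n) → (a ⊕ b) ⊕ (c ⊕ d) ≡ (a ⊕ c) ⊕ (b ⊕ d)
⊕-interchange a b c d = begin
  (a ⊕ b) ⊕ (c ⊕ d) ≡⟨ ⊕-assoc a b (c ⊕ d) ⟩
  a ⊕ (b ⊕ (c ⊕ d)) ≡⟨ cong (a ⊕_) (sym (⊕-assoc b c d)) ⟩
  a ⊕ ((b ⊕ c) ⊕ d) ≡⟨ cong (λ x → a ⊕ (x ⊕ d)) (⊕-comm b c) ⟩
  a ⊕ ((c ⊕ b) ⊕ d) ≡⟨ cong (a ⊕_) (⊕-assoc c b d) ⟩
  a ⊕ (c ⊕ (b ⊕ d)) ≡⟨ sym (⊕-assoc a c (b ⊕ d)) ⟩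
  (a ⊕ c) ⊕ (b ⊕ d) ∎
  where open ≡-Reasoning

infixr 7 _·_
_·_ : ∀ {n} → Bool → F2^ n → F2^ n
b · a = if b then a else zeros

-- Linear maps are handled as vectors of columns: bases, direction spaces and generators of
-- configurations are then the same kind of object, and `lin as` parametrises the span of `as`.
lin : ∀ {m n} → Vec (F2^ n) m → F2^ m → F2^ n
lin [] [] = zeros
lin (a ∷ as) (b ∷ v) = (b · a) ⊕ lin as v

·-xor : ∀ {n} b c (a : F2^ n) → (b xor c) · a ≡ b · a ⊕ c · a
·-xor false c a = sym (⊕-idˡ _)
·-xor true false a = sym (⊕-idʳ a)
·-xor true true a = sym (⊕-self a)

lin-⊕ : ∀ {m n} (as : Vec (F2^ n) m) u v → lin as (u ⊕ v) ≡ lin as u ⊕ lin as v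
lin-⊕ [] [] [] = sym (⊕-self zeros)
lin-⊕ (a ∷ as) (b ∷ u) (c ∷ v) =
  trans (cong₂ _⊕_ (·-xor b c a) (lin-⊕ as u v)) (⊕-interchange (b · a) (c · a) _ _)

lin-zero : ∀ {m n} (as : Vec (F2^ n) m) → lin as zeros ≡ zeros
lin-zero [] = refl
lin-zero (a ∷ as) = trans (⊕-idˡ _) (lin-zero as)

lin-· : ∀ {m n} (as : Vec (F2^ n) m) b v → lin as (b · v) ≡ b · lin as v
lin-· as false v = lin-zero as
lin-· as true v = refl

-- Equations between sums of vectors are decided by comparing coefficient
-- vectors, since lin ρ is additive.
infixl 6 _:⊕_
data Expr (m : ℕ) : Set where
  var  : Fin m → Expr m
  :0   : Expr m
  _:⊕_ : Expr m → Expr m → Expr m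

unit : ∀ {m} → Fin m → F2^ m
unit zero = true ∷ zeros
unit (suc i) = false ∷ unit i

lin-unit : ∀ {m n} (as : Vec (F2^ n) m) i → lin as (unit i) ≡ lookup as i
lin-unit (a ∷ as) zero = trans (cong (a ⊕_) (lin-zero as)) (⊕-idʳ a)
lin-unit (a ∷ as) (suc i) = trans (⊕-idˡ _) (lin-unit as i)

⟦_⟧ : ∀ {m n} → Expr m → Vec (F2^ n) m → F2^ n
⟦ var i ⟧ ρ = lookup ρ i
⟦ :0 ⟧ ρ = zeros
⟦ e :⊕ f ⟧ ρ = ⟦ e ⟧ ρ ⊕ ⟦ f ⟧ ρ

coeffs : ∀ {m} → Expr m → F2^ m
coeffs (var i) = unit i
coeffs :0 = zeros
coeffs (e :⊕ f) = coeffs e ⊕ coeffs f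

⟦⟧-coeffs : ∀ {m n} (e : Expr m) (ρ : Vec (F2^ n) m) → ⟦ e ⟧ ρ ≡ lin ρ (coeffs e)
⟦⟧-coeffs (var i) ρ = sym (lin-unit ρ i)
⟦⟧-coeffs :0 ρ = sym (lin-zero ρ)
⟦⟧-coeffs (e :⊕ f) ρ =
  trans (cong₂ _⊕_ (⟦⟧-coeffs e ρ) (⟦⟧-coeffs f ρ)) (sym (lin-⊕ ρ (coeffs e) (coeffs f)))

⊕-solve : ∀ {m n} (ρ : Vec (F2^ n) m) (e f : Expr m) → coeffs e ≡ coeffs f → ⟦ e ⟧ ρ ≡ ⟦ f ⟧ ρ
⊕-solve ρ e f p = trans (⟦⟧-coeffs e ρ) (trans (cong (lin ρ) p) (sym (⟦⟧-coeffs f ρ)))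

x₀ : ∀ {m} → Expr (1 + m)
x₀ = var zero
x₁ : ∀ {m} → Expr (2 + m)
x₁ = var (suc zero)
x₂ : ∀ {m} → Expr (3 + m)
x₂ = var (suc (suc zero))
x₃ : ∀ {m} → Expr (4 + m)
x₃ = var (suc (suc (suc zero)))

⊕-cancel : ∀ {n} (a b : F2^ n) → a ⊕ b ⊕ b ≡ a
⊕-cancel a b = ⊕-solve (a ∷ b ∷ []) (x₀ :⊕ x₁ :⊕ x₁) x₀ refl

⊕≡0⇒≡ : ∀ {n} (a b : F2^ n) → a ⊕ b ≡ zeros → a ≡ b
⊕≡0⇒≡ a b p = trans (sym (⊕-cancel a b)) (trans (cong (_⊕ b) p) (⊕-idˡ b))

Inj : ∀ {m n} → Vec (F2^ n) m → Set
Inj as = ∀ v → lin as v ≡ zeros → v ≡ zeros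

Inj⇒≡ : ∀ {m n} (as : Vec (F2^ n) m) → Inj as → ∀ u v → lin as u ≡ lin as v → u ≡ v
Inj⇒≡ as inj u v p = ⊕≡0⇒≡ u v (inj (u ⊕ v) (trans (lin-⊕ as u v) (trans (cong (_⊕ lin as v) p) (⊕-self _))))

infixr 9 _⊙_
_⊙_ : ∀ {l m n} → Vec (F2^ n) m → Vec (F2^ m) l → Vec (F2^ n) l
as ⊙ bs = map (lin as) bs

lin-⊙ : ∀ {l m n} (as : Vec (F2^ n) m) (bs : Vec (F2^ m) l) v → lin (as ⊙ bs) v ≡ lin as (lin bs v)
lin-⊙ as [] [] = sym (lin-zero as)
lin-⊙ as (b ∷ bs) (c ∷ v) =
  trans (cong₂ _⊕_ (sym (lin-· as c b)) (lin-⊙ as bs v)) (sym (lin-⊕ as (c · b) (lin bs v)))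

Inj-⊙ : ∀ {l m n} (as : Vec (F2^ n) m) (bs : Vec (F2^ m) l) → Inj as → Inj bs → Inj (as ⊙ bs)
Inj-⊙ as bs ia ib v p = ib v (ia _ (trans (sym (lin-⊙ as bs v)) p))

zeros-++ : ∀ m {n} → zeros {m} ++ᵛ zeros {n} ≡ zeros {m + n}
zeros-++ zero = refl
zeros-++ (suc m) = cong (false ∷_) (zeros-++ m)

lin-++ : ∀ {l m n} (as : Vec (F2^ n) l) (bs : Vec (F2^ n) m) u v →
  lin (as ++ᵛ bs) (u ++ᵛ v) ≡ lin as u ⊕ lin bs v
lin-++ [] bs [] v = sym (⊕-idˡ _)
lin-++ (a ∷ as) bs (c ∷ u) v = trans (cong (c · a ⊕_) (lin-++ as bs u v)) (sym (⊕-assoc _ _ _))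

Additive : ∀ {m n} → (F2^ m → F2^ n) → Set
Additive f = ∀ u v → f (u ⊕ v) ≡ f u ⊕ f v

additive-zero : ∀ {m n} (f : F2^ m → F2^ n) → Additive f → f zeros ≡ zeros
additive-zero f add = trans (sym (⊕-cancel (f zeros) (f zeros)))
  (trans (cong (_⊕ f zeros) (trans (sym (add zeros zeros)) (cong f (⊕-self zeros)))) (⊕-self _))

columns : ∀ {m n} → (F2^ m → F2^ n) → Vec (F2^ n) m
columns {zero} f = []
columns {suc m} f = f (true ∷ zeros) ∷ columns (f ∘ (false ∷_))

lin-columns : ∀ {m n} (f : F2^ m → F2^ n) → Additive f → ∀ v → lin (columns f) v ≡ f v
lin-columns {zero} f add [] = sym (additive-zero f add)
lin-columns {suc m} f add (false ∷ v) =
  trans (⊕-idˡ _) (lin-columns (f ∘ (false ∷_)) (λ u w → add (false ∷ u) (false ∷ w)) v)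
lin-columns {suc m} f add (true ∷ v) =
  trans (cong (f (true ∷ zeros) ⊕_) (lin-columns (f ∘ (false ∷_)) (λ u w → add (false ∷ u) (false ∷ w)) v))
    (trans (sym (add (true ∷ zeros) (false ∷ v))) (cong (λ x → f (true ∷ x)) (⊕-idˡ v)))

-- Transposition: `LinMap` stores rows, the proof works with columns.
matrix : ∀ {m n} → Vec (F2^ n) m → LinMap m n
matrix {n = zero} as = []
matrix {n = suc n} as = map head as ∷ matrix (map tail as)

lin-∷ : ∀ {m n} (as : Vec (F2^ (suc n)) m) v → dot (map head as) v ∷ lin (map tail as) v ≡ lin as v
lin-∷ [] [] = refl
lin-∷ ((a ∷ as) ∷ bs) (false ∷ v) with lin bs v | lin-∷ bs v
... | _ | refl = cong₂ _∷_ (cong (_xor dot (map head bs) v) (∧-zeroʳ a)) refl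
lin-∷ ((a ∷ as) ∷ bs) (true ∷ v) with lin bs v | lin-∷ bs v
... | _ | refl = cong₂ _∷_ (cong (_xor dot (map head bs) v) (∧-identityʳ a)) refl

apply-matrix : ∀ {m n} (as : Vec (F2^ n) m) v → apply (matrix as) v ≡ lin as v
apply-matrix {n = zero} as v with lin as v
... | [] = refl
apply-matrix {n = suc n} as v =
  trans (cong (dot (map head as) v ∷_) (apply-matrix (map tail as) v)) (lin-∷ as v)

dot-⊕ : ∀ {n} (r u v : F2^ n) → dot r (u ⊕ v) ≡ dot r u xor dot r v
dot-⊕ [] [] [] = refl
dot-⊕ (r ∷ rs) (a ∷ u) (b ∷ v) rewrite dot-⊕ rs u v = lemma r a b (dot rs u) (dot rs v)
  where
  lemma : ∀ r a b x y → (r ∧ (a xor b)) xor (x xor y) ≡ ((r ∧ a) xor x) xor ((r ∧ b) xor y)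
  lemma false a b x y = refl
  lemma true false b false y = refl
  lemma true false false true y = refl
  lemma true false true true false = refl
  lemma true false true true true = refl
  lemma true true false false y = refl
  lemma true true true false false = refl
  lemma true true true false true = refl
  lemma true true false true false = refl
  lemma true true false true true = refl
  lemma true true true true y = refl

apply-⊕ : ∀ {m n} (A : LinMap m n) → Additive (apply A)
apply-⊕ [] u v = refl
apply-⊕ (r ∷ A) u v = cong₂ _∷_ (dot-⊕ r u v) (apply-⊕ A u v)

matrix-injective : ∀ {m n} (as : Vec (F2^ n) m) → Inj as → Injective (matrix as)
matrix-injective as inj v p = inj v (trans (sym (apply-matrix as v)) p)

columns-Inj : ∀ {m n} (A : LinMap m n) → Injective A → Inj (columns (apply A))
columns-Inj A inj v p = inj v (trans (sym (lin-columns (apply A) (apply-⊕ A) v)) p)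

-- Finite search

record Enum (A : Set) : Set where
  constructor enum
  field
    elems    : List A
    complete : ∀ a → a ∈ elems
open Enum public

∃-dec : ∀ {A : Set} {P : A → Set} → Enum A → (∀ a → Dec (P a)) → Dec (∃ P)
∃-dec E d with any? d (elems E)
... | yes p = yes (let (a , _ , q) = find p in a , q)
... | no ¬p = no λ (a , q) → ¬p (lose (complete E a) q)

∀-dec : ∀ {A : Set} {P : A → Set} → Enum A → (∀ a → Dec (P a)) → Dec (∀ a → P a)
∀-dec E d with ∃-dec E (λ a → ¬? (d a))
... | yes (a , ¬p) = no λ f → ¬p (f a)
... | no ¬e = yes λ a → decidable-stable (d a) λ ¬p → ¬e (a , ¬p)

∈-allVecs : ∀ {n} (v : F2^ n) → v ∈ allVecs n
∈-allVecs [] = here refl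
∈-allVecs (false ∷ v) = ∈-++⁺ˡ (∈-map⁺ (false ∷_) (∈-allVecs v))
∈-allVecs {suc n} (true ∷ v) = ∈-++⁺ʳ (L.map (false ∷_) (allVecs n)) (∈-map⁺ (true ∷_) (∈-allVecs v))

length-allVecs : ∀ n → length (allVecs n) ≡ 2 ^ n
length-allVecs zero = refl
length-allVecs (suc n) = trans (length-++ (L.map (false ∷_) (allVecs n)))
  (trans (cong₂ _+_ (length-map _ (allVecs n)) (length-map _ (allVecs n)))
  (trans (cong (λ x → x + x) (length-allVecs n)) (cong (2 ^ n +_) (sym (+-identityʳ _)))))

enumV : ∀ {n} → Enum (F2^ n)
enumV {n} = enum (allVecs n) ∈-allVecs

tuples : ∀ {A : Set} m → List A → List (Vec A m)
tuples zero xs = [] ∷ []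
tuples (suc m) xs = L.concatMap (λ x → L.map (x ∷_) (tuples m xs)) xs

∈-tuples : ∀ {A : Set} {m} {xs : List A} → (∀ a → a ∈ xs) → (t : Vec A m) → t ∈ tuples m xs
∈-tuples h [] = here refl
∈-tuples h (x ∷ t) = ∈-concatMap⁺ (λ x → L.map (x ∷_) (tuples _ _)) (Any.map (λ { refl → ∈-map⁺ (x ∷_) (∈-tuples h t) }) (h x))

length-concatMap : ∀ {A B : Set} (f : A → List B) K xs → (∀ a → length (f a) ≤ K) →
  length (L.concatMap f xs) ≤ length xs * K
length-concatMap f K [] h = z≤n
length-concatMap f K (x ∷ xs) h = ≤-trans (≤-reflexive (length-++ (f x))) (+-mono-≤ (h x) (length-concatMap f K xs h))

length-tuples : ∀ {A : Set} m (xs : List A) → length (tuples m xs) ≤ length xs ^ m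
length-tuples zero xs = ≤-refl
length-tuples (suc m) xs = length-concatMap _ _ xs λ x → ≤-trans (≤-reflexive (length-map _ (tuples m xs))) (length-tuples m xs)

enumT : ∀ {A : Set} {m} → Enum A → Enum (Vec A m)
enumT {m = m} E = enum (tuples m (elems E)) (∈-tuples (complete E))

allTuples : ∀ n m → List (Vec (F2^ n) m)
allTuples n m = tuples m (allVecs n)

length-allTuples : ∀ n m → length (allTuples n m) ≤ 2 ^ (n * m)
length-allTuples n m = ≤-trans (length-tuples m (allVecs n))
  (≤-reflexive (trans (cong (_^ m) (length-allVecs n)) (^-*-assoc 2 n m)))

enumVT : ∀ {n m} → Enum (Vec (F2^ n) m)
enumVT = enumT enumV

does-true : ∀ {P : Set} (d : Dec P) → does d ≡ true → P
does-true (yes p) _ = p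

does-intro : ∀ {P : Set} (d : Dec P) → P → does d ≡ true
does-intro (yes _) _ = refl
does-intro (no ¬p) p = contradiction p ¬p

does-false : ∀ {P : Set} (d : Dec P) → does d ≡ false → ¬ P
does-false (no ¬p) _ = ¬p

does-intro-¬ : ∀ {P : Set} (d : Dec P) → ¬ P → does d ≡ false
does-intro-¬ (yes p) ¬p = contradiction p ¬p
does-intro-¬ (no _) _ = refl

Inj? : ∀ {m n} (as : Vec (F2^ n) m) → Dec (Inj as)
Inj? as = ∀-dec enumV λ v → (lin as v ≟V zeros) →-dec (v ≟V zeros)

_≗?_ : ∀ {n} (f g : F2^ n → Bool) → Dec (f ≗ g)
f ≗? g = ∀-dec enumV λ v → f v ≟B g v

true≢false : ∀ {b} → b ≡ true → b ≡ false → ⊥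
true≢false refl ()

≢true⇒false : ∀ {b} → ¬ (b ≡ true) → b ≡ false
≢true⇒false {false} _ = refl
≢true⇒false {true} h = ⊥-elim (h refl)

≢false⇒true : ∀ {b} → ¬ (b ≡ false) → b ≡ true
≢false⇒true {true} _ = refl
≢false⇒true {false} h = ⊥-elim (h refl)

∧-true : ∀ {a b} → a ∧ b ≡ true → a ≡ true × b ≡ true
∧-true {true} p = refl , p

∧-intro : ∀ {a b} → a ≡ true → b ≡ true → a ∧ b ≡ true
∧-intro refl q = q

not-true : ∀ {b} → not b ≡ true → b ≡ false
not-true {false} _ = refl

not-intro : ∀ {b} → b ≡ false → not b ≡ true
not-intro refl = refl

does-⇔ : ∀ {P Q : Set} (d : Dec P) (e : Dec Q) → (P → Q) → (Q → P) → does d ≡ does e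
does-⇔ (yes p) e f g = sym (does-intro e (f p))
does-⇔ (no ¬p) e f g = sym (does-intro-¬ e (¬p ∘ g))

-- Sums over F₂ⁿ and cardinalities

+-interchange : ∀ a b c d → (a + b) + (c + d) ≡ (a + c) + (b + d)
+-interchange = solve 4 (λ a b c d → (a :+ b) :+ (c :+ d) := (a :+ c) :+ (b :+ d)) refl
  where open +-*-Solver

abstract
  ∑ : ∀ {n} → (F2^ n → ℕ) → ℕ
  ∑ {zero} f = f []
  ∑ {suc n} f = ∑ (λ v → f (false ∷ v)) + ∑ (λ v → f (true ∷ v))

  ∑-cong : ∀ {n} {f g : F2^ n → ℕ} → (∀ v → f v ≡ g v) → ∑ f ≡ ∑ g
  ∑-cong {zero} h = h []
  ∑-cong {suc n} h = cong₂ _+_ (∑-cong (h ∘ (false ∷_))) (∑-cong (h ∘ (true ∷_)))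

  ∑-mono : ∀ {n} {f g : F2^ n → ℕ} → (∀ v → f v ≤ g v) → ∑ f ≤ ∑ g
  ∑-mono {zero} h = h []
  ∑-mono {suc n} h = +-mono-≤ (∑-mono (h ∘ (false ∷_))) (∑-mono (h ∘ (true ∷_)))

  ∑-+ : ∀ {n} (f g : F2^ n → ℕ) → ∑ (λ v → f v + g v) ≡ ∑ f + ∑ g
  ∑-+ {zero} f g = refl
  ∑-+ {suc n} f g = trans (cong₂ _+_ (∑-+ (f ∘ (false ∷_)) (g ∘ (false ∷_))) (∑-+ (f ∘ (true ∷_)) (g ∘ (true ∷_))))
    (+-interchange (∑ (f ∘ (false ∷_))) (∑ (g ∘ (false ∷_))) (∑ (f ∘ (true ∷_))) (∑ (g ∘ (true ∷_))))

  ∑-* : ∀ {n} c (f : F2^ n → ℕ) → ∑ (λ v → c * f v) ≡ c * ∑ f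
  ∑-* {zero} c f = refl
  ∑-* {suc n} c f = trans (cong₂ _+_ (∑-* c (f ∘ (false ∷_))) (∑-* c (f ∘ (true ∷_)))) (sym (*-distribˡ-+ c _ _))

  ∑-*ʳ : ∀ {n} c (f : F2^ n → ℕ) → ∑ (λ v → f v * c) ≡ ∑ f * c
  ∑-*ʳ c f = trans (∑-cong (λ v → *-comm (f v) c)) (trans (∑-* c f) (*-comm c _))

  ∑-const : ∀ n c → ∑ {n} (λ _ → c) ≡ 2 ^ n * c
  ∑-const zero c = sym (+-identityʳ c)
  ∑-const (suc n) c = trans (cong₂ _+_ (∑-const n c) (∑-const n c))
    (trans (sym (*-distribʳ-+ c (2 ^ n) (2 ^ n))) (cong (λ x → (2 ^ n + x) * c) (sym (+-identityʳ (2 ^ n)))))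

  ∑-swap : ∀ {m n} (f : F2^ m → F2^ n → ℕ) → ∑ (λ u → ∑ (f u)) ≡ ∑ (λ v → ∑ (λ u → f u v))
  ∑-swap {zero} f = refl
  ∑-swap {suc m} f = trans (cong₂ _+_ (∑-swap (f ∘ (false ∷_))) (∑-swap (f ∘ (true ∷_)))) (sym (∑-+ (λ v → ∑ (λ u → f (false ∷ u) v)) (λ v → ∑ (λ u → f (true ∷ u) v))))

  ∑-translate : ∀ {n} (a : F2^ n) (f : F2^ n → ℕ) → ∑ (λ v → f (v ⊕ a)) ≡ ∑ f
  ∑-translate [] f = refl
  ∑-translate (false ∷ a) f = cong₂ _+_ (∑-translate a (f ∘ (false ∷_))) (∑-translate a (f ∘ (true ∷_)))
  ∑-translate (true ∷ a) f =
    trans (cong₂ _+_ (∑-translate a (f ∘ (true ∷_))) (∑-translate a (f ∘ (false ∷_)))) (+-comm (∑ (f ∘ (true ∷_))) _)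

  ∑-[] : (f : F2^ 0 → ℕ) → ∑ f ≡ f []
  ∑-[] f = refl

  ∑-∷ : ∀ {n} (f : F2^ (suc n) → ℕ) → ∑ f ≡ ∑ (λ v → f (false ∷ v)) + ∑ (λ v → f (true ∷ v))
  ∑-∷ f = refl

  ∑-++ : ∀ m {n} (f : F2^ (m + n) → ℕ) → ∑ f ≡ ∑ {m} (λ u → ∑ (λ v → f (u ++ᵛ v)))
  ∑-++ zero f = refl
  ∑-++ (suc m) f = cong₂ _+_ (∑-++ m (f ∘ (false ∷_))) (∑-++ m (f ∘ (true ∷_)))

  bit : Bool → ℕ
  bit b = if b then 1 else 0

  bit≤1 : ∀ b → bit b ≤ 1
  bit≤1 true = ≤-refl
  bit≤1 false = z≤n

  bit-mono : ∀ {a b} → (a ≡ true → b ≡ true) → bit a ≤ bit b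
  bit-mono {false} h = z≤n
  bit-mono {true} h rewrite h refl = ≤-refl

  bit-not : ∀ b → bit b + bit (not b) ≡ 1
  bit-not true = refl
  bit-not false = refl

  bit-∪ : ∀ {a b c} → (a ≡ true → b ≡ true ⊎ c ≡ true) → bit a ≤ bit b + bit c
  bit-∪ {false} h = z≤n
  bit-∪ {true} {b} {c} h with h refl
  ... | inj₁ refl = s≤s z≤n
  ... | inj₂ refl = m≤n+m 1 (bit b)

  bit-true : bit true ≡ 1
  bit-true = refl

  bit-false : bit false ≡ 0
  bit-false = refl

  bit-* : ∀ a b → bit a * bit b ≡ bit (a ∧ b)
  bit-* true true = refl
  bit-* true false = refl
  bit-* false b = refl

  bit-≤ : ∀ {b n} → (b ≡ true → 1 ≤ n) → bit b ≤ n
  bit-≤ {false} h = z≤n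
  bit-≤ {true} h = h refl

  bit-< : ∀ {a b} → bit a < bit b → a ≡ false × b ≡ true
  bit-< {false} {true} _ = refl , refl
  bit-< {true} {true} (s≤s ())

∑-<⇒∃ : ∀ {n} (f g : F2^ n → ℕ) → ∑ f < ∑ g → ∃ λ v → f v < g v
∑-<⇒∃ f g p with ∃-dec enumV (λ v → f v <? g v)
... | yes q = q
... | no ¬q = contradiction (∑-mono λ v → ≮⇒≥ λ q → ¬q (v , q)) (<⇒≱ p)

#_ : ∀ {n} → (F2^ n → Bool) → ℕ
# f = ∑ (λ v → bit (f v))
infix 8 #_

#-∅ : ∀ {n} → # (λ (v : F2^ n) → false) ≡ 0
#-∅ {n} = trans (∑-cong (λ _ → bit-false)) (trans (∑-const n 0) (*-zeroʳ (2 ^ n)))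

#-cong : ∀ {n} {f g : F2^ n → Bool} → f ≗ g → # f ≡ # g
#-cong h = ∑-cong (λ v → cong bit (h v))

#-mono : ∀ {n} {f g : F2^ n → Bool} → (∀ v → f v ≡ true → g v ≡ true) → # f ≤ # g
#-mono h = ∑-mono (λ v → bit-mono (h v))

#-∪ : ∀ {n} {f g h : F2^ n → Bool} → (∀ v → f v ≡ true → g v ≡ true ⊎ h v ≡ true) → # f ≤ # g + # h
#-∪ k = ≤-trans (∑-mono (λ v → bit-∪ (k v))) (≤-reflexive (∑-+ _ _))

#-not : ∀ {n} (f : F2^ n → Bool) → # f + # (not ∘ f) ≡ 2 ^ n
#-not {n} f = trans (sym (∑-+ _ _)) (trans (∑-cong (λ v → bit-not (f v))) (trans (∑-const n 1) (*-identityʳ _)))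

#-translate : ∀ {n} (a : F2^ n) (f : F2^ n → Bool) → # (λ v → f (v ⊕ a)) ≡ # f
#-translate a f = ∑-translate a (bit ∘ f)

#≤ : ∀ {n} (f : F2^ n → Bool) → # f ≤ 2 ^ n
#≤ f = ≤-trans (m≤m+n _ _) (≤-reflexive (#-not f))

#-<⇒∃ : ∀ {n} (f g : F2^ n → Bool) → # f < # g → ∃ λ v → f v ≡ false × g v ≡ true
#-<⇒∃ f g p with ∑-<⇒∃ _ _ p
... | v , q = v , bit-< q

eqV : ∀ {n} → F2^ n → F2^ n → Bool
eqV u v = does (u ≟V v)

∑-δ : ∀ {n} (a : F2^ n) (f : F2^ n → ℕ) → ∑ (λ v → bit (eqV v a) * f v) ≡ f a
∑-δ [] f = trans (∑-[] _) (trans (cong (_* f []) bit-true) (+-identityʳ (f [])))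
∑-δ {suc n} (b ∷ a) f = go b
  where
  g : Bool → F2^ (suc n) → ℕ
  g b v = bit (eqV v (b ∷ a)) * f v
  same : ∀ b v → eqV (b ∷ v) (b ∷ a) ≡ eqV v a
  same b v = does-⇔ ((b ∷ v) ≟V (b ∷ a)) (v ≟V a) (λ { refl → refl }) (cong (b ∷_))
  diff : ∀ b v → eqV (not b ∷ v) (b ∷ a) ≡ false
  diff true v = does-intro-¬ ((false ∷ v) ≟V (true ∷ a)) λ ()
  diff false v = does-intro-¬ ((true ∷ v) ≟V (false ∷ a)) λ ()
  S : ∀ b → ∑ (λ v → g b (b ∷ v)) ≡ f (b ∷ a)
  S b = trans (∑-cong (λ v → cong (λ x → bit x * f (b ∷ v)) (same b v))) (∑-δ a (f ∘ (b ∷_)))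
  Z : ∀ b → ∑ (λ v → g b (not b ∷ v)) ≡ 0
  Z b = trans (∑-cong (λ v → cong (λ x → bit x * f (not b ∷ v)) (diff b v))) (trans (∑-cong (λ v → cong (_* f (not b ∷ v)) bit-false)) (trans (∑-const n 0) (*-zeroʳ (2 ^ n))))
  go : ∀ b → ∑ (g b) ≡ f (b ∷ a)
  go false = trans (∑-∷ (g false)) (trans (cong₂ _+_ (S false) (Z false)) (+-identityʳ _))
  go true = trans (∑-∷ (g true)) (cong₂ _+_ (Z true) (S true))

#-point : ∀ {n} (a : F2^ n) → # (λ v → eqV v a) ≡ 1
#-point a = trans (∑-cong (λ v → sym (*-identityʳ _))) (∑-δ a (λ _ → 1))

-- Double counting: insert the indicator of `w ≡ to d v`, which by means of `from` factors into two
-- delta functions, and exchange the sums.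
∑-bijection : ∀ {j m n} (to : F2^ j → F2^ m → F2^ n) (from : F2^ n → F2^ j × F2^ m) →
  (∀ d v → from (to d v) ≡ (d , v)) → (∀ w → to (proj₁ (from w)) (proj₂ (from w)) ≡ w) →
  (f : F2^ n → ℕ) → ∑ f ≡ ∑ (λ d → ∑ (λ v → f (to d v)))
∑-bijection {j} {m} {n} to from ft tf f = begin
  ∑ f
    ≡⟨ ∑-cong (λ w → sym (one w)) ⟩
  ∑ (λ w → ∑ λ d → ∑ λ v → bit (eqV w (to d v)) * f w)
    ≡⟨ ∑-swap _ ⟩
  ∑ (λ d → ∑ λ w → ∑ λ v → bit (eqV w (to d v)) * f w)
    ≡⟨ ∑-cong (λ d → ∑-swap _) ⟩
  ∑ (λ d → ∑ λ v → ∑ λ w → bit (eqV w (to d v)) * f w)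
    ≡⟨ ∑-cong (λ d → ∑-cong (λ v → ∑-δ (to d v) f)) ⟩
  ∑ (λ d → ∑ (λ v → f (to d v))) ∎
  where
  open ≡-Reasoning
  ind : ∀ w d v → bit (eqV w (to d v)) ≡ bit (eqV d (proj₁ (from w))) * bit (eqV v (proj₂ (from w)))
  ind w d v = trans (cong bit (does-⇔ (w ≟V to d v) ((d ≟V proj₁ (from w)) ×-dec (v ≟V proj₂ (from w)))
      (λ { refl → cong proj₁ (sym (ft d v)) , cong proj₂ (sym (ft d v)) })
      λ { (refl , refl) → sym (tf w) }))
    (sym (bit-* (eqV d (proj₁ (from w))) (eqV v (proj₂ (from w)))))
  one : ∀ w → ∑ (λ d → ∑ λ v → bit (eqV w (to d v)) * f w) ≡ f w
  one w = trans (∑-cong λ d → trans (∑-cong λ v → trans (cong (_* f w) (ind w d v)) (*-assoc (bit (eqV d _)) _ _))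
      (trans (∑-* (bit (eqV d (proj₁ (from w)))) _) (cong (bit (eqV d (proj₁ (from w))) *_) (∑-δ (proj₂ (from w)) (λ _ → f w)))))
    (∑-δ (proj₁ (from w)) (λ _ → f w))

2^>0 : ∀ n → 0 < 2 ^ n
2^>0 n = m^n>0 2 n

#-image : ∀ {m n} (f : F2^ m → F2^ n) (g : F2^ n → Bool) →
  (∀ w → g w ≡ true → ∃ λ v → w ≡ f v) → # g ≤ 2 ^ m
#-image {m} f g h = begin
  # g ≤⟨ ∑-mono (λ w → le w) ⟩
  ∑ (λ w → ∑ (λ v → bit (eqV w (f v)))) ≡⟨ ∑-swap _ ⟩
  ∑ (λ v → ∑ (λ w → bit (eqV w (f v)))) ≡⟨ ∑-cong (λ v → #-point (f v)) ⟩
  ∑ {m} (λ v → 1) ≡⟨ trans (∑-const m 1) (*-identityʳ _) ⟩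
  2 ^ m ∎
  where
  open ≤-Reasoning
  le : ∀ w → bit (g w) ≤ ∑ (λ v → bit (eqV w (f v)))
  le w = bit-≤ λ eq → let (v , w≡) = h w eq in
    ≤-trans (≤-reflexive (sym (#-point v))) (#-mono λ u p →
      does-intro (w ≟V f u) (trans w≡ (cong f (sym (does-true (u ≟V v) p)))))

#-preimage : ∀ {m n} (f : F2^ m → F2^ n) (g : F2^ n → Bool) →
  (∀ u v → f u ≡ f v → u ≡ v) → # (g ∘ f) ≤ # g
#-preimage f g inj = begin
  # (g ∘ f) ≡⟨ ∑-cong (λ v → sym (∑-δ (f v) (bit ∘ g))) ⟩
  ∑ (λ v → ∑ (λ w → bit (eqV w (f v)) * bit (g w))) ≡⟨ ∑-swap _ ⟩
  ∑ (λ w → ∑ (λ v → bit (eqV w (f v)) * bit (g w))) ≡⟨ ∑-cong (λ w → ∑-*ʳ (bit (g w)) _) ⟩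
  ∑ (λ w → # (λ v → eqV w (f v)) * bit (g w)) ≤⟨ ∑-mono (λ w → *-monoˡ-≤ (bit (g w)) (one w)) ⟩
  ∑ (λ w → 1 * bit (g w)) ≡⟨ ∑-cong (λ w → *-identityˡ _) ⟩
  # g ∎
  where
  open ≤-Reasoning
  one : ∀ w → # (λ v → eqV w (f v)) ≤ 1
  one w with ∃-dec enumV (λ v → w ≟V f v)
  ... | yes (v , refl) = ≤-trans (#-mono λ u p → does-intro (u ≟V v) (sym (inj v u (does-true (f v ≟V f u) p)))) (≤-reflexive (#-point v))
  ... | no ¬p = ≤-trans (#-mono {g = λ v → false} λ v q → ⊥-elim (¬p (v , does-true (w ≟V f v) q))) (≤-trans (≤-reflexive #-∅) z≤n)

inList : ∀ {n} → List (F2^ n) → F2^ n → Bool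
inList W v = does (any? (v ≟V_) W)

inList-intro : ∀ {n} {W : List (F2^ n)} {v} → v ∈ W → inList W v ≡ true
inList-intro {W = W} {v} p = does-intro (any? (v ≟V_) W) p

inList-elim : ∀ {n} {W : List (F2^ n)} {v} → inList W v ≡ true → v ∈ W
inList-elim {W = W} {v} p = does-true (any? (v ≟V_) W) p

#-list : ∀ {n} (W : List (F2^ n)) → # (inList W) ≤ length W
#-list {n} [] = ≤-reflexive #-∅
#-list (w ∷ W) = ≤-trans (#-∪ {f = inList (w ∷ W)} {g = λ v → eqV v w} {h = inList W} split) (+-mono-≤ (≤-reflexive (#-point w)) (#-list W))
  where
  split : ∀ v → inList (w ∷ W) v ≡ true → eqV v w ≡ true ⊎ inList W v ≡ true
  split v p with inList-elim {W = w ∷ W} p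
  ... | here q = inj₁ (does-intro (v ≟V w) q)
  ... | there q = inj₂ (inList-intro q)

some : ∀ {m} → (F2^ m → Bool) → Bool
some f = does (∃-dec enumV (λ v → f v ≟B true))

some-intro : ∀ {m} (f : F2^ m → Bool) v → f v ≡ true → some f ≡ true
some-intro f v p = does-intro (∃-dec enumV (λ v → f v ≟B true)) (v , p)

some-elim : ∀ {m} (f : F2^ m → Bool) → some f ≡ true → ∃ λ v → f v ≡ true
some-elim f p = does-true (∃-dec enumV (λ v → f v ≟B true)) p

#-some : ∀ {m n} (f : F2^ m → F2^ n → Bool) → # (λ w → some (λ v → f v w)) ≤ ∑ (λ v → # (f v))
#-some f = ≤-trans (∑-mono le) (≤-reflexive (∑-swap _))
  where
  le : ∀ w → bit (some (λ v → f v w)) ≤ ∑ (λ v → bit (f v w))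
  le w = bit-≤ λ q → let (v , p) = some-elim (λ v → f v w) q in
    ≤-trans (≤-reflexive (sym (#-point v))) (#-mono λ u q →
      subst (λ x → f x w ≡ true) (sym (does-true (u ≟V v) q)) p)

#>0⇒∃ : ∀ {n} (f : F2^ n → Bool) → 0 < # f → ∃ λ v → f v ≡ true
#>0⇒∃ {n} f p with #-<⇒∃ (λ _ → false) f (subst (_< # f) (sym #-∅) p)
... | v , _ , q = v , q

-- Classes of sets covered by few functions

Class : ℕ → Set₁
Class n = (F2^ n → Bool) → Set

-- An upper bound on the cardinality of a class up to pointwise equality. It asks for no decision
-- procedure for `Q`: the list may contain functions outside the class.
Cov : ∀ {n} → Class n → ℕ → Set
Cov {n} Q K = Σ (List (F2^ n → Bool)) λ L → length L ≤ K × (∀ S → Q S → Any (S ≗_) L)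

cov-mono : ∀ {n} {Q : Class n} {K K'} → K ≤ K' → Cov Q K → Cov Q K'
cov-mono le (L , p , q) = L , ≤-trans p le , q

cov-⊆ : ∀ {n} {Q Q' : Class n} {K} → (∀ S → Q S → Q' S) → Cov Q' K → Cov Q K
cov-⊆ h (L , p , q) = L , p , λ S r → q S (h S r)

-- Occurrence in a finite list up to pointwise equality is decidable, hence stable. This is what
-- allows the members of a class to be classified under a double negation.
cov-stable : ∀ {n} {Q Q' : Class n} {K} → (∀ S → Q S → ¬ ¬ Q' S) → Cov Q' K → Cov Q K
cov-stable h (L , p , q) = L , p , λ S r → decidable-stable (any? (S ≗?_) L) λ ¬a → h S r λ r' → ¬a (q S r')

cov-∪ : ∀ {n} {Q Q₁ Q₂ : Class n} {K₁ K₂} → (∀ S → Q S → Q₁ S ⊎ Q₂ S) → Cov Q₁ K₁ → Cov Q₂ K₂ → Cov Q (K₁ + K₂)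
cov-∪ {n} {Q} h (L₁ , p₁ , q₁) (L₂ , p₂ , q₂) =
  L₁ ++ L₂ , ≤-trans (≤-reflexive (length-++ L₁)) (+-mono-≤ p₁ p₂) , cover
  where
  cover : ∀ S → Q S → Any (S ≗_) (L₁ ++ L₂)
  cover S r with h S r
  ... | inj₁ r₁ = AnyP.++⁺ˡ (q₁ S r₁)
  ... | inj₂ r₂ = AnyP.++⁺ʳ L₁ (q₂ S r₂)

cov-⋃ : ∀ {n} {A : Set} {Q : Class n} {K} (xs : List A) (R : A → Class n) → (∀ x → Cov (R x) K) →
  (∀ S → Q S → Any (λ x → R x S) xs) → Cov Q (length xs * K)
cov-⋃ {n} {A} {Q} {K} xs R c h = L.concatMap (λ x → proj₁ (c x)) xs ,
  length-concatMap (λ x → proj₁ (c x)) K xs (λ x → proj₁ (proj₂ (c x))) ,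
  λ S r → AnyP.concat⁺ (AnyP.map⁺ (Any.map (λ {x} t → proj₂ (proj₂ (c x)) S t) (h S r)))

cov-map : ∀ {n m} {Q : Class n} {Q' : Class m} {K} (φ : (F2^ n → Bool) → (F2^ m → Bool)) →
  (∀ {S T} → S ≗ T → φ S ≗ φ T) → (∀ S' → Q' S' → ∃ λ S → Q S × S' ≗ φ S) → Cov Q K → Cov Q' K
cov-map φ r h (L , p , q) = L.map φ L , ≤-trans (≤-reflexive (length-map φ L)) p ,
  λ S' s' → let (S , s , e) = h S' s' in AnyP.map⁺ (Any.map (λ f v → trans (e v) (r f v)) (q S s))

update-same : ∀ {n} (a : F2^ n) b f → update a b f a ≡ b
update-same a b f rewrite does-intro (a ≟V a) refl = refl

update-other : ∀ {n} (a : F2^ n) b f {v} → v ≢ a → update a b f v ≡ f v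
update-other a b f {v} ne rewrite does-intro-¬ (v ≟V a) ne = refl

update-cong : ∀ {n} (a : F2^ n) b {f g} → f ≗ g → update a b f ≗ update a b g
update-cong a b h v with does (v ≟V a)
... | true = refl
... | false = h v

update-id : ∀ {n} (a : F2^ n) {b} f → f a ≡ b → update a b f ≗ f
update-id a f refl v with v ≟V a
... | yes refl = refl
... | no _ = refl

update-update : ∀ {n} (a : F2^ n) b c f → update a b (update a c f) ≗ update a b f
update-update a b c f v with does (v ≟V a)
... | true = refl
... | false = refl

#-remove : ∀ {n} (D : F2^ n → Bool) a → D a ≡ true → suc (# (update a false D)) ≡ # D
#-remove D a p = trans (cong (_+ # (update a false D)) (sym (#-point a)))
  (trans (sym (∑-+ _ _)) (∑-cong lemma))
  where
  lemma : ∀ v → bit (eqV v a) + bit (update a false D v) ≡ bit (D v)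
  lemma v with v ≟V a
  ... | yes refl rewrite p | bit-true | bit-false = refl
  ... | no _ rewrite bit-false = refl

#≡0⇒false : ∀ {n} (D : F2^ n → Bool) → # D ≡ 0 → ∀ v → D v ≡ false
#≡0⇒false D p v = ≢true⇒false λ t → 1+n≢0 (trans (#-remove D v t) p)

Free : ∀ {n} → (F2^ n → Bool) → (F2^ n → Bool) → Class n
Free D g S = ∀ v → D v ≡ false → S v ≡ g v

free-update : ∀ {n} {D g S : F2^ n → Bool} a → Free D g S → Free (update a false D) (update a (S a) g) S
free-update {D = D} {g} {S} a h v p with v ≟V a
... | yes refl = refl
... | no _ = h v p

free-weaken : ∀ {n} {D g S : F2^ n → Bool} a {b} → D a ≡ true → Free (update a false D) (update a b g) S → Free D g S
free-weaken {D = D} {g} {S} a {b} da h v p = trans (h v (trans (update-other a false D ne) p)) (update-other a b g ne)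
  where
  ne : v ≢ a
  ne refl = true≢false da p

cov-free : ∀ {n} K (D g : F2^ n → Bool) → # D ≡ K → Cov (Free D g) (2 ^ K)
cov-free zero D g p = g ∷ [] , ≤-refl , λ S h → here λ v → h v (#≡0⇒false D p v)
cov-free (suc K) D g p with #>0⇒∃ D (subst (0 <_) (sym p) (s≤s z≤n))
... | a , da = cov-mono (≤-reflexive (cong (2 ^ K +_) (sym (+-identityʳ _)))) (cov-∪ split (c false) (c true))
  where
  c : ∀ b → Cov (Free (update a false D) (update a b g)) (2 ^ K)
  c b = cov-free K _ _ (suc-injective (trans (#-remove D a da) p))
  split : ∀ S → Free D g S → Free (update a false D) (update a false g) S ⊎ Free (update a false D) (update a true g) S
  split S h with S a in eq
  ... | false = inj₁ (subst (λ b → Free (update a false D) (update a b g) S) eq (free-update a h))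
  ... | true = inj₂ (subst (λ b → Free (update a false D) (update a b g) S) eq (free-update a h))

length-filter-not : ∀ {A : Set} (f : A → Bool) xs →
  length (L.filter (λ x → f x ≟B false) xs) + length (L.filter (λ x → f x ≟B true) xs) ≡ length xs
length-filter-not f [] = refl
length-filter-not f (x ∷ xs) with f x
... | false = cong suc (length-filter-not f xs)
... | true = trans (+-suc _ _) (cong suc (length-filter-not f xs))

any-filter : ∀ {A : Set} {P Q : A → Set} (Q? : ∀ x → Dec (Q x)) {xs} → Any (λ x → P x × Q x) xs → Any P (L.filter Q? xs)
any-filter Q? {x ∷ xs} (here (p , q)) with Q? x
... | yes _ = here p
... | no ¬q = ⊥-elim (¬q q)
any-filter Q? {x ∷ xs} (there a) with Q? x
... | yes _ = there (any-filter Q? a)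
... | no _ = any-filter Q? a

-- The list is divided according to the value at a free point `a`; each half covers one of the two
-- subcubes. This turns covers into genuine lower bounds and is the source of every counting
-- contradiction.
cov-free-lower : ∀ {n} K (D g : F2^ n → Bool) {B} → # D ≡ K → Cov (Free D g) B → 2 ^ K ≤ B
cov-free-lower zero D g p ([] , le , q) = case q g (λ v _ → refl) of λ ()
cov-free-lower zero D g p (_ ∷ _ , le , q) = ≤-trans (s≤s z≤n) le
cov-free-lower (suc K) D g p (L , le , q) with #>0⇒∃ D (subst (0 <_) (sym p) (s≤s z≤n))
... | a , da = begin
  2 ^ K + (2 ^ K + 0) ≡⟨ cong (2 ^ K +_) (+-identityʳ _) ⟩
  2 ^ K + 2 ^ K ≤⟨ +-mono-≤ (low false) (low true) ⟩
  length (L.filter (λ S → S a ≟B false) L) + length (L.filter (λ S → S a ≟B true) L) ≡⟨ length-filter-not (λ S → S a) L ⟩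
  length L ≤⟨ le ⟩
  _ ∎
  where
  open ≤-Reasoning
  low : ∀ b → 2 ^ K ≤ length (L.filter (λ S → S a ≟B b) L)
  low b = cov-free-lower K (update a false D) (update a b g) (suc-injective (trans (#-remove D a da) p))
    (_ , ≤-refl , λ S h → any-filter (λ S → S a ≟B b) (Any.map (λ {T} e → e , trans (sym (e a)) (Sa S h)) (q S (free-weaken a da h))))
    where
    Sa : ∀ S → Free (update a false D) (update a b g) S → S a ≡ b
    Sa S h = trans (h a (update-same a false D)) (update-same a b g)

-- Shattering (Pajor's form of the Sauer–Shelah lemma)

Shatters : ∀ {n} → Class n → Class n
Shatters {n} F S = ∀ (p : F2^ n → Bool) → ∃ λ M → F M × (∀ v → S v ≡ true → M v ≡ p v)

Supp : ∀ {n} → (F2^ n → Bool) → Class n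
Supp D S = ∀ v → D v ≡ false → S v ≡ false

-- Induction on the ground set. After deletion of a point `a`, the size of `F` is that of `FU`, the
-- traces with some extension in `F`, plus that of `FI`, the traces with both extensions in `F`. A
-- set shattered by `FU` is shattered by `F`, and adding `a` to a set shattered by `FI` gives
-- another set shattered by `F`. The sets found in these two ways are told apart by their value at
-- `a`.
pajor : ∀ {n} N (D : F2^ n → Bool) (F : Class n) → # D ≡ N → (∀ f → Dec (F f)) → (∀ {f g} → f ≗ g → F f → F g) →
  (∀ f → F f → Supp D f) → ∀ {K} → Cov (λ S → Supp D S × Shatters F S) K → Cov F K
pajor zero D F p F? ext supp (L , le , q) with F? (λ _ → false)
... | no ¬f = [] , z≤n , λ S f → ⊥-elim (¬f (ext (λ v → supp S f v (#≡0⇒false D p v)) f))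
... | yes f₀ = (λ _ → false) ∷ [] , ≤-trans (nonempty (q (λ _ → false) ((λ _ _ → refl) , λ p → _ , f₀ , λ v ()))) le ,
    λ S f → here λ v → supp S f v (#≡0⇒false D p v)
  where
  nonempty : ∀ {A : Set} {P : A → Set} {xs} → Any P xs → 1 ≤ length xs
  nonempty (here _) = s≤s z≤n
  nonempty (there _) = s≤s z≤n
pajor {n} (suc N) D F p F? ext supp {K} (L , le , q) with #>0⇒∃ D (subst (0 <_) (sym p) (s≤s z≤n))
... | a , da = cov-mono (≤-trans (≤-reflexive lens) le) (cov-∪ split covU covI)
  where
  D' : F2^ n → Bool
  D' = update a false D
  p' : # D' ≡ N
  p' = suc-injective (trans (#-remove D a da) p)
  FU FI : Class n
  FU f = f a ≡ false × (F (update a false f) ⊎ F (update a true f))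
  FI f = f a ≡ false × (F (update a false f) × F (update a true f))
  L₀ L₁ : List (F2^ n → Bool)
  L₀ = L.filter (λ S → S a ≟B false) L
  L₁ = L.map (update a false) (L.filter (λ S → S a ≟B true) L)
  lens : length L₀ + length L₁ ≡ length L
  lens = trans (cong (length L₀ +_) (length-map _ (L.filter (λ S → S a ≟B true) L))) (length-filter-not (λ S → S a) L)
  suppF : ∀ b f → f a ≡ false → F (update a b f) → Supp D' f
  suppF b f fa Ff v dv with v ≟V a in eq
  ... | yes refl = fa
  ... | no ne = trans (sym (update-other a b f ne)) (supp _ Ff v dv)
  suppUp : ∀ {S} → Supp D' S → Supp D (update a true S)
  suppUp {S} s v dv = trans (update-other a true S ne) (s v (trans (update-other a false D ne) dv))
    where ne : v ≢ a
          ne refl = true≢false da dv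
  suppD : ∀ {S} → Supp D' S → Supp D S
  suppD {S} s v dv = s v (trans (update-other a false D ne) dv)
    where ne : v ≢ a
          ne refl = true≢false da dv
  coverU : ∀ S → Supp D' S × Shatters FU S → Any (S ≗_) L₀
  coverU S (s , sh) = any-filter (λ S → S a ≟B false) (Any.map (λ e → e , trans (sym (e a)) Sa) (q S (suppD s , sh')))
    where
    Sa : S a ≡ false
    Sa = s a (update-same a false D)
    sh' : Shatters F S
    sh' pt with sh pt
    ... | M , (_ , inj₁ Fm) , agr = _ , Fm , λ v sv → trans (update-other a false M (λ { refl → true≢false sv Sa })) (agr v sv)
    ... | M , (_ , inj₂ Fm) , agr = _ , Fm , λ v sv → trans (update-other a true M (λ { refl → true≢false sv Sa })) (agr v sv)
  coverI : ∀ S → Supp D' S × Shatters FI S → Any (S ≗_) L₁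
  coverI S (s , sh) = AnyP.map⁺ (any-filter (λ S → S a ≟B true) (Any.map
      (λ {T} e → (λ v → trans (sym (trans (update-update a false true S v) (update-id a S Sa v))) (update-cong a false e v)) , trans (sym (e a)) (update-same a true S))
      (q (update a true S) (suppUp s , sh'))))
    where
    Sa : S a ≡ false
    Sa = s a (update-same a false D)
    agree : ∀ b (pt M : F2^ n → Bool) → b ≡ pt a → (∀ v → S v ≡ true → M v ≡ pt v) → ∀ v → update a true S v ≡ true → update a b M v ≡ pt v
    agree b pt M e agr v sv with v ≟V a
    ... | yes refl = e
    ... | no _ = agr v sv
    sh' : Shatters F (update a true S)
    sh' pt = go (pt a) refl
      where
      go : ∀ b → pt a ≡ b → ∃ λ M → F M × (∀ v → update a true S v ≡ true → M v ≡ pt v)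
      go false eq = let (M , (_ , F0 , F1) , agr) = sh pt in _ , F0 , agree false pt M (sym eq) agr
      go true eq = let (M , (_ , F0 , F1) , agr) = sh pt in _ , F1 , agree true pt M (sym eq) agr
  covU₀ : Cov FU (length L₀)
  covU₀ = pajor N D' FU p' (λ f → (f a ≟B false) ×-dec (F? _ ⊎-dec F? _))
    (λ {f} {g} e (fa , r) → trans (sym (e a)) fa , [ (λ x → inj₁ (ext (update-cong a false e) x)) , (λ x → inj₂ (ext (update-cong a true e) x)) ]′ r)
    (λ f (fa , r) → [ suppF false f fa , suppF true f fa ]′ r) (L₀ , ≤-refl , coverU)
  covI₀ : Cov FI (length L₁)
  covI₀ = pajor N D' FI p' (λ f → (f a ≟B false) ×-dec (F? _ ×-dec F? _))
    (λ {f} {g} e (fa , x , y) → trans (sym (e a)) fa , ext (update-cong a false e) x , ext (update-cong a true e) y)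
    (λ f (fa , x , _) → suppF false f fa x) (L₁ , ≤-refl , coverI)
  -- One preimage for every trace in `FU`: the extension by `false` if it lies in `F`, otherwise the
  -- one by `true`. `QU` consists of these preimages, `QI` of the remaining members of `F`.
  pick : (F2^ n → Bool) → (F2^ n → Bool)
  pick f = update a (not (does (F? (update a false f)))) f
  QU QI : Class n
  QU f = F f × (f a ≡ false ⊎ ¬ F (update a false f))
  QI f = F f × f a ≡ true × F (update a false f)
  covU : Cov QU (length L₀)
  covU = L.map pick (proj₁ covU₀) , ≤-trans (≤-reflexive (length-map pick (proj₁ covU₀))) (proj₁ (proj₂ covU₀)) , cov
    where
    inU : ∀ f → F f → FU (update a false f)
    inU f Ff = update-same a false f , res
      where
      res : F (update a false (update a false f)) ⊎ F (update a true (update a false f))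
      res with f a in eq
      ... | false = inj₁ (ext (λ v → sym (trans (update-update a false false f v) (update-id a f eq v))) Ff)
      ... | true = inj₂ (ext (λ v → sym (trans (update-update a true false f v) (update-id a f eq v))) Ff)
    cov : ∀ f → QU f → Any (f ≗_) (L.map pick (proj₁ covU₀))
    cov f (Ff , c) = AnyP.map⁺ (Any.map good (proj₂ (proj₂ covU₀) (update a false f) (inU f Ff)))
      where
      good : ∀ {h} → update a false f ≗ h → f ≗ pick h
      good {h} e v = trans (sym (update-id a f (sym (val c)) v)) (trans (sym (update-update a _ false f v)) (update-cong a _ e v))
        where
        h0 : update a false h ≗ update a false f
        h0 v = trans (sym (update-cong a false e v)) (update-update a false false f v)
        val : f a ≡ false ⊎ ¬ F (update a false f) → not (does (F? (update a false h))) ≡ f a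
        val (inj₁ fa) rewrite does-intro (F? (update a false h)) (ext (λ v → sym (trans (h0 v) (update-id a f fa v))) Ff) = sym fa
        val (inj₂ ¬F) rewrite does-intro-¬ (F? (update a false h)) (λ x → ¬F (ext h0 x)) =
          sym (≢false⇒true λ fa → ¬F (ext (λ v → sym (update-id a f fa v)) Ff))
  covI : Cov QI (length L₁)
  covI = cov-map (update a true) (update-cong a true)
    (λ f (Ff , fa , F0) → update a false f ,
      (update-same a false f , ext (λ v → sym (update-update a false false f v)) F0 ,
        ext (λ v → sym (trans (update-update a true false f v) (update-id a f fa v))) Ff) ,
      λ v → sym (trans (update-update a true false f v) (update-id a f fa v))) covI₀
  split : ∀ f → F f → QU f ⊎ QI f
  split f Ff with f a | F? (update a false f)
  ... | false | _ = inj₁ (Ff , inj₁ refl)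
  ... | true | no ¬F = inj₁ (Ff , inj₂ ¬F)
  ... | true | yes F0 = inj₂ (Ff , refl , F0)

-- Sparse sets

-- The partial sum of the binomial coefficients of `K` up to index `d`, by Pascal's rule.
few : ℕ → ℕ → ℕ
few zero d = 1
few (suc K) zero = 1
few (suc K) (suc d) = few K (suc d) + few K d

-- The bound (1 + x)^K x^-d on the partial binomial sum at x = 1/c, with denominators cleared.
few-bound : ∀ c K d → few K d * c ^ K ≤ suc c ^ K * c ^ d ⊎ c ≡ 0
few-bound zero K d = inj₂ refl
few-bound c@(suc _) zero d = inj₁ (≤-trans (m^n>0 c d) (≤-reflexive (sym (+-identityʳ _))))
few-bound c@(suc _) (suc K) zero = inj₁ (≤-trans (≤-reflexive (+-identityʳ _))
  (≤-trans (^-monoˡ-≤ (suc K) (n≤1+n c)) (≤-reflexive (sym (*-identityʳ _)))))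
few-bound c@(suc _) (suc K) (suc d) with few-bound c K (suc d) | few-bound c K d
... | inj₁ p | inj₁ q = inj₁ (begin
  (few K (suc d) + few K d) * (c * c ^ K)
    ≡⟨ solve 4 (λ x y c k → (x :+ y) :* (c :* k) := c :* (x :* k :+ y :* k)) refl (few K (suc d)) (few K d) c (c ^ K) ⟩
  c * (few K (suc d) * c ^ K + few K d * c ^ K)
    ≤⟨ *-monoʳ-≤ c (+-mono-≤ p q) ⟩
  c * (suc c ^ K * (c * c ^ d) + suc c ^ K * c ^ d)
    ≡⟨ solve 3 (λ c s e → c :* (s :* (c :* e) :+ s :* e) := (con 1 :+ c) :* s :* (c :* e)) refl c (suc c ^ K) (c ^ d) ⟩
  suc c * suc c ^ K * (c * c ^ d) ∎)
  where open ≤-Reasoning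
        open +-*-Solver
few-bound (suc c) (suc K) (suc d) | inj₂ () | _
few-bound (suc c) (suc K) (suc d) | _ | inj₂ ()

cov-few : ∀ {n} K d (D : F2^ n → Bool) → # D ≡ K → Cov (λ S → Supp D S × # S ≤ d) (few K d)
cov-few zero d D p = (λ _ → false) ∷ [] , ≤-refl , λ S (s , _) → here λ v → s v (#≡0⇒false D p v)
cov-few (suc K) zero D p = (λ _ → false) ∷ [] , ≤-refl , λ S (_ , z) → here (#≡0⇒false S (n≤0⇒n≡0 z))
cov-few {n} (suc K) (suc d) D p with #>0⇒∃ D (subst (0 <_) (sym p) (s≤s z≤n))
... | a , da = cov-∪ split (cov-few K (suc d) D' p')
    (cov-map {Q' = λ S → Supp D S × # S ≤ suc d × S a ≡ true} (update a true) (update-cong a true)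
      (λ S (s , c , t) → update a false S , (supp' S s , ≤-pred (≤-trans (≤-reflexive (#-remove S a t)) c)) ,
        λ v → sym (trans (update-update a true false S v) (update-id a S t v))) (cov-few K d D' p'))
  where
  D' : F2^ n → Bool
  D' = update a false D
  p' : # D' ≡ K
  p' = suc-injective (trans (#-remove D a da) p)
  supp' : ∀ S → Supp D S → Supp D' (update a false S)
  supp' S s v dv with v ≟V a
  ... | yes refl = refl
  ... | no _ = s v dv
  split : ∀ S → Supp D S × # S ≤ suc d → (Supp D' S × # S ≤ suc d) ⊎ (Supp D S × # S ≤ suc d × S a ≡ true)
  split S (s , c) with S a in eq
  ... | true = inj₂ (s , c , refl)
  ... | false = inj₁ ((λ v dv → trans (sym (update-id a S eq v)) (supp' S s v dv)) , c)

-- Bernoulli's inequality for (1 + 1/y)^n without denominators. With exponent `suc y` it makes a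
-- factor 1 - 1/(y+1), repeated y+1 times, at most one half.
bernoulli : ∀ y n → y ^ n * (y + n) ≤ suc y ^ n * y
bernoulli y zero = ≤-reflexive (cong (1 *_) (+-identityʳ y))
bernoulli y (suc n) = begin
  y * y ^ n * (y + suc n) ≤⟨ m≤m+n _ (y ^ n * n) ⟩
  y * y ^ n * (y + suc n) + y ^ n * n
    ≡⟨ solve 3 (λ y p n → y :* p :* (y :+ (con 1 :+ n)) :+ p :* n := (con 1 :+ y) :* (p :* (y :+ n))) refl y (y ^ n) n ⟩
  suc y * (y ^ n * (y + n)) ≤⟨ *-monoʳ-≤ (suc y) (bernoulli y n) ⟩
  suc y * (suc y ^ n * y) ≡⟨ sym (*-assoc (suc y) (suc y ^ n) y) ⟩
  suc y ^ suc n * y ∎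
  where open ≤-Reasoning
        open +-*-Solver

shrink : ∀ y → y ^ suc y * 2 ≤ suc y ^ suc y
shrink zero = z≤n
shrink y@(suc _) = *-cancelʳ-≤ _ _ y (begin
  y ^ suc y * 2 * y ≡⟨ *-assoc (y ^ suc y) 2 y ⟩
  y ^ suc y * (2 * y) ≤⟨ *-monoʳ-≤ (y ^ suc y) (+-monoʳ-≤ y (≤-trans (≤-reflexive (+-identityʳ y)) (n≤1+n y))) ⟩
  y ^ suc y * (y + suc y) ≤⟨ bernoulli y (suc y) ⟩
  suc y ^ suc y * y ∎)
  where open ≤-Reasoning

^-distribʳ-* : ∀ n x y → (x * y) ^ n ≡ x ^ n * y ^ n
^-distribʳ-* zero x y = refl
^-distribʳ-* (suc n) x y = trans (cong (x * y *_) (^-distribʳ-* n x y))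
  (solve 4 (λ x y p q → x :* y :* (p :* q) := x :* p :* (y :* q)) refl x y (x ^ n) (y ^ n))
  where open +-*-Solver

2^-split : ∀ {a n} → a ≤ n → 2 ^ (n ∸ a) * 2 ^ a ≡ 2 ^ n
2^-split {a} {n} le = trans (sym (^-distribˡ-+-* 2 (n ∸ a) a)) (cong (2 ^_) (m∸n+n≡m le))

2^-half : ∀ {a n} → suc a ≤ n → 2 ^ (n ∸ suc a) + 2 ^ (n ∸ suc a) ≡ 2 ^ (n ∸ a)
2^-half {a} {n} le = trans (cong (2 ^ (n ∸ suc a) +_) (sym (+-identityʳ _))) (cong (2 ^_) (sym (+-∸-assoc 1 le)))

2^-mono : ∀ {a b} → a ≤ b → 2 ^ a ≤ 2 ^ b
2^-mono = ^-monoʳ-≤ 2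

n<2^n : ∀ n → n < 2 ^ n
n<2^n zero = s≤s z≤n
n<2^n (suc n) = begin
  suc (suc n) ≤⟨ s≤s (n<2^n n) ⟩
  suc (2 ^ n) ≤⟨ +-monoˡ-≤ (2 ^ n) (2^>0 n) ⟩
  2 ^ n + 2 ^ n ≡⟨ cong (2 ^ n +_) (sym (+-identityʳ _)) ⟩
  2 ^ suc n ∎
  where open ≤-Reasoning

*2^-cancel : ∀ a {x y} → x * 2 ^ a ≤ y * 2 ^ a → x ≤ y
*2^-cancel a {x} {y} p = *-cancelʳ-≤ x y (2 ^ a) {{m^n≢0 2 a}} p

-- This is (1 - 1/(c+1))^m ≥ 1 - m/(c+1) with denominators cleared; for c = 2m it gives (1 +
-- 1/(2m))^m ≤ 2.
growth : ∀ m r c → suc c ≡ m + r → suc c ^ m * r ≤ c ^ m * suc c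
growth zero r c e = ≤-reflexive (trans (+-identityʳ r) (trans (sym e) (sym (+-identityʳ _))))
growth (suc m) r c e = begin
  suc c * suc c ^ m * r ≡⟨ solve 3 (λ s p r → s :* p :* r := p :* (s :* r)) refl (suc c) (suc c ^ m) r ⟩
  suc c ^ m * (suc c * r) ≤⟨ *-monoʳ-≤ (suc c ^ m) le ⟩
  suc c ^ m * (c * suc r) ≡⟨ solve 3 (λ p c r → p :* (c :* r) := c :* (p :* r)) refl (suc c ^ m) c (suc r) ⟩
  c * (suc c ^ m * suc r) ≤⟨ *-monoʳ-≤ c (growth m (suc r) c (trans e (sym (+-suc m r)))) ⟩
  c * (c ^ m * suc c) ≡⟨ sym (*-assoc c (c ^ m) (suc c)) ⟩
  c * c ^ m * suc c ∎
  where
  open ≤-Reasoning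
  open +-*-Solver
  le : suc c * r ≤ c * suc r
  le = ≤-trans (+-monoˡ-≤ (c * r) (≤-trans (m≤n+m r m) (≤-reflexive (sym (suc-injective e))))) (≤-reflexive (sym (*-suc c r)))

double : ∀ m → suc (2 * m) ^ m ≤ 2 * (2 * m) ^ m
double m = *-cancelʳ-≤ _ _ (suc m) (begin
  suc (2 * m) ^ m * suc m ≤⟨ growth m (suc m) (2 * m) (trans (cong (λ x → suc (m + x)) (+-identityʳ m)) (sym (+-suc m m))) ⟩
  (2 * m) ^ m * suc (2 * m) ≤⟨ *-monoʳ-≤ ((2 * m) ^ m) (≤-trans (n≤1+n _) (≤-reflexive (sym (*-suc 2 m)))) ⟩
  (2 * m) ^ m * (2 * suc m) ≡⟨ solve 2 (λ p s → p :* (con 2 :* s) := con 2 :* p :* s) refl ((2 * m) ^ m) (suc m) ⟩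
  2 * (2 * m) ^ m * suc m ∎)
  where open ≤-Reasoning
        open +-*-Solver

Sparse : ∀ {n} → ℕ → Class n
Sparse {n} q S = # S * 2 ^ q ≤ 2 ^ n

-- `few-bound` at c = 2^g leaves two factors, (1 + 1/c)^(2^n) and c^d. The first is at most 2^x by
-- `double`, the second because g d ≤ x, where x is half of 2^(n-p).
cov-sparse : ∀ p → Σ ℕ λ q → p < q × (∀ n → q ≤ n → Cov {n} (Sparse q) (2 ^ (2 ^ (n ∸ p))))
cov-sparse p = q , ≤-trans (m≤m+n (suc p) g) ≤-refl , main
  where
  g q m c : ℕ
  -- With this value `c` is `2 * m`, as `double` requires.
  g = suc (suc p)
  q = suc p + g
  m = 2 ^ suc p
  c = 2 ^ g
  main : ∀ n → q ≤ n → Cov (Sparse q) (2 ^ (2 ^ (n ∸ p)))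
  main n q≤n = cov-mono bound (cov-⊆ (λ S s → (λ v ()) , *2^-cancel q (≤-trans s (≤-reflexive (sym (2^-split q≤n))))) (cov-few (2 ^ n) d (λ _ → true) full))
    where
    d x : ℕ
    d = 2 ^ (n ∸ q)
    x = 2 ^ (n ∸ suc p)
    p<n : suc p ≤ n
    p<n = ≤-trans (m≤m+n (suc p) g) q≤n
    full : # (λ (v : F2^ n) → true) ≡ 2 ^ n
    full = trans (∑-cong (λ _ → bit-true)) (trans (∑-const n 1) (*-identityʳ _))
    open ≤-Reasoning
    open +-*-Solver
    big : suc c ^ (2 ^ n) ≤ 2 ^ x * c ^ (2 ^ n)
    big = begin
      suc c ^ (2 ^ n) ≡⟨ cong (suc c ^_) (trans (sym (2^-split p<n)) (*-comm x m)) ⟩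
      suc c ^ (m * x) ≡⟨ sym (^-*-assoc (suc c) m x) ⟩
      (suc c ^ m) ^ x ≤⟨ ^-monoˡ-≤ x (double m) ⟩
      (2 * c ^ m) ^ x ≡⟨ ^-distribʳ-* x 2 (c ^ m) ⟩
      2 ^ x * (c ^ m) ^ x ≡⟨ cong (2 ^ x *_) (trans (^-*-assoc c m x) (cong (c ^_) (trans (*-comm m x) (2^-split p<n)))) ⟩
      2 ^ x * c ^ (2 ^ n) ∎
    gd : g * d ≤ x
    gd = *2^-cancel (suc p) (begin
      g * d * 2 ^ suc p ≤⟨ *-monoˡ-≤ (2 ^ suc p) (*-monoˡ-≤ d (<⇒≤ (n<2^n g))) ⟩
      2 ^ g * d * 2 ^ suc p ≡⟨ solve 3 (λ a b c → a :* b :* c := b :* (c :* a)) refl (2 ^ g) d (2 ^ suc p) ⟩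
      d * (2 ^ suc p * 2 ^ g) ≡⟨ cong (d *_) (sym (^-distribˡ-+-* 2 (suc p) g)) ⟩
      d * 2 ^ q ≡⟨ 2^-split q≤n ⟩
      2 ^ n ≡⟨ sym (2^-split p<n) ⟩
      x * 2 ^ suc p ∎)
    fb : few (2 ^ n) d * c ^ (2 ^ n) ≤ suc c ^ (2 ^ n) * c ^ d
    fb with few-bound c (2 ^ n) d
    ... | inj₁ r = r
    ... | inj₂ r = ⊥-elim (m^n≢0' r)
      where m^n≢0' : c ≡ 0 → ⊥
            m^n≢0' e = <-irrefl (sym e) (2^>0 g)
    bound : few (2 ^ n) d ≤ 2 ^ (2 ^ (n ∸ p))
    bound = *-cancelʳ-≤ _ _ (c ^ (2 ^ n)) {{m^n≢0 c (2 ^ n) {{m^n≢0 2 g}}}} (begin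
      few (2 ^ n) d * c ^ (2 ^ n) ≤⟨ fb ⟩
      suc c ^ (2 ^ n) * c ^ d ≤⟨ *-monoˡ-≤ (c ^ d) big ⟩
      2 ^ x * c ^ (2 ^ n) * c ^ d ≡⟨ solve 3 (λ a b c → a :* b :* c := (a :* c) :* b) refl (2 ^ x) (c ^ (2 ^ n)) (c ^ d) ⟩
      (2 ^ x * c ^ d) * c ^ (2 ^ n) ≡⟨ cong (λ y → (2 ^ x * y) * c ^ (2 ^ n)) (^-*-assoc 2 g d) ⟩
      (2 ^ x * 2 ^ (g * d)) * c ^ (2 ^ n) ≤⟨ *-monoˡ-≤ (c ^ (2 ^ n)) (*-monoʳ-≤ (2 ^ x) (2^-mono gd)) ⟩
      (2 ^ x * 2 ^ x) * c ^ (2 ^ n) ≡⟨ cong (_* c ^ (2 ^ n)) (trans (sym (^-distribˡ-+-* 2 x x)) (cong (2 ^_) (2^-half p<n))) ⟩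
      2 ^ (2 ^ (n ∸ p)) * c ^ (2 ^ n) ∎)

-- Forbidding one pattern on each of many disjoint tiles

NoDup : ∀ {A : Set} → List A → Set
NoDup [] = ⊤
NoDup (x ∷ xs) = x ∉ xs × NoDup xs

NoDup-++ : ∀ {A : Set} (xs : List A) {ys} → NoDup xs → NoDup ys → (∀ x → x ∈ xs → x ∉ ys) → NoDup (xs ++ ys)
NoDup-++ [] _ d _ = d
NoDup-++ (x ∷ xs) (n , c) d h =
  (λ p → [ n , h x (here refl) ]′ (AnyP.++⁻ xs p)) , NoDup-++ xs c d (λ y q → h y (there q))

#-NoDup : ∀ {n} (W : List (F2^ n)) → NoDup W → length W ≤ # (inList W)
#-NoDup [] _ = z≤n
#-NoDup (w ∷ W) (nw , d) = begin
  suc (length W) ≤⟨ s≤s (#-NoDup W d) ⟩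
  suc (# (inList W)) ≤⟨ s≤s (#-mono λ v p → trans (update-other w false (inList (w ∷ W)) (λ { refl → nw (inList-elim p) })) (inList-intro {W = w ∷ W} (there (inList-elim p)))) ⟩
  suc (# (update w false (inList (w ∷ W)))) ≡⟨ #-remove (inList (w ∷ W)) w (inList-intro {W = w ∷ W} (here refl)) ⟩
  # (inList (w ∷ W)) ∎
  where open ≤-Reasoning

assigns : ∀ {n} → List (F2^ n) → (F2^ n → Bool) → List (F2^ n → Bool)
assigns [] g = g ∷ []
assigns (x ∷ t) g = L.concatMap (λ h → update x false h ∷ update x true h ∷ []) (assigns t g)

length-assigns : ∀ {n} (t : List (F2^ n)) g → length (assigns t g) ≤ 2 ^ length t
length-assigns [] g = ≤-refl
length-assigns (x ∷ t) g = ≤-trans (length-concatMap _ 2 (assigns t g) (λ _ → ≤-refl))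
  (≤-trans (*-monoˡ-≤ 2 (length-assigns t g)) (≤-reflexive (*-comm (2 ^ length t) 2)))

assigns-complete : ∀ {n} (t : List (F2^ n)) g (S : F2^ n → Bool) →
  Any (λ h → (∀ v → v ∈ t → S v ≡ h v) × (∀ v → v ∉ t → h v ≡ g v)) (assigns t g)
assigns-complete [] g S = here ((λ v ()) , λ v _ → refl)
assigns-complete {n} (x ∷ t) g S = AnyP.concat⁺ (AnyP.map⁺ (Any.map step (assigns-complete t g S)))
  where
  ok : ∀ {h} b → S x ≡ b → (∀ v → v ∈ t → S v ≡ h v) × (∀ v → v ∉ t → h v ≡ g v) →
    (∀ v → v ∈ x ∷ t → S v ≡ update x b h v) × (∀ v → v ∉ x ∷ t → update x b h v ≡ g v)
  ok {h} b e (p , q) = (λ v → on v) , λ v nv → trans (update-other x b h (λ r → nv (here r))) (q v (λ r → nv (there r)))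
    where
    on : ∀ v → v ∈ x ∷ t → S v ≡ update x b h v
    on v m with v ≟V x
    ... | yes refl = e
    on v (here r) | no ne = ⊥-elim (ne r)
    on v (there r) | no ne = p v r
  step : ∀ {h} → _ → Any _ (update x false h ∷ update x true h ∷ [])
  step {h} pq = go (S x) refl
    where
    go : ∀ b → S x ≡ b → Any (λ h → (∀ v → v ∈ x ∷ t → S v ≡ h v) × (∀ v → v ∉ x ∷ t → h v ≡ g v)) (update x false h ∷ update x true h ∷ [])
    go false e = here (ok {h} false e pq)
    go true e = there (here (ok {h} true e pq))

length-filter-< : ∀ {A : Set} {P : A → Set} (P? : ∀ x → Dec (P x)) {xs} → Any (λ x → ¬ P x) xs →
  suc (length (L.filter P? xs)) ≤ length xs
length-filter-< P? {x ∷ xs} (here np) with P? x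
... | yes p = ⊥-elim (np p)
... | no _ = s≤s (lf xs)
  where
  lf : ∀ ys → length (L.filter P? ys) ≤ length ys
  lf [] = z≤n
  lf (y ∷ ys) with P? y
  ... | yes _ = s≤s (lf ys)
  ... | no _ = m≤n⇒m≤1+n (lf ys)
length-filter-< P? {x ∷ xs} (there a) with P? x
... | yes p = s≤s (length-filter-< P? a)
... | no _ = m≤n⇒m≤1+n (length-filter-< P? a)

all∈? : ∀ {n} (t : List (F2^ n)) (f g : F2^ n → Bool) → Dec (∀ v → v ∈ t → f v ≡ g v)
all∈? t f g = ∀-dec enumV λ v → any? (v ≟V_) t →-dec (f v ≟B g v)

-- A place inside `C` and outside the points `W` already used, on which one of the 2^b patterns
-- never occurs in a member of `Q`. Every use of the forbidden structures of `P` is reduced to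
-- supplying such tiles.
record Tile {n} (b : ℕ) (C : F2^ n → Bool) (Q : Class n) (W : List (F2^ n)) : Set where
  constructor mkTile
  field
    pts      : List (F2^ n)
    pat      : F2^ n → Bool
    size     : length pts ≡ b
    distinct : NoDup pts
    inside   : ∀ v → v ∈ pts → C v ≡ true
    fresh    : ∀ v → v ∈ pts → v ∉ W
    avoided  : ∀ S → Q S → ¬ (∀ v → v ∈ pts → S v ≡ pat v)

module _ {n} (b : ℕ) (C : F2^ n → Bool) (Q : Class n) (supp : ∀ S → Q S → Supp C S) where

  private
    Agree : List (F2^ n) → (F2^ n → Bool) → Class n
    Agree W g S = Q S × (∀ w → w ∈ W → S w ≡ g w)

  tiles-fit : ∀ m W → NoDup W → (∀ w → w ∈ W → C w ≡ true) →
    (∀ W' → length W' ≤ length W + m * b → Tile b C Q W') → length W + m * b ≤ # C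
  tiles-fit zero W d c _ = ≤-trans (≤-reflexive (+-identityʳ _)) (≤-trans (#-NoDup W d) (#-mono λ v p → c v (inList-elim p)))
  tiles-fit (suc m) W d c find = ≤-trans (≤-reflexive eq) (tiles-fit m (pts ++ W) (NoDup-++ pts distinct d fresh)
      (λ w p → [ inside w , c w ]′ (AnyP.++⁻ pts p)) (λ W' l → find W' (≤-trans l (≤-reflexive (sym eq)))))
    where
    open Tile (find W (m≤m+n _ _))
    eq : length W + (b + m * b) ≡ length (pts ++ W) + m * b
    eq = trans (trans (sym (+-assoc (length W) b (m * b))) (cong (_+ m * b) (+-comm (length W) b)))
      (cong (_+ m * b) (sym (trans (length-++ pts) (cong (_+ length W) size))))

  -- Greedy: each of the `m` disjoint tiles leaves at most 2^b - 1 of its 2^b patterns, and the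
  -- points of `C` outside all tiles remain free.
  cov-tiles : ∀ m W g → NoDup W → (∀ w → w ∈ W → C w ≡ true) →
    (∀ W' → length W' ≤ length W + m * b → Tile b C Q W') →
    Cov (Agree W g) ((2 ^ b ∸ 1) ^ m * 2 ^ (# C ∸ (length W + m * b)))
  cov-tiles zero W g d c _ = cov-mono le (cov-⊆ free (cov-free (# D) D g' refl))
    where
    D g' : F2^ n → Bool
    D v = C v ∧ not (inList W v)
    g' v = C v ∧ g v
    free : ∀ S → Agree W g S → Free D g' S
    free S (s , a) v dv with C v in eq
    ... | false = supp S s v eq
    ... | true = a v (inList-elim {W = W} (≢false⇒true λ e → true≢false (not-intro e) dv))
    le : 2 ^ # D ≤ 1 * 2 ^ (# C ∸ (length W + 0))
    le = ≤-trans (2^-mono (≤-trans (m+n≤o⇒m≤o∸n (# D) lt) (≤-reflexive (cong (# C ∸_) (sym (+-identityʳ (length W))))))) (≤-reflexive (sym (+-identityʳ _)))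
      where
      both : ∀ v → bit (D v) + bit (inList W v) ≤ bit (C v)
      both v with inList W v in eq | C v in eq'
      ... | true | true rewrite bit-true | bit-false = ≤-refl
      ... | true | false = ⊥-elim (true≢false (c v (inList-elim eq)) eq')
      ... | false | true rewrite bit-true | bit-false = ≤-refl
      ... | false | false rewrite bit-false = ≤-refl
      lt : # D + length W ≤ # C
      lt = ≤-trans (+-monoʳ-≤ (# D) (#-NoDup W d)) (≤-trans (≤-reflexive (sym (∑-+ _ _))) (∑-mono both))
  cov-tiles (suc m) W g d c find = cov-mono le (cov-⋃ hs (λ h → Agree (pts ++ W) h) ih cover)
    where
    open Tile (find W (m≤m+n _ _))
    eq : length W + (b + m * b) ≡ length (pts ++ W) + m * b
    eq = trans (trans (sym (+-assoc (length W) b (m * b))) (cong (_+ m * b) (+-comm (length W) b)))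
      (cong (_+ m * b) (sym (trans (length-++ pts) (cong (_+ length W) size))))
    Q? : ∀ h → Dec (¬ (∀ v → v ∈ pts → h v ≡ pat v))
    Q? h = ¬? (all∈? pts h pat)
    hs : List (F2^ n → Bool)
    hs = L.filter Q? (assigns pts g)
    len : length hs ≤ 2 ^ b ∸ 1
    len = <⇒≤pred (≤-trans (length-filter-< Q? (Any.map (λ (p , _) ¬h → ¬h λ v m → sym (p v m)) (assigns-complete pts g pat)))
      (≤-trans (length-assigns pts g) (≤-reflexive (cong (2 ^_) size))))
    ih : ∀ h → Cov (Agree (pts ++ W) h) ((2 ^ b ∸ 1) ^ m * 2 ^ (# C ∸ (length (pts ++ W) + m * b)))
    ih h = cov-tiles m (pts ++ W) h (NoDup-++ pts distinct d fresh) (λ w p → [ inside w , c w ]′ (AnyP.++⁻ pts p))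
      (λ W' l → find W' (≤-trans l (≤-reflexive (sym eq))))
    cover : ∀ S → Agree W g S → Any (λ h → Agree (pts ++ W) h S) hs
    cover S (s , a) = any-filter Q? (Any.map pick (assigns-complete pts g S))
      where
      pick : ∀ {h} → (∀ v → v ∈ pts → S v ≡ h v) × (∀ v → v ∉ pts → h v ≡ g v) →
        Agree (pts ++ W) h S × ¬ (∀ v → v ∈ pts → h v ≡ pat v)
      pick {h} (p , q) = (s , λ w r → [ p w , (λ r' → trans (a w r') (sym (q w λ r'' → fresh w r'' r'))) ]′ (AnyP.++⁻ pts r)) ,
        λ hp → avoided S s λ v m → trans (p v m) (hp v m)
    le : length hs * ((2 ^ b ∸ 1) ^ m * 2 ^ (# C ∸ (length (pts ++ W) + m * b))) ≤ (2 ^ b ∸ 1) ^ suc m * 2 ^ (# C ∸ (length W + suc m * b))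
    le = ≤-trans (*-monoˡ-≤ _ len) (≤-reflexive (trans (sym (*-assoc (2 ^ b ∸ 1) ((2 ^ b ∸ 1) ^ m) _))
      (cong (λ e → (2 ^ b ∸ 1) ^ suc m * 2 ^ (# C ∸ e)) (sym eq))))

shrink-2^ : ∀ b m → (2 ^ b ∸ 1) ^ (2 ^ b * m) * 2 ^ m ≤ 2 ^ (2 ^ b * m * b)
shrink-2^ b m = begin
  (2 ^ b ∸ 1) ^ (2 ^ b * m) * 2 ^ m ≡⟨ cong (_* 2 ^ m) (sym (^-*-assoc (2 ^ b ∸ 1) (2 ^ b) m)) ⟩
  ((2 ^ b ∸ 1) ^ 2 ^ b) ^ m * 2 ^ m ≡⟨ sym (^-distribʳ-* m ((2 ^ b ∸ 1) ^ 2 ^ b) 2) ⟩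
  ((2 ^ b ∸ 1) ^ 2 ^ b * 2) ^ m ≤⟨ ^-monoˡ-≤ m (sh (2 ^ b) (2^>0 b)) ⟩
  ((2 ^ b) ^ 2 ^ b) ^ m ≡⟨ ^-*-assoc (2 ^ b) (2 ^ b) m ⟩
  (2 ^ b) ^ (2 ^ b * m) ≡⟨ ^-*-assoc 2 b (2 ^ b * m) ⟩
  2 ^ (b * (2 ^ b * m)) ≡⟨ cong (2 ^_) (*-comm b _) ⟩
  2 ^ (2 ^ b * m * b) ∎
  where
  open ≤-Reasoning
  sh : ∀ x → 0 < x → (x ∸ 1) ^ x * 2 ≤ x ^ x
  sh (suc y) _ = shrink y

-- Since (1 - 2^-b)^(2^b) ≤ 1/2, every 2^b disjoint tiles of size `b` halve the number of sets. The
-- first component records that so many tiles fit into `C`.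
loss : ∀ {n} b (C : F2^ n → Bool) (Q : Class n) → (∀ S → Q S → Supp C S) → ∀ m →
  (∀ W → length W ≤ 2 ^ b * m * b → Tile b C Q W) → 2 ^ b * m * b ≤ # C × Cov Q (2 ^ (# C ∸ m))
loss {n} b C Q supp m find = fit , cov-mono le (cov-⊆ (λ S s → s , λ w ()) (cov-tiles b C Q supp M [] (λ _ → false) tt (λ w ()) find))
  where
  M : ℕ
  M = 2 ^ b * m
  fit : M * b ≤ # C
  fit = tiles-fit b C Q supp M [] tt (λ w ()) find
  open ≤-Reasoning
  le : (2 ^ b ∸ 1) ^ M * 2 ^ (# C ∸ M * b) ≤ 2 ^ (# C ∸ m)
  le = *2^-cancel m (begin
    (2 ^ b ∸ 1) ^ M * 2 ^ (# C ∸ M * b) * 2 ^ m ≡⟨ solve 3 (λ x y z → x :* y :* z := (x :* z) :* y) refl ((2 ^ b ∸ 1) ^ M) (2 ^ (# C ∸ M * b)) (2 ^ m) ⟩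
    ((2 ^ b ∸ 1) ^ M * 2 ^ m) * 2 ^ (# C ∸ M * b) ≤⟨ *-monoˡ-≤ (2 ^ (# C ∸ M * b)) (shrink-2^ b m) ⟩
    2 ^ (M * b) * 2 ^ (# C ∸ M * b) ≡⟨ trans (*-comm (2 ^ (M * b)) _) (2^-split fit) ⟩
    2 ^ # C ≤⟨ 2^-mono (m≤n+m∸n (# C) m) ⟩
    2 ^ (m + (# C ∸ m)) ≡⟨ trans (^-distribˡ-+-* 2 m (# C ∸ m)) (*-comm (2 ^ m) _) ⟩
    2 ^ (# C ∸ m) * 2 ^ m ∎)
    where open +-*-Solver

-- Affine flats in dense sets

⊕-++ : ∀ {m n} (a c : F2^ m) (b d : F2^ n) → (a ++ᵛ b) ⊕ (c ++ᵛ d) ≡ (a ⊕ c) ++ᵛ (b ⊕ d)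
⊕-++ [] [] b d = refl
⊕-++ (x ∷ a) (y ∷ c) b d = cong ((x xor y) ∷_) (⊕-++ a c b d)

++-zeros : ∀ {m n} (a : F2^ m) (b : F2^ n) → a ++ᵛ b ≡ zeros → a ≡ zeros × b ≡ zeros
++-zeros [] b p = refl , p
++-zeros (x ∷ a) b p with ++-zeros a b (cong tail p)
... | q , r = cong₂ _∷_ (cong head p) q , r

lin-prefix : ∀ q {z s} (Y : Vec (F2^ z) s) v → lin (map (zeros {q} ++ᵛ_) Y) v ≡ zeros ++ᵛ lin Y v
lin-prefix q [] [] = sym (zeros-++ q)
lin-prefix q (y ∷ Y) (b ∷ v) = trans (cong₂ _⊕_ (pull b) (lin-prefix q Y v))
  (trans (⊕-++ zeros zeros (b · y) (lin Y v)) (cong (λ (x : F2^ q) → x ++ᵛ (b · y ⊕ lin Y v)) (⊕-self zeros)))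
  where
  pull : ∀ b → b · (zeros {q} ++ᵛ y) ≡ zeros ++ᵛ (b · y)
  pull false = sym (zeros-++ q)
  pull true = refl

#-all : ∀ n → # (λ (v : F2^ n) → true) ≡ 2 ^ n
#-all n = trans (∑-cong (λ _ → bit-true)) (trans (∑-const n 1) (*-identityʳ _))

HasFlat : ℕ → ℕ → ℕ → Set
HasFlat s z p = (E : F2^ z → Bool) → 2 ^ z ≤ # E * 2 ^ p →
  ∃₂ λ y (Y : Vec (F2^ z) s) → Inj Y × (∀ v → E (y ⊕ lin Y v) ≡ true)

-- Cut the space into 2^q slices. The density makes the average column contain at least two points,
-- so after discarding one point per column many columns still contain a pair. One pair of slices
-- `u₁`, `u₂` serves a 2^-p' part of the columns; a flat in that part, doubled in the direction
-- `u₁ ⊕ u₂`, lies in `E`. In 2^p' the exponent 3q pays for the pairs and for the weight of a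
-- column, the extra factor 2 for strictness.
flat-step : ∀ s p q p' z' → 2 ^ q ≡ 2 * 2 ^ p → 2 ^ p' ≡ 2 * 2 ^ (q + (q + q)) → HasFlat s z' p' → HasFlat (suc s) (q + z') p
flat-step s p q p' z' eq-q eq-p ih = main
  where
  main : HasFlat (suc s) (q + z') p
  main E h = go (∃-dec enumV λ u₁ → ∃-dec enumV λ u₂ → 2 ^ z' ≤? # (G u₁ u₂) * 2 ^ p')
    where
    open ≤-Reasoning
    open +-*-Solver
    G : F2^ q → F2^ q → F2^ z' → Bool
    G u₁ u₂ w = not (eqV u₁ u₂) ∧ (E (u₁ ++ᵛ w) ∧ E (u₂ ++ᵛ w))
    good : F2^ z' → Bool
    good w = some λ u₁ → some λ u₂ → G u₁ u₂ w
    col : ∀ w → # (λ u → E (u ++ᵛ w)) ≤ 2 ^ q * bit (good w) + 1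
    col w with good w in eq
    ... | true rewrite bit-true = ≤-trans (#≤ _) (≤-trans (≤-reflexive (sym (*-identityʳ _))) (m≤m+n _ 1))
    ... | false = ≤-trans single (m≤n+m 1 _)
      where
      single : # (λ u → E (u ++ᵛ w)) ≤ 1
      single with ∃-dec enumV (λ u → E (u ++ᵛ w) ≟B true)
      ... | no ¬e = ≤-trans (#-mono {g = λ _ → false} λ u e → ⊥-elim (¬e (u , e))) (≤-trans (≤-reflexive #-∅) z≤n)
      ... | yes (u₁ , e₁) = ≤-trans (#-mono {g = λ u → eqV u u₁} λ u e → does-intro (u ≟V u₁)
            (decidable-stable (u ≟V u₁) λ ne → true≢false
              (some-intro (λ u₁ → some λ u₂ → G u₁ u₂ w) u₁ (some-intro (λ u₂ → G u₁ u₂ w) u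
                (∧-intro (not-intro (does-intro-¬ (u₁ ≟V u) (λ x → ne (sym x)))) (∧-intro e₁ e)))) eq))
          (≤-reflexive (#-point u₁))
    total : # E ≤ 2 ^ q * # good + 2 ^ z'
    total = begin
      # E ≡⟨ ∑-++ q _ ⟩
      ∑ (λ u → ∑ (λ w → bit (E (u ++ᵛ w)))) ≡⟨ ∑-swap _ ⟩
      ∑ (λ w → # (λ u → E (u ++ᵛ w))) ≤⟨ ∑-mono col ⟩
      ∑ (λ w → 2 ^ q * bit (good w) + 1) ≡⟨ ∑-+ _ _ ⟩
      ∑ (λ w → 2 ^ q * bit (good w)) + ∑ {z'} (λ w → 1) ≡⟨ cong₂ _+_ (∑-* (2 ^ q) _) (trans (∑-const z' 1) (*-identityʳ _)) ⟩
      2 ^ q * # good + 2 ^ z' ∎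
    many : 2 ^ z' ≤ 2 ^ q * # good
    many = +-cancelʳ-≤ (2 ^ z') _ _ (*2^-cancel p (begin
      (2 ^ z' + 2 ^ z') * 2 ^ p ≡⟨ trans (solve 2 (λ a b → (a :+ a) :* b := con 2 :* b :* a) refl (2 ^ z') (2 ^ p)) (cong (_* 2 ^ z') (sym eq-q)) ⟩
      2 ^ q * 2 ^ z' ≡⟨ sym (^-distribˡ-+-* 2 q z') ⟩
      2 ^ (q + z') ≤⟨ h ⟩
      # E * 2 ^ p ≤⟨ *-monoˡ-≤ (2 ^ p) total ⟩
      (2 ^ q * # good + 2 ^ z') * 2 ^ p ∎))
    go : Dec (∃₂ λ u₁ u₂ → 2 ^ z' ≤ # (G u₁ u₂) * 2 ^ p') → _
    go (no ¬e) = ⊥-elim (<⇒≱ (m<m+n (2 ^ (q + (q + q)) * 2 ^ z') (*-mono-≤ (2^>0 (q + (q + q))) (2^>0 z'))) (begin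
      2 ^ (q + (q + q)) * 2 ^ z' + 2 ^ (q + (q + q)) * 2 ^ z'
        ≡⟨ trans (solve 2 (λ a b → a :* b :+ a :* b := b :* (con 2 :* a)) refl (2 ^ (q + (q + q))) (2 ^ z')) (cong (2 ^ z' *_) (sym eq-p)) ⟩
      2 ^ z' * 2 ^ p' ≤⟨ *-monoˡ-≤ (2 ^ p') many ⟩
      2 ^ q * # good * 2 ^ p' ≤⟨ *-monoˡ-≤ (2 ^ p') (*-monoʳ-≤ (2 ^ q) cnt) ⟩
      2 ^ q * ∑ (λ u₁ → ∑ (λ u₂ → # (G u₁ u₂))) * 2 ^ p' ≡⟨ *-assoc (2 ^ q) _ (2 ^ p') ⟩
      2 ^ q * (∑ (λ u₁ → ∑ (λ u₂ → # (G u₁ u₂))) * 2 ^ p')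
        ≡⟨ cong (2 ^ q *_) (trans (sym (∑-*ʳ (2 ^ p') _)) (∑-cong λ u₁ → sym (∑-*ʳ (2 ^ p') _))) ⟩
      2 ^ q * ∑ (λ u₁ → ∑ (λ u₂ → # (G u₁ u₂) * 2 ^ p'))
        ≤⟨ *-monoʳ-≤ (2 ^ q) (∑-mono λ u₁ → ∑-mono λ u₂ → <⇒≤ (≰⇒> λ l → ¬e (u₁ , u₂ , l))) ⟩
      2 ^ q * ∑ {q} (λ u₁ → ∑ {q} (λ u₂ → 2 ^ z')) ≡⟨ cong (2 ^ q *_) (trans (∑-cong λ _ → ∑-const q (2 ^ z')) (∑-const q _)) ⟩
      2 ^ q * (2 ^ q * (2 ^ q * 2 ^ z')) ≡⟨ solve 2 (λ a b → a :* (a :* (a :* b)) := (a :* (a :* a)) :* b) refl (2 ^ q) (2 ^ z') ⟩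
      2 ^ q * (2 ^ q * 2 ^ q) * 2 ^ z' ≡⟨ cong (_* 2 ^ z') (sym (trans (^-distribˡ-+-* 2 q (q + q)) (cong (2 ^ q *_) (^-distribˡ-+-* 2 q q)))) ⟩
      2 ^ (q + (q + q)) * 2 ^ z' ∎))
      where
      cnt : # good ≤ ∑ (λ u₁ → ∑ (λ u₂ → # (G u₁ u₂)))
      cnt = ≤-trans (#-some (λ u₁ w → some λ u₂ → G u₁ u₂ w)) (∑-mono λ u₁ → #-some (λ u₂ w → G u₁ u₂ w))
    go (yes (u₁ , u₂ , l)) with ih (G u₁ u₂) l
    ... | y' , Y' , inj , on = u₁ ++ᵛ y' , ((u₁ ⊕ u₂) ++ᵛ zeros) ∷ map (zeros ++ᵛ_) Y' , inj' , on'
      where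
      ne : u₁ ≢ u₂
      ne = does-false (u₁ ≟V u₂) (not-true (proj₁ (∧-true {not (eqV u₁ u₂)} (on zeros))))
      dir : ∀ b v → lin (((u₁ ⊕ u₂) ++ᵛ zeros) ∷ map (zeros ++ᵛ_) Y') (b ∷ v) ≡ (b · (u₁ ⊕ u₂)) ++ᵛ lin Y' v
      dir b v = trans (cong₂ _⊕_ (pull b) (lin-prefix q Y' v)) (trans (⊕-++ (b · (u₁ ⊕ u₂)) zeros zeros (lin Y' v)) (cong₂ (λ (x : F2^ q) (y : F2^ z') → x ++ᵛ y) (⊕-idʳ _) (⊕-idˡ _)))
        where
        pull : ∀ b → b · ((u₁ ⊕ u₂) ++ᵛ zeros {z'}) ≡ (b · (u₁ ⊕ u₂)) ++ᵛ zeros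
        pull false = sym (zeros-++ q)
        pull true = refl
      inj' : Inj (((u₁ ⊕ u₂) ++ᵛ zeros) ∷ map (zeros ++ᵛ_) Y')
      inj' (b ∷ v) e with ++-zeros (b · (u₁ ⊕ u₂)) (lin Y' v) (trans (sym (dir b v)) e)
      inj' (false ∷ v) e | _ , r = cong (false ∷_) (inj v r)
      inj' (true ∷ v) e | r , _ = ⊥-elim (ne (⊕≡0⇒≡ u₁ u₂ r))
      on' : ∀ v → E ((u₁ ++ᵛ y') ⊕ lin (((u₁ ⊕ u₂) ++ᵛ zeros) ∷ map (zeros ++ᵛ_) Y') v) ≡ true
      on' (b ∷ v) = subst (λ x → E x ≡ true) (sym (trans (cong ((u₁ ++ᵛ y') ⊕_) (dir b v)) (⊕-++ u₁ (b · (u₁ ⊕ u₂)) y' (lin Y' v)))) (pick b)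
        where
        both : E (u₁ ++ᵛ (y' ⊕ lin Y' v)) ≡ true × E (u₂ ++ᵛ (y' ⊕ lin Y' v)) ≡ true
        both = ∧-true (proj₂ (∧-true {not (eqV u₁ u₂)} (on v)))
        pick : ∀ b → E ((u₁ ⊕ b · (u₁ ⊕ u₂)) ++ᵛ (y' ⊕ lin Y' v)) ≡ true
        pick false = subst (λ x → E (x ++ᵛ (y' ⊕ lin Y' v)) ≡ true) (sym (⊕-idʳ u₁)) (proj₁ both)
        pick true = subst (λ x → E (x ++ᵛ (y' ⊕ lin Y' v)) ≡ true) (⊕-solve (u₁ ∷ u₂ ∷ []) x₁ (x₀ :⊕ (x₀ :⊕ x₁)) refl) (proj₂ both)

abstract
  flat : ∀ s p → Σ ℕ λ z → HasFlat s z p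
  flat zero p = zero , λ E h → let (y , ey) = #>0⇒∃ E (pos (# E) h) in
      y , [] , (λ { [] _ → refl }) , λ { [] → subst (λ x → E x ≡ true) (sym (⊕-idʳ y)) ey }
    where
    pos : ∀ x → 1 ≤ x * 2 ^ p → 0 < x
    pos (suc x) _ = s≤s z≤n
  flat (suc s) p = let q = suc p; p' = suc (q + (q + q)) in
    q + proj₁ (flat s p') , flat-step s p q p' (proj₁ (flat s p')) refl refl (proj₂ (flat s p'))

-- The flat starts at `y` and has its directions in the span of the fixed `Z`. Flats found for
-- different sets thus share a bounded supply of directions, and nested ones can be taken inside
-- each other.
OnFlat : ∀ s {z n} → Vec (F2^ n) z → (F2^ n → Bool) → F2^ n → Set
OnFlat s {z} Z E y = ∃ λ (Y : Vec (F2^ z) s) → Inj Y × (∀ v → E (y ⊕ lin Z (lin Y v)) ≡ true)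

OnFlat? : ∀ s {z n} (Z : Vec (F2^ n) z) (E : F2^ n → Bool) y → Dec (OnFlat s Z E y)
OnFlat? s Z E y = ∃-dec enumVT λ Y → Inj? Y ×-dec ∀-dec enumV λ v → E (y ⊕ lin Z (lin Y v)) ≟B true

offFlat : ∀ s {z n} → Vec (F2^ n) z → (F2^ n → Bool) → F2^ n → Bool
offFlat s Z E y = E y ∧ not (does (OnFlat? s Z E y))

-- Averaging over the translates of the span of `Z`: were the exceptional set dense in one of them,
-- it would contain a flat itself, and the base point of that flat would not be exceptional.
offFlat-sparse : ∀ s p {n} (Z : Vec (F2^ n) (proj₁ (flat s p))) E → Sparse p (offFlat s Z E)
offFlat-sparse s p {n} Z E = *2^-cancel z (begin
  # E' * 2 ^ p * 2 ^ z ≡⟨ solve 3 (λ a b c → a :* b :* c := c :* a :* b) refl (# E') (2 ^ p) (2 ^ z) ⟩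
  2 ^ z * # E' * 2 ^ p ≡⟨ cong (_* 2 ^ p) (sym (∑-const z (# E'))) ⟩
  ∑ {z} (λ u → # E') * 2 ^ p ≡⟨ cong (_* 2 ^ p) (∑-cong λ u → sym (#-translate (lin Z u) E')) ⟩
  ∑ (λ u → # (λ x → E' (x ⊕ lin Z u))) * 2 ^ p ≡⟨ cong (_* 2 ^ p) (∑-swap _) ⟩
  ∑ (λ x → # (λ u → E' (x ⊕ lin Z u))) * 2 ^ p ≡⟨ sym (∑-*ʳ (2 ^ p) _) ⟩
  ∑ (λ x → # (λ u → E' (x ⊕ lin Z u)) * 2 ^ p) ≤⟨ ∑-mono (λ x → <⇒≤ (≰⇒> (sparse x))) ⟩
  ∑ {n} (λ x → 2 ^ z) ≡⟨ ∑-const n (2 ^ z) ⟩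
  2 ^ n * 2 ^ z ∎)
  where
  open ≤-Reasoning
  open +-*-Solver
  z : ℕ
  z = proj₁ (flat s p)
  E' : F2^ n → Bool
  E' = offFlat s Z E
  sparse : ∀ x → ¬ (2 ^ z ≤ # (λ u → E' (x ⊕ lin Z u)) * 2 ^ p)
  sparse x l with proj₂ (flat s p) (λ u → E' (x ⊕ lin Z u)) l
  ... | y , Y , inj , on = does-false (OnFlat? s Z E (x ⊕ lin Z y)) (not-true (proj₂ (∧-true {E (x ⊕ lin Z y)} base)))
      (Y , inj , λ v → subst (λ w → E w ≡ true) (reassoc v) (proj₁ (∧-true (on v))))
    where
    reassoc : ∀ v → x ⊕ lin Z (y ⊕ lin Y v) ≡ x ⊕ lin Z y ⊕ lin Z (lin Y v)
    reassoc v = trans (cong (x ⊕_) (lin-⊕ Z y (lin Y v))) (sym (⊕-assoc x _ _))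
    base : E' (x ⊕ lin Z y) ≡ true
    base = subst (λ w → E' (x ⊕ lin Z w) ≡ true) (trans (cong (y ⊕_) (lin-zero Y)) (⊕-idʳ y)) (on zeros)

dense⇒flat : ∀ s p {n} (Z : Vec (F2^ n) (proj₁ (flat s p))) E → 2 ^ n < # E * 2 ^ p → ∃ (OnFlat s Z E)
dense⇒flat s p Z E l with ∃-dec enumV (OnFlat? s Z E)
... | yes q = q
... | no ¬q = ⊥-elim (<⇒≱ l (≤-trans (*-monoˡ-≤ (2 ^ p) (#-mono {g = offFlat s Z E} λ v e →
    ∧-intro e (not-intro (does-intro-¬ (OnFlat? s Z E v) λ o → ¬q (v , o))))) (offFlat-sparse s p Z E)))

-- Monochromatic subspaces

Inj-++ˡ : ∀ {l m n} (A : Vec (F2^ n) l) (B : Vec (F2^ n) m) → Inj (A ++ᵛ B) → Inj A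
Inj-++ˡ A B inj v p = proj₁ (++-zeros v zeros (inj (v ++ᵛ zeros)
  (trans (lin-++ A B v zeros) (trans (cong₂ _⊕_ p (lin-zero B)) (⊕-self zeros)))))

Inj-++ʳ : ∀ {l m n} (A : Vec (F2^ n) l) (B : Vec (F2^ n) m) → Inj (A ++ᵛ B) → Inj B
Inj-++ʳ {l} A B inj v p = proj₂ (++-zeros (zeros {l}) v (inj (zeros ++ᵛ v)
  (trans (lin-++ A B zeros v) (trans (cong₂ _⊕_ (lin-zero A) p) (⊕-self zeros)))))

Mono : ∀ {s} → (F2^ s → Bool) → Bool → ℕ → Set
Mono {s} χ b d = ∃ λ (Y : Vec (F2^ s) d) → Inj Y × (∀ v → v ≢ zeros → χ (lin Y v) ≡ b)

mono-[] : ∀ {s} (χ : F2^ s → Bool) b → Mono χ b 0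
mono-[] χ b = [] , (λ { [] _ → refl }) , λ { [] ne → ⊥-elim (ne refl) }

mono-pull : ∀ {s z} (χ : F2^ z → Bool) (X : Vec (F2^ z) s) → Inj X → ∀ {b d} → Mono (χ ∘ lin X) b d → Mono χ b d
mono-pull χ X ix (Y , iy , m) = X ⊙ Y , Inj-⊙ X Y ix iy , λ v ne → trans (cong χ (lin-⊙ X Y v)) (m v ne)

lin-false∷ : ∀ {z s} (Y : Vec (F2^ z) s) v → lin (map (false ∷_) Y) v ≡ false ∷ lin Y v
lin-false∷ Y v = lin-prefix 1 Y v

mono-extend : ∀ {z s} (χ : F2^ (suc z) → Bool) (X : Vec (F2^ z) s) → Inj X → ∀ {b} y →
  (∀ v → χ (true ∷ (y ⊕ lin X v)) ≡ b) → ∀ {d} → Mono (χ ∘ lin (map (false ∷_) X)) b d → Mono χ b (suc d)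
mono-extend χ X ix {b} y on (Y , iy , m) = (true ∷ y) ∷ (X' ⊙ Y) , inj , mono
  where
  X' : Vec _ _
  X' = map (false ∷_) X
  ix' : Inj X'
  ix' v e = ix v (cong tail (trans (sym (lin-false∷ X v)) e))
  inj : Inj ((true ∷ y) ∷ (X' ⊙ Y))
  inj (false ∷ v) e = cong (false ∷_) (iy v (ix' _ (trans (sym (trans (⊕-idˡ _) (lin-⊙ X' Y v))) e)))
  inj (true ∷ v) e with trans (sym (cong ((true ∷ y) ⊕_) (trans (lin-⊙ X' Y v) (lin-false∷ X (lin Y v))))) e
  ... | ()
  mono : ∀ v → v ≢ zeros → χ (lin ((true ∷ y) ∷ (X' ⊙ Y)) v) ≡ b
  mono (false ∷ v) ne = trans (cong χ (trans (⊕-idˡ _) (lin-⊙ X' Y v))) (m v λ e → ne (cong (false ∷_) e))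
  mono (true ∷ v) ne = trans (cong χ (cong ((true ∷ y) ⊕_) (trans (lin-⊙ X' Y v) (lin-false∷ X (lin Y v))))) (on (lin Y v))

HasMono : ℕ → ℕ → ℕ → Set
HasMono d₀ d₁ s = (χ : F2^ s → Bool) → Mono χ false d₀ ⊎ Mono χ true d₁

-- The more frequent colour on the affine hyperplane of first coordinate `true` contains a flat.
-- Inside its direction space an induction hypothesis gives a monochromatic subspace; if it has the
-- colour of the flat, the base point of the flat is added as one more generator. The flat has
-- dimension `s₁ + s₂` so that it can serve either hypothesis.
ramsey-step : ∀ d₀ d₁ s₁ s₂ z → HasMono d₀ (suc d₁) s₁ → HasMono (suc d₀) d₁ s₂ → HasFlat (s₁ + s₂) z 1 →
  HasMono (suc d₀) (suc d₁) (suc z)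
ramsey-step d₀ d₁ s₁ s₂ z r₁ r₂ fl χ = [ whenTrue , whenFalse ]′ dense
  where
  T N : F2^ z → Bool
  T v = χ (true ∷ v)
  N v = not (χ (true ∷ v))
  dense : 2 ^ z ≤ # T * 2 ^ 1 ⊎ 2 ^ z ≤ # N * 2 ^ 1
  dense with 2 ^ z ≤? # T * 2
  ... | yes l = inj₁ l
  ... | no ¬l = inj₂ (+-cancelˡ-≤ (# T * 2) _ _ (≤-trans (+-monoˡ-≤ (2 ^ z) (<⇒≤ (≰⇒> ¬l)))
      (≤-reflexive (trans (cong (2 ^ z +_) (sym (+-identityʳ _))) (trans (cong (2 *_) (sym (#-not T)))
        (trans (*-comm 2 (# T + # (not ∘ T))) (*-distribʳ-+ 2 (# T) (# (not ∘ T)))))))))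
  pull : ∀ {s} (Y : Vec (F2^ z) s) → Inj Y → ∀ {b d} → Mono (χ ∘ lin (map (false ∷_) Y)) b d → Mono χ b d
  pull Y iY = mono-pull χ (map (false ∷_) Y) λ v e → iY v (cong tail (trans (sym (lin-false∷ Y v)) e))
  whenTrue : 2 ^ z ≤ # T * 2 ^ 1 → Mono χ false (suc d₀) ⊎ Mono χ true (suc d₁)
  whenTrue l with fl T l
  ... | y , Y , inj , on with V.splitAt s₁ Y
  ...   | Y₁ , Y₂ , refl = [ (λ m → inj₁ (pull Y₂ (Inj-++ʳ Y₁ Y₂ inj) m)) ,
            (λ m → inj₂ (mono-extend χ Y₂ (Inj-++ʳ Y₁ Y₂ inj) y
              (λ v → trans (cong (λ x → χ (true ∷ (y ⊕ x))) (sym (trans (lin-++ Y₁ Y₂ zeros v) (trans (cong (_⊕ lin Y₂ v) (lin-zero Y₁)) (⊕-idˡ _))))) (on (zeros ++ᵛ v))) m)) ]′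
          (r₂ (χ ∘ lin (map (false ∷_) Y₂)))
  whenFalse : 2 ^ z ≤ # N * 2 ^ 1 → Mono χ false (suc d₀) ⊎ Mono χ true (suc d₁)
  whenFalse l with fl N l
  ... | y , Y , inj , on with V.splitAt s₁ Y
  ...   | Y₁ , Y₂ , refl = [ (λ m → inj₁ (mono-extend χ Y₁ (Inj-++ˡ Y₁ Y₂ inj) y
              (λ v → trans (cong (λ x → χ (true ∷ (y ⊕ x))) (sym (trans (lin-++ Y₁ Y₂ v zeros) (trans (cong (lin Y₁ v ⊕_) (lin-zero Y₂)) (⊕-idʳ _))))) (not-true (on (v ++ᵛ zeros)))) m)) ,
            (λ m → inj₂ (pull Y₁ (Inj-++ˡ Y₁ Y₂ inj) m)) ]′
          (r₁ (χ ∘ lin (map (false ∷_) Y₁)))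

abstract
  ramsey : ∀ d₀ d₁ → Σ ℕ λ s → HasMono d₀ d₁ s
  ramsey zero d₁ = 0 , λ χ → inj₁ (mono-[] χ false)
  ramsey (suc d₀) zero = 0 , λ χ → inj₂ (mono-[] χ true)
  ramsey (suc d₀) (suc d₁) =
    let r₁ = ramsey d₀ (suc d₁)
        r₂ = ramsey (suc d₀) d₁
        fl = flat (proj₁ r₁ + proj₁ r₂) 1
    in suc (proj₁ fl) , ramsey-step d₀ d₁ (proj₁ r₁) (proj₁ r₂) (proj₁ fl) (proj₂ r₁) (proj₂ r₂) (proj₂ fl)

-- Complements

Indep : ∀ {j m n} → Vec (F2^ n) j → Vec (F2^ n) m → Set
Indep bs as = ∀ d v → lin bs d ⊕ lin as v ≡ zeros → d ≡ zeros × v ≡ zeros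

Indep⇒Inj : ∀ {j m n} (bs : Vec (F2^ n) j) (as : Vec (F2^ n) m) → Indep bs as → Inj (bs ++ᵛ as)
Indep⇒Inj {j} bs as ind w e with V.splitAt j w
... | d , v , refl with ind d v (trans (sym (lin-++ bs as d v)) e)
...   | refl , refl = zeros-++ j

Inj⇒≤ : ∀ {m n} (as : Vec (F2^ n) m) → Inj as → m ≤ n
Inj⇒≤ {m} {n} as inj = ^-cancelʳ-≤' (begin
  2 ^ m ≡⟨ sym (#-all m) ⟩
  # (λ (v : F2^ m) → true) ≤⟨ #-preimage (lin as) (λ _ → true) (Inj⇒≡ as inj) ⟩
  # (λ (v : F2^ n) → true) ≡⟨ #-all n ⟩
  2 ^ n ∎)
  where
  open ≤-Reasoning
  ^-cancelʳ-≤' : 2 ^ m ≤ 2 ^ n → m ≤ n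
  ^-cancelʳ-≤' p = ≮⇒≥ λ l → <⇒≱ (^-monoʳ-< 2 (s≤s (s≤s z≤n)) l) p

Subgroup : ∀ {n} → (F2^ n → Bool) → Set
Subgroup U = U zeros ≡ true × (∀ u v → U u ≡ true → U v ≡ true → U (u ⊕ v) ≡ true)

Spans : ∀ {j m n} → Vec (F2^ n) j → Vec (F2^ n) m → (F2^ n → Bool) → Set
Spans bs as U = ∀ w → U w ≡ true → ∃₂ λ d v → w ≡ lin bs d ⊕ lin as v

In : ∀ {m n} → Vec (F2^ n) m → (F2^ n → Bool) → Set
In as U = ∀ v → U (lin as v) ≡ true

module _ {n} (U : F2^ n → Bool) (sub : Subgroup U) {m} (as : Vec (F2^ n) m) (as⊆ : In as U) where

  -- Adjoins elements of `U` outside the current span. Independence bounds the number of generators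
  -- by `n`, so the fuel cannot run out before `U` is exhausted.
  grow : ∀ f {j} (bs : Vec (F2^ n) j) → n ≤ (j + m) + f → Indep bs as → In bs U →
    Σ ℕ λ j → Σ (Vec (F2^ n) j) λ bs → Indep bs as × In bs U × Spans bs as U
  grow f {j} bs fuel ind bs⊆ with ∃-dec enumV (λ w → (U w ≟B true) ×-dec ¬? (∃-dec enumV λ d → ∃-dec enumV λ v → w ≟V (lin bs d ⊕ lin as v)))
  ... | no ¬w = j , bs , ind , bs⊆ , λ w uw → decidable-stable (∃-dec enumV λ d → ∃-dec enumV λ v → w ≟V (lin bs d ⊕ lin as v)) λ ¬s → ¬w (w , uw , ¬s)
  ... | yes (w , uw , ¬s) = next f fuel
    where
    ind' : Indep (w ∷ bs) as
    ind' (false ∷ d) v e with ind d v (trans (cong (_⊕ lin as v) (sym (⊕-idˡ (lin bs d)))) e)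
    ... | refl , refl = refl , refl
    ind' (true ∷ d) v e = ⊥-elim (¬s (d , v , ⊕≡0⇒≡ w _ (trans (sym (⊕-assoc w _ _)) e)))
    bs⊆' : In (w ∷ bs) U
    bs⊆' (false ∷ v) = subst (λ x → U x ≡ true) (sym (⊕-idˡ _)) (bs⊆ v)
    bs⊆' (true ∷ v) = proj₂ sub w _ uw (bs⊆ v)
    next : ∀ f → n ≤ (j + m) + f → _
    next zero fuel = ⊥-elim (<⇒≱ (Inj⇒≤ (w ∷ bs ++ᵛ as) (Indep⇒Inj (w ∷ bs) as ind')) (≤-trans fuel (≤-reflexive (+-identityʳ _))))
    next (suc f) fuel = grow f (w ∷ bs) (≤-trans fuel (≤-reflexive (+-suc (j + m) f))) ind' bs⊆'

  complement : Inj as → Σ ℕ λ j → Σ (Vec (F2^ n) j) λ bs → Indep bs as × In bs U × Spans bs as U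
  complement inj = grow n [] (m≤n+m n m) (λ { [] v e → refl , inj v (trans (sym (⊕-idˡ _)) e) })
    λ { [] → proj₁ sub }

record Split {j m n} (bs : Vec (F2^ n) j) (as : Vec (F2^ n) m) : Set where
  constructor split
  field
    indep : Indep bs as
    spans : ∀ w → ∃₂ λ d v → w ≡ lin bs d ⊕ lin as v

  to : F2^ j → F2^ m → F2^ n
  to d v = lin bs d ⊕ lin as v

  from : F2^ n → F2^ j × F2^ m
  from w = proj₁ (spans w) , proj₁ (proj₂ (spans w))

  to-from : ∀ w → to (proj₁ (from w)) (proj₂ (from w)) ≡ w
  to-from w = sym (proj₂ (proj₂ (spans w)))

  to-inj : ∀ {d v d' v'} → to d v ≡ to d' v' → d ≡ d' × v ≡ v'
  to-inj {d} {v} {d'} {v'} e with indep (d ⊕ d') (v ⊕ v')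
    (trans (cong₂ _⊕_ (lin-⊕ bs d d') (lin-⊕ as v v')) (trans (⊕-interchange (lin bs d) (lin bs d') (lin as v) (lin as v')) (trans (cong (_⊕ to d' v') e) (⊕-self _))))
  ... | p , q = ⊕≡0⇒≡ d d' p , ⊕≡0⇒≡ v v' q

  from-to : ∀ d v → from (to d v) ≡ (d , v)
  from-to d v with to-inj (to-from (to d v))
  ... | p , q = cong₂ _,_ p q

  ∑-split : (f : F2^ n → ℕ) → ∑ f ≡ ∑ (λ d → ∑ (λ v → f (to d v)))
  ∑-split = ∑-bijection to from from-to to-from

  2^-dims : 2 ^ n ≡ 2 ^ j * 2 ^ m
  2^-dims = trans (sym (#-all n)) (trans (∑-split _) (trans (∑-cong λ d → #-all m) (∑-const j (2 ^ m))))

2^-injective : ∀ {a b} → 2 ^ a ≡ 2 ^ b → a ≡ b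
2^-injective {a} {b} e = ≤-antisym (≮⇒≥ λ l → <-irrefl (sym e) (^-monoʳ-< 2 (s≤s (s≤s z≤n)) l))
  (≮⇒≥ λ l → <-irrefl e (^-monoʳ-< 2 (s≤s (s≤s z≤n)) l))

split-dims : ∀ {j m n} {bs : Vec (F2^ n) j} {as : Vec (F2^ n) m} → Split bs as → n ≡ j + m
split-dims {j} {m} sp = 2^-injective (trans (Split.2^-dims sp) (sym (^-distribˡ-+-* 2 j m)))

splitting : ∀ {m n} (as : Vec (F2^ n) m) → Inj as → Σ ℕ λ j → Σ (Vec (F2^ n) j) λ bs → Split bs as
splitting as inj with complement (λ _ → true) (refl , λ _ _ _ _ → refl) as (λ _ → refl) inj
... | j , bs , ind , _ , sp = j , bs , split ind (λ w → sp w refl)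

-- Translating the generators of a complement so as to avoid a given finite set

-- For fixed `c` and `v` the point depends injectively on `l`, so each of the 2^(k+D) choices
-- excludes at most `length W` values of `l`.
lift-step : ∀ {k m n D} (a : F2^ n) (A : Vec (F2^ n) k) (B : Vec (F2^ n) m) → Inj B → (ℓ : Vec (F2^ m) k)
  (Y : Vec (F2^ m) D) (W : List (F2^ n)) → length W * 2 ^ (k + D) < 2 ^ m →
  ∃ λ l → ∀ c v → a ⊕ lin A c ⊕ lin B (l ⊕ lin ℓ c ⊕ lin Y v) ∉ W
lift-step {k} {m} {n} {D} a A B iB ℓ Y W h =
  let (l , nb , _) = #-<⇒∃ bad (λ _ → true) (<-≤-trans few-bad (≤-reflexive (sym (#-all m)))) in
  l , λ c v p → true≢false (some-intro (λ c → some λ v → inList W (pt c v l)) c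
    (some-intro (λ v → inList W (pt c v l)) v (inList-intro {W = W} p))) nb
  where
  pt : F2^ k → F2^ D → F2^ m → F2^ n
  pt c v l = a ⊕ lin A c ⊕ lin B (l ⊕ lin ℓ c ⊕ lin Y v)
  cancelˡ : ∀ {n} (w x y : F2^ n) → w ⊕ x ≡ w ⊕ y → x ≡ y
  cancelˡ w x y e = trans (⊕-solve (w ∷ x ∷ []) x₁ (x₀ :⊕ (x₀ :⊕ x₁)) refl)
    (trans (cong (w ⊕_) e) (⊕-solve (w ∷ y ∷ []) (x₀ :⊕ (x₀ :⊕ x₁)) x₁ refl))
  cancelʳ : ∀ {n} (w x y : F2^ n) → x ⊕ w ≡ y ⊕ w → x ≡ y
  cancelʳ w x y e = cancelˡ w x y (trans (⊕-comm w x) (trans e (⊕-comm y w)))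
  pt-inj : ∀ c v l l' → pt c v l ≡ pt c v l' → l ≡ l'
  pt-inj c v l l' e = cancelʳ (lin ℓ c) l l' (cancelʳ (lin Y v) _ _ (Inj⇒≡ B iB _ _ (cancelˡ (a ⊕ lin A c) _ _ e)))
  bad : F2^ m → Bool
  bad l = some λ c → some λ v → inList W (pt c v l)
  few-bad : # bad < 2 ^ m
  few-bad = begin-strict
    # bad ≤⟨ ≤-trans (#-some (λ c l → some λ v → inList W (pt c v l))) (∑-mono λ c → #-some (λ v l → inList W (pt c v l))) ⟩
    ∑ (λ c → ∑ (λ v → # (λ l → inList W (pt c v l)))) ≤⟨ ∑-mono (λ c → ∑-mono λ v → ≤-trans (#-preimage (pt c v) (inList W) (pt-inj c v)) (#-list W)) ⟩
    ∑ {k} (λ c → ∑ {D} (λ v → length W)) ≡⟨ trans (∑-cong λ _ → ∑-const D (length W)) (∑-const k _) ⟩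
    2 ^ k * (2 ^ D * length W) ≡⟨ trans (sym (*-assoc (2 ^ k) (2 ^ D) _)) (trans (cong (_* length W) (sym (^-distribˡ-+-* 2 k D))) (*-comm _ (length W))) ⟩
    length W * 2 ^ (k + D) <⟨ h ⟩
    2 ^ m ∎
    where open ≤-Reasoning

-- The generators are translated one at a time. Only combinations that involve the new generator
-- constrain its translation; the others were settled before.
lifts : ∀ {k m n D} (A : Vec (F2^ n) k) (B : Vec (F2^ n) m) → Inj B → (Y : Vec (F2^ m) D) (W : List (F2^ n)) →
  length W * 2 ^ (k + D) < 2 ^ m →
  ∃ λ (ℓ : Vec (F2^ m) k) → ∀ c → c ≢ zeros → ∀ v → lin A c ⊕ lin B (lin ℓ c ⊕ lin Y v) ∉ W
lifts [] B iB Y W h = [] , λ { [] ne → ⊥-elim (ne refl) }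
lifts {suc k} {m} {n} {D} (a ∷ A) B iB Y W h = l ∷ ℓ , good
  where
  h' : length W * 2 ^ (k + D) < 2 ^ m
  h' = ≤-<-trans (*-monoʳ-≤ (length W) (2^-mono (n≤1+n (k + D)))) h
  ih : ∃ λ (ℓ : Vec (F2^ m) k) → ∀ c → c ≢ zeros → ∀ v → lin A c ⊕ lin B (lin ℓ c ⊕ lin Y v) ∉ W
  ih = lifts A B iB Y W h'
  ℓ : Vec (F2^ m) k
  ℓ = proj₁ ih
  st : ∃ λ l → ∀ c v → a ⊕ lin A c ⊕ lin B (l ⊕ lin ℓ c ⊕ lin Y v) ∉ W
  st = lift-step a A B iB ℓ Y W h'
  l : F2^ m
  l = proj₁ st
  good : ∀ c → c ≢ zeros → ∀ v → lin (a ∷ A) c ⊕ lin B (lin (l ∷ ℓ) c ⊕ lin Y v) ∉ W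
  good (false ∷ c) ne v p = proj₂ ih c (λ e → ne (cong (false ∷_) e)) v
    (subst (_∈ W) (cong₂ (λ x y → x ⊕ lin B (y ⊕ lin Y v)) (⊕-idˡ (lin A c)) (⊕-idˡ (lin ℓ c))) p)
  good (true ∷ c) ne v p = proj₂ st c v p

dichotomy : ∀ {A : Set} b → (b ≡ true → A) → (b ≡ false → A) → A
dichotomy true f g = f refl
dichotomy false f g = g refl

-- Containers for independent sets of a dense bipartite graph

any-concatMap : ∀ {A B : Set} {P : B → Set} (f : A → List B) {xs} → Any (λ x → Any P (f x)) xs → Any P (L.concatMap f xs)
any-concatMap f a = AnyP.concat⁺ (AnyP.map⁺ a)

allFuns : ∀ {A : Set} m → List A → List (F2^ m → A)
allFuns zero L = L.map (λ a _ → a) L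
allFuns (suc m) L = L.concatMap (λ g₀ → L.map (λ g₁ v → if head v then g₁ (tail v) else g₀ (tail v)) (allFuns m L)) (allFuns m L)

length-allFuns : ∀ {A : Set} m (L : List A) → length (allFuns m L) ≤ length L ^ (2 ^ m)
length-allFuns zero L = ≤-reflexive (trans (length-map _ L) (sym (*-identityʳ _)))
length-allFuns (suc m) L = begin
  length (allFuns (suc m) L) ≤⟨ length-concatMap _ (length L ^ (2 ^ m)) (allFuns m L) (λ g₀ → ≤-trans (≤-reflexive (length-map _ (allFuns m L))) (length-allFuns m L)) ⟩
  length (allFuns m L) * length L ^ (2 ^ m) ≤⟨ *-monoˡ-≤ _ (length-allFuns m L) ⟩
  length L ^ (2 ^ m) * length L ^ (2 ^ m) ≡⟨ sym (^-distribˡ-+-* (length L) (2 ^ m) (2 ^ m)) ⟩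
  length L ^ (2 ^ m + 2 ^ m) ≡⟨ cong (λ x → length L ^ (2 ^ m + x)) (sym (+-identityʳ _)) ⟩
  length L ^ (2 ^ suc m) ∎
  where open ≤-Reasoning

allFuns-complete : ∀ {A : Set} m {L : List A} {P : F2^ m → A → Set} → (∀ u → Any (P u) L) →
  Any (λ g → ∀ u → P u (g u)) (allFuns m L)
allFuns-complete zero h = AnyP.map⁺ (Any.map (λ p → λ { [] → p }) (h []))
allFuns-complete (suc m) {L} {P} h = any-concatMap _ (Any.map
  (λ p₀ → AnyP.map⁺ (Any.map (λ p₁ → λ { (false ∷ u) → p₀ u ; (true ∷ u) → p₁ u }) (allFuns-complete m (λ u → h (true ∷ u)))))
  (allFuns-complete m (λ u → h (false ∷ u))))

lists≤ : ∀ {A : Set} → ℕ → List A → List (List A)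
lists≤ zero xs = [] ∷ []
lists≤ (suc f) xs = [] ∷ L.concatMap (λ x → L.map (x ∷_) (lists≤ f xs)) xs

length-lists≤ : ∀ {A : Set} f (xs : List A) → length (lists≤ f xs) ≤ suc (length xs) ^ f
length-lists≤ zero xs = ≤-refl
length-lists≤ (suc f) xs = +-mono-≤ (m^n>0 (suc (length xs)) f)
  (length-concatMap _ _ xs λ x → ≤-trans (≤-reflexive (length-map _ (lists≤ f xs))) (length-lists≤ f xs))

∈-lists≤ : ∀ {A : Set} f {xs : List A} (l : List A) → (∀ a → a ∈ xs) → length l ≤ f → l ∈ lists≤ f xs
∈-lists≤ zero [] h _ = here refl
∈-lists≤ (suc f) [] h _ = here refl
∈-lists≤ (suc f) (x ∷ l) h (s≤s le) = there (any-concatMap _ (Any.map (λ { refl → ∈-map⁺ (x ∷_) (∈-lists≤ f l h le) }) (h x)))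

length-lists≤V : ∀ m f → length (lists≤ f (allVecs m)) ≤ 2 ^ (suc m * f)
length-lists≤V m f = begin
  length (lists≤ f (allVecs m)) ≤⟨ length-lists≤ f (allVecs m) ⟩
  suc (length (allVecs m)) ^ f ≤⟨ ^-monoˡ-≤ f (≤-trans (≤-reflexive (cong suc (length-allVecs m))) (≤-trans (+-monoˡ-≤ (2 ^ m) (2^>0 m)) (≤-reflexive (cong (2 ^ m +_) (sym (+-identityʳ _)))))) ⟩
  (2 ^ suc m) ^ f ≡⟨ ^-*-assoc 2 (suc m) f ⟩
  2 ^ (suc m * f) ∎
  where open ≤-Reasoning

-- The two sides are copies of `F2^ m`. Let an independent set have right part `X`, and let F ⊆ X be
-- its fingerprint: the left part then avoids the neighbours `N F`, and once no vertex of `X` has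
-- many new neighbours, the right part lies in `right F`. So `F` alone determines a container.
module Bipartite {m} (G : F2^ m → F2^ m → Bool) (p : ℕ) where

  N : List (F2^ m) → F2^ m → Bool
  N F x = does (any? (λ x' → G x x' ≟B true) F)

  new : List (F2^ m) → F2^ m → F2^ m → Bool
  new F x' x = G x x' ∧ not (N F x)

  right? : ∀ F x' → Dec (# (new F x') * 2 ^ p < 2 ^ m)
  right? F x' = # (new F x') * 2 ^ p <? 2 ^ m

  right : List (F2^ m) → F2^ m → Bool
  right F x' = does (right? F x')

  -- A right vertex that stays in the container has degree at most |N F| + 2^(m-p), any other at
  -- most 2^m. Hence in a graph with many edges the container omits many vertices.
  bip-count : ∀ F → ∑ (λ x' → # (λ x → G x x')) * 2 ^ p ≤
    2 ^ p * 2 ^ m * (# (N F) + # (not ∘ right F)) + 2 ^ m * 2 ^ m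
  bip-count F = begin
    ∑ (λ x' → # (λ x → G x x')) * 2 ^ p ≡⟨ sym (∑-*ʳ (2 ^ p) _) ⟩
    ∑ (λ x' → # (λ x → G x x') * 2 ^ p) ≤⟨ ∑-mono one ⟩
    ∑ (λ x' → # (N F) * 2 ^ p + (2 ^ m + 2 ^ m * 2 ^ p * bit (not (right F x')))) ≡⟨ ∑-+ _ _ ⟩
    ∑ {m} (λ x' → # (N F) * 2 ^ p) + ∑ (λ x' → 2 ^ m + 2 ^ m * 2 ^ p * bit (not (right F x')))
      ≡⟨ cong₂ _+_ (∑-const m _) (trans (∑-+ _ _) (cong₂ _+_ (∑-const m _) (∑-* (2 ^ m * 2 ^ p) _))) ⟩
    2 ^ m * (# (N F) * 2 ^ p) + (2 ^ m * 2 ^ m + 2 ^ m * 2 ^ p * # (not ∘ right F))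
      ≡⟨ solve 4 (λ M P a b → M :* (a :* P) :+ (M :* M :+ M :* P :* b) := P :* M :* (a :+ b) :+ M :* M) refl (2 ^ m) (2 ^ p) (# (N F)) (# (not ∘ right F)) ⟩
    2 ^ p * 2 ^ m * (# (N F) + # (not ∘ right F)) + 2 ^ m * 2 ^ m ∎
    where
    open ≤-Reasoning
    open +-*-Solver
    rest : ∀ x' → # (new F x') * 2 ^ p ≤ 2 ^ m + 2 ^ m * 2 ^ p * bit (not (right F x'))
    rest x' = dichotomy (right F x')
      (λ e → ≤-trans (<⇒≤ (does-true (right? F x') e)) (m≤m+n _ _))
      λ e → ≤-trans (*-monoˡ-≤ (2 ^ p) (#≤ (new F x'))) (≤-trans (≤-reflexive (sym (*-identityʳ _)))
        (≤-trans (≤-reflexive (cong (2 ^ m * 2 ^ p *_) (sym (trans (cong (bit ∘ not) e) bit-true)))) (m≤n+m _ (2 ^ m))))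
    cover : ∀ x' → # (λ x → G x x') ≤ # (N F) + # (new F x')
    cover x' = #-∪ λ x g → dichotomy (N F x) (λ e → inj₁ e) (λ e → inj₂ (∧-intro g (not-intro e)))
    one : ∀ x' → # (λ x → G x x') * 2 ^ p ≤ # (N F) * 2 ^ p + (2 ^ m + 2 ^ m * 2 ^ p * bit (not (right F x')))
    one x' = ≤-trans (*-monoˡ-≤ (2 ^ p) (cover x')) (≤-trans (≤-reflexive (*-distribʳ-+ (2 ^ p) (# (N F)) _)) (+-monoʳ-≤ (# (N F) * 2 ^ p) (rest x')))

  Done : (F2^ m → Bool) → List (F2^ m) → Set
  Done X F = ∀ x' → X x' ≡ true → right F x' ≡ true

  greedy : (X : F2^ m → Bool) → ∀ i → ∃ λ F → length F ≤ i × (∀ x' → x' ∈ F → X x' ≡ true) ×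
    (Done X F ⊎ i * 2 ^ m ≤ # (N F) * 2 ^ p)
  greedy X zero = [] , z≤n , (λ x' ()) , inj₂ z≤n
  greedy X (suc i) = next (greedy X i)
    where
    next : _ → _
    next (F , le , sub , inj₁ done) = F , m≤n⇒m≤1+n le , sub , inj₁ done
    next (F , le , sub , inj₂ big) with ∃-dec enumV (λ x' → (X x' ≟B true) ×-dec ¬? (right? F x'))
    ... | no ¬e = F , m≤n⇒m≤1+n le , sub , inj₁ (λ x' xx → does-intro (right? F x') (decidable-stable (right? F x') λ nr → ¬e (x' , xx , nr)))
    ... | yes (x' , xx , nr) = x' ∷ F , s≤s le , (λ { y (here refl) → xx ; y (there q) → sub y q }) , inj₂ (begin
        2 ^ m + i * 2 ^ m ≤⟨ +-mono-≤ (≮⇒≥ nr) big ⟩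
        # (new F x') * 2 ^ p + # (N F) * 2 ^ p ≡⟨ sym (*-distribʳ-+ (2 ^ p) (# (new F x')) _) ⟩
        (# (new F x') + # (N F)) * 2 ^ p ≤⟨ *-monoˡ-≤ (2 ^ p) (≤-trans (≤-reflexive (sym (∑-+ _ _))) (∑-mono both)) ⟩
        # (N (x' ∷ F)) * 2 ^ p ∎)
      where
      open ≤-Reasoning
      both : ∀ x → bit (new F x' x) + bit (N F x) ≤ bit (N (x' ∷ F) x)
      both x with G x x' | N F x
      ... | true | true rewrite bit-false | bit-true = ≤-refl
      ... | true | false rewrite bit-false | bit-true = ≤-refl
      ... | false | true rewrite bit-false | bit-true = ≤-refl
      ... | false | false rewrite bit-false = ≤-refl

  -- Each greedy choice adds at least 2^(m-p) new neighbours, so after 2^p choices every left vertex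
  -- is a neighbour and nothing new remains.
  fingerprint : (X : F2^ m → Bool) → ∃ λ F → length F ≤ 2 ^ p × (∀ x' → x' ∈ F → X x' ≡ true) × Done X F
  fingerprint X with greedy X (2 ^ p)
  ... | F , le , sub , inj₁ done = F , le , sub , done
  ... | F , le , sub , inj₂ big = F , le , sub , λ x' _ → does-intro (right? F x') (subst (_< 2 ^ m) (sym (cong (_* 2 ^ p) (zero' x'))) (2^>0 m))
    where
    full : 2 ^ m ≤ # (N F)
    full = *2^-cancel p (≤-trans (≤-reflexive (*-comm (2 ^ m) (2 ^ p))) big)
    none : # (not ∘ N F) ≡ 0
    none = n≤0⇒n≡0 (+-cancelˡ-≤ (2 ^ m) _ _ (≤-trans (+-monoˡ-≤ _ full) (≤-reflexive (trans (#-not (N F)) (sym (+-identityʳ _))))))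
    zero' : ∀ x' → # (new F x') ≡ 0
    zero' x' = n≤0⇒n≡0 (≤-trans (#-mono {g = not ∘ N F} λ x q → proj₂ (∧-true {G x x'} q)) (≤-reflexive none))

Poly : ℕ → ℕ → Set
Poly c h = Σ ℕ λ n₀ → ∀ n → n₀ ≤ n → c * (n * n) + c ≤ 2 ^ (n ∸ h)

poly : ∀ c h → Poly c h
poly c h = n₀ , λ n le → subst (λ n → c * (n * n) + c ≤ 2 ^ (n ∸ h)) (m∸n+n≡m le) (go (n ∸ n₀))
  where
  open ≤-Reasoning
  open +-*-Solver
  x n₀ : ℕ
  x = c + h + 5
  n₀ = 4 * x
  x≥1 : 1 ≤ x
  x≥1 = ≤-trans (s≤s z≤n) (m≤n+m 5 (c + h))
  h≤x : 5 + h ≤ x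
  h≤x = ≤-trans (≤-reflexive (+-comm 5 h)) (+-monoˡ-≤ 5 (m≤n+m h c))
  step : ∀ n → 2 ≤ n → c * (suc n * suc n) + c ≤ 2 * (c * (n * n) + c)
  step n le = begin
    c * (suc n * suc n) + c ≡⟨ solve 2 (λ c n → c :* ((con 1 :+ n) :* (con 1 :+ n)) :+ c := c :* (n :* n) :+ c :+ c :+ c :* (con 2 :* n)) refl c n ⟩
    c * (n * n) + c + c + c * (2 * n) ≤⟨ +-monoʳ-≤ (c * (n * n) + c + c) (*-monoʳ-≤ c (*-monoˡ-≤ n le)) ⟩
    c * (n * n) + c + c + c * (n * n) ≡⟨ solve 2 (λ c q → c :* q :+ c :+ c :+ c :* q := con 2 :* (c :* q :+ c)) refl c (n * n) ⟩
    2 * (c * (n * n) + c) ∎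
  base : c * (n₀ * n₀) + c ≤ 2 ^ (n₀ ∸ h)
  base = begin
    c * (n₀ * n₀) + c ≡⟨ solve 2 (λ c x → c :* ((con 4 :* x) :* (con 4 :* x)) :+ c := con 16 :* c :* (x :* x) :+ c) refl c x ⟩
    16 * c * (x * x) + c ≤⟨ +-monoʳ-≤ (16 * c * (x * x)) (≤-trans (≤-reflexive (sym (*-identityʳ c))) (≤-trans (*-monoʳ-≤ c (*-mono-≤ x≥1 x≥1)) (≤-trans (≤-reflexive (sym (*-identityˡ _))) (≤-trans (*-monoˡ-≤ (c * (x * x)) {1} {16} (s≤s z≤n)) (≤-reflexive (sym (*-assoc 16 c (x * x)))))))) ⟩
    16 * c * (x * x) + 16 * c * (x * x) ≡⟨ solve 2 (λ c q → con 16 :* c :* q :+ con 16 :* c :* q := con 32 :* (c :* q)) refl c (x * x) ⟩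
    32 * (c * (x * x)) ≤⟨ *-monoʳ-≤ 32 (*-mono-≤ (≤-trans (≤-trans (m≤m+n c h) (m≤m+n (c + h) 5)) (<⇒≤ (n<2^n x))) (*-mono-≤ (<⇒≤ (n<2^n x)) (<⇒≤ (n<2^n x)))) ⟩
    2 ^ 5 * (2 ^ x * (2 ^ x * 2 ^ x)) ≡⟨ trans (cong (λ y → 2 ^ 5 * (2 ^ x * y)) (sym (^-distribˡ-+-* 2 x x))) (trans (cong (2 ^ 5 *_) (sym (^-distribˡ-+-* 2 x (x + x)))) (sym (^-distribˡ-+-* 2 5 (x + (x + x))))) ⟩
    2 ^ (5 + (x + (x + x))) ≤⟨ 2^-mono (m+n≤o⇒m≤o∸n (5 + (x + (x + x))) (≤-trans (≤-reflexive (solve 2 (λ x h → con 5 :+ (x :+ (x :+ x)) :+ h := con 5 :+ h :+ (x :+ (x :+ x))) refl x h)) (≤-trans (+-monoˡ-≤ (x + (x + x)) h≤x) (≤-reflexive (solve 1 (λ x → x :+ (x :+ (x :+ x)) := con 4 :* x) refl x))))) ⟩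
    2 ^ (n₀ ∸ h) ∎
  h≤n₀ : h ≤ n₀
  h≤n₀ = ≤-trans (≤-trans (m≤n+m h 5) h≤x) (m≤m+n x (3 * x))
  2≤n₀ : 2 ≤ n₀
  2≤n₀ = ≤-trans (≤-trans (s≤s (s≤s z≤n)) (*-monoʳ-≤ 4 x≥1)) ≤-refl
  go : ∀ i → c * ((i + n₀) * (i + n₀)) + c ≤ 2 ^ (i + n₀ ∸ h)
  go zero = base
  go (suc i) = begin
    c * (suc (i + n₀) * suc (i + n₀)) + c ≤⟨ step (i + n₀) (≤-trans 2≤n₀ (m≤n+m n₀ i)) ⟩
    2 * (c * ((i + n₀) * (i + n₀)) + c) ≤⟨ *-monoʳ-≤ 2 (go i) ⟩
    2 * 2 ^ (i + n₀ ∸ h) ≡⟨ cong (2 ^_) (sym (+-∸-assoc 1 (≤-trans h≤n₀ (m≤n+m n₀ i)))) ⟩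
    2 ^ (suc (i + n₀) ∸ h) ∎

-- Containers for sets without Bose–Burton configurations

-- The configuration on generators A and directions Y consists of the translates
-- of the span of Y by the nonzero elements of the span of A.
BB⊆ : ∀ {k s n} → Vec (F2^ n) k → Vec (F2^ n) s → (F2^ n → Bool) → Set
BB⊆ A Y S = ∀ c → c ≢ zeros → ∀ v → S (lin A c ⊕ lin Y v) ≡ true

BBfree : ∀ k s {z n} → Vec (F2^ n) z → Class n
BBfree k s {z} {n} e S = (A : Vec (F2^ n) k) (Y : Vec (F2^ z) s) → Inj Y → ¬ BB⊆ A (e ⊙ Y) S

_⊆_ : ∀ {n} → (F2^ n → Bool) → (F2^ n → Bool) → Set
S ⊆ C = ∀ v → S v ≡ true → C v ≡ true

-- The space is cut into the cosets of the span of `a ∷ X`; each is a bipartite vertex set whose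
-- sides are the values of the `a`-coordinate. Two points of S at distance a + Xu both lie in S ∩ (S
-- + a + Xu), hence in its container `Cu u`. Joining the pairs for which this fails makes S
-- independent in every block.
module Blocks {n j m} (a : F2^ n) (X : Vec (F2^ n) m) (B : Vec (F2^ n) j) (Cu : F2^ m → F2^ n → Bool)
  (p : ℕ) where

  point : F2^ j → F2^ (suc m) → F2^ n
  point d y = lin B d ⊕ lin (a ∷ X) y

  G : F2^ j → F2^ m → F2^ m → Bool
  G d x x' = not (Cu (x ⊕ x') (point d (false ∷ x)) ∧ Cu (x ⊕ x') (point d (true ∷ x')))

  module Bip d = Bipartite (G d) p

  val : (F2^ j → List (F2^ m)) → F2^ j → F2^ (suc m) → Bool
  val F d (false ∷ x) = not (Bip.N d (F d) x)
  val F d (true ∷ x) = Bip.right d (F d) x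

  rep? : ∀ F v → Dec (∃₂ λ d y → v ≡ point d y × val F d y ≡ true)
  rep? F v = ∃-dec enumV λ d → ∃-dec enumV λ y → (v ≟V point d y) ×-dec (val F d y ≟B true)

  container : (F2^ j → List (F2^ m)) → F2^ n → Bool
  container F v = does (rep? F v)

  module _ (sp : Split B (a ∷ X)) (F : F2^ j → List (F2^ m)) where
    open Split sp using (to; from; to-from; to-inj; ∑-split; 2^-dims)

    container-point : ∀ d y → container F (point d y) ≡ val F d y
    container-point d y = dichotomy (val F d y)
      (λ e → trans (does-intro (rep? F (point d y)) (d , y , refl , e)) (sym e))
      (λ e → trans (does-intro-¬ (rep? F (point d y)) λ { (d' , y' , q , t) → true≢false t
        (subst₂ (λ d y → val F d y ≡ false) (proj₁ (to-inj {d} {y} {d'} {y'} q)) (proj₂ (to-inj {d} {y} {d'} {y'} q)) e) }) (sym e))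

    not-not-N : ∀ d x → bit (not (not (Bip.N d (F d) x))) ≡ bit (Bip.N d (F d) x)
    not-not-N d x = cong bit (not-involutive _)

    #-container : # (not ∘ container F) ≡ ∑ (λ d → # (Bip.N d (F d)) + # (not ∘ Bip.right d (F d)))
    #-container = trans (∑-split _) (∑-cong λ d → trans (∑-cong λ y → cong (bit ∘ not) (container-point d y))
      (trans (∑-∷ _) (cong (_+ # (not ∘ Bip.right d (F d))) (∑-cong (not-not-N d)))))

    edges : F2^ j → ℕ
    edges d = ∑ (λ x' → # (λ x → G d x x'))

    edges-upper : ∑ edges * 2 ^ p ≤ 2 ^ p * 2 ^ m * # (not ∘ container F) + 2 ^ j * (2 ^ m * 2 ^ m)
    edges-upper = begin
      ∑ edges * 2 ^ p ≡⟨ sym (∑-*ʳ (2 ^ p) _) ⟩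
      ∑ (λ d → edges d * 2 ^ p) ≤⟨ ∑-mono (λ d → Bip.bip-count d (F d)) ⟩
      ∑ (λ d → 2 ^ p * 2 ^ m * (# (Bip.N d (F d)) + # (not ∘ Bip.right d (F d))) + 2 ^ m * 2 ^ m)
        ≡⟨ trans (∑-+ _ _) (cong₂ _+_ (∑-* (2 ^ p * 2 ^ m) _) (∑-const j _)) ⟩
      2 ^ p * 2 ^ m * ∑ (λ d → # (Bip.N d (F d)) + # (not ∘ Bip.right d (F d))) + 2 ^ j * (2 ^ m * 2 ^ m)
        ≡⟨ cong (λ x → 2 ^ p * 2 ^ m * x + 2 ^ j * (2 ^ m * 2 ^ m)) (sym #-container) ⟩
      2 ^ p * 2 ^ m * # (not ∘ container F) + 2 ^ j * (2 ^ m * 2 ^ m) ∎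
      where open ≤-Reasoning

    ∑-diff : ∀ x (f : F2^ m → ℕ) → ∑ (λ x' → f (x ⊕ x')) ≡ ∑ f
    ∑-diff x f = trans (∑-cong λ x' → cong f (⊕-comm x x')) (∑-translate x f)

    -- For each `u`, every point is an end of exactly one pair at distance a + Xu. A point missing
    -- from `Cu u` makes its pair an edge, and an edge has only two ends.
    edges-lower : ∑ (λ u → # (not ∘ Cu u)) ≤ 2 * ∑ edges
    edges-lower = begin
      ∑ (λ u → # (not ∘ Cu u))
        ≡⟨ ∑-cong (λ u → ∑-split _) ⟩
      ∑ (λ u → ∑ λ d → ∑ λ y → c u d y)
        ≡⟨ ∑-cong (λ u → ∑-cong λ d → ∑-∷ _) ⟩
      ∑ (λ u → ∑ λ d → ∑ (λ x → c u d (false ∷ x)) + ∑ (λ x → c u d (true ∷ x)))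
        ≡⟨ ∑-swap _ ⟩
      ∑ (λ d → ∑ λ u → ∑ (λ x → c u d (false ∷ x)) + ∑ (λ x → c u d (true ∷ x)))
        ≡⟨ ∑-cong (λ d → trans (∑-+ _ _) (cong₂ _+_ (left d) (rightS d))) ⟩
      ∑ (λ d → ∑ (λ x' → ∑ λ x → c (x ⊕ x') d (false ∷ x)) + ∑ (λ x' → ∑ λ x → c (x ⊕ x') d (true ∷ x')))
        ≡⟨ ∑-cong (λ d → trans (sym (∑-+ _ _)) (∑-cong λ x' → sym (∑-+ _ _))) ⟩
      ∑ (λ d → ∑ λ x' → ∑ λ x → c (x ⊕ x') d (false ∷ x) + c (x ⊕ x') d (true ∷ x'))
        ≤⟨ ∑-mono (λ d → ∑-mono λ x' → ∑-mono λ x → two (Cu (x ⊕ x') (point d (false ∷ x))) (Cu (x ⊕ x') (point d (true ∷ x')))) ⟩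
      ∑ (λ d → ∑ λ x' → ∑ λ x → 2 * bit (G d x x'))
        ≡⟨ trans (∑-cong λ d → trans (∑-cong λ x' → ∑-* 2 _) (∑-* 2 _)) (∑-* 2 _) ⟩
      2 * ∑ edges ∎
      where
      open ≤-Reasoning
      c : F2^ m → F2^ j → F2^ (suc m) → ℕ
      c u d y = bit (not (Cu u (point d y)))
      left : ∀ d → ∑ (λ u → ∑ λ x → c u d (false ∷ x)) ≡ ∑ (λ x' → ∑ λ x → c (x ⊕ x') d (false ∷ x))
      left d = trans (∑-swap _) (trans (∑-cong λ x → sym (∑-diff x (λ u → c u d (false ∷ x)))) (∑-swap _))
      rightS : ∀ d → ∑ (λ u → ∑ λ x → c u d (true ∷ x)) ≡ ∑ (λ x' → ∑ λ x → c (x ⊕ x') d (true ∷ x'))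
      rightS d = trans (∑-swap _) (∑-cong λ x' → sym (∑-translate x' (λ u → c u d (true ∷ x'))))
      two : ∀ α β → bit (not α) + bit (not β) ≤ 2 * bit (not (α ∧ β))
      two true true rewrite bit-false = ≤-refl
      two true false rewrite bit-false | bit-true = s≤s z≤n
      two false true rewrite bit-false | bit-true = s≤s z≤n
      two false false rewrite bit-true = ≤-refl

    -- The factor 2 of `edges-lower` is the price of one step of codimension: if every `Cu u` omits
    -- about a 2^-k part of the space, the new container omits about a 2^-(k+1) part.
    container-size : ∀ k → (∀ u → 2 ^ n * 2 ^ p ≤ 2 ^ k * 2 ^ p * # (not ∘ Cu u) + 2 ^ n) →
      2 ^ n * 2 ^ p ≤ 2 * 2 ^ k * 2 ^ p * # (not ∘ container F) + (2 ^ k + 1) * 2 ^ n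
    container-size k h = *2^-cancel m (begin
      2 ^ n * 2 ^ p * 2 ^ m
        ≡⟨ trans (*-comm _ (2 ^ m)) (sym (∑-const m _)) ⟩
      ∑ {m} (λ u → 2 ^ n * 2 ^ p)
        ≤⟨ ∑-mono h ⟩
      ∑ (λ u → 2 ^ k * 2 ^ p * # (not ∘ Cu u) + 2 ^ n)
        ≡⟨ trans (∑-+ _ _) (cong₂ _+_ (∑-* (2 ^ k * 2 ^ p) _) (∑-const m _)) ⟩
      2 ^ k * 2 ^ p * ∑ (λ u → # (not ∘ Cu u)) + 2 ^ m * 2 ^ n
        ≤⟨ +-monoˡ-≤ (2 ^ m * 2 ^ n) (*-monoʳ-≤ (2 ^ k * 2 ^ p) edges-lower) ⟩
      2 ^ k * 2 ^ p * (2 * ∑ edges) + 2 ^ m * 2 ^ n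
        ≡⟨ cong (_+ 2 ^ m * 2 ^ n) (solve 3 (λ K P E → K :* P :* (con 2 :* E) := con 2 :* K :* (E :* P)) refl (2 ^ k) (2 ^ p) (∑ edges)) ⟩
      2 * 2 ^ k * (∑ edges * 2 ^ p) + 2 ^ m * 2 ^ n
        ≤⟨ +-monoˡ-≤ (2 ^ m * 2 ^ n) (*-monoʳ-≤ (2 * 2 ^ k) edges-upper) ⟩
      2 * 2 ^ k * (2 ^ p * 2 ^ m * R + 2 ^ j * (2 ^ m * 2 ^ m)) + 2 ^ m * 2 ^ n
        ≡⟨ solve 6 (λ K P M R J N → con 2 :* K :* (P :* M :* R :+ J :* (M :* M)) :+ M :* N := (con 2 :* K :* P :* R :+ K :* (J :* (con 2 :* M)) :+ N) :* M) refl (2 ^ k) (2 ^ p) (2 ^ m) R (2 ^ j) (2 ^ n) ⟩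
      (2 * 2 ^ k * 2 ^ p * R + 2 ^ k * (2 ^ j * 2 ^ suc m) + 2 ^ n) * 2 ^ m
        ≡⟨ cong (λ x → (2 * 2 ^ k * 2 ^ p * R + 2 ^ k * x + 2 ^ n) * 2 ^ m) (sym 2^-dims) ⟩
      (2 * 2 ^ k * 2 ^ p * R + 2 ^ k * 2 ^ n + 2 ^ n) * 2 ^ m
        ≡⟨ cong (_* 2 ^ m) (solve 3 (λ A K N → A :+ K :* N :+ N := A :+ (K :+ con 1) :* N) refl (2 * 2 ^ k * 2 ^ p * R) (2 ^ k) (2 ^ n)) ⟩
      (2 * 2 ^ k * 2 ^ p * R + (2 ^ k + 1) * 2 ^ n) * 2 ^ m ∎)
      where
      open ≤-Reasoning
      open +-*-Solver
      R : ℕ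
      R = # (not ∘ container F)

    container-⊇ : ∀ S → (∀ u w → S w ≡ true → S (w ⊕ (a ⊕ lin X u)) ≡ true → Cu u w ≡ true) →
      (∀ d x' → x' ∈ F d → S (point d (true ∷ x')) ≡ true) →
      (∀ d x' → S (point d (true ∷ x')) ≡ true → Bip.right d (F d) x' ≡ true) → S ⊆ container F
    container-⊇ S hT hF hD w sw = subst (λ x → container F x ≡ true) (to-from w)
        (trans (container-point d y) (good y (subst (λ x → S x ≡ true) (sym (to-from w)) sw)))
      where
      d : F2^ j
      d = proj₁ (from w)
      y : F2^ (suc m)
      y = proj₂ (from w)
      link : ∀ x x' → point d (false ∷ x) ⊕ (a ⊕ lin X (x ⊕ x')) ≡ point d (true ∷ x')
      link x x' = trans (cong (λ q → point d (false ∷ x) ⊕ (a ⊕ q)) (lin-⊕ X x x'))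
        (⊕-solve (lin B d ∷ lin X x ∷ lin X x' ∷ a ∷ []) ((x₀ :⊕ (:0 :⊕ x₁)) :⊕ (x₃ :⊕ (x₁ :⊕ x₂))) (x₀ :⊕ (x₃ :⊕ x₂)) refl)
      link' : ∀ x x' → point d (true ∷ x') ⊕ (a ⊕ lin X (x ⊕ x')) ≡ point d (false ∷ x)
      link' x x' = trans (cong (λ q → point d (true ∷ x') ⊕ (a ⊕ q)) (lin-⊕ X x x'))
        (⊕-solve (lin B d ∷ lin X x ∷ lin X x' ∷ a ∷ []) ((x₀ :⊕ (x₃ :⊕ x₂)) :⊕ (x₃ :⊕ (x₁ :⊕ x₂))) (x₀ :⊕ (:0 :⊕ x₁)) refl)
      good : ∀ y → S (point d y) ≡ true → val F d y ≡ true
      good (true ∷ x') s = hD d x' s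
      good (false ∷ x) s = not-intro (≢true⇒false λ t → let (x' , m , g) = find (does-true (any? (λ x' → G d x x' ≟B true) (F d)) t)
                                                            s' = hF d x' m in
        true≢false (∧-intro (hT (x ⊕ x') (point d (false ∷ x)) s (subst (λ q → S q ≡ true) (sym (link x x')) s'))
          (hT (x ⊕ x') (point d (true ∷ x')) s' (subst (λ q → S q ≡ true) (sym (link' x x')) s))) (not-true g))

-- The second condition says that `C` omits at least (1 - 2^-p) 2^(n-k) points, almost as many as a
-- subspace of codimension `k` contains.
Container : ∀ {n} → ℕ → ℕ → (F2^ n → Bool) → (F2^ n → Bool) → Set
Container {n} k p S C = S ⊆ C × 2 ^ n * 2 ^ p ≤ 2 ^ k * 2 ^ p * # (not ∘ C) + 2 ^ n

Containers : ℕ → ℕ → ℕ → ℕ → ℕ → Set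
Containers k s p z n = (e : Vec (F2^ n) z) → Σ (List (F2^ n → Bool)) λ L → length L ≤ 2 ^ (2 ^ (n ∸ p)) ×
  (Inj e → ∀ S → S zeros ≡ false → BBfree (suc k) s e S → Any (Container k p S) L)

base-size : ∀ {n} p q k (S : F2^ n → Bool) → p < q → Sparse q S → 2 ^ n * 2 ^ p ≤ 2 ^ k * 2 ^ p * # (not ∘ S) + 2 ^ n
base-size {n} p q k S p<q sp = begin
  2 ^ n * 2 ^ p ≡⟨ cong (_* 2 ^ p) (sym (#-not S)) ⟩
  (# S + # (not ∘ S)) * 2 ^ p ≡⟨ solve 3 (λ a b P → (a :+ b) :* P := P :* b :+ a :* P) refl (# S) (# (not ∘ S)) (2 ^ p) ⟩
  2 ^ p * # (not ∘ S) + # S * 2 ^ p ≤⟨ +-mono-≤ (*-monoˡ-≤ (# (not ∘ S)) (≤-trans (≤-reflexive (sym (*-identityˡ (2 ^ p)))) (*-monoˡ-≤ (2 ^ p) (2^>0 k))))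
      (≤-trans (*-monoʳ-≤ (# S) (2^-mono (<⇒≤ p<q))) sp) ⟩
  2 ^ k * 2 ^ p * # (not ∘ S) + 2 ^ n ∎
  where open ≤-Reasoning
        open +-*-Solver

container-≗ : ∀ {n k p} {S C D : F2^ n → Bool} → C ≗ D → Container k p S C → Container k p S D
container-≗ {k = k} {p} {S} {C} {D} e (sub , size) = (λ v s → trans (sym (e v)) (sub v s)) ,
  ≤-trans size (≤-reflexive (cong (λ x → 2 ^ k * 2 ^ p * x + _) (#-cong (λ v → cong not (e v)))))

-- In codimension one a configuration is an affine flat. A set without flats along `e` is sparse,
-- and sparse sets are few enough to be their own containers.
containers-base : ∀ s p n (sp : Σ ℕ λ q → p < q × (∀ n → q ≤ n → Cov {n} (Sparse q) (2 ^ (2 ^ (n ∸ p))))) →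
  proj₁ sp ≤ n → Containers 0 s p (proj₁ (flat s (proj₁ sp))) n
containers-base s p n (q , p<q , cov) q≤n e = L , le , λ inj S s0 free →
    let sparse = ≮⇒≥ (λ l → noflat S free (dense⇒flat s q e S l)) in
    Any.map (λ eq → container-≗ {k = 0} {p} eq ((λ v t → t) , base-size p q 0 S p<q sparse)) (cover S sparse)
  where
  L : List (F2^ n → Bool)
  L = proj₁ (cov n q≤n)
  le : length L ≤ 2 ^ (2 ^ (n ∸ p))
  le = proj₁ (proj₂ (cov n q≤n))
  cover : ∀ S → Sparse q S → Any (S ≗_) L
  cover = proj₂ (proj₂ (cov n q≤n))
  noflat : ∀ S → BBfree 1 s e S → ¬ ∃ (OnFlat s e S)
  noflat S free (y , Y , iY , on) = free (y ∷ []) Y iY λ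
    { (false ∷ []) ne v → ⊥-elim (ne refl)
    ; (true ∷ []) ne v → subst (λ x → S x ≡ true) (cong₂ _⊕_ (sym (⊕-idʳ y)) (sym (lin-⊙ e Y v))) (on v) }

-- A set containing the flat a + ⟨X⟩ + ⟨Q⟩ is handled by applying the container
-- theorem one dimension lower to the sets T u = S ∩ (S + a + Xu).
module Slices {n k s z m zk} (e : Vec (F2^ n) z) (ie : Inj e) (S : F2^ n → Bool) (s0 : S zeros ≡ false)
  (free : BBfree (suc (suc k)) s e S) (a : F2^ n) (Y₁ : Vec (F2^ z) m) (Y₂ : Vec (F2^ z) zk)
  (iY : Inj (Y₁ ++ᵛ Y₂)) (on : ∀ v → S (a ⊕ lin e (lin (Y₁ ++ᵛ Y₂) v)) ≡ true) where

  X : Vec (F2^ n) m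
  X = e ⊙ Y₁
  Q : Vec (F2^ n) zk
  Q = e ⊙ Y₂

  onXQ : ∀ u v → S (a ⊕ lin X u ⊕ lin Q v) ≡ true
  onXQ u v = subst (λ x → S x ≡ true)
    (trans (cong (λ y → a ⊕ lin e y) (lin-++ Y₁ Y₂ u v)) (trans (cong (a ⊕_) (trans (lin-⊕ e _ _) (cong₂ _⊕_ (sym (lin-⊙ e Y₁ u)) (sym (lin-⊙ e Y₂ v))))) (sym (⊕-assoc a _ _))))
    (on (u ++ᵛ v))

  iQ : Inj Q
  iQ = Inj-⊙ e Y₂ ie (Inj-++ʳ Y₁ Y₂ iY)

  iaX : Inj (a ∷ X)
  iaX (false ∷ x) eq = cong (false ∷_) (Inj-⊙ e Y₁ ie (Inj-++ˡ Y₁ Y₂ iY) x (trans (sym (⊕-idˡ _)) eq))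
  -- If `a` were in the span of `X`, the flat contained in `S` would pass through `zeros`.
  iaX (true ∷ x) eq = ⊥-elim (true≢false (subst (λ w → S w ≡ true) (trans (cong₂ _⊕_ eq (lin-zero Q)) (⊕-self zeros)) (onXQ x zeros)) s0)

  T : F2^ m → F2^ n → Bool
  T u w = S w ∧ S (w ⊕ (a ⊕ lin X u))

  T0 : ∀ u → T u zeros ≡ false
  T0 u = cong (_∧ S (zeros ⊕ (a ⊕ lin X u))) s0

  -- Adding the generator a + Xu to a configuration in `T u` gives one in `S` with one generator
  -- more: the old translates lie in `S`, their shifts by a + Xu do so by definition of `T u`, and
  -- the shift of the centre lies on the given flat because the directions are taken from `Q`.
  Tfree : ∀ u → BBfree (suc k) s Q (T u)
  Tfree u A Y iY' bb = free ((a ⊕ lin X u) ∷ A) (Y₂ ⊙ Y) (Inj-⊙ Y₂ Y (Inj-++ʳ Y₁ Y₂ iY) iY') full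
    where
    dir : ∀ v → lin (e ⊙ (Y₂ ⊙ Y)) v ≡ lin (Q ⊙ Y) v
    dir v = trans (lin-⊙ e (Y₂ ⊙ Y) v) (trans (cong (lin e) (lin-⊙ Y₂ Y v)) (sym (trans (lin-⊙ Q Y v) (lin-⊙ e Y₂ (lin Y v)))))
    full : BB⊆ ((a ⊕ lin X u) ∷ A) (e ⊙ (Y₂ ⊙ Y)) S
    full (false ∷ c) ne v = subst (λ x → S x ≡ true) (sym (cong₂ _⊕_ (⊕-idˡ _) (dir v)))
      (proj₁ (∧-true (bb c (λ q → ne (cong (false ∷_) q)) v)))
    full (true ∷ c) ne v with c ≟V zeros
    ... | yes refl = subst (λ x → S x ≡ true) (sym (cong₂ _⊕_ (trans (cong (a ⊕ lin X u ⊕_) (lin-zero A)) (⊕-idʳ _)) (trans (dir v) (lin-⊙ Q Y v)))) (onXQ u (lin Y v))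
    ... | no c≢0 = subst (λ x → S x ≡ true)
      (trans (⊕-solve (lin A c ∷ lin (Q ⊙ Y) v ∷ (a ⊕ lin X u) ∷ []) ((x₀ :⊕ x₁) :⊕ x₂) ((x₂ :⊕ x₀) :⊕ x₁) refl) (cong (a ⊕ lin X u ⊕ lin A c ⊕_) (sym (dir v))))
      (proj₂ (∧-true {S (lin A c ⊕ lin (Q ⊙ Y) v)} (bb c c≢0 v)))

size-weaken : ∀ n k p r R → 2 ^ n * 2 ^ (p + r) ≤ 2 ^ k * 2 ^ (p + r) * R + 2 ^ n → 2 ^ n * 2 ^ p ≤ 2 ^ k * 2 ^ p * R + 2 ^ n
size-weaken n k p r R h = *2^-cancel r (begin
  2 ^ n * 2 ^ p * 2 ^ r ≡⟨ trans (*-assoc (2 ^ n) (2 ^ p) (2 ^ r)) (cong (2 ^ n *_) (sym (^-distribˡ-+-* 2 p r))) ⟩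
  2 ^ n * 2 ^ (p + r) ≤⟨ h ⟩
  2 ^ k * 2 ^ (p + r) * R + 2 ^ n ≤⟨ +-monoʳ-≤ _ (≤-trans (≤-reflexive (sym (*-identityʳ (2 ^ n)))) (*-monoʳ-≤ (2 ^ n) (2^>0 r))) ⟩
  2 ^ k * 2 ^ (p + r) * R + 2 ^ n * 2 ^ r ≡⟨ cong (λ x → 2 ^ k * x * R + 2 ^ n * 2 ^ r) (^-distribˡ-+-* 2 p r) ⟩
  2 ^ k * (2 ^ p * 2 ^ r) * R + 2 ^ n * 2 ^ r ≡⟨ solve 5 (λ K P Q R N → K :* (P :* Q) :* R :+ N :* Q := (K :* P :* R :+ N) :* Q) refl (2 ^ k) (2 ^ p) (2 ^ r) R (2 ^ n) ⟩
  (2 ^ k * 2 ^ p * R + 2 ^ n) * 2 ^ r ∎)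
  where open ≤-Reasoning
        open +-*-Solver

size-divide : ∀ n k p R → 2 ^ n * 2 ^ (suc k + p) ≤ 2 * 2 ^ k * 2 ^ (suc k + p) * R + (2 ^ k + 1) * 2 ^ n →
  2 ^ n * 2 ^ p ≤ 2 ^ suc k * 2 ^ p * R + 2 ^ n
size-divide n k p R h = *2^-cancel (suc k) (begin
  2 ^ n * 2 ^ p * 2 ^ suc k ≡⟨ trans (*-assoc (2 ^ n) (2 ^ p) (2 ^ suc k)) (cong (2 ^ n *_) (trans (*-comm (2 ^ p) _) (sym (^-distribˡ-+-* 2 (suc k) p)))) ⟩
  2 ^ n * 2 ^ (suc k + p) ≤⟨ h ⟩
  2 * 2 ^ k * 2 ^ (suc k + p) * R + (2 ^ k + 1) * 2 ^ n ≤⟨ +-monoʳ-≤ _ (*-monoˡ-≤ (2 ^ n) (≤-trans (+-monoʳ-≤ (2 ^ k) (2^>0 k)) (≤-reflexive (cong (2 ^ k +_) (sym (+-identityʳ _)))))) ⟩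
  2 ^ suc k * 2 ^ (suc k + p) * R + 2 ^ suc k * 2 ^ n ≡⟨ cong (λ x → 2 ^ suc k * x * R + 2 ^ suc k * 2 ^ n) (^-distribˡ-+-* 2 (suc k) p) ⟩
  2 ^ suc k * (2 ^ suc k * 2 ^ p) * R + 2 ^ suc k * 2 ^ n ≡⟨ solve 4 (λ K P R N → K :* (K :* P) :* R :+ K :* N := (K :* P :* R :+ N) :* K) refl (2 ^ suc k) (2 ^ p) R (2 ^ n) ⟩
  (2 ^ suc k * 2 ^ p * R + 2 ^ n) * 2 ^ suc k ∎)
  where open ≤-Reasoning
        open +-*-Solver

any-weaken : ∀ {A : Set} {P Q : A → Set} {xs} → (∀ {x} → P x → Q x) → Any P xs → Any Q xs
any-weaken f a = Any.map f a

2*2^ : ∀ x → 2 ^ x + 2 ^ x ≡ 2 ^ suc x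
2*2^ x = cong (2 ^ x +_) (sym (+-identityʳ _))

-- A container is determined by a complement `B`, the generators `a ∷ X`, the directions `Q`, one
-- container `Cu u` for each of the 2^m values of `u`, and one fingerprint for each of the 2^(n-m-1)
-- blocks. `count` adds up the bits of these five choices. Sparse sets have no flat to start from
-- and are listed separately.
module Step (k s p r m zk q n : ℕ) (ih : Containers k s (suc k + p + r) zk n)
  (q> : suc p < q) (cov : Cov {n} (Sparse q) (2 ^ (2 ^ (n ∸ suc p)))) (p<n : suc p ≤ n)
  (count : n * (n ∸ suc m) + (n * suc m + (n * zk + (2 ^ (n ∸ (suc k + p + r)) * 2 ^ m + suc m * 2 ^ (suc k + p) * 2 ^ (n ∸ suc m)))) ≤ 2 ^ (n ∸ suc p)) where

  private
    j p' z : ℕ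
    j = n ∸ suc m
    p' = suc k + p
    z = proj₁ (flat (m + zk) q)

    Fs : List (F2^ j → List (F2^ m))
    Fs = allFuns j (lists≤ (2 ^ p') (allVecs m))

    forCu : Vec (F2^ n) j → Vec (F2^ n) (suc m) → (F2^ m → F2^ n → Bool) → List (F2^ n → Bool)
    forCu B aX Cu = L.map (Blocks.container (head aX) (tail aX) B Cu p') Fs

    forQ : Vec (F2^ n) j → Vec (F2^ n) (suc m) → Vec (F2^ n) zk → List (F2^ n → Bool)
    forQ B aX Q = L.concatMap (forCu B aX) (allFuns m (proj₁ (ih Q)))

    forX : Vec (F2^ n) j → Vec (F2^ n) (suc m) → List (F2^ n → Bool)
    forX B aX = L.concatMap (forQ B aX) (allTuples n zk)

    forB : Vec (F2^ n) j → List (F2^ n → Bool)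
    forB B = L.concatMap (forX B) (allTuples n (suc m))

    dense : List (F2^ n → Bool)
    dense = L.concatMap forB (allTuples n j)

    e₁ e₂ : ℕ
    e₁ = suc m * 2 ^ p' * 2 ^ j
    e₂ = 2 ^ (n ∸ (p' + r)) * 2 ^ m

    len-Fs : ∀ B aX Cu → length (forCu B aX Cu) ≤ 2 ^ e₁
    len-Fs B aX Cu = begin
      length (forCu B aX Cu) ≡⟨ length-map _ Fs ⟩
      length Fs ≤⟨ length-allFuns j _ ⟩
      length (lists≤ (2 ^ p') (allVecs m)) ^ (2 ^ j) ≤⟨ ^-monoˡ-≤ (2 ^ j) (length-lists≤V m (2 ^ p')) ⟩
      (2 ^ (suc m * 2 ^ p')) ^ (2 ^ j) ≡⟨ ^-*-assoc 2 (suc m * 2 ^ p') (2 ^ j) ⟩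
      2 ^ e₁ ∎
      where open ≤-Reasoning

    glue : ∀ a b {x y} → x ≤ 2 ^ a → y ≤ 2 ^ b → x * y ≤ 2 ^ (a + b)
    glue a b h₁ h₂ = ≤-trans (*-mono-≤ h₁ h₂) (≤-reflexive (sym (^-distribˡ-+-* 2 a b)))

    len-Q : ∀ B aX Q → length (forQ B aX Q) ≤ 2 ^ (e₂ + e₁)
    len-Q B aX Q = ≤-trans (length-concatMap (forCu B aX) (2 ^ e₁) (allFuns m (proj₁ (ih Q))) (len-Fs B aX)) (glue e₂ e₁
      (≤-trans (length-allFuns m (proj₁ (ih Q))) (≤-trans (^-monoˡ-≤ (2 ^ m) (proj₁ (proj₂ (ih Q)))) (≤-reflexive (^-*-assoc 2 (2 ^ (n ∸ (p' + r))) (2 ^ m))))) ≤-refl)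

    len-X : ∀ B aX → length (forX B aX) ≤ 2 ^ (n * zk + (e₂ + e₁))
    len-X B aX = ≤-trans (length-concatMap (forQ B aX) _ (allTuples n zk) (len-Q B aX)) (glue (n * zk) _ (length-allTuples n zk) ≤-refl)

    len-B : ∀ B → length (forB B) ≤ 2 ^ (n * suc m + (n * zk + (e₂ + e₁)))
    len-B B = ≤-trans (length-concatMap (forX B) _ (allTuples n (suc m)) (len-X B)) (glue (n * suc m) _ (length-allTuples n (suc m)) ≤-refl)

    len : length dense ≤ 2 ^ (2 ^ (n ∸ suc p))
    len = ≤-trans (≤-trans (length-concatMap forB _ (allTuples n j) len-B) (glue (n * j) _ (length-allTuples n j) ≤-refl)) (2^-mono count)

    total : length (proj₁ cov ++ dense) ≤ 2 ^ (2 ^ (n ∸ p))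
    total = begin
      length (proj₁ cov ++ dense) ≡⟨ length-++ (proj₁ cov) ⟩
      length (proj₁ cov) + length dense ≤⟨ +-mono-≤ (proj₁ (proj₂ cov)) len ⟩
      2 ^ y + 2 ^ y ≡⟨ 2*2^ y ⟩
      2 ^ suc y ≤⟨ 2^-mono (≤-trans (+-monoˡ-≤ y (2^>0 (n ∸ suc p))) (≤-reflexive (2^-half p<n))) ⟩
      2 ^ (2 ^ (n ∸ p)) ∎
      where
      open ≤-Reasoning
      y : ℕ
      y = 2 ^ (n ∸ suc p)

    module _ (e : Vec (F2^ n) z) (ie : Inj e) (S : F2^ n → Bool) (s0 : S zeros ≡ false) (free : BBfree (suc (suc k)) s e S)
      (a : F2^ n) (Y₁ : Vec (F2^ z) m) (Y₂ : Vec (F2^ z) zk) (iY : Inj (Y₁ ++ᵛ Y₂))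
      (on : ∀ v → S (a ⊕ lin e (lin (Y₁ ++ᵛ Y₂) v)) ≡ true) where
      open Slices {k = k} {s} {z} {m} {zk} e ie S s0 free a Y₁ Y₂ iY on

      withSplit : (B : Vec (F2^ n) j) → Split B (a ∷ X) → Any (Container (suc k) p S) dense
      withSplit B sp = any-concatMap forB (lose (∈-tuples ∈-allVecs B) (any-concatMap (forX B) (lose (∈-tuples ∈-allVecs (a ∷ X))
          (any-concatMap (forQ B (a ∷ X)) (lose (∈-tuples ∈-allVecs Q) (any-concatMap (forCu B (a ∷ X))
            (any-weaken inner (allFuns-complete m (λ u → proj₂ (proj₂ (ih Q)) iQ (T u) (T0 u) (Tfree u))))))))))
        where
        inner : ∀ {Cu} → (∀ u → Container k (p' + r) (T u) (Cu u)) → Any (Container (suc k) p S) (forCu B (a ∷ X) Cu)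
        inner {Cu} hCu = AnyP.map⁺ (any-weaken final (allFuns-complete j {P = GoodF} λ d →
            let (F , le , sub , done) = Bip.fingerprint d (λ x' → S (point d (true ∷ x'))) in
            any-weaken {P = λ G → F ≡ G} (λ { refl → sub , done }) (∈-lists≤ (2 ^ p') F ∈-allVecs le)))
          where
          open Blocks a X B Cu p'
          GoodF : F2^ j → List (F2^ m) → Set
          GoodF d F = (∀ x' → x' ∈ F → S (point d (true ∷ x')) ≡ true) × (∀ x' → S (point d (true ∷ x')) ≡ true → Bip.right d F x' ≡ true)
          final : ∀ {F} → (∀ d → GoodF d (F d)) → Container (suc k) p S (container F)
          final {F} hF = container-⊇ sp F S (λ u w s₁ s₂ → proj₁ (hCu u) w (∧-intro s₁ s₂)) (λ d → proj₁ (hF d)) (λ d → proj₂ (hF d)) ,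
            size-divide n k p _ (container-size sp F k λ u → size-weaken n k p' r _ (proj₂ (hCu u)))

      fromFlat : Any (Container (suc k) p S) dense
      fromFlat with splitting (a ∷ X) iaX
      ... | j' , B , sp = cast j' B sp (trans (sym (m+n∸n≡m j' (suc m))) (cong (_∸ suc m) (sym (split-dims sp))))
        where
        cast : ∀ j' (B : Vec (F2^ n) j') → Split B (a ∷ X) → j' ≡ j → Any (Container (suc k) p S) dense
        cast .j B sp refl = withSplit B sp

  containers-step : Containers (suc k) s p z n
  containers-step e = proj₁ cov ++ dense , total , λ ie S s0 free → go ie S s0 free (# S * 2 ^ q ≤? 2 ^ n)
    where
    go : Inj e → ∀ S → S zeros ≡ false → BBfree (suc (suc k)) s e S → Dec (# S * 2 ^ q ≤ 2 ^ n) → Any (Container (suc k) p S) (proj₁ cov ++ dense)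
    go ie S s0 free (yes sparse) = AnyP.++⁺ˡ (any-weaken (λ eq → container-≗ {k = suc k} {p} eq ((λ v t → t) , base-size p q (suc k) S (<-trans ≤-refl q>) sparse)) (proj₂ (proj₂ cov) S sparse))
    go ie S s0 free (no ¬sparse) with dense⇒flat (m + zk) q e S (≰⇒> ¬sparse)
    ... | a , Y , iY , on with V.splitAt m Y
    ...   | Y₁ , Y₂ , refl = AnyP.++⁺ʳ (proj₁ cov) (fromFlat e ie S s0 free a Y₁ Y₂ iY on)

-- A fingerprint costs about (m+1) 2^p' bits while a block has 2^(m+1) points. Large blocks make the
-- fingerprints cheap, and m = 2Q + 2 is large enough.
block-dim : ∀ Q → suc (2 * Q + 2) * 2 ^ Q ≤ 2 ^ suc (2 * Q + 2)
block-dim Q = begin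
  suc (2 * Q + 2) * 2 ^ Q ≤⟨ *-monoˡ-≤ (2 ^ Q) le ⟩
  2 ^ (Q + 3) * 2 ^ Q ≡⟨ sym (^-distribˡ-+-* 2 (Q + 3) Q) ⟩
  2 ^ (Q + 3 + Q) ≡⟨ cong (2 ^_) (solve 1 (λ Q → Q :+ con 3 :+ Q := con 1 :+ (con 2 :* Q :+ con 2)) refl Q) ⟩
  2 ^ suc (2 * Q + 2) ∎
  where
  open ≤-Reasoning
  open +-*-Solver
  le : suc (2 * Q + 2) ≤ 2 ^ (Q + 3)
  le = begin
    suc (2 * Q + 2) ≤⟨ m≤m+n _ (6 * Q + 5) ⟩
    suc (2 * Q + 2) + (6 * Q + 5) ≡⟨ solve 1 (λ Q → con 1 :+ (con 2 :* Q :+ con 2) :+ (con 6 :* Q :+ con 5) := (con 1 :+ Q) :* con 8) refl Q ⟩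
    suc Q * 8 ≤⟨ *-monoˡ-≤ 8 (n<2^n Q) ⟩
    2 ^ Q * 8 ≡⟨ sym (^-distribˡ-+-* 2 Q 3) ⟩
    2 ^ (Q + 3) ∎

count-bound : ∀ k p m zk n → suc m * 2 ^ (suc k + p + (p + 3)) ≤ 2 ^ suc m → suc k + p + (m + (p + 3)) ≤ n → suc m ≤ n →
  suc zk * (n * n) + suc zk ≤ 2 ^ (n ∸ (p + 3)) →
  n * (n ∸ suc m) + (n * suc m + (n * zk + (2 ^ (n ∸ (suc k + p + (m + (p + 3)))) * 2 ^ m + suc m * 2 ^ (suc k + p) * 2 ^ (n ∸ suc m)))) ≤ 2 ^ (n ∸ suc p)
count-bound k p m zk n hm hn hmn hp = begin
  n * (n ∸ suc m) + (n * suc m + (n * zk + (e₂ + e₁))) ≡⟨ trans (sym (+-assoc (n * (n ∸ suc m)) (n * suc m) _)) (cong (_+ (n * zk + (e₂ + e₁))) (trans (sym (*-distribˡ-+ n (n ∸ suc m) (suc m))) (cong (n *_) (m∸n+n≡m hmn)))) ⟩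
  n * n + (n * zk + (e₂ + e₁)) ≡⟨ sym (+-assoc (n * n) (n * zk) _) ⟩
  n * n + n * zk + (e₂ + e₁) ≤⟨ +-mono-≤ part₁ (+-mono-≤ part₂ part₃) ⟩
  x + (x + x) ≤⟨ m≤m+n _ x ⟩
  x + (x + x) + x ≡⟨ solve 1 (λ x → x :+ (x :+ x) :+ x := (x :+ x) :+ (x :+ x)) refl x ⟩
  (x + x) + (x + x) ≡⟨ cong (λ y → y + y) half₁ ⟩
  2 ^ (n ∸ suc (suc p)) + 2 ^ (n ∸ suc (suc p)) ≡⟨ 2^-half (≤-trans (≤-trans (n≤1+n (suc (suc p))) (≤-reflexive (+-comm 3 p))) p3≤n) ⟩
  2 ^ (n ∸ suc p) ∎
  where
  open ≤-Reasoning
  open +-*-Solver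
  x e₁ e₂ : ℕ
  x = 2 ^ (n ∸ (p + 3))
  e₁ = suc m * 2 ^ (suc k + p) * 2 ^ (n ∸ suc m)
  e₂ = 2 ^ (n ∸ (suc k + p + (m + (p + 3)))) * 2 ^ m
  p3≤n : p + 3 ≤ n
  p3≤n = ≤-trans (≤-trans (m≤n+m (p + 3) m) (m≤n+m _ (suc k + p))) hn
  half₁ : x + x ≡ 2 ^ (n ∸ suc (suc p))
  half₁ = trans (cong (λ y → 2 ^ (n ∸ y) + 2 ^ (n ∸ y)) (+-comm p 3)) (2^-half (≤-trans (≤-reflexive (+-comm 3 p)) p3≤n))
  part₁ : n * n + n * zk ≤ x
  part₁ = ≤-trans (≤-trans (+-monoʳ-≤ (n * n) (≤-trans (≤-reflexive (*-comm n zk)) (*-monoʳ-≤ zk (nn n)))) (m≤m+n _ (suc zk))) hp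
    where
    nn : ∀ n → n ≤ n * n
    nn zero = z≤n
    nn (suc n) = m≤m+n (suc n) (n * suc n)
  part₂ : e₂ ≤ x
  part₂ = ≤-trans (≤-reflexive (sym (^-distribˡ-+-* 2 (n ∸ t) m))) (2^-mono {n ∸ t + m} {n ∸ (p + 3)} (m+n≤o⇒m≤o∸n (n ∸ t + m) (begin
    n ∸ t + m + (p + 3) ≡⟨ +-assoc (n ∸ t) m (p + 3) ⟩
    n ∸ t + (m + (p + 3)) ≤⟨ +-monoʳ-≤ (n ∸ t) (m≤n+m _ (suc k + p)) ⟩
    n ∸ t + t ≡⟨ m∸n+n≡m hn ⟩
    n ∎)))
    where
    t : ℕ
    t = suc k + p + (m + (p + 3))
  part₃ : e₁ ≤ x
  part₃ = *2^-cancel (p + 3) (begin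
    e₁ * 2 ^ (p + 3) ≡⟨ solve 4 (λ a b c d → a :* b :* c :* d := a :* (b :* d) :* c) refl (suc m) (2 ^ (suc k + p)) (2 ^ (n ∸ suc m)) (2 ^ (p + 3)) ⟩
    suc m * (2 ^ (suc k + p) * 2 ^ (p + 3)) * 2 ^ (n ∸ suc m) ≡⟨ cong (λ y → suc m * y * 2 ^ (n ∸ suc m)) (sym (^-distribˡ-+-* 2 (suc k + p) (p + 3))) ⟩
    suc m * 2 ^ (suc k + p + (p + 3)) * 2 ^ (n ∸ suc m) ≤⟨ *-monoˡ-≤ (2 ^ (n ∸ suc m)) hm ⟩
    2 ^ suc m * 2 ^ (n ∸ suc m) ≡⟨ trans (*-comm (2 ^ suc m) _) (2^-split hmn) ⟩
    2 ^ n ≡⟨ sym (2^-split p3≤n) ⟩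
    x * 2 ^ (p + 3) ∎)

abstract
  containers : ∀ k s p → Σ ℕ λ z → Σ ℕ λ n₀ → ∀ n → n₀ ≤ n → Containers k s p z n
  containers zero s p = let sp = cov-sparse p in
    proj₁ (flat s (proj₁ sp)) , proj₁ sp , λ n le → containers-base s p n sp le
  containers (suc k) s p =
    -- The precision `suc k + p` absorbs the error factor 2^k + 1 of one step, and `p + 3` leaves
    -- room to add several costs of size 2^(n-p-3). Since 2^m containers are recorded, the induction
    -- hypothesis is used with `m` further bits of precision, which is the choice of `r`.
    let Q = suc k + p + (p + 3)
        m = 2 * Q + 2
        r = m + (p + 3)
        ih = containers k s (suc k + p + r)
        zk = proj₁ ih
        n₁ = proj₁ (proj₂ ih)
        sp = cov-sparse (suc p)
        q = proj₁ sp
        po = poly (suc zk) (p + 3)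
    in proj₁ (flat (m + zk) q) , n₁ + (q + (suc m + (proj₁ po + (suc k + p + r)))) , λ n le →
      let l₁ = ≤-trans (m≤m+n n₁ _) le
          l₂ = ≤-trans (≤-trans (m≤m+n q _) (m≤n+m _ n₁)) le
          l₃ = ≤-trans (≤-trans (≤-trans (m≤m+n (suc m) _) (m≤n+m _ q)) (m≤n+m _ n₁)) le
          l₄ = ≤-trans (≤-trans (≤-trans (≤-trans (m≤m+n (proj₁ po) _) (m≤n+m _ (suc m))) (m≤n+m _ q)) (m≤n+m _ n₁)) le
          l₅ = ≤-trans (≤-trans (≤-trans (≤-trans (m≤n+m (suc k + p + r) (proj₁ po)) (m≤n+m _ (suc m))) (m≤n+m _ q)) (m≤n+m _ n₁)) le
      in Step.containers-step k s p r m zk q n (proj₂ (proj₂ ih) n l₁) (proj₁ (proj₂ sp)) (proj₂ (proj₂ sp) n l₂)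
        (≤-trans (<⇒≤ (proj₁ (proj₂ sp))) l₂) (count-bound k p m zk n (block-dim Q) l₅ l₃ (proj₂ po n l₄))

-- Configurations as tiles

every : ∀ {m} → (F2^ m → Bool) → Bool
every f = does (∀-dec enumV (λ v → f v ≟B true))

every-intro : ∀ {m} (f : F2^ m → Bool) → (∀ v → f v ≡ true) → every f ≡ true
every-intro f h = does-intro (∀-dec enumV (λ v → f v ≟B true)) h

every-elim : ∀ {m} (f : F2^ m → Bool) → every f ≡ true → ∀ v → f v ≡ true
every-elim f p = does-true (∀-dec enumV (λ v → f v ≟B true)) p

every-false : ∀ {m} (f : F2^ m → Bool) → every f ≡ false → ∃ λ v → f v ≡ false
every-false f p with ∃-dec enumV (λ v → f v ≟B false)
... | yes q = q
... | no ¬q = ⊥-elim (true≢false (every-intro f (λ v → ≢false⇒true λ e → ¬q (v , e))) p)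

NoDup-map : ∀ {A B : Set} (f : A → B) {xs} → (∀ x y → f x ≡ f y → x ≡ y) → NoDup xs → NoDup (L.map f xs)
NoDup-map f {[]} inj _ = tt
NoDup-map f {x ∷ xs} inj (n , d) = (λ m → let (y , q , e) = find (AnyP.map⁻ m) in n (subst (_∈ xs) (sym (inj _ _ e)) q)) , NoDup-map f inj d

NoDup-filter : ∀ {A : Set} {P : A → Set} (P? : ∀ x → Dec (P x)) {xs} → NoDup xs → NoDup (L.filter P? xs)
NoDup-filter P? {[]} _ = tt
NoDup-filter P? {x ∷ xs} (n , d) with P? x
... | yes _ = (λ m → n (sub xs m)) , NoDup-filter P? d
  where
  sub : ∀ ys → x ∈ L.filter P? ys → x ∈ ys
  sub (y ∷ ys) m with P? y
  sub (y ∷ ys) (here e) | yes _ = here e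
  sub (y ∷ ys) (there m) | yes _ = there (sub ys m)
  sub (y ∷ ys) m | no _ = there (sub ys m)
... | no _ = NoDup-filter P? d

NoDup-allVecs : ∀ n → NoDup (allVecs n)
NoDup-allVecs zero = (λ ()) , tt
NoDup-allVecs (suc n) = NoDup-++ (L.map (false ∷_) (allVecs n)) (NoDup-map (false ∷_) (λ { x .x refl → refl }) (NoDup-allVecs n))
  (NoDup-map (true ∷_) (λ { x .x refl → refl }) (NoDup-allVecs n))
  λ x p q → let (y , _ , e) = find (AnyP.map⁻ p); (y' , _ , e') = find (AnyP.map⁻ q) in clash (trans (sym e) e')
  where
  clash : ∀ {y y' : F2^ n} → _≡_ {A = F2^ (suc n)} (false ∷ y) (true ∷ y') → ⊥
  clash ()

take-++ : ∀ {A : Set} {m n} (a : Vec A m) (b : Vec A n) → V.take m (a ++ᵛ b) ≡ a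
take-++ [] b = refl
take-++ (x ∷ a) b = cong (x ∷_) (take-++ a b)

filter-elim : ∀ {A : Set} {P : A → Set} (P? : ∀ x → Dec (P x)) {xs x} → x ∈ L.filter P? xs → P x
filter-elim P? {y ∷ ys} m with P? y
filter-elim P? {y ∷ ys} (here refl) | yes p = p
filter-elim P? {y ∷ ys} (there m) | yes _ = filter-elim P? {ys} m
filter-elim P? {y ∷ ys} m | no _ = filter-elim P? {ys} m

length-filter-≤ : ∀ {A : Set} {P : A → Set} (P? : ∀ x → Dec (P x)) xs → length (L.filter P? xs) ≤ length xs
length-filter-≤ P? [] = z≤n
length-filter-≤ P? (x ∷ xs) with P? x
... | yes _ = s≤s (length-filter-≤ P? xs)
... | no _ = m≤n⇒m≤1+n (length-filter-≤ P? xs)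

abstract
  idx : ∀ {K} → (F2^ K → Bool) → ∀ s → List (F2^ (K + s))
  idx {K} ι s = L.filter (λ w → ι (V.take K w) ≟B true) (allVecs (K + s))

  config : ∀ {K s n} → Vec (F2^ n) K → Vec (F2^ n) s → (F2^ K → Bool) → List (F2^ n)
  config {K} {s} A Y ι = L.map (lin (A ++ᵛ Y)) (idx ι s)

  config-elim : ∀ {K s n} (A : Vec (F2^ n) K) (Y : Vec (F2^ n) s) ι {w} → w ∈ config A Y ι →
    ∃₂ λ c v → ι c ≡ true × w ≡ lin A c ⊕ lin Y v
  config-elim {K} A Y ι m with find (AnyP.map⁻ m)
  ... | x , q , e with V.splitAt K x
  ...   | c , v , refl = c , v , subst (λ d → ι d ≡ true) (take-++ c v) (filter-elim (λ w → ι (V.take K w) ≟B true) {allVecs (K + _)} q) , trans e (lin-++ A Y c v)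

  config-intro : ∀ {K s n} (A : Vec (F2^ n) K) (Y : Vec (F2^ n) s) ι c v → ι c ≡ true → lin A c ⊕ lin Y v ∈ config A Y ι
  config-intro {K} A Y ι c v h = AnyP.map⁺ (any-filter (λ w → ι (V.take K w) ≟B true)
    (any-weaken (λ { refl → sym (lin-++ A Y c v) , subst (λ d → ι d ≡ true) (sym (take-++ c v)) h }) (∈-allVecs (c ++ᵛ v))))

  config-NoDup : ∀ {K s n} (A : Vec (F2^ n) K) (Y : Vec (F2^ n) s) ι → Inj (A ++ᵛ Y) → NoDup (config A Y ι)
  config-NoDup {K} {s} A Y ι inj = NoDup-map (lin (A ++ᵛ Y)) (Inj⇒≡ (A ++ᵛ Y) inj) (NoDup-filter (λ w → ι (V.take K w) ≟B true) (NoDup-allVecs (K + s)))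

  size-idx : ∀ {K} → (F2^ K → Bool) → ℕ → ℕ
  size-idx ι s = length (idx ι s)

  size-idx≤ : ∀ {K} (ι : F2^ K → Bool) s → size-idx ι s ≤ 2 ^ (K + s)
  size-idx≤ {K} ι s = ≤-trans (length-filter-≤ (λ w → ι (V.take K w) ≟B true) (allVecs (K + s))) (≤-reflexive (length-allVecs (K + s)))

  size-idx>0 : ∀ {K} (ι : F2^ K → Bool) s c → ι c ≡ true → 1 ≤ size-idx ι s
  size-idx>0 {K} ι s c h = nonempty (any-filter {P = λ _ → ⊤} (λ w → ι (V.take K w) ≟B true)
      (any-weaken (λ { refl → tt , subst (λ d → ι d ≡ true) (sym (take-++ c zeros)) h }) (∈-allVecs (c ++ᵛ zeros {s}))))
    where
    nonempty : ∀ {A : Set} {P : A → Set} {xs} → Any P xs → 1 ≤ length xs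
    nonempty (here _) = s≤s z≤n
    nonempty (there _) = s≤s z≤n

  length-config : ∀ {K s n} (A : Vec (F2^ n) K) (Y : Vec (F2^ n) s) ι → length (config A Y ι) ≡ size-idx ι s
  length-config {K} {s} A Y ι = length-map _ (idx ι s)

BB-indep : ∀ {K s n} (A : Vec (F2^ n) K) (Y : Vec (F2^ n) s) {C} → Inj Y → C zeros ≡ false → BB⊆ A Y C → Indep A Y
BB-indep A Y {C} iY c0 bb c v e with c ≟V zeros
... | no ne = ⊥-elim (true≢false (bb c ne v) (trans (cong C e) c0))
... | yes refl = refl , iY v (trans (sym (⊕-idˡ _)) (trans (cong (_⊕ lin Y v) (sym (lin-zero A))) e))

Avoids : ∀ K s {n} → Class n
Avoids K s {n} S = (A : Vec (F2^ n) K) (Y : Vec (F2^ n) s) → Inj Y → ¬ BB⊆ A Y S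

-- Only the translates selected by `ι` form the tile. The others are contained in every member of
-- `Q`, so a member containing the tile would contain the whole configuration; for the same reason
-- only the selected points have to be fresh.
record Placement {K s n} (ι : F2^ K → Bool) (C : F2^ n → Bool) (Q : Class n) (W : List (F2^ n)) : Set where
  field
    gens  : Vec (F2^ n) K
    dirs  : Vec (F2^ n) s
    inj   : Inj dirs
    bb    : BB⊆ gens dirs C
    off   : ∀ c v → ι c ≡ true → lin gens c ⊕ lin dirs v ∉ W
    known : ∀ S → Q S → ∀ c → c ≢ zeros → ι c ≡ false → ∀ v → S (lin gens c ⊕ lin dirs v) ≡ true

loss-config : ∀ {K s n} (ι : F2^ K → Bool) (C : F2^ n → Bool) (Q : Class n) → C zeros ≡ false → ι zeros ≡ false →
  (∀ S → Q S → Supp C S) → (∀ S → Q S → Avoids K s S) → ∀ m → let b = size-idx ι s in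
  (∀ W → length W ≤ 2 ^ b * m * b → Placement {s = s} ι C Q W) → Cov Q (2 ^ (# C ∸ m))
loss-config {K} {s} {n} ι C Q c0 ι0 supp av m place = proj₂ (loss (size-idx ι s) C Q supp m tile)
  where
  tile : ∀ W → length W ≤ 2 ^ size-idx ι s * m * size-idx ι s → Tile (size-idx ι s) C Q W
  tile W le = mkTile (config gens dirs ι) (λ _ → true) (length-config gens dirs ι)
      (config-NoDup gens dirs ι (Indep⇒Inj gens dirs (BB-indep gens dirs {C} inj c0 bb)))
      (λ v m → let (c , u , ic , e) = config-elim gens dirs ι m in subst (λ x → C x ≡ true) (sym e) (bb c (λ c≡0 → true≢false ic (trans (cong ι c≡0) ι0)) u))
      (λ v m → let (c , u , ic , e) = config-elim gens dirs ι m in subst (_∉ W) (sym e) (off c u ic))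
      (λ S q all → av S q gens dirs inj λ c ne v → dichotomy (ι c) (λ ic → all _ (config-intro gens dirs ι c v ic)) (λ ic → known S q c ne ic v))
    where open Placement (place W le)

#-translates : ∀ {j m n} (A : Vec (F2^ n) j) (Z : Vec (F2^ n) m) (t : F2^ n) (W : List (F2^ n)) →
  # (λ y → some λ c → some λ u → inList W (y ⊕ (t ⊕ lin A c ⊕ lin Z u))) ≤ length W * 2 ^ (j + m)
#-translates {j} {m} A Z t W = begin
  # (λ y → some λ c → some λ u → inList W (y ⊕ (t ⊕ lin A c ⊕ lin Z u)))
    ≤⟨ ≤-trans (#-some (λ c y → some λ u → inList W (y ⊕ (t ⊕ lin A c ⊕ lin Z u)))) (∑-mono λ c → #-some (λ u y → inList W (y ⊕ (t ⊕ lin A c ⊕ lin Z u)))) ⟩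
  ∑ (λ c → ∑ λ u → # (λ y → inList W (y ⊕ (t ⊕ lin A c ⊕ lin Z u))))
    ≤⟨ ∑-mono (λ c → ∑-mono λ u → ≤-trans (≤-reflexive (#-translate (t ⊕ lin A c ⊕ lin Z u) (inList W))) (#-list W)) ⟩
  ∑ {j} (λ c → ∑ {m} λ u → length W) ≡⟨ trans (∑-cong λ _ → ∑-const m (length W)) (∑-const j _) ⟩
  2 ^ j * (2 ^ m * length W) ≡⟨ trans (sym (*-assoc (2 ^ j) (2 ^ m) _)) (trans (cong (_* length W) (sym (^-distribˡ-+-* 2 j m))) (*-comm _ (length W))) ⟩
  length W * 2 ^ (j + m) ∎
  where open ≤-Reasoning

-- A point of `W` excludes at most 2^(j+m) values of `y` for each value of `b`.
pick-off : ∀ {j m n} (P : F2^ n → Bool) (A : Vec (F2^ n) j) (Z : Vec (F2^ n) m) (r : F2^ n) (W : List (F2^ n)) →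
  length W * 2 ^ (j + m) + length W * 2 ^ (j + m) < # P →
  ∃ λ y → P y ≡ true × (∀ b c u → y ⊕ (b · r ⊕ lin A c ⊕ lin Z u) ∉ W)
pick-off {j} {m} {n} P A Z r W h = let (y , nb , py) = #-<⇒∃ (λ y → bad zeros y ∨ bad r y) P (≤-<-trans le h) in
    y , py , ok y nb
  where
  bad : F2^ n → F2^ n → Bool
  bad t y = some λ c → some λ u → inList W (y ⊕ (t ⊕ lin A c ⊕ lin Z u))
  or : ∀ a b → a ∨ b ≡ true → a ≡ true ⊎ b ≡ true
  or true b _ = inj₁ refl
  or false b p = inj₂ p
  or-false : ∀ a b → a ∨ b ≡ false → a ≡ false × b ≡ false
  or-false false b p = refl , p
  le : # (λ y → bad zeros y ∨ bad r y) ≤ length W * 2 ^ (j + m) + length W * 2 ^ (j + m)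
  le = ≤-trans (#-∪ {g = bad zeros} {h = bad r} λ y p → or _ _ p) (+-mono-≤ (#-translates A Z zeros W) (#-translates A Z r W))
  contra : ∀ t y → bad t y ≡ false → ∀ c u → y ⊕ (t ⊕ lin A c ⊕ lin Z u) ∉ W
  contra t y nb c u p = true≢false (some-intro (λ c → some λ u → inList W (y ⊕ (t ⊕ lin A c ⊕ lin Z u))) c
    (some-intro (λ u → inList W (y ⊕ (t ⊕ lin A c ⊕ lin Z u))) u (inList-intro {W = W} p))) nb
  ok : ∀ y → bad zeros y ∨ bad r y ≡ false → ∀ b c u → y ⊕ (b · r ⊕ lin A c ⊕ lin Z u) ∉ W
  ok y nb false c u = contra zeros y (proj₁ (or-false _ _ nb)) c u
  ok y nb true c u = contra r y (proj₂ (or-false _ _ nb)) c u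

repl : ∀ {k n} → Vec (F2^ n) k → Fin k → F2^ n → Vec (F2^ n) k
repl (a ∷ A) zero r = (a ⊕ r) ∷ A
repl (a ∷ A) (suc i) r = a ∷ repl A i r

lin-repl : ∀ {k n} (A : Vec (F2^ n) k) i r c → lin (repl A i r) c ≡ lin A c ⊕ lookup c i · r
lin-repl (a ∷ A) zero r (false ∷ c) = sym (⊕-idʳ _)
lin-repl (a ∷ A) zero r (true ∷ c) = ⊕-solve (a ∷ r ∷ lin A c ∷ []) ((x₀ :⊕ x₁) :⊕ x₂) ((x₀ :⊕ x₂) :⊕ x₁) refl
lin-repl (a ∷ A) (suc i) r (b ∷ c) = trans (cong (b · a ⊕_) (lin-repl A i r c)) (sym (⊕-assoc (b · a) _ _))


coset⊆ : ∀ {k n} → Vec (F2^ n) k → (F2^ n → Bool) → F2^ n → Bool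
coset⊆ A C y = every λ c → C (y ⊕ lin A c)

lookup-zeros : ∀ {k} (i : Fin k) → lookup (zeros {k}) i ≡ false
lookup-zeros zero = refl
lookup-zeros (suc i) = lookup-zeros i

-- The sets counted lie in `C`, contain a fixed configuration on `A` and `Z` with `k` generators,
-- and avoid every one with `k + 1`. The fixed part makes a tile out of any way to enlarge the
-- configuration within `C`. If there are many such ways, few sets are left; otherwise the
-- complement `R` of `C` is rigid.
module Config {n k s z' z} (C : F2^ n → Bool) (c0 : C zeros ≡ false) (A : Vec (F2^ n) k) (Z : Vec (F2^ n) z)
  (iZ : Inj Z) (Y₀ : Vec (F2^ z') s) (iY₀ : Inj Y₀) where

  Q : Class n
  Q S = Supp C S × BB⊆ A Z S × Avoids (suc k) s S

  R R* : F2^ n → Bool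
  R = not ∘ C
  R* r = R r ∧ every λ c → eqV c zeros ∨ C (r ⊕ lin A c)

  R*-elim : ∀ r → R* r ≡ true → ∀ c → c ≢ zeros → C (r ⊕ lin A c) ≡ true
  R*-elim r h c ne = or (does-intro-¬ (c ≟V zeros) ne) (every-elim _ (proj₂ (∧-true {R r} h)) c)
    where
    or : ∀ {a b} → a ≡ false → a ∨ b ≡ true → b ≡ true
    or refl p = p

  ι₃ : F2^ (suc k) → Bool
  ι₃ = head

  ι₄ : Fin k → F2^ (suc k) → Bool
  ι₄ i c = head c ∨ lookup (tail c) i

  onE : F2^ n → Bool
  onE y = does (OnFlat? z' Z (coset⊆ A C) y)

  dirs-⊙ : ∀ {a b} (Y : Vec (F2^ z) a) (Y' : Vec (F2^ a) b) v → lin (Z ⊙ (Y ⊙ Y')) v ≡ lin Z (lin Y (lin Y' v))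
  dirs-⊙ Y Y' v = trans (lin-⊙ Z (Y ⊙ Y') v) (cong (lin Z) (lin-⊙ Y Y' v))

  -- If many cosets y + ⟨A⟩ lie in `C`, the new generator is such a `y`; the tile consists of the
  -- translates that involve it.
  cov₃ : BB⊆ A Z C → ∀ m → let b = size-idx ι₃ s in
    (∀ l → l ≤ 2 ^ b * m * b → l * 2 ^ (k + z) + l * 2 ^ (k + z) < # onE) → Cov Q (2 ^ (# C ∸ m))
  cov₃ bbC m room = loss-config ι₃ C Q c0 refl (λ S q → proj₁ q) (λ S q → proj₂ (proj₂ q)) m place
    where
    place : ∀ W → length W ≤ _ → Placement {s = s} ι₃ C Q W
    place W le = let (y , py , off) = pick-off onE A Z zeros W (room (length W) le) in
        build y off (does-true (OnFlat? z' Z (coset⊆ A C) y) py)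
      where
      build : ∀ y → (∀ b c u → y ⊕ (b · zeros ⊕ lin A c ⊕ lin Z u) ∉ W) → OnFlat z' Z (coset⊆ A C) y → Placement {s = s} ι₃ C Q W
      build y off (Y , iY , on) = record
        { gens = y ∷ A ; dirs = Z ⊙ (Y ⊙ Y₀) ; inj = Inj-⊙ Z (Y ⊙ Y₀) iZ (Inj-⊙ Y Y₀ iY iY₀)
        ; bb = bb ; off = off' ; known = λ { S q (false ∷ c) ne _ v → subst (λ x → S x ≡ true) (sym (ptF c v)) (proj₁ (proj₂ q) c (λ e → ne (cong (false ∷_) e)) _) ; S q (true ∷ c) ne () v } }
        where
        ptF : ∀ c v → lin (y ∷ A) (false ∷ c) ⊕ lin (Z ⊙ (Y ⊙ Y₀)) v ≡ lin A c ⊕ lin Z (lin Y (lin Y₀ v))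
        ptF c v = cong₂ _⊕_ (⊕-idˡ _) (dirs-⊙ Y Y₀ v)
        ptT : ∀ c v → lin (y ∷ A) (true ∷ c) ⊕ lin (Z ⊙ (Y ⊙ Y₀)) v ≡ y ⊕ lin Z (lin Y (lin Y₀ v)) ⊕ lin A c
        ptT c v = trans (cong (λ x → y ⊕ lin A c ⊕ x) (dirs-⊙ Y Y₀ v)) (⊕-solve (y ∷ lin A c ∷ lin Z (lin Y (lin Y₀ v)) ∷ []) ((x₀ :⊕ x₁) :⊕ x₂) ((x₀ :⊕ x₂) :⊕ x₁) refl)
        bb : BB⊆ (y ∷ A) (Z ⊙ (Y ⊙ Y₀)) C
        bb (false ∷ c) ne v = subst (λ x → C x ≡ true) (sym (ptF c v)) (bbC c (λ e → ne (cong (false ∷_) e)) _)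
        bb (true ∷ c) ne v = subst (λ x → C x ≡ true) (sym (ptT c v)) (every-elim (λ c → C (y ⊕ lin Z (lin Y (lin Y₀ v)) ⊕ lin A c)) (on (lin Y₀ v)) c)
        off' : ∀ c v → head c ≡ true → lin (y ∷ A) c ⊕ lin (Z ⊙ (Y ⊙ Y₀)) v ∉ W
        off' (true ∷ c) v _ = subst (_∉ W) (trans (⊕-solve (y ∷ lin A c ∷ lin Z (lin Y (lin Y₀ v)) ∷ []) (x₀ :⊕ (:0 :⊕ x₁ :⊕ x₂)) ((x₀ :⊕ x₂) :⊕ x₁) refl) (sym (ptT c v))) (off false c (lin Y (lin Y₀ v)))

  Γ : Fin k → F2^ n → F2^ n → Bool
  Γ i r = coset⊆ (repl A i r) C

  module Fourth (g : ℕ) (z'≡ : z' ≡ proj₁ (flat s g)) where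

    manyΓ? : ∀ i r → Dec (2 ^ n + 2 ^ n < # (Γ i r) * 2 ^ g)
    manyΓ? i r = 2 ^ n + 2 ^ n <? # (Γ i r) * 2 ^ g

    Gr : Fin k → F2^ n → Bool
    Gr i r = does (OnFlat? z' Z R* r) ∧ does (manyΓ? i r)

    onΓ : ∀ i r (Y : Vec (F2^ z) z') → 2 ^ n + 2 ^ n < # (Γ i r) * 2 ^ g →
      2 ^ n < # (λ y → does (OnFlat? s (Z ⊙ Y) (Γ i r) y)) * 2 ^ g
    onΓ i r Y h = +-cancelʳ-< (2 ^ n) _ _ (begin-strict
      2 ^ n + 2 ^ n <⟨ h ⟩
      # (Γ i r) * 2 ^ g ≤⟨ *-monoˡ-≤ (2 ^ g) (#-∪ {g = on} {h = offFlat s (Z ⊙ Y) (Γ i r)} λ y p → dichotomy (on y) inj₁ (λ e → inj₂ (∧-intro p (not-intro e)))) ⟩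
      (# on + # (offFlat s (Z ⊙ Y) (Γ i r))) * 2 ^ g ≡⟨ *-distribʳ-+ (2 ^ g) (# on) _ ⟩
      # on * 2 ^ g + # (offFlat s (Z ⊙ Y) (Γ i r)) * 2 ^ g ≤⟨ +-monoʳ-≤ _ (sparse z' z'≡ (Z ⊙ Y)) ⟩
      # on * 2 ^ g + 2 ^ n ∎)
      where
      open ≤-Reasoning
      on : F2^ n → Bool
      on y = does (OnFlat? s (Z ⊙ Y) (Γ i r) y)
      sparse : ∀ z' → z' ≡ proj₁ (flat s g) → (Z' : Vec (F2^ n) z') → # (offFlat s Z' (Γ i r)) * 2 ^ g ≤ 2 ^ n
      sparse _ refl Z' = offFlat-sparse s g Z' (Γ i r)

    -- Besides the new generator `y`, the generator number `i` is replaced by its sum with some r in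
    -- R. That r is the only point of its coset of ⟨A⟩ in R keeps the modified translates inside
    -- `C`. The tile consists of the translates that involve `y` or the modified generator. For
    -- directions common to both, a flat of `R*` is chosen first and a flat for `y` inside its
    -- direction space.
    cov₄ : ∀ i → BB⊆ A Z C → ∀ m → let b = size-idx (ι₄ i) s in
      (∀ l → l ≤ 2 ^ b * m * b → l * 2 ^ (k + z) + l * 2 ^ (k + z) < # (Gr i)) →
      (∀ l → l ≤ 2 ^ b * m * b → (l * 2 ^ (k + z) + l * 2 ^ (k + z)) * 2 ^ g ≤ 2 ^ n) → Cov Q (2 ^ (# C ∸ m))
    cov₄ i bbC m room room' = loss-config (ι₄ i) C Q c0 (lookup-zeros i) (λ S q → proj₁ q) (λ S q → proj₂ (proj₂ q)) m place
      where
      place : ∀ W → length W ≤ _ → Placement {s = s} (ι₄ i) C Q W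
      place W le = let (r , pr , offr) = pick-off (Gr i) A Z zeros W (room (length W) le) in
          go r offr (does-true (OnFlat? z' Z R* r) (proj₁ (∧-true pr))) (does-true (manyΓ? i r) (proj₂ (∧-true {does (OnFlat? z' Z R* r)} pr)))
        where
        go : ∀ r → (∀ b c u → r ⊕ (b · zeros ⊕ lin A c ⊕ lin Z u) ∉ W) → OnFlat z' Z R* r → 2 ^ n + 2 ^ n < # (Γ i r) * 2 ^ g → Placement {s = s} (ι₄ i) C Q W
        go r offr (Y , iY , onr) many = go' (pick-off (λ y → does (OnFlat? s (Z ⊙ Y) (Γ i r) y)) A Z r W
            (*-cancelʳ-< (2 ^ g) _ _ (≤-<-trans (room' (length W) le) (onΓ i r Y many))))
          where
          go' : (∃ λ y → does (OnFlat? s (Z ⊙ Y) (Γ i r) y) ≡ true × (∀ b c u → y ⊕ (b · r ⊕ lin A c ⊕ lin Z u) ∉ W)) → Placement {s = s} (ι₄ i) C Q W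
          go' (y , py , offy) = go'' (does-true (OnFlat? s (Z ⊙ Y) (Γ i r) y) py)
            where
            go'' : OnFlat s (Z ⊙ Y) (Γ i r) y → Placement {s = s} (ι₄ i) C Q W
            go'' (Y' , iY' , ony) = record
              { gens = y ∷ repl A i r ; dirs = dirs ; inj = Inj-⊙ (Z ⊙ Y) Y' (Inj-⊙ Z Y iZ iY) iY'
              ; bb = bb ; off = off' ; known = known' }
              where
              dirs : Vec (F2^ n) s
              dirs = (Z ⊙ Y) ⊙ Y'
              δ : F2^ s → F2^ z
              δ v = lin Y (lin Y' v)
              dir : ∀ v → lin dirs v ≡ lin Z (δ v)
              dir v = trans (lin-⊙ (Z ⊙ Y) Y' v) (lin-⊙ Z Y (lin Y' v))
              ptT : ∀ c v → lin (y ∷ repl A i r) (true ∷ c) ⊕ lin dirs v ≡ y ⊕ (lookup c i · r ⊕ lin A c ⊕ lin Z (δ v))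
              ptT c v = trans (cong₂ (λ p q → y ⊕ p ⊕ q) (lin-repl A i r c) (dir v))
                (⊕-solve (y ∷ lin A c ∷ (lookup c i · r) ∷ lin Z (δ v) ∷ []) ((x₀ :⊕ (x₁ :⊕ x₂)) :⊕ x₃) (x₀ :⊕ ((x₂ :⊕ x₁) :⊕ x₃)) refl)
              ptF : ∀ c v → lin (y ∷ repl A i r) (false ∷ c) ⊕ lin dirs v ≡ lookup c i · r ⊕ (lin A c ⊕ lin Z (δ v))
              ptF c v = trans (cong₂ (λ p q → zeros ⊕ p ⊕ q) (lin-repl A i r c) (dir v))
                (⊕-solve (lin A c ∷ (lookup c i · r) ∷ lin Z (δ v) ∷ []) ((:0 :⊕ (x₀ :⊕ x₁)) :⊕ x₂) (x₁ :⊕ (x₀ :⊕ x₂)) refl)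
              bb : BB⊆ (y ∷ repl A i r) dirs C
              bb (true ∷ c) ne v = subst (λ x → C x ≡ true)
                (trans (cong (λ q → y ⊕ q ⊕ lin (repl A i r) c) (sym (lin-⊙ (Z ⊙ Y) Y' v))) (⊕-solve (y ∷ lin dirs v ∷ lin (repl A i r) c ∷ []) ((x₀ :⊕ x₁) :⊕ x₂) ((x₀ :⊕ x₂) :⊕ x₁) refl))
                (every-elim (λ c → C (y ⊕ lin (Z ⊙ Y) (lin Y' v) ⊕ lin (repl A i r) c)) (ony v) c)
              bb (false ∷ c) ne v = subst (λ x → C x ≡ true) (sym (ptF c v)) (cases (lookup c i))
                where
                c≢0 : c ≢ zeros
                c≢0 e = ne (cong (false ∷_) e)
                cases : ∀ b → C (b · r ⊕ (lin A c ⊕ lin Z (δ v))) ≡ true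
                cases false = subst (λ x → C x ≡ true) (sym (⊕-idˡ _)) (bbC c c≢0 (δ v))
                cases true = subst (λ x → C x ≡ true) (⊕-solve (r ∷ lin Z (δ v) ∷ lin A c ∷ []) ((x₀ :⊕ x₁) :⊕ x₂) (x₀ :⊕ (x₂ :⊕ x₁)) refl)
                  (R*-elim (r ⊕ lin Z (δ v)) (onr (lin Y' v)) c c≢0)
              off' : ∀ c v → ι₄ i c ≡ true → lin (y ∷ repl A i r) c ⊕ lin dirs v ∉ W
              off' (true ∷ c) v _ = subst (_∉ W) (sym (ptT c v)) (offy (lookup c i) c (δ v))
              off' (false ∷ c) v h = subst (_∉ W) (trans (⊕-solve (r ∷ lin A c ∷ lin Z (δ v) ∷ []) (x₀ :⊕ ((:0 :⊕ x₁) :⊕ x₂)) (x₀ :⊕ (x₁ :⊕ x₂)) refl)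
                (sym (trans (ptF c v) (cong (λ b → b · r ⊕ (lin A c ⊕ lin Z (δ v))) h)))) (offr false c (δ v))
              known' : ∀ S → Q S → ∀ c → c ≢ zeros → ι₄ i c ≡ false → ∀ v → S (lin (y ∷ repl A i r) c ⊕ lin dirs v) ≡ true
              known' S q (false ∷ c) ne h v = subst (λ x → S x ≡ true) (sym (trans (ptF c v) (trans (cong (λ b → b · r ⊕ (lin A c ⊕ lin Z (δ v))) h) (⊕-idˡ _))))
                (proj₁ (proj₂ q) c (λ e → ne (cong (false ∷_) e)) (δ v))

-- Stability: an almost extremal container is close to the complement of a subspace

anyF : ∀ {k} → (Fin k → Bool) → Bool
anyF {zero} f = false
anyF {suc k} f = f zero ∨ anyF (f ∘ suc)

anyF-intro : ∀ {k} (f : Fin k → Bool) i → f i ≡ true → anyF f ≡ true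
anyF-intro f zero p rewrite p = refl
anyF-intro f (suc i) p with f zero
... | true = refl
... | false = anyF-intro (f ∘ suc) i p

∨-true : ∀ {a b} → a ∨ b ≡ true → a ≡ true ⊎ b ≡ true
∨-true {true} _ = inj₁ refl
∨-true {false} p = inj₂ p

∨-introˡ : ∀ {a b} → a ≡ true → a ∨ b ≡ true
∨-introˡ refl = refl

∨-introʳ : ∀ {a b} → b ≡ true → a ∨ b ≡ true
∨-introʳ {true} _ = refl
∨-introʳ {false} p = p

#-anyF : ∀ {k n} (f : Fin k → F2^ n → Bool) g t → (∀ i → # (f i) * g ≤ t) → # (λ v → anyF (λ i → f i v)) * g ≤ k * t
#-anyF {zero} f g t h = ≤-reflexive (cong (_* g) #-∅)
#-anyF {suc k} f g t h = ≤-trans (*-monoˡ-≤ g (#-∪ {g = f zero} {h = λ v → anyF (λ i → f (suc i) v)} λ v → ∨-true))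
  (≤-trans (≤-reflexive (*-distribʳ-+ g (# (f zero)) _)) (+-mono-≤ (h zero) (#-anyF (f ∘ suc) g t (h ∘ suc))))

module Tiling {n} (R : F2^ n → Bool) where

  cnt : ∀ {k} → Vec (F2^ n) k → F2^ n → ℕ
  cnt A y = # (λ c → R (y ⊕ lin A c))

  two : ∀ {k} → Vec (F2^ n) k → F2^ n → Bool
  two A y = does (2 ≤? cnt A y)

  ∑-cnt : ∀ {k} (A : Vec (F2^ n) k) → ∑ (cnt A) ≡ 2 ^ k * # R
  ∑-cnt {k} A = trans (∑-swap _) (trans (∑-cong λ c → #-translate (lin A c) R) (∑-const k (# R)))

  -- The counts sum to 2^k |R|, and a coset with count zero lies in `C`. So if |R| is about 2^(n-k)
  -- and few cosets lie in `C`, almost all cosets of ⟨A⟩ meet `R` exactly once.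
  two-bound : ∀ {k} (A : Vec (F2^ n) k) C → (∀ v → R v ≡ false → C v ≡ true) → # (two A) + 2 ^ n ≤ 2 ^ k * # R + # (coset⊆ A C)
  two-bound {k} A C RC = begin
    # (two A) + 2 ^ n ≡⟨ cong (# (two A) +_) (sym (trans (∑-const n 1) (*-identityʳ _))) ⟩
    # (two A) + ∑ {n} (λ _ → 1) ≡⟨ sym (∑-+ _ _) ⟩
    ∑ (λ y → bit (two A y) + 1) ≤⟨ ∑-mono (λ y → num (cnt A y) (bit (coset⊆ A C y)) (zero-cnt y)) ⟩
    ∑ (λ y → cnt A y + bit (coset⊆ A C y)) ≡⟨ trans (∑-+ _ _) (cong (_+ # (coset⊆ A C)) (∑-cnt A)) ⟩
    2 ^ k * # R + # (coset⊆ A C) ∎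
    where
    open ≤-Reasoning
    num : ∀ x e → (x ≡ 0 → 1 ≤ e) → bit (does (2 ≤? x)) + 1 ≤ x + e
    num 0 e h rewrite bit-false = h refl
    num 1 e h rewrite bit-false = s≤s z≤n
    num (suc (suc x)) e h = ≤-trans (+-monoˡ-≤ 1 (bit≤1 _)) (s≤s (s≤s z≤n))
    zero-cnt : ∀ y → cnt A y ≡ 0 → 1 ≤ bit (coset⊆ A C y)
    zero-cnt y e = ≤-reflexive (sym (trans (cong bit (every-intro (λ c → C (y ⊕ lin A c)) λ c → RC _ (#≡0⇒false (λ c → R (y ⊕ lin A c)) e c))) bit-true))

  two-intro : ∀ {k} (A : Vec (F2^ n) k) y c → c ≢ zeros → R y ≡ true → R (y ⊕ lin A c) ≡ true → two A y ≡ true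
  two-intro A y c ne p q = does-intro (2 ≤? cnt A y) (begin
    2 ≡⟨ cong₂ _+_ (sym (#-point zeros)) (sym (#-point c)) ⟩
    # (λ d → eqV d zeros) + # (λ d → eqV d c) ≡⟨ sym (∑-+ _ _) ⟩
    ∑ (λ d → bit (eqV d zeros) + bit (eqV d c)) ≤⟨ ∑-mono each ⟩
    cnt A y ∎)
    where
    open ≤-Reasoning
    each : ∀ d → bit (eqV d zeros) + bit (eqV d c) ≤ bit (R (y ⊕ lin A d))
    each d with d ≟V zeros | d ≟V c
    ... | yes refl | yes refl = ⊥-elim (ne refl)
    ... | yes refl | no _ rewrite trans (cong (λ x → R (y ⊕ x)) (lin-zero A)) (trans (cong R (⊕-idʳ y)) p) | bit-false | bit-true = ≤-refl
    ... | no _ | yes refl rewrite q | bit-false | bit-true = ≤-refl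
    ... | no _ | no _ rewrite bit-false = z≤n

nonzero-coord : ∀ {k} (c : F2^ k) → c ≢ zeros → ∃ λ i → lookup c i ≡ true
nonzero-coord [] ne = ⊥-elim (ne refl)
nonzero-coord (true ∷ c) ne = zero , refl
nonzero-coord (false ∷ c) ne = let (i , p) = nonzero-coord c (λ e → ne (cong (false ∷_) e)) in suc i , p

module Stable {n k s z' z} (C : F2^ n → Bool) (c0 : C zeros ≡ false) (A : Vec (F2^ n) k) (Z : Vec (F2^ n) z)
  (iZ : Inj Z) (Y₀ : Vec (F2^ z') s) (iY₀ : Inj Y₀) (g : ℕ) (z'≡ : z' ≡ proj₁ (flat s g)) where

  open Config {k = k} {s} {z'} {z} C c0 A Z iZ Y₀ iY₀
  open Fourth g z'≡
  open Tiling R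

  RC : ∀ v → R v ≡ false → C v ≡ true
  RC v e = ≢false⇒true λ e' → true≢false (not-intro e') e

  Small : ℕ → (F2^ n → Bool) → Set
  Small t X = # X * 2 ^ g ≤ t * 2 ^ n

  module Bounds (hR : 2 ^ k * # R * 2 ^ g ≤ 2 ^ n * 2 ^ g + 2 ^ n)
    (offE : # (offFlat z' Z (coset⊆ A C)) * 2 ^ g ≤ 2 ^ n) (offR* : # (offFlat z' Z R*) * 2 ^ g ≤ 2 ^ n)
    (h₃ : # onE * 2 ^ g ≤ 2 ^ n) (h₄ : ∀ i → # (Gr i) * 2 ^ g ≤ 2 ^ n) where

    smallE : Small 2 (coset⊆ A C)
    smallE = begin
      # (coset⊆ A C) * 2 ^ g ≤⟨ *-monoˡ-≤ (2 ^ g) (#-∪ {g = onE} {h = offFlat z' Z (coset⊆ A C)} λ y p → dichotomy (onE y) inj₁ (λ e → inj₂ (∧-intro p (not-intro e)))) ⟩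
      (# onE + # (offFlat z' Z (coset⊆ A C))) * 2 ^ g ≡⟨ *-distribʳ-+ (2 ^ g) (# onE) _ ⟩
      # onE * 2 ^ g + # (offFlat z' Z (coset⊆ A C)) * 2 ^ g ≤⟨ +-mono-≤ h₃ offE ⟩
      2 ^ n + 2 ^ n ≡⟨ cong (2 ^ n +_) (sym (+-identityʳ _)) ⟩
      2 * 2 ^ n ∎
      where open ≤-Reasoning

    small-two : (A' : Vec (F2^ n) k) → Small 2 (coset⊆ A' C) → Small 3 (two A')
    small-two A' h = +-cancelʳ-≤ (2 ^ n * 2 ^ g) _ _ (begin
      # (two A') * 2 ^ g + 2 ^ n * 2 ^ g ≡⟨ sym (*-distribʳ-+ (2 ^ g) (# (two A')) (2 ^ n)) ⟩
      (# (two A') + 2 ^ n) * 2 ^ g ≤⟨ *-monoˡ-≤ (2 ^ g) (two-bound A' C RC) ⟩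
      (2 ^ k * # R + # (coset⊆ A' C)) * 2 ^ g ≡⟨ *-distribʳ-+ (2 ^ g) (2 ^ k * # R) _ ⟩
      2 ^ k * # R * 2 ^ g + # (coset⊆ A' C) * 2 ^ g ≤⟨ +-mono-≤ hR h ⟩
      2 ^ n * 2 ^ g + 2 ^ n + 2 * 2 ^ n ≡⟨ solve 2 (λ x N → x :+ N :+ con 2 :* N := con 3 :* N :+ x) refl (2 ^ n * 2 ^ g) (2 ^ n) ⟩
      3 * 2 ^ n + 2 ^ n * 2 ^ g ∎)
      where open ≤-Reasoning
            open +-*-Solver

    lower : 2 ^ n * 2 ^ g ≤ 2 ^ k * # R * 2 ^ g + 2 * 2 ^ n
    lower = begin
      2 ^ n * 2 ^ g ≤⟨ *-monoˡ-≤ (2 ^ g) (≤-trans (m≤n+m (2 ^ n) (# (two A))) (two-bound A C RC)) ⟩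
      (2 ^ k * # R + # (coset⊆ A C)) * 2 ^ g ≡⟨ *-distribʳ-+ (2 ^ g) (2 ^ k * # R) _ ⟩
      2 ^ k * # R * 2 ^ g + # (coset⊆ A C) * 2 ^ g ≤⟨ +-monoʳ-≤ _ smallE ⟩
      2 ^ k * # R * 2 ^ g + 2 * 2 ^ n ∎
      where open ≤-Reasoning

    -- The exceptional `r`: its coset has a second point in `R`, or it starts no flat in `R*`, or
    -- for some `i` it leaves many cosets of the modified generators inside `C`.
    Bad : F2^ n → Bool
    Bad r = two A r ∨ (offFlat z' Z R* r ∨ anyF (λ i → Gr i r))

    small-Bad : Small (4 + k) Bad
    small-Bad = begin
      # Bad * 2 ^ g ≤⟨ *-monoˡ-≤ (2 ^ g) (#-∪ {g = two A} {h = λ r → offFlat z' Z R* r ∨ anyF (λ i → Gr i r)} λ r → ∨-true) ⟩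
      (# (two A) + # (λ r → offFlat z' Z R* r ∨ anyF (λ i → Gr i r))) * 2 ^ g
        ≤⟨ *-monoˡ-≤ (2 ^ g) (+-monoʳ-≤ (# (two A)) (#-∪ {g = offFlat z' Z R*} {h = λ r → anyF (λ i → Gr i r)} λ r → ∨-true)) ⟩
      (# (two A) + (# (offFlat z' Z R*) + # (λ r → anyF (λ i → Gr i r)))) * 2 ^ g
        ≡⟨ solve 4 (λ a b c d → (a :+ (b :+ c)) :* d := a :* d :+ (b :* d :+ c :* d)) refl (# (two A)) (# (offFlat z' Z R*)) (# (λ r → anyF (λ i → Gr i r))) (2 ^ g) ⟩
      # (two A) * 2 ^ g + (# (offFlat z' Z R*) * 2 ^ g + # (λ r → anyF (λ i → Gr i r)) * 2 ^ g)
        ≤⟨ +-mono-≤ (small-two A smallE) (+-mono-≤ offR* (#-anyF Gr (2 ^ g) (2 ^ n) h₄)) ⟩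
      3 * 2 ^ n + (2 ^ n + k * 2 ^ n) ≡⟨ solve 2 (λ k N → con 3 :* N :+ (N :+ k :* N) := (con 4 :+ k) :* N) refl k (2 ^ n) ⟩
      (4 + k) * 2 ^ n ∎
      where open ≤-Reasoning
            open +-*-Solver

    inR* : ∀ r → R r ≡ true → two A r ≡ false → R* r ≡ true
    inR* r Rr nt = ∧-intro Rr (every-intro _ λ c → dichotomy (eqV c zeros) (λ e → ∨-introˡ e)
      λ e → ∨-introʳ {eqV c zeros} (RC _ (≢true⇒false λ q → true≢false (two-intro A r c (does-false (c ≟V zeros) e) Rr q) nt)))

    ∨-false : ∀ {a b} → a ∨ b ≡ false → a ≡ false × b ≡ false
    ∨-false {false} p = refl , p

    smallΓ : ∀ r → R r ≡ true → Bad r ≡ false → ∀ i → Small 2 (Γ i r)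
    smallΓ r Rr nb i = ≤-trans (≮⇒≥ λ m → true≢false (anyF-intro (λ i → Gr i r) i (∧-intro on (does-intro (manyΓ? i r) m))) (proj₂ nb'))
        (≤-reflexive (cong (2 ^ n +_) (sym (+-identityʳ _))))
      where
      nb' : offFlat z' Z R* r ≡ false × anyF (λ i → Gr i r) ≡ false
      nb' = ∨-false {offFlat z' Z R* r} (proj₂ (∨-false {two A r} nb))
      on : does (OnFlat? z' Z R* r) ≡ true
      on = ≢false⇒true λ e → true≢false (∧-intro (inR* r Rr (proj₁ (∨-false {two A r} nb))) (not-intro e)) (proj₁ nb')

    -- Let w be in R and r + w in `C`. Either the whole coset of r + w lies in `C`, which is rare,
    -- or r + w + Ac is in R for some nonzero c. In the second case let c_i be 1: then w and w + Ac
    -- + r are two points of R in one coset of the generators with the i-th one shifted by r. These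
    -- generators also tile with R almost perfectly, so this is rare too.
    invariant : ∀ r → R r ≡ true → Bad r ≡ false → Small (2 + k * 3) (λ w → R w ∧ not (R (r ⊕ w)))
    invariant r Rr nb = begin
      # (λ w → R w ∧ not (R (r ⊕ w))) * 2 ^ g
        ≤⟨ *-monoˡ-≤ (2 ^ g) (#-∪ {g = λ w → coset⊆ A C (w ⊕ r)} {h = λ w → anyF (λ i → two (repl A i r) w)} cover) ⟩
      (# (λ w → coset⊆ A C (w ⊕ r)) + # (λ w → anyF (λ i → two (repl A i r) w))) * 2 ^ g
        ≡⟨ trans (*-distribʳ-+ (2 ^ g) (# (λ w → coset⊆ A C (w ⊕ r))) _) (cong (λ x → x * 2 ^ g + # (λ w → anyF (λ i → two (repl A i r) w)) * 2 ^ g) (#-translate r (coset⊆ A C))) ⟩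
      # (coset⊆ A C) * 2 ^ g + # (λ w → anyF (λ i → two (repl A i r) w)) * 2 ^ g
        ≤⟨ +-mono-≤ smallE (#-anyF (λ i → two (repl A i r)) (2 ^ g) (3 * 2 ^ n) λ i → small-two (repl A i r) (smallΓ r Rr nb i)) ⟩
      2 * 2 ^ n + k * (3 * 2 ^ n) ≡⟨ solve 2 (λ k N → con 2 :* N :+ k :* (con 3 :* N) := (con 2 :+ k :* con 3) :* N) refl k (2 ^ n) ⟩
      (2 + k * 3) * 2 ^ n ∎
      where
      open ≤-Reasoning
      open +-*-Solver
      cover : ∀ w → R w ∧ not (R (r ⊕ w)) ≡ true → coset⊆ A C (w ⊕ r) ≡ true ⊎ anyF (λ i → two (repl A i r) w) ≡ true
      cover w h = dichotomy (coset⊆ A C (w ⊕ r)) inj₁ λ e →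
          let (c , q) = every-false (λ c → C (w ⊕ r ⊕ lin A c)) e
              (i , ci) = nonzero-coord c (ne c q)
          in inj₂ (anyF-intro _ i (two-intro (repl A i r) w c (ne c q) (proj₁ (∧-true h))
            (trans (cong R (trans (cong (w ⊕_) (trans (lin-repl A i r c) (cong (λ b → lin A c ⊕ b · r) ci)))
              (⊕-solve (w ∷ lin A c ∷ r ∷ []) (x₀ :⊕ (x₁ :⊕ x₂)) (x₀ :⊕ x₂ :⊕ x₁) refl))) (not-intro q))))
        where
        ne : ∀ c → C (w ⊕ r ⊕ lin A c) ≡ false → c ≢ zeros
        ne c q c≡0 = true≢false (not-intro q) (trans (cong R (trans (cong (w ⊕ r ⊕_) (trans (cong (lin A) c≡0) (lin-zero A))) (trans (⊕-idʳ _) (⊕-comm w r)))) (not-true (proj₂ (∧-true {R w} h))))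

-- A set R that is almost invariant under almost all of its own elements is
-- close to the subgroup of all x with |R ∩ (R + x)| not small.
module Stabiliser {n} (R Bad : F2^ n → Bool) (δ N' : ℕ) (δ>0 : 0 < δ)
  (small-Bad : # Bad ≤ δ) (inv : ∀ r → R r ≡ true → Bad r ≡ false → # (λ w → R w ∧ not (R (r ⊕ w))) ≤ δ)
  (upper : # R ≤ N' + δ) (lower : N' ≤ # R + δ) (tiny : 16 * δ ≤ N') where

  h out : F2^ n → ℕ
  h x = # (λ w → R w ∧ R (x ⊕ w))
  out x = # (λ w → R w ∧ not (R (x ⊕ w)))

  h+out : ∀ x → h x + out x ≡ # R
  h+out x = trans (sym (∑-+ _ _)) (∑-cong λ w → lem (R w) (R (x ⊕ w)))
    where
    lem : ∀ a b → bit (a ∧ b) + bit (a ∧ not b) ≡ bit a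
    lem true true rewrite bit-false = +-identityʳ _
    lem true false rewrite bit-false = refl
    lem false b rewrite bit-false = refl

  big : 15 * δ ≤ # R
  big = +-cancelʳ-≤ δ _ _ (≤-trans (≤-reflexive (+-comm (15 * δ) δ)) (≤-trans tiny lower))

  U? : ∀ x → Dec (δ + δ < h x)
  U? x = δ + δ <? h x

  U : F2^ n → Bool
  U x = does (U? x)

  out-⊕ : ∀ x y → out (x ⊕ y) ≤ out x + out y
  out-⊕ x y = ≤-trans (#-∪ {g = λ w → R w ∧ not (R (x ⊕ w))} {h = λ w → R (w ⊕ x) ∧ not (R (y ⊕ (w ⊕ x)))} cover)
      (+-monoʳ-≤ (out x) (≤-reflexive (#-translate x (λ w → R w ∧ not (R (y ⊕ w))))))
    where
    cover : ∀ w → R w ∧ not (R (x ⊕ y ⊕ w)) ≡ true → R w ∧ not (R (x ⊕ w)) ≡ true ⊎ R (w ⊕ x) ∧ not (R (y ⊕ (w ⊕ x))) ≡ true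
    cover w p = dichotomy (R (x ⊕ w)) (λ e → inj₂ (∧-intro (trans (cong R (⊕-comm w x)) e)
      (not-intro (trans (cong R (⊕-solve (x ∷ y ∷ w ∷ []) (x₁ :⊕ (x₂ :⊕ x₀)) (x₀ :⊕ x₁ :⊕ x₂) refl)) (not-true (proj₂ (∧-true {R w} p)))))))
      (λ e → inj₁ (∧-intro (proj₁ (∧-true p)) (not-intro e)))

  -- x ∈ U is a sum of two good elements of R
  U-out : ∀ x → U x ≡ true → out x ≤ δ + δ
  U-out x ux = let (w , nb , p) = #-<⇒∃ (λ w → Bad w ∨ Bad (x ⊕ w)) (λ w → R w ∧ R (x ⊕ w)) (≤-<-trans fewbad (does-true (U? x) ux)) in
      subst (λ t → out t ≤ δ + δ) (⊕-solve (w ∷ x ∷ []) (x₀ :⊕ (x₁ :⊕ x₀)) x₁ refl)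
        (≤-trans (out-⊕ w (x ⊕ w)) (+-mono-≤ (inv w (proj₁ (∧-true p)) (proj₁ (or-false _ _ nb)))
          (inv (x ⊕ w) (proj₂ (∧-true {R w} p)) (proj₂ (or-false _ _ nb)))))
    where
    or-false : ∀ a b → a ∨ b ≡ false → a ≡ false × b ≡ false
    or-false false b p = refl , p
    fewbad : # (λ w → Bad w ∨ Bad (x ⊕ w)) ≤ δ + δ
    fewbad = ≤-trans (#-∪ {g = Bad} {h = λ w → Bad (w ⊕ x)} λ w p → [ inj₁ , (λ q → inj₂ (trans (cong Bad (⊕-comm w x)) q)) ]′ (∨-true p))
      (+-mono-≤ small-Bad (≤-trans (≤-reflexive (#-translate x Bad)) small-Bad))

  U-from-out : ∀ x → out x ≤ 4 * δ → U x ≡ true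
  U-from-out x o = does-intro (U? x) (+-cancelʳ-< (4 * δ) _ _ (begin-strict
    δ + δ + 4 * δ ≡⟨ solve 1 (λ d → d :+ d :+ con 4 :* d := con 6 :* d) refl δ ⟩
    6 * δ <⟨ m<m+n (6 * δ) (≤-trans δ>0 (m≤m+n δ (8 * δ))) ⟩
    6 * δ + 9 * δ ≡⟨ solve 1 (λ d → con 6 :* d :+ con 9 :* d := con 15 :* d) refl δ ⟩
    15 * δ ≤⟨ big ⟩
    # R ≡⟨ sym (h+out x) ⟩
    h x + out x ≤⟨ +-monoʳ-≤ (h x) o ⟩
    h x + 4 * δ ∎))
    where open ≤-Reasoning
          open +-*-Solver

  out-0 : out zeros ≡ 0
  out-0 = n≤0⇒n≡0 (≤-trans (#-mono {g = λ _ → false} λ w p → ⊥-elim (true≢false (proj₁ (∧-true p)) (trans (cong R (sym (⊕-idˡ w))) (not-true (proj₂ (∧-true {R w} p)))))) (≤-reflexive #-∅))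

  -- The values of `out` leave a gap: members of `U` have value at most 2δ, sums of two members at
  -- most 4δ, and any value up to 4δ already implies membership because |R| ≥ 15δ.
  subgroup : Subgroup U
  subgroup = U-from-out zeros (≤-trans (≤-reflexive out-0) z≤n) , λ u v uu uv → U-from-out (u ⊕ v)
    (≤-trans (out-⊕ u v) (≤-trans (+-mono-≤ (U-out u uu) (U-out v uv)) (≤-reflexive (solve 1 (λ d → (d :+ d) :+ (d :+ d) := con 4 :* d) refl δ))))
    where open +-*-Solver

  R⊆U : # R ≤ # (λ w → U w ∧ R w) + δ
  R⊆U = ≤-trans (#-∪ {g = λ w → U w ∧ R w} {h = Bad} λ w r → dichotomy (Bad w) inj₂ λ nb →
    inj₁ (∧-intro (U-from-out w (≤-trans (inv w r nb) (m≤m+n δ (3 * δ)))) r)) (+-monoʳ-≤ _ small-Bad)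

  ∑h : ∑ h ≡ # R * # R
  ∑h = trans (∑-swap _) (trans (∑-cong λ w → trans (∑-cong λ x → sym (bit-* (R w) (R (x ⊕ w)))) (trans (∑-* (bit (R w)) _) (cong (bit (R w) *_) (#-translate w R)))) (∑-*ʳ (# R) _))

  -- The overlaps `h` sum to |R|², and each member of `U` contributes at least |R| - 2δ.
  U-upper : # U * # R ≤ # R * # R + # U * (δ + δ)
  U-upper = begin
    # U * # R ≡⟨ sym (∑-*ʳ (# R) _) ⟩
    ∑ (λ x → bit (U x) * # R) ≤⟨ ∑-mono each ⟩
    ∑ (λ x → h x + bit (U x) * (δ + δ)) ≡⟨ trans (∑-+ _ _) (cong₂ _+_ ∑h (∑-*ʳ (δ + δ) _)) ⟩
    # R * # R + # U * (δ + δ) ∎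
    where
    open ≤-Reasoning
    each : ∀ x → bit (U x) * # R ≤ h x + bit (U x) * (δ + δ)
    each x = dichotomy (U x)
      (λ e → ≤-trans (≤-reflexive (trans (cong (_* # R) (trans (cong bit e) bit-true)) (+-identityʳ _)))
        (≤-trans (≤-reflexive (sym (h+out x))) (+-monoʳ-≤ (h x) (≤-trans (U-out x e) (≤-reflexive (sym (trans (cong (_* (δ + δ)) (trans (cong bit e) bit-true)) (+-identityʳ _))))))))
      (λ e → ≤-trans (≤-reflexive (cong (_* # R) (trans (cong bit e) bit-false))) z≤n)

  -- Together with `N'<2U` this determines the dimension of `U`: the cardinality of a subgroup is a
  -- power of 2, and strictly between N'/2 and 2N' there is only N' = 2^(n-k).
  U<2N' : # U < 2 * N'
  U<2N' = ≰⇒> λ le → <⇒≱ 6δ<R (*-cancelʳ-≤ (# R) (6 * δ) N' {{pos N' N'>0}} (+-cancelʳ-≤ (N' * # R) _ _ (begin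
    # R * N' + N' * # R ≡⟨ solve 2 (λ R N → R :* N :+ N :* R := con 2 :* N :* R) refl (# R) N' ⟩
    2 * N' * # R ≤⟨ mono le ⟩
    # R * # R + 2 * N' * (δ + δ) ≤⟨ +-monoˡ-≤ (2 * N' * (δ + δ)) (*-monoˡ-≤ (# R) upper) ⟩
    (N' + δ) * # R + 2 * N' * (δ + δ) ≡⟨ solve 3 (λ N d R → (N :+ d) :* R :+ con 2 :* N :* (d :+ d) := d :* R :+ (con 4 :* d :* N :+ N :* R)) refl N' δ (# R) ⟩
    δ * # R + (4 * δ * N' + N' * # R) ≤⟨ +-monoˡ-≤ _ (*-monoʳ-≤ δ R≤2N') ⟩
    δ * (2 * N') + (4 * δ * N' + N' * # R) ≡⟨ solve 3 (λ N d R → d :* (con 2 :* N) :+ (con 4 :* d :* N :+ N :* R) := con 6 :* d :* N :+ N :* R) refl N' δ (# R) ⟩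
    6 * δ * N' + N' * # R ∎)))
    where
    open ≤-Reasoning
    open +-*-Solver
    N'>0 : 0 < N'
    N'>0 = ≤-trans (≤-trans δ>0 (m≤m+n δ (15 * δ))) tiny
    pos : ∀ x → 0 < x → Data.Nat.NonZero x
    pos (suc x) _ = _
    6δ<R : 6 * δ < # R
    6δ<R = <-≤-trans (m<m+n (6 * δ) (≤-trans δ>0 (m≤m+n δ (8 * δ)))) (≤-trans (≤-reflexive (solve 1 (λ d → con 6 :* d :+ con 9 :* d := con 15 :* d) refl δ)) big)
    R≤2N' : # R ≤ 2 * N'
    R≤2N' = ≤-trans upper (+-monoʳ-≤ N' (≤-trans (≤-trans (m≤m+n δ (15 * δ)) tiny) (≤-reflexive (sym (+-identityʳ N')))))
    2δ≤R : δ + δ ≤ # R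
    2δ≤R = ≤-trans (≤-trans (m≤m+n (δ + δ) (13 * δ)) (≤-reflexive (solve 1 (λ d → d :+ d :+ con 13 :* d := con 15 :* d) refl δ))) big
    mono : 2 * N' ≤ # U → 2 * N' * # R ≤ # R * # R + 2 * N' * (δ + δ)
    mono le = begin
      2 * N' * # R ≡⟨ cong (2 * N' *_) (sym (m∸n+n≡m 2δ≤R)) ⟩
      2 * N' * (# R ∸ (δ + δ) + (δ + δ)) ≡⟨ *-distribˡ-+ (2 * N') (# R ∸ (δ + δ)) (δ + δ) ⟩
      2 * N' * (# R ∸ (δ + δ)) + 2 * N' * (δ + δ) ≤⟨ +-monoˡ-≤ _ (*-monoˡ-≤ (# R ∸ (δ + δ)) le) ⟩
      # U * (# R ∸ (δ + δ)) + 2 * N' * (δ + δ) ≤⟨ +-monoˡ-≤ _ (+-cancelʳ-≤ (# U * (δ + δ)) _ _ (≤-trans (≤-reflexive (trans (sym (*-distribˡ-+ (# U) (# R ∸ (δ + δ)) (δ + δ))) (cong (# U *_) (m∸n+n≡m 2δ≤R)))) U-upper)) ⟩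
      # R * # R + 2 * N' * (δ + δ) ∎

  U∖R : # (λ w → U w ∧ not (R w)) + N' ≤ # U + (δ + δ)
  U∖R = begin
    # (λ w → U w ∧ not (R w)) + N' ≤⟨ +-monoʳ-≤ _ (≤-trans lower (+-monoˡ-≤ δ R⊆U)) ⟩
    # (λ w → U w ∧ not (R w)) + (# (λ w → U w ∧ R w) + δ + δ) ≡⟨ solve 3 (λ a b d → a :+ (b :+ d :+ d) := (b :+ a) :+ (d :+ d)) refl (# (λ w → U w ∧ not (R w))) (# (λ w → U w ∧ R w)) δ ⟩
    (# (λ w → U w ∧ R w) + # (λ w → U w ∧ not (R w))) + (δ + δ) ≡⟨ cong (_+ (δ + δ)) (trans (sym (∑-+ _ _)) (∑-cong λ w → lem (U w) (R w))) ⟩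
    # U + (δ + δ) ∎
    where
    open ≤-Reasoning
    open +-*-Solver
    lem : ∀ a b → bit (a ∧ b) + bit (a ∧ not b) ≡ bit a
    lem true true rewrite bit-false = +-identityʳ _
    lem true false rewrite bit-false = refl
    lem false b rewrite bit-false = refl

  N'<2U : N' < 2 * # U
  N'<2U = ≰⇒> λ le → <⇒≱ {4 * δ} {N'} (<-≤-trans (m<m+n (4 * δ) (≤-trans δ>0 (m≤m+n δ (11 * δ)))) (≤-trans (≤-reflexive (solve 1 (λ d → con 4 :* d :+ con 12 :* d := con 16 :* d) refl δ)) tiny))
    (+-cancelˡ-≤ N' _ _ (begin
      N' + N' ≡⟨ cong (N' +_) (sym (+-identityʳ N')) ⟩
      2 * N' ≤⟨ *-monoʳ-≤ 2 (≤-trans (m≤n+m N' _) U∖R) ⟩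
      2 * (# U + (δ + δ)) ≡⟨ solve 2 (λ u d → con 2 :* (u :+ (d :+ d)) := con 2 :* u :+ con 4 :* d) refl (# U) δ ⟩
      2 * # U + 4 * δ ≤⟨ +-monoˡ-≤ (4 * δ) le ⟩
      N' + 4 * δ ∎))
    where open ≤-Reasoning
          open +-*-Solver

subgroup-basis : ∀ {n} (U : F2^ n → Bool) → Subgroup U → Σ ℕ λ j → Σ (Vec (F2^ n) j) λ B →
  Inj B × In B U × (∀ w → U w ≡ true → ∃ λ v → w ≡ lin B v) × # U ≡ 2 ^ j
subgroup-basis {n} U sub with complement U sub [] (λ { [] → proj₁ sub }) (λ { [] _ → refl })
... | j , B , ind , inU , sp = j , B , inj , inU , spans , ≤-antisym (#-image (lin B) U spans)
      (≤-trans (≤-reflexive (trans (sym (#-all j)) (#-cong λ v → sym (inU v)))) (#-preimage (lin B) U (Inj⇒≡ B inj)))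
  where
  inj : Inj B
  inj v e = proj₁ (ind v [] (trans (⊕-idʳ _) e))
  spans : ∀ w → U w ≡ true → ∃ λ v → w ≡ lin B v
  spans w uw = pick (sp w uw)
    where
    pick : _ → _
    pick (d , [] , e) = d , trans e (⊕-idʳ _)

inSpan? : ∀ {m n} (B : Vec (F2^ n) m) w → Dec (∃ λ v → w ≡ lin B v)
inSpan? B w = ∃-dec enumV λ v → w ≟V lin B v

inSpan : ∀ {m n} → Vec (F2^ n) m → F2^ n → Bool
inSpan B w = does (inSpan? B w)

#-inSpan : ∀ {m n} (B : Vec (F2^ n) m) → Inj B → # (inSpan B) ≡ 2 ^ m
#-inSpan {m} B inj = ≤-antisym (#-image (lin B) (inSpan B) (λ w p → does-true (inSpan? B w) p))
  (≤-trans (≤-reflexive (trans (sym (#-all m)) (#-cong λ v → sym (does-intro (inSpan? B (lin B v)) (v , refl))))) (#-preimage (lin B) (inSpan B) (Inj⇒≡ B inj)))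

2^-cancel-< : ∀ {a b} → 2 ^ a < 2 ^ b → a < b
2^-cancel-< {a} {b} h = ≰⇒> λ le → <⇒≱ h (2^-mono le)

subspace-near : ∀ {n} k (C Bad : F2^ n → Bool) δ → k ≤ n → 0 < δ → # Bad ≤ δ →
  (∀ r → not (C r) ≡ true → Bad r ≡ false → # (λ w → not (C w) ∧ not (not (C (r ⊕ w)))) ≤ δ) →
  # (not ∘ C) ≤ 2 ^ (n ∸ k) + δ → 2 ^ (n ∸ k) ≤ # (not ∘ C) + δ → 16 * δ ≤ 2 ^ (n ∸ k) →
  ∃ λ (B : Vec (F2^ n) (n ∸ k)) → Inj B × # (λ w → inSpan B w ∧ C w) ≤ δ + δ
subspace-near {n} k C Bad δ k≤n δ>0 sb inv up lo tiny = build (subgroup-basis U subgroup)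
  where
  open Stabiliser (not ∘ C) Bad δ (2 ^ (n ∸ k)) δ>0 sb inv up lo tiny
  build : (Σ ℕ λ j → Σ (Vec (F2^ n) j) λ B → Inj B × In B U × (∀ w → U w ≡ true → ∃ λ v → w ≡ lin B v) × # U ≡ 2 ^ j) → _
  build (j , B , inj , inU , spans , size) = cast j B inj inU size (≤-antisym (≤-pred (2^-cancel-< {j} {suc (n ∸ k)} (subst (_< 2 ^ suc (n ∸ k)) size U<2N')))
      (≤-pred (2^-cancel-< {n ∸ k} {suc j} (subst (λ x → 2 ^ (n ∸ k) < 2 * x) size N'<2U))))
    where
    cast : ∀ j (B : Vec (F2^ n) j) → Inj B → In B U → # U ≡ 2 ^ j → j ≡ n ∸ k → ∃ λ (B : Vec (F2^ n) (n ∸ k)) → Inj B × # (λ w → inSpan B w ∧ C w) ≤ δ + δ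
    cast .(n ∸ k) B inj inU size refl = B , inj , ≤-trans (#-mono {g = λ w → U w ∧ not (not (C w))} λ w p →
        let (v , e) = does-true (inSpan? B w) (proj₁ (∧-true p)) in
        ∧-intro (trans (cong U e) (inU v)) (trans (not-involutive (C w)) (proj₂ (∧-true {inSpan B w} p))))
      (+-cancelʳ-≤ (2 ^ (n ∸ k)) _ _ (≤-trans U∖R (≤-reflexive (trans (cong (_+ (δ + δ)) size) (+-comm (2 ^ (n ∸ k)) (δ + δ))))))

-- The error coefficients `4 + k` and `2 + k * 3` of the stability estimates are paid by the `2 + k`
-- bits by which `g` exceeds `g'`.
4+3k≤2^ : ∀ k → 4 + k * 3 ≤ 2 ^ (2 + k)
4+3k≤2^ zero = ≤-refl
4+3k≤2^ (suc k) = begin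
  4 + (3 + k * 3) ≡⟨ solve 1 (λ x → con 4 :+ (con 3 :+ x) := (con 4 :+ x) :+ con 3) refl (k * 3) ⟩
  4 + k * 3 + 3 ≤⟨ +-mono-≤ (4+3k≤2^ k) (≤-trans (≤-trans (s≤s (s≤s (s≤s z≤n))) (m≤m+n 4 (k * 3))) (4+3k≤2^ k)) ⟩
  2 ^ (2 + k) + 2 ^ (2 + k) ≡⟨ 2*2^ (2 + k) ⟩
  2 ^ (2 + suc k) ∎
  where open ≤-Reasoning
        open +-*-Solver

small⇒≤ : ∀ {n} g' k t x → g' ≤ n → t ≤ 2 ^ (2 + k) → x * 2 ^ (g' + (2 + k)) ≤ t * 2 ^ n → x ≤ 2 ^ (n ∸ g')
small⇒≤ {n} g' k t x le ht h = *2^-cancel g' (*2^-cancel (2 + k) (begin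
  x * 2 ^ g' * 2 ^ (2 + k) ≡⟨ trans (*-assoc x (2 ^ g') (2 ^ (2 + k))) (cong (x *_) (sym (^-distribˡ-+-* 2 g' (2 + k)))) ⟩
  x * 2 ^ (g' + (2 + k)) ≤⟨ h ⟩
  t * 2 ^ n ≤⟨ *-monoˡ-≤ (2 ^ n) ht ⟩
  2 ^ (2 + k) * 2 ^ n ≡⟨ trans (*-comm (2 ^ (2 + k)) _) (cong (_* 2 ^ (2 + k)) (sym (2^-split le))) ⟩
  2 ^ (n ∸ g') * 2 ^ g' * 2 ^ (2 + k) ∎))
  where open ≤-Reasoning

module _ {n k s z' z} (C : F2^ n → Bool) (c0 : C zeros ≡ false) (A : Vec (F2^ n) k) (Z : Vec (F2^ n) z)
  (iZ : Inj Z) (Y₀ : Vec (F2^ z') s) (iY₀ : Inj Y₀) (g' : ℕ) (z'≡ : z' ≡ proj₁ (flat s (g' + (2 + k)))) where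

  private
    g : ℕ
    g = g' + (2 + k)
  open Config {k = k} {s} {z'} {z} C c0 A Z iZ Y₀ iY₀
  open Fourth g z'≡

  stability : z ≡ proj₁ (flat z' g) → 4 + k ≤ g' → g ≤ n → 2 ^ k * # R * 2 ^ g ≤ 2 ^ n * 2 ^ g + 2 ^ n →
    # onE * 2 ^ g ≤ 2 ^ n → (∀ i → # (Gr i) * 2 ^ g ≤ 2 ^ n) →
    ∃ λ (B : Vec (F2^ n) (n ∸ k)) → Inj B × # (λ w → inSpan B w ∧ C w) ≤ 2 ^ (n ∸ g') + 2 ^ (n ∸ g')
  stability z≡ kg gn hR h₃ h₄ = subspace-near k C S.Bad (2 ^ (n ∸ g')) k≤n (2^>0 (n ∸ g')) bad inv up lo tiny
    where
    module St = Stable {k = k} {s} {z'} {z} C c0 A Z iZ Y₀ iY₀ g z'≡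
    sparse : ∀ z (Z : Vec (F2^ n) z) E → z ≡ proj₁ (flat z' g) → # (offFlat z' Z E) * 2 ^ g ≤ 2 ^ n
    sparse _ Z E refl = offFlat-sparse z' g Z E
    module S = St.Bounds hR (sparse z Z (coset⊆ A C) z≡) (sparse z Z R* z≡) h₃ h₄
    open ≤-Reasoning
    g'≤n : g' ≤ n
    g'≤n = ≤-trans (m≤m+n g' (2 + k)) gn
    k≤n : k ≤ n
    k≤n = ≤-trans (≤-trans (m≤n+m k 4) kg) g'≤n
    bad : # S.Bad ≤ 2 ^ (n ∸ g')
    bad = small⇒≤ g' k (4 + k) _ g'≤n (≤-trans (+-monoʳ-≤ 4 (m≤m*n k 3)) (4+3k≤2^ k)) S.small-Bad
    inv : ∀ r → not (C r) ≡ true → S.Bad r ≡ false → # (λ w → not (C w) ∧ not (not (C (r ⊕ w)))) ≤ 2 ^ (n ∸ g')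
    inv r Rr nb = small⇒≤ g' k (2 + k * 3) _ g'≤n (≤-trans (+-monoˡ-≤ (k * 3) {2} {4} (s≤s (s≤s z≤n))) (4+3k≤2^ k)) (S.invariant r Rr nb)
    δ≤2^kδ : ∀ x → x ≤ 2 ^ k * x
    δ≤2^kδ x = ≤-trans (≤-reflexive (sym (*-identityˡ x))) (*-monoˡ-≤ x (2^>0 k))
    up' : 2 ^ k * # R ≤ 2 ^ n + 2 ^ (n ∸ g')
    up' = *2^-cancel g (≤-trans hR (≤-trans (+-monoʳ-≤ (2 ^ n * 2 ^ g) (≤-trans (≤-reflexive (sym (2^-split g'≤n))) (*-monoʳ-≤ (2 ^ (n ∸ g')) (2^-mono (m≤m+n g' (2 + k)))))) (≤-reflexive (sym (*-distribʳ-+ (2 ^ g) (2 ^ n) _)))))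
    up : # R ≤ 2 ^ (n ∸ k) + 2 ^ (n ∸ g')
    up = *-cancelˡ-≤ (2 ^ k) {{m^n≢0 2 k}} (begin
      2 ^ k * # R ≤⟨ up' ⟩
      2 ^ n + 2 ^ (n ∸ g') ≤⟨ +-mono-≤ (≤-reflexive (trans (sym (2^-split k≤n)) (*-comm _ (2 ^ k)))) (δ≤2^kδ _) ⟩
      2 ^ k * 2 ^ (n ∸ k) + 2 ^ k * 2 ^ (n ∸ g') ≡⟨ sym (*-distribˡ-+ (2 ^ k) _ _) ⟩
      2 ^ k * (2 ^ (n ∸ k) + 2 ^ (n ∸ g')) ∎)
    2N≤ : 2 * 2 ^ n ≤ 2 ^ (n ∸ g') * 2 ^ g
    2N≤ = begin
      2 * 2 ^ n ≡⟨ *-comm 2 (2 ^ n) ⟩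
      2 ^ n * 2 ≡⟨ cong (_* 2) (sym (2^-split g'≤n)) ⟩
      2 ^ (n ∸ g') * 2 ^ g' * 2 ^ 1 ≡⟨ trans (*-assoc (2 ^ (n ∸ g')) (2 ^ g') (2 ^ 1)) (cong (2 ^ (n ∸ g') *_) (sym (^-distribˡ-+-* 2 g' 1))) ⟩
      2 ^ (n ∸ g') * 2 ^ (g' + 1) ≤⟨ *-monoʳ-≤ (2 ^ (n ∸ g')) (2^-mono (+-monoʳ-≤ g' (s≤s z≤n))) ⟩
      2 ^ (n ∸ g') * 2 ^ g ∎
    lo : 2 ^ (n ∸ k) ≤ # R + 2 ^ (n ∸ g')
    lo = *-cancelˡ-≤ (2 ^ k) {{m^n≢0 2 k}} (begin
      2 ^ k * 2 ^ (n ∸ k) ≡⟨ trans (*-comm (2 ^ k) _) (2^-split k≤n) ⟩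
      2 ^ n ≤⟨ *2^-cancel g (≤-trans S.lower (≤-trans (+-monoʳ-≤ (2 ^ k * # R * 2 ^ g) 2N≤) (≤-reflexive (sym (*-distribʳ-+ (2 ^ g) (2 ^ k * # R) _))))) ⟩
      2 ^ k * # R + 2 ^ (n ∸ g') ≤⟨ +-monoʳ-≤ _ (δ≤2^kδ _) ⟩
      2 ^ k * # R + 2 ^ k * 2 ^ (n ∸ g') ≡⟨ sym (*-distribˡ-+ (2 ^ k) _ _) ⟩
      2 ^ k * (# R + 2 ^ (n ∸ g')) ∎)
    tiny : 16 * 2 ^ (n ∸ g') ≤ 2 ^ (n ∸ k)
    tiny = *2^-cancel k (begin
      16 * 2 ^ (n ∸ g') * 2 ^ k ≡⟨ solve 2 (λ a b → con 16 :* a :* b := a :* (con 16 :* b)) refl (2 ^ (n ∸ g')) (2 ^ k) ⟩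
      2 ^ (n ∸ g') * (2 ^ 4 * 2 ^ k) ≡⟨ cong (2 ^ (n ∸ g') *_) (sym (^-distribˡ-+-* 2 4 k)) ⟩
      2 ^ (n ∸ g') * 2 ^ (4 + k) ≤⟨ *-monoʳ-≤ (2 ^ (n ∸ g')) (2^-mono kg) ⟩
      2 ^ (n ∸ g') * 2 ^ g' ≡⟨ trans (2^-split g'≤n) (sym (2^-split k≤n)) ⟩
      2 ^ (n ∸ k) * 2 ^ k ∎)
      where open +-*-Solver

-- Sets with a sparse intersection with a subspace of codimension k

nz : ∀ {k} → F2^ k → Bool
nz c = not (eqV c zeros)

nz-intro : ∀ {k} {c : F2^ k} → c ≢ zeros → nz c ≡ true
nz-intro {c = c} ne = not-intro (does-intro-¬ (c ≟V zeros) ne)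

nz-elim : ∀ {k} {c : F2^ k} → nz c ≡ true → c ≢ zeros
nz-elim {c = c} p = does-false (c ≟V zeros) (not-true p)

lift : ∀ {k m n} → Vec (F2^ n) k → Vec (F2^ n) m → Vec (F2^ m) k → Vec (F2^ n) k
lift A B ℓ = zipWith _⊕_ A (B ⊙ ℓ)

lin-zip : ∀ {k n} (A A' : Vec (F2^ n) k) c → lin (zipWith _⊕_ A A') c ≡ lin A c ⊕ lin A' c
lin-zip [] [] [] = sym (⊕-self zeros)
lin-zip (a ∷ A) (a' ∷ A') (b ∷ c) = trans (cong₂ _⊕_ (dist b) (lin-zip A A' c)) (⊕-interchange (b · a) (b · a') _ _)
  where
  dist : ∀ b → b · (a ⊕ a') ≡ b · a ⊕ b · a'
  dist true = refl
  dist false = sym (⊕-self zeros)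

lin-lift : ∀ {k m n D} (A : Vec (F2^ n) k) (B : Vec (F2^ n) m) (ℓ : Vec (F2^ m) k) (Y : Vec (F2^ m) D) c v →
  lin (lift A B ℓ) c ⊕ lin (B ⊙ Y) v ≡ lin A c ⊕ lin B (lin ℓ c ⊕ lin Y v)
lin-lift A B ℓ Y c v = trans (cong₂ _⊕_ (trans (lin-zip A (B ⊙ ℓ) c) (cong (lin A c ⊕_) (lin-⊙ B ℓ c))) (lin-⊙ B Y v))
  (trans (⊕-assoc _ _ _) (cong (lin A c ⊕_) (sym (lin-⊕ B _ _))))

lift-indep : ∀ {k m n D} (A : Vec (F2^ n) k) (B : Vec (F2^ n) m) (ℓ : Vec (F2^ m) k) (Y : Vec (F2^ m) D) →
  Indep A B → Inj Y → Indep (lift A B ℓ) (B ⊙ Y)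
lift-indep A B ℓ Y ind iY c v e with ind c (lin ℓ c ⊕ lin Y v) (trans (sym (lin-lift A B ℓ Y c v)) e)
... | refl , q = refl , iY v (trans (sym (⊕-idˡ _)) (trans (cong (_⊕ lin Y v) (sym (lin-zero ℓ))) q))

tileOf : ∀ {k m n D} → Vec (F2^ n) k → Vec (F2^ n) m → Vec (F2^ m) D → Vec (F2^ m) k → List (F2^ n)
tileOf A B Y ℓ = config (lift A B ℓ) (B ⊙ Y) nz

-- The tiles are the nonzero translates of a subspace of ⟨B⟩, for all positions obtained by moving
-- the generators within their cosets of ⟨B⟩. The centre of the tile is excluded: there the matroid
-- itself supplies the values.
Starved : ∀ {k m n D} → Vec (F2^ n) k → Vec (F2^ n) m → Vec (F2^ m) D → List (F2^ n) → Class n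
Starved {k} {m} A B Y W₀ S = (ℓ : Vec (F2^ m) k) → (∀ w → w ∈ tileOf A B Y ℓ → w ∉ W₀) → ¬ (∀ w → w ∈ tileOf A B Y ℓ → S w ≡ true)

fresh-lift : ∀ {k m n D} (A : Vec (F2^ n) k) (B : Vec (F2^ n) m) → Inj B → (Y : Vec (F2^ m) D) (W : List (F2^ n)) →
  length W * 2 ^ (k + D) < 2 ^ m → ∃ λ ℓ → ∀ w → w ∈ tileOf A B Y ℓ → w ∉ W
fresh-lift A B iB Y W h = let (ℓ , ok) = lifts A B iB Y W h in ℓ , λ w p →
  let (c , v , ic , e) = config-elim (lift A B ℓ) (B ⊙ Y) nz p in
  subst (_∉ W) (sym (trans e (lin-lift A B ℓ Y c v))) (ok c (nz-elim ic) v)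

split? : ∀ {j m n} (A : Vec (F2^ n) j) (B : Vec (F2^ n) m) → Dec (Split A B)
split? A B with (∀-dec enumV λ d → ∀-dec enumV λ v → ((lin A d ⊕ lin B v) ≟V zeros) →-dec ((d ≟V zeros) ×-dec (v ≟V zeros)))
              | ∀-dec enumV (λ w → ∃-dec enumV λ d → ∃-dec enumV λ v → w ≟V (lin A d ⊕ lin B v))
... | yes i | yes s = yes (split i s)
... | no ¬i | _ = no λ sp → ¬i (Split.indep sp)
... | _ | no ¬s = no λ sp → ¬s (Split.spans sp)

cov-∅ : ∀ {n} {Q : Class n} {K} → (∀ S → ¬ Q S) → Cov Q K
cov-∅ h = [] , z≤n , λ S q → ⊥-elim (h S q)

OnSubspace : ∀ {k m n D} → Vec (F2^ n) k → Vec (F2^ n) m → Vec (F2^ m) D → List (F2^ n) → (F2^ n → Bool) → Class n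
OnSubspace A B Y W₀ T S = Split A B × Inj Y × Starved A B Y W₀ S × (∀ w → inSpan B w ≡ true → S w ≡ T w)

-- The trace on ⟨B⟩ is prescribed, and the remaining 2^n - 2^r points contain many disjoint
-- translated tiles, none of which may lie in `S`. The generators can be moved away from any small
-- set, in particular from `W₀`.
cov-subspace : ∀ {k r n D} (A : Vec (F2^ n) k) (B : Vec (F2^ n) r) (Y : Vec (F2^ r) D) (W₀ : List (F2^ n)) T m →
  let b = size-idx {k} nz D in (2 ^ b * m * b + length W₀) * 2 ^ (k + D) < 2 ^ r →
  Cov (OnSubspace A B Y W₀ T) (2 ^ ((2 ^ n ∸ 2 ^ r) ∸ m))
cov-subspace {k} {r} {n} {D} A B Y W₀ T m room with split? A B | Inj? Y
... | no ¬s | _ = cov-∅ λ S q → ¬s (proj₁ q)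
... | yes _ | no ¬i = cov-∅ λ S q → ¬i (proj₁ (proj₂ q))
... | yes sp | yes iY = cov-map glue glue-cong lower-part (cov-mono (2^-mono (∸-monoˡ-≤ m (≤-reflexive size))) (proj₂ (loss b C Q (λ S q → proj₁ q) m tile)))
  where
  b : ℕ
  b = size-idx {k} nz D
  C : F2^ n → Bool
  C = not ∘ inSpan B
  iB : Inj B
  iB v e = proj₂ (Split.indep sp zeros v (trans (cong (_⊕ lin B v) (lin-zero A)) (trans (⊕-idˡ _) e)))
  size : # C ≡ 2 ^ n ∸ 2 ^ r
  size = trans (sym (m+n∸m≡n (2 ^ r) (# C))) (cong (_∸ 2 ^ r) (trans (cong (_+ # C) (sym (#-inSpan B iB))) (#-not (inSpan B))))
  Q : Class n
  Q S = Supp C S × Starved A B Y W₀ S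
  outside : ∀ ℓ w → w ∈ tileOf A B Y ℓ → C w ≡ true
  outside ℓ w p = let (c , v , ic , e) = config-elim (lift A B ℓ) (B ⊙ Y) nz p in
    not-intro (does-intro-¬ (inSpan? B w) λ (u , q) → nz-elim ic
      (proj₁ (Split.to-inj sp {c} {lin ℓ c ⊕ lin Y v} {zeros} {u} (trans (sym (trans e (lin-lift A B ℓ Y c v))) (trans q (sym (trans (cong (_⊕ lin B u) (lin-zero A)) (⊕-idˡ _))))))))
  tile : ∀ W → length W ≤ 2 ^ b * m * b → Tile b C Q W
  tile W le = let (ℓ , off) = fresh-lift A B iB Y (W ++ W₀) (≤-<-trans (*-monoˡ-≤ (2 ^ (k + D)) (≤-trans (≤-reflexive (length-++ W)) (+-monoˡ-≤ (length W₀) le))) room) in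
    mkTile (tileOf A B Y ℓ) (λ _ → true) (length-config (lift A B ℓ) (B ⊙ Y) nz)
      (config-NoDup (lift A B ℓ) (B ⊙ Y) nz (Indep⇒Inj (lift A B ℓ) (B ⊙ Y) (lift-indep A B ℓ Y (Split.indep sp) iY)))
      (outside ℓ) (λ v p q → off v p (AnyP.++⁺ˡ q)) (λ S q → proj₂ q ℓ (λ w p r → off w p (AnyP.++⁺ʳ W r)))
  glue : (F2^ n → Bool) → F2^ n → Bool
  glue S w = if inSpan B w then T w else S w
  glue-cong : ∀ {S S'} → S ≗ S' → glue S ≗ glue S'
  glue-cong h w with inSpan B w
  ... | true = refl
  ... | false = h w
  lower-part : ∀ S → OnSubspace A B Y W₀ T S → ∃ λ S' → Q S' × S ≗ glue S'
  lower-part S (_ , _ , st , onT) = (λ w → C w ∧ S w) , ((λ w e → cong (_∧ S w) e) ,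
      λ ℓ fr all → st ℓ fr λ w p → proj₂ (∧-true {C w} (all w p))) , eq
    where
    eq : S ≗ glue (λ w → C w ∧ S w)
    eq w with inSpan B w in e
    ... | true = onT w e
    ... | false = refl

-- Shattered sets miss tiles

cov-⋃∈ : ∀ {n} {A : Set} {Q : Class n} {K} (xs : List A) (R : A → Class n) → (∀ x → x ∈ xs → Cov (R x) K) →
  (∀ S → Q S → Any (λ x → R x S) xs) → Cov Q (length xs * K)
cov-⋃∈ [] R c h = cov-∅ λ S q → case h S q of λ ()
cov-⋃∈ {n} {Q = Q} (x ∷ xs) R c h = cov-∪ {Q₂ = λ S → Any (λ x → R x S) xs} (λ S q → pick S (h S q)) (c x (here refl)) (cov-⋃∈ xs R (λ y m → c y (there m)) (λ S a → a))
  where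
  pick : ∀ S → Any (λ x → R x S) (x ∷ xs) → R x S ⊎ Any (λ x → R x S) xs
  pick S (here p) = inj₁ p
  pick S (there p) = inj₂ p

module Shattered {n b} (1≤b : 1 ≤ b) {Λ I : Set} (labels : List Λ) (Good : Λ → Set) (is : List I)
  (pts : Λ → I → List (F2^ n)) (pat : Λ → I → F2^ n → Bool) (good? : ∀ l → Dec (Good l))
  (len : ∀ l i → length (pts l i) ≡ b) (dup : ∀ l i → Good l → NoDup (pts l i)) where

  Miss : Λ → Class n
  Miss l M = Good l × (∀ i → i ∈ is → ¬ (∀ v → v ∈ pts l i → M v ≡ pat l i v))

  -- For some good label, a small set `W` meets every tile of that label contained in `S`.
  Sparse-tiles : ℕ → Class n
  Sparse-tiles K S = Any (λ l → Good l × ∃ λ W → length W ≤ K ×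
    (∀ i → i ∈ is → (∀ v → v ∈ pts l i → v ∉ W) → ¬ (∀ v → v ∈ pts l i → S v ≡ true))) labels

  -- Otherwise, for every good label, `S` contains so many disjoint tiles that at most 2^(|S|-m)
  -- subsets of `S` miss the pattern of that label on all of them. Each subset of `S` is the trace
  -- of a member of `F`, hence belongs to some label; but fewer than 2^m labels cannot account for
  -- 2^|S| subsets.
  shattered : ∀ (F : Class n) S m → length labels < 2 ^ m → (∀ M → F M → ¬ ¬ Any (λ l → Miss l M) labels) →
    Shatters F S → ¬ ¬ Sparse-tiles (2 ^ b * m * b) S
  shattered F S m few hF sh none = noLabel λ { (l , lm , gl) → <⇒≱ (strict (m≤S l lm gl)) (cov-free-lower (# S) S (λ _ → false) refl cover) }
    where
    find' : ∀ l → l ∈ labels → Good l → ∀ W → length W ≤ 2 ^ b * m * b →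
      ∃ λ i → i ∈ is × (∀ v → v ∈ pts l i → v ∉ W) × (∀ v → v ∈ pts l i → S v ≡ true)
    find' l lm gl W le with any? (λ i → (∀-dec enumV λ v → any? (v ≟V_) (pts l i) →-dec ¬? (any? (v ≟V_) W)) ×-dec (∀-dec enumV λ v → any? (v ≟V_) (pts l i) →-dec (S v ≟B true))) is
    ... | yes a = let (i , im , p) = find a in i , im , p
    ... | no ¬a = ⊥-elim (none (lose lm (gl , W , le , λ i im fr all → ¬a (lose im (fr , all)))))
    Q' : Λ → Class n
    Q' l p = Supp S p × Good l × (∀ i → i ∈ is → (∀ v → v ∈ pts l i → S v ≡ true) → ¬ (∀ v → v ∈ pts l i → p v ≡ pat l i v))
    lossL : ∀ l → l ∈ labels → Good l → 2 ^ b * m * b ≤ # S × Cov (Q' l) (2 ^ (# S ∸ m))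
    lossL l lm gl = loss b S (Q' l) (λ p q → proj₁ q) m λ W le → let (i , im , fr , inS) = find' l lm gl W le in
      mkTile (pts l i) (pat l i) (len l i) (dup l i gl) inS fr (λ p q → proj₂ (proj₂ q) i im inS)
    covL : ∀ l → l ∈ labels → Cov (Q' l) (2 ^ (# S ∸ m))
    covL l lm with good? l
    ... | yes gl = proj₂ (lossL l lm gl)
    ... | no ¬g = cov-∅ λ p q → ¬g (proj₁ (proj₂ q))
    cover : Cov (Free S (λ _ → false)) (length labels * 2 ^ (# S ∸ m))
    cover = cov-stable {Q' = λ p → Any (λ l → Q' l p) labels} (λ p supp k → let (M , FM , agr) = sh p in
        hF M FM λ a → k (any-weaken (λ {l} (gl , miss) → supp , gl , λ i im inS all → miss i im λ v vm → trans (agr v (inS v vm)) (all v vm)) a))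
      (cov-⋃∈ labels Q' covL (λ _ a → a))
    m≤S : ∀ l → l ∈ labels → Good l → m ≤ # S
    m≤S l lm gl = ≤-trans (≤-trans (≤-trans (≤-reflexive (sym (*-identityˡ m))) (*-monoˡ-≤ m (2^>0 b))) (≤-trans (≤-reflexive (sym (*-identityʳ _))) (*-monoʳ-≤ (2 ^ b * m) 1≤b))) (proj₁ (lossL l lm gl))
    strict : m ≤ # S → length labels * 2 ^ (# S ∸ m) < 2 ^ # S
    strict le = <-≤-trans (*-monoˡ-< (2 ^ (# S ∸ m)) {{m^n≢0 2 (# S ∸ m)}} few) (≤-reflexive (trans (*-comm (2 ^ m) _) (2^-split le)))
    noLabel : ¬ ¬ (∃ λ l → l ∈ labels × Good l)
    noLabel k = let (M , FM , _) = sh (λ _ → false) in hF M FM λ a → let (l , lm , (gl , _)) = find a in k (l , lm , gl)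

emb : ∀ {z n} → z ≤ n → Vec (F2^ n) z
emb z≤n = []
emb (s≤s p) = (true ∷ zeros) ∷ map (false ∷_) (emb p)

emb-Inj : ∀ {z n} (p : z ≤ n) → Inj (emb p)
emb-Inj z≤n [] _ = refl
emb-Inj (s≤s p) (b ∷ v) e with trans (sym (cong (b · (true ∷ zeros) ⊕_) (lin-false∷ (emb p) v))) e
emb-Inj (s≤s p) (false ∷ v) e | q = cong (false ∷_) (emb-Inj p v (trans (sym (⊕-idˡ _)) (cong tail q)))
emb-Inj (s≤s p) (true ∷ v) e | ()

cov-⊆C : ∀ {n} (C : F2^ n → Bool) → Cov (Supp C) (2 ^ # C)
cov-⊆C C = cov-free (# C) C (λ _ → false) refl

⊆⇒Supp : ∀ {n} {S C : F2^ n → Bool} → S ⊆ C → Supp C S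
⊆⇒Supp h v e = ≢true⇒false λ s → true≢false (h v s) e

cov2-⋃ : ∀ {n} {A : Set} {Q : Class n} a {e} (xs : List A) (R : A → Class n) → length xs ≤ 2 ^ a → (∀ x → Cov (R x) (2 ^ e)) →
  (∀ S → Q S → Any (λ x → R x S) xs) → Cov Q (2 ^ (a + e))
cov2-⋃ a {e} xs R le c h = cov-mono (≤-trans (*-monoˡ-≤ (2 ^ e) le) (≤-reflexive (sym (^-distribˡ-+-* 2 a e)))) (cov-⋃ xs R c h)

container-upper : ∀ {n} k p (C : F2^ n → Bool) → k ≤ n → p ≤ n → 2 ^ n * 2 ^ p ≤ 2 ^ k * 2 ^ p * # (not ∘ C) + 2 ^ n →
  2 ^ (n ∸ k) ≤ # (not ∘ C) + 2 ^ (n ∸ p)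
container-upper {n} k p C k≤n p≤n h = *-cancelˡ-≤ (2 ^ k) {{m^n≢0 2 k}} (*2^-cancel p (begin
  2 ^ k * 2 ^ (n ∸ k) * 2 ^ p ≡⟨ cong (_* 2 ^ p) (trans (*-comm (2 ^ k) _) (2^-split k≤n)) ⟩
  2 ^ n * 2 ^ p ≤⟨ h ⟩
  2 ^ k * 2 ^ p * r + 2 ^ n ≡⟨ cong₂ _+_ (solve 3 (λ a b c → a :* b :* c := a :* c :* b) refl (2 ^ k) (2 ^ p) r) (sym (2^-split p≤n)) ⟩
  2 ^ k * r * 2 ^ p + 2 ^ (n ∸ p) * 2 ^ p ≡⟨ sym (*-distribʳ-+ (2 ^ p) (2 ^ k * r) _) ⟩
  (2 ^ k * r + 2 ^ (n ∸ p)) * 2 ^ p ≤⟨ *-monoˡ-≤ (2 ^ p) (+-monoʳ-≤ (2 ^ k * r) (≤-trans (≤-reflexive (sym (*-identityˡ _))) (*-monoˡ-≤ (2 ^ (n ∸ p)) (2^>0 k)))) ⟩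
  (2 ^ k * r + 2 ^ k * 2 ^ (n ∸ p)) * 2 ^ p ≡⟨ cong (_* 2 ^ p) (sym (*-distribˡ-+ (2 ^ k) r _)) ⟩
  2 ^ k * (r + 2 ^ (n ∸ p)) * 2 ^ p ∎))
  where
  open ≤-Reasoning
  open +-*-Solver
  r : ℕ
  r = # (not ∘ C)

#C≤ : ∀ {n} (C : F2^ n → Bool) a y → a ≤ # (not ∘ C) + y → a ≤ 2 ^ n → # C ≤ 2 ^ n ∸ a + y
#C≤ {n} C a y h a≤ = +-cancelʳ-≤ a _ _ (begin
  # C + a ≤⟨ +-monoʳ-≤ (# C) h ⟩
  # C + (# (not ∘ C) + y) ≡⟨ sym (+-assoc (# C) _ y) ⟩
  # C + # (not ∘ C) + y ≡⟨ cong (_+ y) (trans (#-not C) (sym (m∸n+n≡m a≤))) ⟩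
  2 ^ n ∸ a + a + y ≡⟨ solve 3 (λ x a y → x :+ a :+ y := x :+ y :+ a) refl (2 ^ n ∸ a) a y ⟩
  2 ^ n ∸ a + y + a ∎)
  where open ≤-Reasoning
        open +-*-Solver

-- Containers far from the complement of a subspace

module Dichotomy {n k s z' z} (A : Vec (F2^ n) k) (Z : Vec (F2^ n) z) (iZ : Inj Z) (Y₀ : Vec (F2^ z') s) (iY₀ : Inj Y₀)
  (g' : ℕ) (z'≡ : z' ≡ proj₁ (flat s (g' + (2 + k)))) (C : F2^ n → Bool) (c0 : C zeros ≡ false) where

  private
    g : ℕ
    g = g' + (2 + k)
  open Config {k = k} {s} {z'} {z} C c0 A Z iZ Y₀ iY₀ public
  open Fourth g z'≡ public

  StableAt : Set
  StableAt = 2 ^ k * # R * 2 ^ g ≤ 2 ^ n * 2 ^ g + 2 ^ n × # onE * 2 ^ g ≤ 2 ^ n × (∀ i → # (Gr i) * 2 ^ g ≤ 2 ^ n)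

  h₄? : ∀ i → Dec (# (Gr i) * 2 ^ g ≤ 2 ^ n)
  h₄? i = # (Gr i) * 2 ^ g ≤? 2 ^ n

  stable? : Dec StableAt
  stable? = (_ ≤? _) ×-dec ((_ ≤? _) ×-dec FinP.all? h₄?)

  -- Stability can fail in three ways. If `R` is too large, `C` is small; if many cosets of ⟨A⟩ lie
  -- in `C`, `cov₃` applies; if a generator can be modified in many ways, `cov₄` applies. The error
  -- `y` of the container is a loss to be beaten by the gain `m`.
  cov-unstable : ∀ m y → g + k ≤ n → m ≤ 2 ^ (n ∸ (g + k)) →
    (∀ b → b ≤ 2 ^ (suc k + s) → (2 ^ b * m * b * 2 ^ (k + z) + 2 ^ b * m * b * 2 ^ (k + z)) * 2 ^ g ≤ 2 ^ n) →
    BB⊆ A Z C → ¬ StableAt → 2 ^ (n ∸ k) ≤ # R + y → Cov Q (2 ^ ((2 ^ n ∸ 2 ^ (n ∸ k) + y) ∸ m))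
  cov-unstable m y gk≤n m≤ room bbC ¬st lowR = go (2 ^ k * # R * 2 ^ g ≤? 2 ^ n * 2 ^ g + 2 ^ n) (# onE * 2 ^ g ≤? 2 ^ n) (FinP.all? h₄?)
    where
    Goal : Set
    Goal = Cov Q (2 ^ ((2 ^ n ∸ 2 ^ (n ∸ k) + y) ∸ m))
    fin : Cov Q (2 ^ (# C ∸ m)) → Goal
    fin c = cov-mono (2^-mono (∸-monoˡ-≤ m (#C≤ C (2 ^ (n ∸ k)) y lowR (2^-mono (m∸n≤m n k))))) c
    dbl : ∀ {l x} → l ≤ x → l * 2 ^ (k + z) + l * 2 ^ (k + z) ≤ x * 2 ^ (k + z) + x * 2 ^ (k + z)
    dbl le = +-mono-≤ (*-monoˡ-≤ (2 ^ (k + z)) le) (*-monoˡ-≤ (2 ^ (k + z)) le)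
    enough : ∀ b → b ≤ 2 ^ (suc k + s) → ∀ P → ¬ (P * 2 ^ g ≤ 2 ^ n) → ∀ l → l ≤ 2 ^ b * m * b → l * 2 ^ (k + z) + l * 2 ^ (k + z) < P
    enough b hb P big l le = *-cancelʳ-< (2 ^ g) _ _ (≤-<-trans (*-monoˡ-≤ (2 ^ g) (dbl le)) (≤-<-trans (room b hb) (≰⇒> big)))
    bigR : 2 ^ n * 2 ^ g + 2 ^ n < 2 ^ k * # R * 2 ^ g → Goal
    bigR h = cov-mono (2^-mono (≤-trans (m+n≤o⇒m≤o∸n (# C) (m+n≤o⇒m≤o∸n (# C + m) le)) (∸-monoˡ-≤ m (m≤m+n _ y)))) (cov-⊆ (λ S q → proj₁ q) (cov-⊆C C))
      where
      open ≤-Reasoning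
      open +-*-Solver
      k≤n : k ≤ n
      k≤n = ≤-trans (m≤n+m k g) gk≤n
      x : ℕ
      x = 2 ^ (n ∸ (g + k))
      split' : 2 ^ k * x * 2 ^ g ≡ 2 ^ n
      split' = trans (solve 3 (λ a b c → a :* b :* c := b :* (c :* a)) refl (2 ^ k) x (2 ^ g)) (trans (cong (x *_) (sym (^-distribˡ-+-* 2 g k))) (2^-split gk≤n))
      R≥ : 2 ^ (n ∸ k) + x ≤ # R
      R≥ = *-cancelˡ-≤ (2 ^ k) {{m^n≢0 2 k}} (*2^-cancel g (begin
        2 ^ k * (2 ^ (n ∸ k) + x) * 2 ^ g ≡⟨ solve 4 (λ K a x G → K :* (a :+ x) :* G := a :* K :* G :+ K :* x :* G) refl (2 ^ k) (2 ^ (n ∸ k)) x (2 ^ g) ⟩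
        2 ^ (n ∸ k) * 2 ^ k * 2 ^ g + 2 ^ k * x * 2 ^ g ≡⟨ cong₂ _+_ (cong (_* 2 ^ g) (2^-split k≤n)) split' ⟩
        2 ^ n * 2 ^ g + 2 ^ n ≤⟨ <⇒≤ h ⟩
        2 ^ k * # R * 2 ^ g ∎))
      le : # C + m + 2 ^ (n ∸ k) ≤ 2 ^ n
      le = begin
        # C + m + 2 ^ (n ∸ k) ≤⟨ +-monoˡ-≤ (2 ^ (n ∸ k)) (+-monoʳ-≤ (# C) m≤) ⟩
        # C + x + 2 ^ (n ∸ k) ≡⟨ solve 3 (λ c x a → c :+ x :+ a := c :+ (a :+ x)) refl (# C) x (2 ^ (n ∸ k)) ⟩
        # C + (2 ^ (n ∸ k) + x) ≤⟨ +-monoʳ-≤ (# C) R≥ ⟩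
        # C + # R ≡⟨ #-not C ⟩
        2 ^ n ∎
    go : Dec (2 ^ k * # R * 2 ^ g ≤ 2 ^ n * 2 ^ g + 2 ^ n) → Dec (# onE * 2 ^ g ≤ 2 ^ n) → Dec (∀ i → # (Gr i) * 2 ^ g ≤ 2 ^ n) → Goal
    go (no ¬r) _ _ = bigR (≰⇒> ¬r)
    go (yes r) (no ¬h₃) _ = fin (cov₃ bbC m (enough (size-idx ι₃ s) (size-idx≤ ι₃ s) (# onE) ¬h₃))
    go (yes r) (yes h₃) (yes h₄) = ⊥-elim (¬st (r , h₃ , h₄))
    go (yes r) (yes h₃) (no ¬h₄) = let (i , ¬hi) = FinP.¬∀⟶∃¬ k _ h₄? ¬h₄ in
      fin (cov₄ i bbC m (enough (size-idx (ι₄ i) s) (size-idx≤ (ι₄ i) s) (# (Gr i)) ¬hi)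
        (λ l le → ≤-trans (*-monoˡ-≤ (2 ^ g) (dbl le)) (room (size-idx (ι₄ i) s) (size-idx≤ (ι₄ i) s))))

BB? : ∀ {k s n} (A : Vec (F2^ n) k) (Y : Vec (F2^ n) s) S → Dec (BB⊆ A Y S)
BB? A Y S = ∀-dec enumV λ c → ¬? (c ≟V zeros) →-dec ∀-dec enumV λ v → S (lin A c ⊕ lin Y v) ≟B true

-- What the counting uses about a set shattered by the bad matroids. The last clause is
-- double-negated because the witnesses against `P` behind it are.
GoodSet : ∀ k s D w n → Class n
GoodSet k s D w n S = S zeros ≡ false × Avoids (suc k) s S ×
  ((A : Vec (F2^ n) k) (B : Vec (F2^ n) (n ∸ k)) → Split A B →
    ¬ ¬ (∃₂ λ (Y : Vec (F2^ (n ∸ k)) D) W₀ → Inj Y × length W₀ ≤ w × Starved A B Y W₀ S))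

-- The number of good sets

module Assemble (κ s D n w z' z g' p₁ p₂ z₁ z₂ p₈ q₈ m m₅ : ℕ) where

  k g E N' : ℕ
  k = suc κ
  g = g' + (2 + k)
  E = 2 ^ n ∸ 2 ^ (n ∸ k)
  N' = 2 ^ (n ∸ k)

  module _ (z'≡ : z' ≡ proj₁ (flat s g)) (z≡ : z ≡ proj₁ (flat z' g)) (Y₀ : Vec (F2^ z') s) (iY₀ : Inj Y₀)
    (c₁ : Containers κ z p₁ z₁ n) (c₂ : Containers k s p₂ z₂ n) (z₁≤n : z₁ ≤ n) (z₂≤n : z₂ ≤ n)
    (sp₈ : Cov {n} (Sparse q₈) (2 ^ (2 ^ (n ∸ p₈))))
    (kg : 4 + k ≤ g') (gk≤n : g + k ≤ n) (p₁≤n : p₁ ≤ n) (p₂≤n : p₂ ≤ n)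
    (gq : (2 ^ (n ∸ g') + 2 ^ (n ∸ g')) * 2 ^ q₈ ≤ 2 ^ n)
    (m≤ : m ≤ 2 ^ (n ∸ (g + k)))
    (room : ∀ b → b ≤ 2 ^ (suc k + s) → (2 ^ b * m * b * 2 ^ (k + z) + 2 ^ b * m * b * 2 ^ (k + z)) * 2 ^ g ≤ 2 ^ n)
    (ov : n * k + (n * z + 2 ^ (n ∸ p₂)) + ((n + n) + 2 ^ (n ∸ p₂)) ≤ m) (mE : m ≤ E)
    (room₅ : (2 ^ size-idx {k} nz D * m₅ * size-idx {k} nz D + w) * 2 ^ (k + D) < 2 ^ (n ∸ k))
    (ov₅ : n * k + (n * (n ∸ k) + ((n ∸ k) * D + (suc n * w + 2 ^ (n ∸ p₈)))) + (n + n) ≤ m₅) (mE₅ : m₅ ≤ E)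
    (ov₁ : 2 ^ (n ∸ p₁) + (2 ^ (n ∸ p₁) + (n + n)) ≤ N') (2≤n : 2 ≤ n) (2n≤E : n + n ≤ E) where

    k≤n : k ≤ n
    k≤n = ≤-trans (m≤n+m k g) gk≤n

    e₁ : Vec (F2^ n) z₁
    e₁ = emb z₁≤n
    e₂ : Vec (F2^ n) z₂
    e₂ = emb z₂≤n

    -- Shattered sets omit `zeros`, so the containers may do so too; this makes generators and
    -- directions of a configuration inside them independent.
    zeroed : (F2^ n → Bool) → F2^ n → Bool
    zeroed C = update zeros false C

    -- Sets without a configuration on `κ + 1` generators: a container for codimension `κ` omits
    -- about 2^(n-κ) points, twice the allowance `N'`, and the surplus pays for the choice of the
    -- container.
    Class₁ : Class n
    Class₁ S = Any (Container κ p₁ S) (proj₁ (c₁ e₁))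

    cov₁ : Cov Class₁ (2 ^ (E ∸ (n + n)))
    cov₁ = cov-mono (2^-mono le) (cov2-⋃ (2 ^ (n ∸ p₁)) (proj₁ (c₁ e₁)) (λ C S → Container κ p₁ S C) (proj₁ (proj₂ (c₁ e₁))) each (λ S a → a))
      where
      x : ℕ
      x = 2 ^ (n ∸ κ)
      x≡ : N' + N' ≡ x
      x≡ = 2^-half {κ} {n} k≤n
      each : ∀ C → Cov (λ S → Container κ p₁ S C) (2 ^ (2 ^ n ∸ x + 2 ^ (n ∸ p₁)))
      each C with 2 ^ n * 2 ^ p₁ ≤? 2 ^ κ * 2 ^ p₁ * # (not ∘ C) + 2 ^ n
      ... | no ¬s = cov-∅ λ S q → ¬s (proj₂ q)
      ... | yes sz = cov-mono (2^-mono (#C≤ C x _ (container-upper κ p₁ C (≤-trans (n≤1+n κ) k≤n) p₁≤n sz) (2^-mono (m∸n≤m n κ)))) (cov-⊆ (λ S q → ⊆⇒Supp (proj₁ q)) (cov-⊆C C))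
      open ≤-Reasoning
      open +-*-Solver
      y : ℕ
      y = 2 ^ (n ∸ p₁)
      le : y + (2 ^ n ∸ x + y) ≤ E ∸ (n + n)
      le = m+n≤o⇒m≤o∸n (y + (2 ^ n ∸ x + y)) (m+n≤o⇒m≤o∸n (y + (2 ^ n ∸ x + y) + (n + n)) (begin
        y + (2 ^ n ∸ x + y) + (n + n) + N' ≡⟨ solve 4 (λ y t n N → y :+ (t :+ y) :+ n :+ N := t :+ ((y :+ (y :+ n)) :+ N)) refl y (2 ^ n ∸ x) (n + n) N' ⟩
        2 ^ n ∸ x + ((y + (y + (n + n))) + N') ≤⟨ +-monoʳ-≤ (2 ^ n ∸ x) (+-monoˡ-≤ N' ov₁) ⟩
        2 ^ n ∸ x + (N' + N') ≡⟨ trans (cong (2 ^ n ∸ x +_) x≡) (m∸n+n≡m (2^-mono (m∸n≤m n κ))) ⟩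
        2 ^ n ∎))

    module D (A : Vec (F2^ n) k) (Z : Vec (F2^ n) z) (iZ : Inj Z) (C : F2^ n → Bool) =
      Dichotomy {k = k} {s} {z'} {z} A Z iZ Y₀ iY₀ g' z'≡ (zeroed C) (update-same zeros false C)

    Unst : Vec (F2^ n) k → Vec (F2^ n) z → (F2^ n → Bool) → Class n
    Unst A Z C S = Σ (Inj Z) λ iZ → ¬ D.StableAt A Z iZ C × 2 ^ n * 2 ^ p₂ ≤ 2 ^ k * 2 ^ p₂ * # (not ∘ C) + 2 ^ n ×
      BB⊆ A Z (zeroed C) × Supp (zeroed C) S × BB⊆ A Z S × Avoids (suc k) s S

    -- Sets that contain a configuration on `A` and `Z` inside an unstable container. The gain `m`
    -- pays for the choice of `A`, `Z` and the container.
    Class₂ : Class n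
    Class₂ S = ∃₂ λ A Z → Any (λ C → Unst A Z C S) (proj₁ (c₂ e₂))

    num : ∀ ov y m → ov + ((n + n) + y) ≤ m → m ≤ E → ov + ((E + y) ∸ m) ≤ E ∸ (n + n)
    num ov y m h mE = m+n≤o⇒m≤o∸n _ (+-cancelʳ-≤ y _ _ (begin
      ov + t + (n + n) + y ≡⟨ solve 4 (λ o t n y → o :+ t :+ n :+ y := (o :+ (n :+ y)) :+ t) refl ov t (n + n) y ⟩
      ov + ((n + n) + y) + t ≤⟨ +-monoˡ-≤ t h ⟩
      m + t ≡⟨ m+[n∸m]≡n (≤-trans mE (m≤m+n E y)) ⟩
      E + y ∎))
      where
      open ≤-Reasoning
      open +-*-Solver
      t : ℕ
      t = (E + y) ∸ m

    cov₂ : Cov Class₂ (2 ^ (E ∸ (n + n)))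
    cov₂ = cov-mono (2^-mono le) (cov2-⋃ (n * k) (allTuples n k) (λ A S → ∃ λ Z → Any (λ C → Unst A Z C S) L) (length-allTuples n k)
        (λ A → cov2-⋃ (n * z) (allTuples n z) (λ Z S → Any (λ C → Unst A Z C S) L) (length-allTuples n z)
          (λ Z → cov2-⋃ (2 ^ (n ∸ p₂)) L (λ C S → Unst A Z C S) (proj₁ (proj₂ (c₂ e₂))) (each A Z) (λ S a → a))
          (λ S (Z , a) → any-weaken (λ { refl → a }) (∈-tuples ∈-allVecs Z)))
        (λ S (A , r) → any-weaken (λ { refl → r }) (∈-tuples ∈-allVecs A)))
      where
      L : List (F2^ n → Bool)
      L = proj₁ (c₂ e₂)
      y : ℕ
      y = 2 ^ (n ∸ p₂)
      each : ∀ A Z C → Cov (Unst A Z C) (2 ^ ((E + y) ∸ m))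
      each A Z C with Inj? Z
      ... | no ¬i = cov-∅ λ S q → ¬i (proj₁ q)
      ... | yes iZ with D.stable? A Z iZ C | 2 ^ n * 2 ^ p₂ ≤? 2 ^ k * 2 ^ p₂ * # (not ∘ C) + 2 ^ n | BB? A Z (zeroed C)
      ...   | no ¬st | yes sz | yes bbC = cov-⊆ (λ S q → let (_ , _ , _ , _ , rest) = q in rest)
              (D.cov-unstable A Z iZ C m y gk≤n m≤ room bbC ¬st lowR)
        where
        lowR : N' ≤ # (not ∘ zeroed C) + y
        lowR = ≤-trans (container-upper k p₂ C k≤n p₂≤n sz) (+-monoˡ-≤ y (#-mono λ v e → not-intro (sub v (not-true e))))
          where
          sub : ∀ v → C v ≡ false → zeroed C v ≡ false
          sub v e with v ≟V zeros
          ... | yes _ = refl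
          ... | no _ = e
      ...   | no _ | no ¬sz | _ = cov-∅ λ S q → ¬sz (proj₁ (proj₂ (proj₂ q)))
      ...   | no _ | yes _ | no ¬bb = cov-∅ λ S q → ¬bb (proj₁ (proj₂ (proj₂ (proj₂ q))))
      ...   | yes st | _ | _ = cov-∅ λ S (iZ' , ¬st , sz , bb , supp , bbS , av) → transport iZ' ¬st
        where
        transport : (iZ' : Inj Z) → ¬ D.StableAt A Z iZ' C → ⊥
        transport iZ' ¬st = ¬st st
      open ≤-Reasoning
      le : n * k + (n * z + (y + ((E + y) ∸ m))) ≤ E ∸ (n + n)
      le = ≤-trans (≤-reflexive (trans (cong (n * k +_) (sym (+-assoc (n * z) y _))) (sym (+-assoc (n * k) (n * z + y) _)))) (num (n * k + (n * z + y)) y m ov mE)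

    -- Sets almost disjoint from a subspace ⟨B⟩ of codimension `k`. The gain `m₅` due to the omitted
    -- tiles pays for `A`, `B`, `Y`, `W₀` and the sparse trace on ⟨B⟩.
    Class₃ : Class n
    Class₃ S = ∃₂ λ A B → ∃₂ λ Y W₀ → length W₀ ≤ w × Sparse q₈ (λ v → inSpan B v ∧ S v) ×
      Split {k} {n ∸ k} A B × Inj {D} Y × Starved A B Y W₀ S

    cov₃' : Cov Class₃ (2 ^ (E ∸ (n + n)))
    cov₃' = cov-mono (2^-mono le)
      (cov2-⋃ (n * k) (allTuples n k) _ (length-allTuples n k)
        (λ A → cov2-⋃ (n * (n ∸ k)) (allTuples n (n ∸ k)) _ (length-allTuples n (n ∸ k))
          (λ B → cov2-⋃ ((n ∸ k) * D) (allTuples (n ∸ k) D) _ (length-allTuples (n ∸ k) D)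
            (λ Y → cov2-⋃ (suc n * w) (lists≤ w (allVecs n)) _ (length-lists≤V n w)
              (λ W₀ → cov2-⋃ (2 ^ (n ∸ p₈)) (proj₁ sp₈) (λ T S → length W₀ ≤ w × OnSubspace A B Y W₀ T S) (proj₁ (proj₂ sp₈)) (each A B Y W₀)
                (λ S (lw , sp , spl , iY , st) → any-weaken (λ {T} eq → lw , spl , iY , st , λ v e → trans (sym (cong (_∧ S v) e)) (eq v)) (proj₂ (proj₂ sp₈) (λ v → inSpan B v ∧ S v) sp)))
              (λ S (W₀ , r) → any-weaken (λ { refl → r }) (∈-lists≤ w W₀ ∈-allVecs (proj₁ r))))
            (λ S (Y , r) → any-weaken (λ { refl → r }) (∈-tuples ∈-allVecs Y)))
          (λ S (B , r) → any-weaken (λ { refl → r }) (∈-tuples ∈-allVecs B)))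
        (λ S (A , r) → any-weaken (λ { refl → r }) (∈-tuples ∈-allVecs A)))
      where
      each : ∀ A B Y W₀ T → Cov (λ S → length W₀ ≤ w × OnSubspace {k} {n ∸ k} {n} {D} A B Y W₀ T S) (2 ^ (E ∸ m₅))
      each A B Y W₀ T with length W₀ ≤? w
      ... | no ¬l = cov-∅ λ S q → ¬l (proj₁ q)
      ... | yes l = cov-⊆ (λ S q → proj₂ q) (cov-subspace A B Y W₀ T m₅ (≤-<-trans (*-monoˡ-≤ (2 ^ (k + D)) (+-monoʳ-≤ (2 ^ size-idx {k} nz D * m₅ * size-idx {k} nz D) l)) room₅))
      le : n * k + (n * (n ∸ k) + ((n ∸ k) * D + (suc n * w + (2 ^ (n ∸ p₈) + (E ∸ m₅))))) ≤ E ∸ (n + n)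
      le = ≤-trans (≤-reflexive assoc) (≤-trans (+-monoʳ-≤ ov' (≤-reflexive (cong (_∸ m₅) (sym (+-identityʳ E))))) (num ov' 0 m₅ (≤-trans (≤-reflexive (cong (ov' +_) (+-identityʳ (n + n)))) ov₅) mE₅))
        where
        open +-*-Solver
        ov' : ℕ
        ov' = n * k + (n * (n ∸ k) + ((n ∸ k) * D + (suc n * w + 2 ^ (n ∸ p₈))))
        assoc : n * k + (n * (n ∸ k) + ((n ∸ k) * D + (suc n * w + (2 ^ (n ∸ p₈) + (E ∸ m₅))))) ≡ ov' + (E ∸ m₅)
        assoc = solve 6 (λ a b c d e f → a :+ (b :+ (c :+ (d :+ (e :+ f)))) := a :+ (b :+ (c :+ (d :+ e))) :+ f) refl (n * k) (n * (n ∸ k)) ((n ∸ k) * D) (suc n * w) (2 ^ (n ∸ p₈)) (E ∸ m₅)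

    supp-zeroed : ∀ {S C} → S zeros ≡ false → S ⊆ C → Supp (zeroed C) S
    supp-zeroed {S} {C} s0 sub v e with v ≟V zeros
    ... | yes refl = s0
    ... | no _ = ⊆⇒Supp sub v e

    third : ∀ S → GoodSet k s D w n S → ∀ A Z (iZ : Inj Z) C → Supp (zeroed C) S → D.StableAt A Z iZ C → ¬ ¬ Class₃ S
    third S (s0 , av , thin) A Z iZ C supp (hR , h₃ , h₄) no3 = go (stability (zeroed C) (update-same zeros false C) A Z iZ Y₀ iY₀ g' z'≡ z≡ kg (≤-trans (m≤m+n g k) gk≤n) hR h₃ h₄)
      where
      go : (∃ λ (B : Vec (F2^ n) (n ∸ k)) → Inj B × # (λ v → inSpan B v ∧ zeroed C v) ≤ 2 ^ (n ∸ g') + 2 ^ (n ∸ g')) → ⊥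
      go (B , iB , small) = go' (splitting B iB)
        where
        sparse : Sparse q₈ (λ v → inSpan B v ∧ S v)
        sparse = ≤-trans (*-monoˡ-≤ (2 ^ q₈) (≤-trans (#-mono λ v e → ∧-intro (proj₁ (∧-true e)) (≢false⇒true λ e' → true≢false (proj₂ (∧-true {inSpan B v} e)) (supp v e'))) small)) gq
        go'' : ∀ j (A' : Vec (F2^ n) j) → Split A' B → j ≡ k → ⊥
        go'' .k A' sp refl = thin A' B sp λ (Y , W₀ , iY , lw , st) → no3 (A' , B , Y , W₀ , lw , sparse , sp , iY , st)
        go' : (Σ ℕ λ j → Σ (Vec (F2^ n) j) λ A' → Split A' B) → ⊥
        go' (j , A' , sp) = go'' j A' sp (+-cancelʳ-≡ (n ∸ k) j k (trans (sym (split-dims sp)) (sym (m+[n∸m]≡n k≤n))))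

    classify : ∀ S → GoodSet k s D w n S → ¬ ¬ (Class₁ S ⊎ (Class₂ S ⊎ Class₃ S))
    classify S good@(s0 , av , thin) none = go (∃-dec enumVT λ A → ∃-dec enumVT λ Y → Inj? Y ×-dec BB? A (e₁ ⊙ Y) S)
      where
      go : Dec (∃₂ λ (A : Vec (F2^ n) k) (Y : Vec (F2^ z₁) z) → Inj Y × BB⊆ A (e₁ ⊙ Y) S) → ⊥
      go (no ¬bb) = none (inj₁ (proj₂ (proj₂ (c₁ e₁)) (emb-Inj z₁≤n) S s0 λ A Y iY bb → ¬bb (A , Y , iY , bb)))
      go (yes (A , Y , iY , bb)) = go' (find (proj₂ (proj₂ (c₂ e₂)) (emb-Inj z₂≤n) S s0 λ A Y iY → av A (e₂ ⊙ Y) (Inj-⊙ e₂ Y (emb-Inj z₂≤n) iY)))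
        where
        Z : Vec (F2^ n) z
        Z = e₁ ⊙ Y
        iZ : Inj Z
        iZ = Inj-⊙ e₁ Y (emb-Inj z₁≤n) iY
        go' : (∃ λ C → C ∈ proj₁ (c₂ e₂) × Container k p₂ S C) → ⊥
        go' (C , mem , sub , size) = go'' (D.stable? A Z iZ C)
          where
          supp : Supp (zeroed C) S
          supp = supp-zeroed {S} {C} s0 sub
          go'' : Dec (D.StableAt A Z iZ C) → ⊥
          go'' (yes st) = third S good A Z iZ C supp st λ c → none (inj₂ (inj₂ c))
          go'' (no ¬st) = none (inj₂ (inj₁ (A , Z , lose mem (iZ , ¬st , size ,
            (λ c ne v → ≢false⇒true λ e → true≢false (bb c ne v) (supp _ e)) , supp , bb , av))))

    -- Each class leaves at most 2^(E-2n) sets. Their number, three, rounded up to 4, is paid by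
    -- `2 ≤ n`; one spare factor 2^-n remains for the final ratio.
    assemble : Cov (GoodSet k s D w n) (2 ^ (E ∸ n))
    assemble = cov-mono le (cov-stable classify (cov-∪ (λ S c → c) cov₁ (cov-∪ {Q = λ S → Class₂ S ⊎ Class₃ S} (λ S c → c) cov₂ cov₃')))
      where
      open ≤-Reasoning
      x : ℕ
      x = 2 ^ (E ∸ (n + n))
      le : x + (x + x) ≤ 2 ^ (E ∸ n)
      le = begin
        x + (x + x) ≤⟨ +-monoˡ-≤ (x + x) (m≤m+n x x) ⟩
        (x + x) + (x + x) ≡⟨ trans (cong (λ y → y + y) (2*2^ (E ∸ (n + n)))) (2*2^ (suc (E ∸ (n + n)))) ⟩
        2 ^ (2 + (E ∸ (n + n))) ≤⟨ 2^-mono (m+n≤o⇒m≤o∸n (2 + (E ∸ (n + n))) (begin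
          2 + (E ∸ (n + n)) + n ≤⟨ +-monoˡ-≤ n (+-monoˡ-≤ (E ∸ (n + n)) 2≤n) ⟩
          n + (E ∸ (n + n)) + n ≡⟨ solve 2 (λ n t → n :+ t :+ n := t :+ (n :+ n)) refl n (E ∸ (n + n)) ⟩
          E ∸ (n + n) + (n + n) ≡⟨ m∸n+n≡m 2n≤E ⟩
          E ∎)) ⟩
        2 ^ (E ∸ n) ∎
        where open +-*-Solver

-- Choice of the parameters

∈⇒≤sum : ∀ {x} (xs : List ℕ) → x ∈ xs → x ≤ sum xs
∈⇒≤sum (x ∷ xs) (here refl) = m≤m+n x _
∈⇒≤sum (x ∷ xs) (there p) = ≤-trans (∈⇒≤sum xs p) (m≤n+m _ x)

room-bound : ∀ n k z g h bm b → b ≤ bm → h ≡ bm + bm + (k + z + suc g) → h ≤ n →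
  (2 ^ b * 2 ^ (n ∸ h) * b * 2 ^ (k + z) + 2 ^ b * 2 ^ (n ∸ h) * b * 2 ^ (k + z)) * 2 ^ g ≤ 2 ^ n
room-bound n k z g h bm b b≤ h≡ h≤n = begin
  (2 ^ b * M * b * P + 2 ^ b * M * b * P) * 2 ^ g
    ≡⟨ solve 5 (λ B M b P G → (B :* M :* b :* P :+ B :* M :* b :* P) :* G := M :* ((B :* b) :* (P :* (con 2 :* G)))) refl (2 ^ b) M b P (2 ^ g) ⟩
  M * ((2 ^ b * b) * (P * 2 ^ suc g))
    ≤⟨ *-monoʳ-≤ M (*-monoˡ-≤ (P * 2 ^ suc g) (*-mono-≤ (2^-mono b≤) (≤-trans b≤ (<⇒≤ (n<2^n bm))))) ⟩
  M * ((2 ^ bm * 2 ^ bm) * (P * 2 ^ suc g))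
    ≡⟨ cong (M *_) (trans (cong₂ _*_ (sym (^-distribˡ-+-* 2 bm bm)) (sym (^-distribˡ-+-* 2 (k + z) (suc g)))) (sym (^-distribˡ-+-* 2 (bm + bm) (k + z + suc g)))) ⟩
  M * 2 ^ (bm + bm + (k + z + suc g)) ≡⟨ cong (λ x → M * 2 ^ x) (sym h≡) ⟩
  M * 2 ^ h ≡⟨ 2^-split h≤n ⟩
  2 ^ n ∎
  where
  open ≤-Reasoning
  open +-*-Solver
  M P : ℕ
  M = 2 ^ (n ∸ h)
  P = 2 ^ (k + z)

ov-bound : ∀ n k z h → h + 3 ≤ n → (k + z + 2) * (n * n) + (k + z + 2) ≤ 2 ^ (n ∸ suc h) →
  n * k + (n * z + 2 ^ (n ∸ (h + 3))) + ((n + n) + 2 ^ (n ∸ (h + 3))) ≤ 2 ^ (n ∸ h)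
ov-bound n k z h h3≤n po = begin
  n * k + (n * z + y) + ((n + n) + y)
    ≡⟨ solve 4 (λ n k z y → n :* k :+ (n :* z :+ y) :+ ((n :+ n) :+ y) := n :* (k :+ z :+ con 2) :+ (y :+ y)) refl n k z y ⟩
  n * (k + z + 2) + (y + y) ≤⟨ +-mono-≤ (≤-trans (≤-trans (≤-reflexive (*-comm n _)) (*-monoʳ-≤ (k + z + 2) (nn n))) (≤-trans (m≤m+n _ (k + z + 2)) po)) yy ⟩
  2 ^ (n ∸ suc h) + 2 ^ (n ∸ suc h) ≡⟨ 2^-half (≤-trans (≤-trans (m≤n+m (suc h) 2) (≤-reflexive (+-comm 3 h))) h3≤n) ⟩
  2 ^ (n ∸ h) ∎
  where
  open ≤-Reasoning
  open +-*-Solver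
  nn : ∀ n → n ≤ n * n
  nn zero = z≤n
  nn (suc n) = m≤m+n (suc n) (n * suc n)
  y : ℕ
  y = 2 ^ (n ∸ (h + 3))
  yy : y + y ≤ 2 ^ (n ∸ suc h)
  yy = ≤-trans (≤-reflexive (trans (cong (λ x → 2 ^ (n ∸ x) + 2 ^ (n ∸ x)) (+-comm h 3)) (2^-half {2 + h} (≤-trans (≤-reflexive (+-comm 3 h)) h3≤n))))
    (2^-mono (∸-monoʳ-≤ n (n≤1+n (suc h))))

ov₅-bound : ∀ n k D w c h → k ≤ n → suc h ≤ n → suc n * w ≤ c * (n * n) + c → (1 + D + c + 2) * (n * n) + (1 + D + c + 2) ≤ 2 ^ (n ∸ suc h) →
  n * k + (n * (n ∸ k) + ((n ∸ k) * D + (suc n * w + 2 ^ (n ∸ suc h)))) + (n + n) ≤ 2 ^ (n ∸ h)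
ov₅-bound n k D w c h k≤n h<n hw po = begin
  n * k + (n * (n ∸ k) + ((n ∸ k) * D + (suc n * w + y))) + (n + n)
    ≤⟨ +-monoˡ-≤ (n + n) (+-monoʳ-≤ (n * k) (+-monoʳ-≤ (n * (n ∸ k)) (+-mono-≤ (≤-trans (*-monoˡ-≤ D (m∸n≤m n k)) (≤-trans (≤-reflexive (*-comm n D)) (*-monoʳ-≤ D (nn n)))) (+-monoˡ-≤ y hw)))) ⟩
  n * k + (n * (n ∸ k) + (D * (n * n) + ((c * (n * n) + c) + y))) + (n + n)
    ≡⟨ solve 8 (λ nk nnk D q c y n m → nk :+ (nnk :+ (D :* q :+ ((c :* q :+ c) :+ y))) :+ (n :+ n) := (nk :+ nnk) :+ (D :* q :+ (c :* q :+ c) :+ (n :+ n)) :+ y) refl (n * k) (n * (n ∸ k)) D (n * n) c y n 0 ⟩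
  (n * k + n * (n ∸ k)) + (D * (n * n) + (c * (n * n) + c) + (n + n)) + y
    ≡⟨ cong (λ x → x + (D * (n * n) + (c * (n * n) + c) + (n + n)) + y) (trans (sym (*-distribˡ-+ n k (n ∸ k))) (cong (n *_) (m+[n∸m]≡n k≤n))) ⟩
  n * n + (D * (n * n) + (c * (n * n) + c) + (n + n)) + y
    ≤⟨ +-monoˡ-≤ y (+-monoʳ-≤ (n * n) (+-mono-≤ (+-monoʳ-≤ (D * (n * n)) (+-monoʳ-≤ (c * (n * n)) (m≤m+n c (3 + D)))) (+-mono-≤ (nn n) (nn n)))) ⟩
  n * n + (D * (n * n) + (c * (n * n) + (c + (3 + D))) + (n * n + n * n)) + y
    ≡⟨ cong (_+ y) (solve 3 (λ q D c → q :+ (D :* q :+ (c :* q :+ (c :+ (con 3 :+ D))) :+ (q :+ q)) := (con 1 :+ D :+ c :+ con 2) :* q :+ (con 1 :+ D :+ c :+ con 2)) refl (n * n) D c) ⟩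
  (1 + D + c + 2) * (n * n) + (1 + D + c + 2) + y ≤⟨ +-monoˡ-≤ y po ⟩
  y + y ≡⟨ 2^-half h<n ⟩
  2 ^ (n ∸ h) ∎
  where
  open ≤-Reasoning
  open +-*-Solver
  nn : ∀ n → n ≤ n * n
  nn zero = z≤n
  nn (suc n) = m≤m+n (suc n) (n * suc n)
  y : ℕ
  y = 2 ^ (n ∸ suc h)

room₅-bound : ∀ n k D b w c h → h ≡ b + b + (k + D + (k + 2)) → h ≤ n → suc n * w ≤ c * (n * n) + c →
  c * (n * n) + c ≤ 2 ^ (n ∸ (k + D + (k + 2))) → (2 ^ b * 2 ^ (n ∸ h) * b + w) * 2 ^ (k + D) < 2 ^ (n ∸ k)
room₅-bound n k D b w c h h≡ h≤n hw po = begin-strict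
  (2 ^ b * M * b + w) * P ≡⟨ *-distribʳ-+ P (2 ^ b * M * b) w ⟩
  2 ^ b * M * b * P + w * P ≤⟨ +-mono-≤ first second ⟩
  x + x <⟨ m<m+n (x + x) (≤-trans (2^>0 (n ∸ (k + 2))) (m≤m+n x x)) ⟩
  (x + x) + (x + x) ≡⟨ cong (λ t → t + t) half ⟩
  2 ^ (n ∸ suc k) + 2 ^ (n ∸ suc k) ≡⟨ 2^-half (≤-trans (≤-trans (n≤1+n (suc k)) (≤-reflexive (+-comm 2 k))) k2≤n) ⟩
  2 ^ (n ∸ k) ∎
  where
  open ≤-Reasoning
  open +-*-Solver
  M P x t : ℕ
  M = 2 ^ (n ∸ h)
  P = 2 ^ (k + D)
  x = 2 ^ (n ∸ (k + 2))
  t = k + D + (k + 2)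
  t≤h : t ≤ h
  t≤h = ≤-trans (m≤n+m t (b + b)) (≤-reflexive (sym h≡))
  k2≤n : k + 2 ≤ n
  k2≤n = ≤-trans (≤-trans (m≤n+m (k + 2) (k + D)) t≤h) h≤n
  half : x + x ≡ 2 ^ (n ∸ suc k)
  half = trans (cong (λ y → 2 ^ (n ∸ y) + 2 ^ (n ∸ y)) (+-comm k 2)) (2^-half {suc k} (≤-trans (≤-reflexive (+-comm 2 k)) k2≤n))
  first : 2 ^ b * M * b * P ≤ x
  first = *2^-cancel (k + 2) (begin
    2 ^ b * M * b * P * 2 ^ (k + 2) ≡⟨ solve 5 (λ B M b P K → B :* M :* b :* P :* K := M :* ((B :* b) :* (P :* K))) refl (2 ^ b) M b P (2 ^ (k + 2)) ⟩
    M * ((2 ^ b * b) * (P * 2 ^ (k + 2))) ≤⟨ *-monoʳ-≤ M (*-monoˡ-≤ (P * 2 ^ (k + 2)) (*-monoʳ-≤ (2 ^ b) (<⇒≤ (n<2^n b)))) ⟩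
    M * ((2 ^ b * 2 ^ b) * (P * 2 ^ (k + 2))) ≡⟨ cong (M *_) (trans (cong₂ _*_ (sym (^-distribˡ-+-* 2 b b)) (sym (^-distribˡ-+-* 2 (k + D) (k + 2)))) (sym (^-distribˡ-+-* 2 (b + b) t))) ⟩
    M * 2 ^ (b + b + t) ≡⟨ cong (λ y → M * 2 ^ y) (sym h≡) ⟩
    M * 2 ^ h ≡⟨ trans (2^-split h≤n) (sym (2^-split k2≤n)) ⟩
    x * 2 ^ (k + 2) ∎)
  second : w * P ≤ x
  second = *2^-cancel (k + 2) (begin
    w * P * 2 ^ (k + 2) ≡⟨ trans (*-assoc w P (2 ^ (k + 2))) (cong (w *_) (sym (^-distribˡ-+-* 2 (k + D) (k + 2)))) ⟩
    w * 2 ^ t ≤⟨ *-monoˡ-≤ (2 ^ t) (≤-trans (m≤m+n w (n * w)) (≤-trans hw po)) ⟩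
    2 ^ (n ∸ t) * 2 ^ t ≡⟨ trans (2^-split (≤-trans t≤h h≤n)) (sym (2^-split k2≤n)) ⟩
    x * 2 ^ (k + 2) ∎)

2n≤-bound : ∀ n j → 2 * (n * n) + 2 ≤ 2 ^ j → n + n ≤ 2 ^ j
2n≤-bound n j h = ≤-trans (≤-trans (+-mono-≤ (nn n) (≤-trans (nn n) (≤-reflexive (sym (+-identityʳ _))))) (m≤m+n _ 2)) h
  where
  nn : ∀ n → n ≤ n * n
  nn zero = z≤n
  nn (suc n) = m≤m+n (suc n) (n * suc n)

ov₁-bound : ∀ n k → k + 3 ≤ n → n + n ≤ 2 ^ (n ∸ (k + 2)) → 2 ^ (n ∸ (k + 3)) + (2 ^ (n ∸ (k + 3)) + (n + n)) ≤ 2 ^ (n ∸ k)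
ov₁-bound n k le h = begin
  y + (y + (n + n)) ≡⟨ sym (+-assoc y y (n + n)) ⟩
  y + y + (n + n) ≤⟨ +-mono-≤ (≤-reflexive yy) h ⟩
  x + x ≡⟨ trans (cong (λ t → 2 ^ (n ∸ t) + 2 ^ (n ∸ t)) (+-comm k 2)) (2^-half {suc k} (≤-trans (n≤1+n (2 + k)) le')) ⟩
  2 ^ (n ∸ suc k) ≤⟨ 2^-mono (∸-monoʳ-≤ n (n≤1+n k)) ⟩
  2 ^ (n ∸ k) ∎
  where
  open ≤-Reasoning
  x y : ℕ
  x = 2 ^ (n ∸ (k + 2))
  y = 2 ^ (n ∸ (k + 3))
  le' : 3 + k ≤ n
  le' = ≤-trans (≤-reflexive (+-comm 3 k)) le
  yy : y + y ≡ x
  yy = trans (cong (λ t → 2 ^ (n ∸ t) + 2 ^ (n ∸ t)) (+-comm k 3)) (trans (2^-half {2 + k} le') (cong (λ t → 2 ^ (n ∸ t)) (+-comm 2 k)))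

E≥N' : ∀ n κ → suc κ ≤ n → 2 ^ (n ∸ suc κ) ≤ 2 ^ n ∸ 2 ^ (n ∸ suc κ)
E≥N' n κ le = m+n≤o⇒m≤o∸n _ (≤-trans (≤-reflexive (2^-half {κ} le)) (2^-mono (m∸n≤m n κ)))

abstract
  set-count : ∀ κ s D (w : ℕ → ℕ) c → (∀ n → suc n * w n ≤ c * (n * n) + c) →
    Σ ℕ λ n₀ → ∀ n → n₀ ≤ n → Cov (GoodSet (suc κ) s D (w n) n) (2 ^ ((2 ^ n ∸ 2 ^ (n ∸ suc κ)) ∸ n))
  set-count κ s D w c hw = sum ts , main
    where
    k b₅ h₅ p₈ q₈ g' g z' z bm h p₂ p₁ z₁ n₁ z₂ n₂ : ℕ
    k = suc κ
    -- Each precision depends on the ones above it: the gain from starved sets fixes `h₅`, the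
    -- traces must be cheaper than this gain (`p₈`), stability must produce traces that sparse
    -- (`g'`), the flats must exist at that density (`z'`, `z`), and the containers must cost less
    -- than the gain from instability (`p₂` against `h`).
    b₅ = size-idx {k} nz D
    h₅ = b₅ + b₅ + (k + D + (k + 2))
    p₈ = suc h₅
    q₈ = proj₁ (cov-sparse p₈)
    g' = suc q₈ + (4 + k)
    g = g' + (2 + k)
    z' = proj₁ (flat s g)
    z = proj₁ (flat z' g)
    bm = 2 ^ (suc k + s)
    h = bm + bm + (k + z + suc g)
    p₂ = h + 3
    p₁ = k + 3
    z₁ = proj₁ (containers κ z p₁)
    n₁ = proj₁ (proj₂ (containers κ z p₁))
    z₂ = proj₁ (containers k s p₂)
    n₂ = proj₁ (proj₂ (containers k s p₂))
    po₁ : Poly (k + z + 2) (suc h)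
    po₁ = poly (k + z + 2) (suc h)
    po₂ : Poly (1 + D + c + 2) (suc h₅)
    po₂ = poly (1 + D + c + 2) (suc h₅)
    po₃ : Poly c (k + D + (k + 2))
    po₃ = poly c (k + D + (k + 2))
    po₄ : Poly 2 (k + 2)
    po₄ = poly 2 (k + 2)
    ts : List ℕ
    ts = n₁ ∷ n₂ ∷ z₁ ∷ z₂ ∷ q₈ ∷ g + k ∷ p₁ ∷ p₂ ∷ suc h₅ ∷ proj₁ po₁ ∷ proj₁ po₂ ∷ proj₁ po₃ ∷ proj₁ po₄ ∷ 2 ∷ []
    -- The whole space is dense, so `flat` applied to it yields `s` independent directions.
    Y₀ : ∃₂ λ (y : F2^ z') (Y : Vec (F2^ z') s) → Inj Y × (∀ (v : F2^ s) → true ≡ true)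
    Y₀ = proj₂ (flat s g) (λ _ → true) (≤-trans (≤-reflexive (sym (*-identityʳ (2 ^ z')))) (*-mono-≤ (≤-reflexive (sym (#-all z'))) (2^>0 g)))
    main : ∀ n → sum ts ≤ n → Cov (GoodSet (suc κ) s D (w n) n) (2 ^ ((2 ^ n ∸ 2 ^ (n ∸ suc κ)) ∸ n))
    main n le = Assemble.assemble κ s D n (w n) z' z g' p₁ p₂ z₁ z₂ p₈ q₈ (2 ^ (n ∸ h)) (2 ^ (n ∸ h₅))
        refl refl (proj₁ (proj₂ Y₀)) (proj₁ (proj₂ (proj₂ Y₀)))
        (proj₂ (proj₂ (containers κ z p₁)) n (th (here refl)))
        (proj₂ (proj₂ (containers k s p₂)) n (th (there (here refl))))
        (th (there (there (here refl)))) (th (there (there (there (here refl)))))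
        (proj₂ (proj₂ (cov-sparse p₈)) n (th (there (there (there (there (here refl)))))))
        (m≤n+m (4 + k) (suc q₈)) gk≤n (th (there (there (there (there (there (there (here refl)))))))) p₂≤n
        gq (2^-mono (∸-monoʳ-≤ n gk≤h)) (λ b hb → room-bound n k z g h bm b hb refl h≤n)
        (ov-bound n k z h p₂≤n (proj₂ po₁ n (th (there (there (there (there (there (there (there (there (there (here refl)))))))))))))
        (≤-trans (2^-mono (∸-monoʳ-≤ n (≤-trans (m≤n+m k g) gk≤h))) (E≥N' n κ k≤n))
        (room₅-bound n k D b₅ (w n) c h₅ refl (≤-trans (n≤1+n h₅) h₅<n) (hw n) (proj₂ po₃ n (th (there (there (there (there (there (there (there (there (there (there (there (here refl))))))))))))) ))
        (ov₅-bound n k D (w n) c h₅ k≤n h₅<n (hw n) (proj₂ po₂ n (th (there (there (there (there (there (there (there (there (there (there (here refl)))))))))))) ))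
        (≤-trans (2^-mono (∸-monoʳ-≤ n k≤h₅)) (E≥N' n κ k≤n))
        (ov₁-bound n k (th (there (there (there (there (there (there (here refl)))))))) 2n≤x)
        (th (there (there (there (there (there (there (there (there (there (there (there (there (there (here refl)))))))))))))))
        (≤-trans 2n≤x (≤-trans (2^-mono (∸-monoʳ-≤ n (m≤m+n k 2))) (E≥N' n κ k≤n)))
      where
      th : ∀ {x} → x ∈ ts → x ≤ n
      th p = ≤-trans (∈⇒≤sum ts p) le
      gk≤n : g + k ≤ n
      gk≤n = th (there (there (there (there (there (here refl))))))
      k≤n : k ≤ n
      k≤n = ≤-trans (m≤n+m k g) gk≤n
      p₂≤n : p₂ ≤ n
      p₂≤n = th (there (there (there (there (there (there (there (here refl))))))))
      h≤n : h ≤ n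
      h≤n = ≤-trans (m≤m+n h 3) p₂≤n
      h₅<n : suc h₅ ≤ n
      h₅<n = th (there (there (there (there (there (there (there (there (here refl)))))))))
      gk≤h : g + k ≤ h
      gk≤h = ≤-trans (≤-reflexive (+-comm g k)) (≤-trans (+-mono-≤ (m≤m+n k z) (n≤1+n g)) (m≤n+m _ (bm + bm)))
      k≤h₅ : k ≤ h₅
      k≤h₅ = ≤-trans (≤-trans (m≤m+n k 2) (m≤n+m (k + 2) (k + D))) (m≤n+m _ (b₅ + b₅))
      2n≤x : n + n ≤ 2 ^ (n ∸ (k + 2))
      2n≤x = 2n≤-bound n (n ∸ (k + 2)) (proj₂ po₄ n (th (there (there (there (there (there (there (there (there (there (there (there (there (here refl)))))))))))))))
      gq : (2 ^ (n ∸ g') + 2 ^ (n ∸ g')) * 2 ^ q₈ ≤ 2 ^ n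
      gq = begin
        (2 ^ (n ∸ g') + 2 ^ (n ∸ g')) * 2 ^ q₈ ≡⟨ solve 2 (λ d q → (d :+ d) :* q := d :* (con 2 :* q)) refl (2 ^ (n ∸ g')) (2 ^ q₈) ⟩
        2 ^ (n ∸ g') * 2 ^ suc q₈ ≤⟨ *-monoʳ-≤ (2 ^ (n ∸ g')) (2^-mono (m≤m+n (suc q₈) (4 + k))) ⟩
        2 ^ (n ∸ g') * 2 ^ g' ≡⟨ 2^-split (≤-trans (m≤m+n g' (2 + k)) (≤-trans (m≤m+n g k) gk≤n)) ⟩
        2 ^ n ∎
        where open ≤-Reasoning
              open +-*-Solver

-- Properties of matroids

idCols : ∀ {n} → Vec (F2^ n) n
idCols = columns id

lin-id : ∀ {n} (v : F2^ n) → lin idCols v ≡ v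
lin-id = lin-columns id (λ _ _ → refl)

colsOf : ∀ {m n} → LinMap m n → Vec (F2^ n) m
colsOf A = columns (apply A)

lin-colsOf : ∀ {m n} (A : LinMap m n) v → lin (colsOf A) v ≡ apply A v
lin-colsOf A = lin-columns (apply A) (apply-⊕ A)

Injective-≢0 : ∀ {m n} (A : LinMap m n) → Injective A → ∀ {v} → v ≢ zeros → apply A v ≢ zeros
Injective-≢0 A inj ne e = ne (inj _ e)

compose : ∀ {l m n} → LinMap m n → LinMap l m → LinMap l n
compose A B = matrix (colsOf A ⊙ colsOf B)

apply-compose : ∀ {l m n} (A : LinMap m n) (B : LinMap l m) v → apply (compose A B) v ≡ apply A (apply B v)
apply-compose A B v = trans (apply-matrix (colsOf A ⊙ colsOf B) v) (trans (lin-⊙ (colsOf A) (colsOf B) v) (trans (lin-colsOf A _) (cong (apply A) (lin-colsOf B v))))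

compose-injective : ∀ {l m n} (A : LinMap m n) (B : LinMap l m) → Injective A → Injective B → Injective (compose A B)
compose-injective A B iA iB v e = iB v (iA _ (trans (sym (apply-compose A B v)) e))

invertible-injective : ∀ {n} (A : LinMap n n) → Invertible A → Injective A
invertible-injective A (B , BA , _) v e = trans (sym (BA v)) (trans (cong (apply B) (trans e (sym (additive-zero (apply A) (apply-⊕ A)))))
  (trans (BA zeros) refl))

prefixCols : ∀ q {n} → Vec (F2^ (q + n)) n
prefixCols q = columns (zeros {q} ++ᵛ_)

lin-prefixCols : ∀ q {n} (v : F2^ n) → lin (prefixCols q) v ≡ zeros {q} ++ᵛ v
lin-prefixCols q = lin-columns (zeros {q} ++ᵛ_) (λ u v → sym (trans (⊕-++ (zeros {q}) zeros u v) (cong (_++ᵛ (u ⊕ v)) (⊕-self zeros))))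

prefixCols-Inj : ∀ q {n} → Inj (prefixCols q {n})
prefixCols-Inj q v e = proj₂ (++-zeros (zeros {q}) v (trans (sym (lin-prefixCols q v)) e))

≡⇒Inj : ∀ {m n} (as : Vec (F2^ n) m) (f : F2^ n → F2^ m) → f zeros ≡ zeros → (∀ v → f (lin as v) ≡ v) → Inj as
≡⇒Inj as f f0 h v e = trans (sym (h v)) (trans (cong f e) f0)

drop-++ : ∀ {A : Set} {m n} (a : Vec A m) (b : Vec A n) → V.drop m (a ++ᵛ b) ≡ b
drop-++ [] b = refl
drop-++ (x ∷ a) b = drop-++ a b

module Prop (P : Property) (isP : IsProperty P) (her : Hereditary P) where

  ext : ∀ {n} {M M' : Matroid n} → (∀ v → NonZero v → M v ≡ M' v) → P n M → P n M'
  ext {n} {M} {M'} h p = isP n M' M I (I , inv , inv) (λ v nz → trans (sym (h v nz)) (cong M (sym (Iv v)))) p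
    where
    I : LinMap n n
    I = matrix idCols
    Iv : ∀ v → apply I v ≡ v
    Iv v = trans (apply-matrix idCols v) (lin-id v)
    inv : ∀ v → apply I (apply I v) ≡ v
    inv v = trans (Iv _) (Iv v)

  restrict : ∀ {m n} (as : Vec (F2^ n) m) → Inj as → {M : Matroid n} → P n M → P m (M ∘ lin as)
  restrict {m} {n} as inj {M} p = ext (λ v _ → cong M (apply-matrix as v)) (her m n M (matrix as) (matrix-injective as inj) p)

  -- Together with heredity this expresses 𝓜(k+1,i) ⊆ P at dimension D.
  Full : ℕ → Bool → ℕ → Set
  Full k i D = (F : Matroid (k + suc D)) → (∀ v → NonZero v → F (zeros {k} ++ᵛ (false ∷ v)) ≡ i) → P (k + suc D) F

  full-shift : ∀ k i D → Full k i D → (F : Matroid (suc k + D)) → (∀ v → NonZero v → F (zeros {suc k} ++ᵛ v) ≡ i) → P (suc k + D) F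
  full-shift k i D full F const = ext (λ x _ → cong F (trans (cong unshift (lin-columns shift shift-⊕ x)) (un-shift x)))
      (restrict (columns shift) inj (full (F ∘ unshift) λ v nzv → trans (cong F (un-zeros v)) (const v nzv)))
    where
    unshift : F2^ (k + suc D) → F2^ (suc k + D)
    unshift x = head (V.drop k x) ∷ (V.take k x ++ᵛ tail (V.drop k x))
    shift : F2^ (suc k + D) → F2^ (k + suc D)
    shift (b ∷ x) = V.take k x ++ᵛ (b ∷ V.drop k x)
    un-++ : ∀ (c : F2^ k) b v → unshift (c ++ᵛ (b ∷ v)) ≡ b ∷ (c ++ᵛ v)
    un-++ c b v = cong₂ (λ p q → head q ∷ (p ++ᵛ tail q)) (take-++ c (b ∷ v)) (drop-++ c (b ∷ v))
    un-zeros : ∀ v → unshift (zeros {k} ++ᵛ (false ∷ v)) ≡ zeros {suc k} ++ᵛ v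
    un-zeros v = un-++ zeros false v
    un-shift : ∀ x → unshift (shift x) ≡ x
    un-shift (b ∷ x) with V.splitAt k x
    ... | c , v , refl = un-++ c b v
    shift-⊕ : Additive shift
    shift-⊕ (b ∷ x) (b' ∷ x') with V.splitAt k x | V.splitAt k x'
    ... | c , v , refl | c' , v' , refl rewrite ⊕-++ c c' v v' | take-++ (c ⊕ c') (v ⊕ v') | drop-++ (c ⊕ c') (v ⊕ v') = sym (⊕-++ c c' (b ∷ v) (b' ∷ v'))
    inj : Inj (columns shift)
    inj = ≡⇒Inj (columns shift) unshift (trans (cong unshift (sym (zeros-++ k))) (trans (un-++ zeros false zeros) (cong (false ∷_) (zeros-++ k))))
      (λ x → trans (cong unshift (lin-columns shift shift-⊕ x)) (un-shift x))

  -- If M' has codimension j < K over M, it is first lifted to codimension exactly K.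
  full⇒ext : ∀ K i m → ((F : Matroid (K + m)) → (∀ v → NonZero v → F (zeros {K} ++ᵛ v) ≡ i) → P (K + m) F) →
    ∀ {n} (M : Matroid m) (M' : Matroid n) → Const i m M → InExtOf K M M' → P n M'
  full⇒ext K i m full {n} M M' const (n≤ , ψ , inj , agree) = go (splitting as (columns-Inj ψ inj))
    where
    as : Vec (F2^ n) m
    as = colsOf ψ
    go : (Σ ℕ λ j → Σ (Vec (F2^ n) j) λ bs → Split bs as) → P n M'
    go (j , bs , sp) = go' K (K ∸ j) (sym (m∸n+n≡m j≤K)) full
      where
      j≤K : j ≤ K
      j≤K = +-cancelʳ-≤ m j K (≤-trans (≤-reflexive (sym (split-dims sp))) (≤-trans n≤ (≤-reflexive (+-comm m K))))
      open Split sp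
      go' : ∀ K e → K ≡ e + j → ((F : Matroid (K + m)) → (∀ v → NonZero v → F (zeros {K} ++ᵛ v) ≡ i) → P (K + m) F) → P n M'
      go' .(e + j) e refl full = ext (λ w _ → cong M' (trans (cong (lin cs) (lin-columns χ χ-⊕ w)) (sect w)))
          (restrict (columns χ) injχ (full F λ v nzv → trans (cong M' (trans (lin-++ (V.replicate e zeros ++ᵛ bs) as zeros v) (trans (cong (_⊕ lin as v) (lin-zero (V.replicate e zeros ++ᵛ bs))) (trans (⊕-idˡ _) (lin-colsOf ψ v))))) (trans (sym (agree v nzv)) (const v nzv))))
        where
        cs : Vec (F2^ n) ((e + j) + m)
        cs = (V.replicate e zeros ++ᵛ bs) ++ᵛ as
        F : Matroid ((e + j) + m)
        F x = M' (lin cs x)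
        χ : F2^ n → F2^ ((e + j) + m)
        χ w = (zeros {e} ++ᵛ proj₁ (from w)) ++ᵛ proj₂ (from w)
        sect : ∀ w → lin cs (χ w) ≡ w
        sect w = trans (lin-++ (V.replicate e zeros ++ᵛ bs) as _ _) (trans (cong (_⊕ lin as (proj₂ (from w)))
          (trans (lin-++ (V.replicate e zeros) bs zeros (proj₁ (from w))) (trans (cong (_⊕ lin bs (proj₁ (from w))) (lin-zero (V.replicate e zeros))) (⊕-idˡ _)))) (to-from w))
        from-⊕ : ∀ u w → from (u ⊕ w) ≡ (proj₁ (from u) ⊕ proj₁ (from w) , proj₂ (from u) ⊕ proj₂ (from w))
        from-⊕ u w = trans (cong from (trans (cong₂ _⊕_ (sym (to-from u)) (sym (to-from w))) (trans (⊕-interchange (lin bs (proj₁ (from u))) (lin as (proj₂ (from u))) _ _) (cong₂ _⊕_ (sym (lin-⊕ bs _ _)) (sym (lin-⊕ as _ _)))))) (from-to _ _)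
        χ-⊕ : Additive χ
        χ-⊕ u w = trans (cong (λ t → (zeros {e} ++ᵛ proj₁ t) ++ᵛ proj₂ t) (from-⊕ u w)) (sym (trans (⊕-++ (zeros {e} ++ᵛ proj₁ (from u)) (zeros {e} ++ᵛ proj₁ (from w)) _ _)
          (cong (_++ᵛ (proj₂ (from u) ⊕ proj₂ (from w))) (trans (⊕-++ (zeros {e}) zeros _ _) (cong (λ t → t ++ᵛ (proj₁ (from u) ⊕ proj₁ (from w))) (⊕-self (zeros {e})))))))
        injχ : Inj (columns χ)
        injχ = ≡⇒Inj (columns χ) (lin cs) (lin-zero cs) (λ w → trans (cong (lin cs) (lin-columns χ χ-⊕ w)) (sect w))

-- The thin property

module Target (P : Property) (isP : IsProperty P) (her : Hereditary P) (k : ℕ) (f : ℕ → ℕ) where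
  open Prop P isP her

  -- `P` omits a member of 𝓜(κ+1,0) and a member of 𝓜(κ+1,1), both constant on a subspace of the
  -- same dimension `d`, so that a monochromatic subspace of dimension `d` can be used whatever its
  -- colour.
  Wit MinWit : ℕ → ℕ → Set
  Wit κ d = ¬ Full κ false d × ¬ Full κ true d
  MinWit κ d = Wit κ d × (∀ d' → d' < d → ¬ Wit κ d')

  MinWit-unique : ∀ {κ d d'} → MinWit κ d → MinWit κ d' → d ≡ d'
  MinWit-unique {κ} {d} {d'} (w , m) (w' , m') = ≤-antisym (≮⇒≥ λ l → m d' l w') (≮⇒≥ λ l → m' d l w)

  ¬¬MinWit : ∀ κ d → Wit κ d → ¬ ¬ (∃ λ d' → MinWit κ d')
  ¬¬MinWit κ d w none = <-rec (λ d → ¬ Wit κ d) (λ d ih w → none (d , w , λ d' l → ih l)) d w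

  -- No function bounds the least witness d in terms of κ constructively. Relaxing T
  -- while n < f d makes it independent of such a bound.
  Escape : ℕ → ℕ → Set
  Escape D n = Σ ℕ λ κ → k ≤ κ × κ ≤ k + D × Σ ℕ λ d → MinWit κ d × n < f d

  Escape-mono : ∀ {D m n} → m ≤ n → Escape D n → Escape D m
  Escape-mono le (κ , a , b , d , mw , l) = κ , a , b , d , mw , ≤-<-trans le l

  -- Each of the finitely many κ has at most one least witness, so that once an escape
  -- through κ has been seen, it is closed from f d onwards.
  no-escape : ∀ {X : Set} D e₀ → (∀ e → e₀ ≤ e → X ⊎ Escape D e) → X
  no-escape {X} D e₀ h = go (suc D) (L.map (k +_) (L.upTo (suc D))) (≤-reflexive (trans (length-map (k +_) (L.upTo (suc D))) (length-upTo (suc D)))) e₀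
      λ e le → [ inj₁ , (λ (κ , a , b , d , r) → inj₂ (κ , subst (_∈ L.map (k +_) (L.upTo (suc D))) (m+[n∸m]≡n a) (∈-map⁺ (k +_) (∈-upTo⁺ (s≤s (m≤n+o⇒m∸n≤o κ k b)))) , d , r)) ]′ (h e le)
    where
    go : ∀ c (Ks : List ℕ) → length Ks ≤ c → ∀ e₀ → (∀ e → e₀ ≤ e → X ⊎ Σ ℕ λ κ → κ ∈ Ks × Σ ℕ λ d → MinWit κ d × e < f d) → X
    go c [] le e₀ h with h e₀ ≤-refl
    ... | inj₁ x = x
    ... | inj₂ (κ , () , _)
    go (suc c) Ks@(_ ∷ _) le e₀ h with h e₀ ≤-refl
    ... | inj₁ x = x
    ... | inj₂ (κ , mem , d , mw , _) = go c (L.filter (λ κ' → ¬? (κ' Data.Nat.≟ κ)) Ks)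
        (≤-pred (≤-trans (length-filter-< (λ κ' → ¬? (κ' Data.Nat.≟ κ)) (any-weaken (λ { refl ¬e → ¬e refl }) mem)) le)) (e₀ + f d) next
      where
      next : ∀ e → e₀ + f d ≤ e → X ⊎ Σ ℕ λ κ' → κ' ∈ L.filter (λ κ' → ¬? (κ' Data.Nat.≟ κ)) Ks × Σ ℕ λ d → MinWit κ' d × e < f d
      next e le' with h e (≤-trans (m≤m+n e₀ (f d)) le')
      ... | inj₁ x = inj₁ x
      ... | inj₂ (κ' , mem' , d' , mw' , l) with κ' Data.Nat.≟ κ
      ...   | yes refl = ⊥-elim (<⇒≱ l (≤-trans (≤-reflexive (cong f (MinWit-unique mw' mw))) (≤-trans (m≤n+m (f d) e₀) le')))
      ...   | no ne = inj₂ (κ' , any-filter (λ κ' → ¬? (κ' Data.Nat.≟ κ)) (any-weaken (λ { refl → refl , ne }) mem') , d' , mw' , l)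

  Ext⊆ : ℕ → ∀ D → Matroid (suc D) → Set
  Ext⊆ n D N = (F : Matroid (k + suc D)) → (∀ v → NonZero v → F (zeros {k} ++ᵛ v) ≡ N v) → P (k + suc D) F ⊎ Escape D n

  T : Property
  T n N = ∀ D → f D ≤ n → (ψ : LinMap (suc D) n) → Injective ψ → Ext⊆ n D (λ v → N (apply ψ v))

  T-isProperty : IsProperty T
  T-isProperty n M₁ M₂ φ inv h t D le ψ iψ F e = t D le (compose φ ψ) (compose-injective φ ψ (invertible-injective φ inv) iψ) F
    λ v nzv → trans (e v nzv) (trans (h (apply ψ v) (Injective-≢0 ψ iψ nzv)) (cong M₂ (sym (apply-compose φ ψ v))))

  T-hereditary : Hereditary T
  T-hereditary m n M φ iφ t D le ψ iψ F e =
      [ inj₁ , (λ s → inj₂ (Escape-mono m≤n s)) ]′ (t D (≤-trans le m≤n) (compose φ ψ) (compose-injective φ ψ iφ iψ) F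
        λ v nzv → trans (e v nzv) (cong M (sym (apply-compose φ ψ v))))
    where
    m≤n : m ≤ n
    m≤n = Inj⇒≤ (colsOf φ) (columns-Inj φ iφ)

  const⊆T : ∀ i → 𝓜 k i ⊆P P → ∀ n N → Const i n N → T n N
  const⊆T i sub n N const D le ψ iψ F e = inj₁ (sub (k + suc D) F (suc D , (λ _ → i) , (λ _ _ → refl) , ≤-reflexive (+-comm k (suc D)) ,
    matrix (prefixCols k) , matrix-injective (prefixCols k) (prefixCols-Inj k) ,
    λ v nzv → trans (sym (trans (e v nzv) (const (apply ψ v) (Injective-≢0 ψ iψ nzv)))) (cong F (sym (trans (apply-matrix (prefixCols k) v) (lin-prefixCols k v))))))

  𝓜0⊆const : ∀ i n M → 𝓜 0 i n M → Const i n M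
  𝓜0⊆const i n M (m , M' , const , n≤ , ψ , inj , agree) w nzw = go (splitting (colsOf ψ) (columns-Inj ψ inj))
    where
    go : (Σ ℕ λ j → Σ (Vec (F2^ n) j) λ bs → Split bs (colsOf ψ)) → M w ≡ i
    go (suc j , bs , sp) = ⊥-elim (<⇒≱ (≤-trans (s≤s (m≤n+m m j)) (≤-reflexive (sym (split-dims sp)))) (≤-trans n≤ (≤-reflexive (+-identityʳ m))))
    go (zero , [] , sp) with Split.spans sp w
    ... | [] , v , e = trans (cong M w≡) (trans (sym (agree v (λ v0 → nzw (trans w≡ (trans (cong (apply ψ) v0) (additive-zero (apply ψ) (apply-⊕ ψ))))))) (const v (λ v0 → nzw (trans w≡ (trans (cong (apply ψ) v0) (additive-zero (apply ψ) (apply-⊕ ψ)))))))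
      where
      w≡ : w ≡ apply ψ v
      w≡ = trans e (trans (⊕-idˡ _) (lin-colsOf ψ v))

  -- `F` is a `k`-extension of its restriction to dimension `D + 1`, which is constant on a
  -- hyperplane. Pulled back along a projection, that restriction becomes a member of 𝓜(1,i) of
  -- arbitrarily large dimension, hence beyond `f D`. So `T` puts `F` into `P` or allows an escape,
  -- and `no-escape` excludes that escapes go on for ever.
  𝓜⊆T⇒Full : ∀ k' i → 𝓜 (suc k') i ⊆P T → ∀ D → Full k i D
  𝓜⊆T⇒Full k' i sub D F const = no-escape D (f D) λ e le → [ inj₁ , (λ s → inj₂ (Escape-mono (m≤m+n e (suc D)) s)) ]′ (at e le)
   where
   at : ∀ e → f D ≤ e → P (k + suc D) F ⊎ Escape D (e + suc D)
   at e le = sub (e + suc D) N^ inM D (≤-trans le (m≤m+n e (suc D))) (matrix ψ) (matrix-injective ψ (prefixCols-Inj e)) F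
      (λ y nzy → sym (trans (cong N^ (trans (apply-matrix ψ y) (lin-prefixCols e y))) (N^-++ zeros y nzy)))
    where
    N^ : Matroid (e + suc D)
    -- The kernel of the projection would ask for a value of `F` at `zeros`; it receives the
    -- constant `i` instead.
    N^ x = if eqV (V.drop e x) zeros then i else F (zeros {k} ++ᵛ V.drop e x)
    N^-++ : ∀ (u : F2^ e) y → NonZero y → N^ (u ++ᵛ y) ≡ F (zeros {k} ++ᵛ y)
    N^-++ u y nzy rewrite drop-++ u y | does-intro-¬ (y ≟V zeros) nzy = refl
    ψ : Vec (F2^ (e + suc D)) (suc D)
    ψ = prefixCols e
    inc : F2^ (e + D) → F2^ (e + suc D)
    inc x = V.take e x ++ᵛ (false ∷ V.drop e x)
    inc-++ : ∀ (u : F2^ e) v → inc (u ++ᵛ v) ≡ u ++ᵛ (false ∷ v)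
    inc-++ u v = cong₂ (λ p q → p ++ᵛ (false ∷ q)) (take-++ u v) (drop-++ u v)
    inc-⊕ : Additive inc
    inc-⊕ x x' with V.splitAt e x | V.splitAt e x'
    ... | u , v , refl | u' , v' , refl = trans (cong inc (⊕-++ u u' v v')) (trans (inc-++ (u ⊕ u') (v ⊕ v')) (sym (⊕-++ u u' (false ∷ v) (false ∷ v'))))
    iinc : Inj (columns inc)
    iinc x q with V.splitAt e x
    ... | u , v , refl with ++-zeros u (false ∷ v) (trans (sym (trans (lin-columns inc inc-⊕ (u ++ᵛ v)) (inc-++ u v))) q)
    ...   | refl , r = trans (cong (zeros {e} ++ᵛ_) (cong tail r)) (zeros-++ e)
    onInc : ∀ u v → N^ (u ++ᵛ (false ∷ v)) ≡ i
    onInc u v rewrite drop-++ u (false ∷ v) = dichotomy (eqV (false ∷ v) zeros)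
      (λ q → cong (λ b → if b then i else F (zeros {k} ++ᵛ (false ∷ v))) q)
      (λ q → trans (cong (λ b → if b then i else F (zeros {k} ++ᵛ (false ∷ v))) q) (const v λ v0 → does-false ((false ∷ v) ≟V zeros) q (cong (false ∷_) v0)))
    inM : 𝓜 (suc k') i (e + suc D) N^
    inM = e + D , (λ _ → i) , (λ _ _ → refl) , ≤-trans (≤-reflexive (+-suc e D)) (≤-trans (s≤s (m≤m+n (e + D) k')) (≤-reflexive (sym (+-suc (e + D) k')))) ,
      matrix (columns inc) , matrix-injective (columns inc) iinc , agree
      where
      agree : ∀ x → NonZero x → i ≡ N^ (apply (matrix (columns inc)) x)
      agree x _ with V.splitAt e x
      ... | u , v , refl = sym (trans (cong N^ (trans (apply-matrix (columns inc) (u ++ᵛ v)) (trans (lin-columns inc inc-⊕ (u ++ᵛ v)) (inc-++ u v)))) (onInc u v))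

  -- A member of some 𝓜(k'+1,i) chain inside `T` would put 𝓜(k+1,i) into `P`, against the maximality
  -- of `k`. Constant matroids lie in `T` because 𝓜(k,i) ⊆ P for one of the colours.
  T-thin : CriticalNumber P k → Thin T
  T-thin ((i , sub) , max) = T-hereditary , (λ d → d , ≤-refl , (λ _ → i) , const⊆T i sub d (λ _ → i) (λ _ _ → refl)) ,
      (i , λ n M m → const⊆T i sub n M (𝓜0⊆const i n M m)) , crit
    where
    crit : ∀ k' (i : Bool) → 𝓜 k' i ⊆P T → k' ≤ 0
    crit zero i _ = z≤n
    crit (suc k') i sub = ⊥-elim (1+n≰n (max (suc k) i λ n M' (m , M , const , ext') →
      full⇒ext (suc k) i m (full-shift k i m (𝓜⊆T⇒Full k' i sub m)) M M' const ext'))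

-- Patterns that shattered sets must avoid

module Pattern {K D n} (gens : Vec (F2^ n) K) (dirs : Vec (F2^ n) D) (φ : F2^ K → F2^ D → Bool) where

  pat? : ∀ w → Dec (∃₂ λ c v → w ≡ lin gens c ⊕ lin dirs v × φ c v ≡ true)
  pat? w = ∃-dec enumV λ c → ∃-dec enumV λ v → (w ≟V (lin gens c ⊕ lin dirs v)) ×-dec (φ c v ≟B true)

  patOf : F2^ n → Bool
  patOf w = does (pat? w)

  patOf-pt : Indep gens dirs → ∀ c v → patOf (lin gens c ⊕ lin dirs v) ≡ φ c v
  patOf-pt ind c v = dichotomy (φ c v)
    (λ t → trans (does-intro (pat? _) (c , v , refl , t)) (sym t))
    (λ t → trans (does-intro-¬ (pat? _) λ (c' , v' , e , t') → true≢false t' (subst₂ (λ c v → φ c v ≡ false) (proj₁ (same e)) (proj₂ (same e)) t)) (sym t))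
    where
    same : ∀ {c' v'} → lin gens c ⊕ lin dirs v ≡ lin gens c' ⊕ lin dirs v' → c ≡ c' × v ≡ v'
    same {c'} {v'} e with ind (c ⊕ c') (v ⊕ v') (trans (cong₂ _⊕_ (lin-⊕ gens c c') (lin-⊕ dirs v v'))
      (trans (⊕-interchange (lin gens c) (lin gens c') (lin dirs v) (lin dirs v')) (trans (cong (_⊕ (lin gens c' ⊕ lin dirs v')) e) (⊕-self _))))
    ... | p , q = ⊕≡0⇒≡ c c' p , ⊕≡0⇒≡ v v' q

2^<2^suc : ∀ x → 2 ^ x < 2 ^ suc x
2^<2^suc x = ^-monoʳ-< 2 (s≤s (s≤s z≤n)) {x} {suc x} ≤-refl

tile-size : ℕ → ℕ → ℕ
tile-size K D = size-idx {K} nz D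

1≤tile-size : ∀ K D → 1 ≤ tile-size (suc K) D
1≤tile-size K D = size-idx>0 nz D (true ∷ zeros) (nz-intro {c = true ∷ zeros {K}} λ ())

ramsey-dim : ℕ → ℕ
ramsey-dim d = proj₁ (ramsey d d)

-- The centre of a configuration needs `ramsey-dim d` dimensions for the colouring and
-- `lift-dim κ d` more as room for translating the generators away from the points already used.
lift-dim centre-dim : ℕ → ℕ → ℕ
lift-dim κ d = 2 ^ tile-size (suc κ) d * suc (suc (ramsey-dim d * d)) * tile-size (suc κ) d * 2 ^ (suc κ + d)
centre-dim κ d = lift-dim κ d + ramsey-dim d

pad : ∀ x {s d} → Vec (F2^ s) d → Vec (F2^ (x + s)) d
pad x = map (zeros {x} ++ᵛ_)

miss-bound : ℕ → ℕ → ℕ → ℕ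
miss-bound n κ D = 2 ^ tile-size κ D * suc ((n ∸ κ) * D + 2 ^ (κ + D)) * tile-size κ D

module Shattering (P : Property) (isP : IsProperty P) (her : Hereditary P) {n} (F : Class n) (F⊆P : ∀ M → F M → P n M) where
  open Prop P isP her

  module _ (κ d s x : ℕ) (rams : HasMono d d s)
    (roomx : 2 ^ tile-size (suc κ) d * suc (suc (s * d)) * tile-size (suc κ) d * 2 ^ (suc κ + d) < 2 ^ (x + s)) (X : Bool → Matroid (κ + suc d)) (constX : ∀ i v → NonZero v → X i (zeros {κ} ++ᵛ (false ∷ v)) ≡ i)
    (¬PX : ∀ i → ¬ P (κ + suc d) (X i)) where

    -- Each `M` in `F` colours the centre of the configuration and is constant, say `i`, on a
    -- subspace `W` of dimension `d`. Around it `M` cannot show the pattern of `X i` on any tile, or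
    -- else `X i` would be a restriction of `M` and lie in `P`. So (W , i) is the label of `M`,
    -- while a configuration inside `S` would contain the tiles of all labels.
    shattered-avoids : ∀ S → S zeros ≡ false → Shatters F S → Avoids (suc κ) (x + s) S
    shattered-avoids S s0 sh A Z iZ bb = shattered F S (suc (suc (s * d))) fewLabels hF sh contra
      where
      b : ℕ
      b = tile-size (suc κ) d
      indAZ : Indep A Z
      indAZ = BB-indep A Z {S} iZ s0 bb
      Λ : Set
      Λ = Vec (F2^ s) d × Bool
      labels : List Λ
      labels = L.concatMap (λ W → (W , false) ∷ (W , true) ∷ []) (allTuples s d)
      ∈labels : ∀ W i → (W , i) ∈ labels
      ∈labels W i = any-concatMap (λ W → (W , false) ∷ (W , true) ∷ []) (any-weaken (λ { refl → pick i }) (∈-tuples ∈-allVecs W))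
        where
        pick : ∀ i → (W , i) ∈ (W , false) ∷ (W , true) ∷ []
        pick false = here refl
        pick true = there (here refl)
      φ : Λ → F2^ (suc κ) → F2^ d → Bool
      -- In `Full` the last of the `κ + 1` generators stands next to the constant subspace; here it
      -- is the head of the generators.
      φ (W , i) (b ∷ c) v = X i (c ++ᵛ (b ∷ v))
      iPad : ∀ W → Inj W → Inj (pad x W)
      iPad W iW v e = iW v (proj₂ (++-zeros (zeros {x}) (lin W v) (trans (sym (lin-prefix x W v)) e)))
      pts : Λ → Vec (F2^ (x + s)) (suc κ) → List (F2^ n)
      pts (W , i) ℓ = tileOf A Z (pad x W) ℓ
      pat : Λ → Vec (F2^ (x + s)) (suc κ) → F2^ n → Bool
      pat (W , i) ℓ = Pattern.patOf (lift A Z ℓ) (Z ⊙ pad x W) (φ (W , i))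
      len-pts : ∀ l ℓ → length (pts l ℓ) ≡ b
      len-pts (W , i) ℓ = length-config (lift A Z ℓ) (Z ⊙ pad x W) nz
      nodup-pts : ∀ l ℓ → Inj (proj₁ l) → NoDup (pts l ℓ)
      nodup-pts (W , i) ℓ iW = config-NoDup (lift A Z ℓ) (Z ⊙ pad x W) nz (Indep⇒Inj (lift A Z ℓ) (Z ⊙ pad x W) (lift-indep A Z ℓ (pad x W) indAZ (iPad W iW)))
      open Shattered {b = b} (1≤tile-size κ d) labels (λ l → Inj (proj₁ l)) (allTuples (x + s) (suc κ)) pts pat (λ l → Inj? (proj₁ l)) len-pts nodup-pts
      fewLabels : length labels < 2 ^ suc (suc (s * d))
      fewLabels = ≤-<-trans (≤-trans (length-concatMap (λ W → (W , false) ∷ (W , true) ∷ []) 2 (allTuples s d) (λ _ → ≤-refl)) (≤-trans (*-monoˡ-≤ 2 (length-allTuples s d)) (≤-reflexive (*-comm (2 ^ (s * d)) 2))))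
        (2^<2^suc (suc (s * d)))
      missing : ∀ M → F M → ∀ i W → Inj W → (∀ v → v ≢ zeros → M (lin Z (zeros {x} ++ᵛ lin W v)) ≡ i) → Miss (W , i) M
      missing M FM i W iW mono = iW , λ ℓ _ agree → ¬PX i (ext (same ℓ agree) (restrict (Ψ ℓ) (iΨ ℓ) (F⊆P M FM)))
        where
        gens : Vec (F2^ (x + s)) (suc κ) → Vec (F2^ n) (suc κ)
        gens ℓ = lift A Z ℓ
        dirs : Vec (F2^ n) d
        dirs = Z ⊙ pad x W
        Ψ : Vec (F2^ (x + s)) (suc κ) → Vec (F2^ n) (κ + suc d)
        Ψ ℓ = tail (gens ℓ) ++ᵛ (head (gens ℓ) ∷ dirs)
        ind : ∀ ℓ → Indep (gens ℓ) dirs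
        ind ℓ = lift-indep A Z ℓ (pad x W) indAZ (iPad W iW)
        linΨ : ∀ ℓ c b v → lin (Ψ ℓ) (c ++ᵛ (b ∷ v)) ≡ lin (gens ℓ) (b ∷ c) ⊕ lin dirs v
        linΨ ℓ c b v = aux (gens ℓ)
          where
          aux : ∀ gs → lin (tail gs ++ᵛ (head gs ∷ dirs)) (c ++ᵛ (b ∷ v)) ≡ lin gs (b ∷ c) ⊕ lin dirs v
          aux (g ∷ gs) = trans (lin-++ gs (g ∷ dirs) c (b ∷ v)) (⊕-solve (lin gs c ∷ (b · g) ∷ lin dirs v ∷ []) (x₀ :⊕ (x₁ :⊕ x₂)) ((x₁ :⊕ x₀) :⊕ x₂) refl)
        iΨ : ∀ ℓ → Inj (Ψ ℓ)
        iΨ ℓ w e with V.splitAt κ w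
        ... | c , (b ∷ v) , refl with ind ℓ (b ∷ c) v (trans (sym (linΨ ℓ c b v)) e)
        ...   | refl , refl = zeros-++ κ
        same : ∀ ℓ → (∀ w → w ∈ pts (W , i) ℓ → M w ≡ pat (W , i) ℓ w) → ∀ w → NonZero w → M (lin (Ψ ℓ) w) ≡ X i w
        same ℓ agree w nzw with V.splitAt κ w
        ... | c , (b ∷ v) , refl = trans (cong M (linΨ ℓ c b v)) (cases ((b ∷ c) ≟V zeros))
          where
          cases : Dec (b ∷ c ≡ zeros) → M (lin (gens ℓ) (b ∷ c) ⊕ lin dirs v) ≡ X i (c ++ᵛ (b ∷ v))
          cases (no ne) = trans (agree _ (config-intro (gens ℓ) dirs nz (b ∷ c) v (nz-intro ne))) (Pattern.patOf-pt (gens ℓ) dirs (φ (W , i)) (ind ℓ) (b ∷ c) v)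
          cases (yes refl) = trans (cong M (trans (cong (_⊕ lin dirs v) (lin-zero (gens ℓ))) (trans (⊕-idˡ _) (trans (lin-⊙ Z (pad x W) v) (cong (lin Z) (lin-prefix x W v))))))
              (trans (mono v v≢0) (sym (constX i v v≢0)))
            where
            v≢0 : v ≢ zeros
            v≢0 e = nzw (trans (cong (λ t → zeros {κ} ++ᵛ (false ∷ t)) e) (zeros-++ κ))
      hF : ∀ M → F M → ¬ ¬ Any (λ l → Miss l M) labels
      hF M FM none = [ use false , use true ]′ (rams (λ u → M (lin Z (zeros {x} ++ᵛ u))))
        where
        use : ∀ i → Mono (λ u → M (lin Z (zeros {x} ++ᵛ u))) i d → ⊥
        use i (W , iW , mono) = none (lose (∈labels W i) (missing M FM i W iW mono))
      contra : ¬ Sparse-tiles (2 ^ b * suc (suc (s * d)) * b) S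
      contra a = go (find a)
        where
        go : _ → ⊥
        go ((W , i) , _ , iW , W₀ , le , st) = let (ℓ , off) = fresh-lift A Z iZ (pad x W) W₀ (≤-<-trans (*-monoˡ-≤ (2 ^ (suc κ + d)) le) roomx) in
          st ℓ (∈-tuples ∈-allVecs ℓ) off λ w p → let (c , v , ic , e) = config-elim (lift A Z ℓ) (Z ⊙ pad x W) nz p in
            subst (λ t → S t ≡ true) (sym (trans e (lin-lift A Z ℓ (pad x W) c v))) (bb c (nz-elim ic) _)

  -- The label of `M` is the position `Y` of a restriction of `M` on ⟨B⟩ together with the table of
  -- an extension `X` outside `P`. On a tile around `Y` the matroid never completes its own values
  -- at the centre to `X`.
  shattered-starved : ∀ κ D (A : Vec (F2^ n) (suc κ)) (B : Vec (F2^ n) (n ∸ suc κ)) → Split A B →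
    (∀ M → F M → ¬ ¬ (∃₂ λ (Y : Vec (F2^ (n ∸ suc κ)) D) (X : Matroid (suc κ + D)) → Inj Y × ¬ P (suc κ + D) X ×
      (∀ v → NonZero v → X (zeros {suc κ} ++ᵛ v) ≡ M (lin B (lin Y v))))) →
    ∀ S → Shatters F S → ¬ ¬ (∃₂ λ (Y : Vec (F2^ (n ∸ suc κ)) D) W₀ → Inj Y × length W₀ ≤ miss-bound n (suc κ) D × Starved A B Y W₀ S)
  shattered-starved κ D A B sp h S sh none = shattered F S (suc (r * D + 2 ^ (suc κ + D))) fewLabels hF sh λ a →
      let ((Y , X) , _ , iY , W₀ , le , st) = find a in none (Y , W₀ , iY , le , λ ℓ fr all → st ℓ (∈-tuples ∈-allVecs ℓ) fr all)
    where
    r : ℕ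
    r = n ∸ suc κ
    Λ : Set
    Λ = Vec (F2^ r) D × Matroid (suc κ + D)
    tables : List (Matroid (suc κ + D))
    tables = allFuns (suc κ + D) (false ∷ true ∷ [])
    labels : List Λ
    labels = L.concatMap (λ Y → L.map (Y ,_) tables) (allTuples r D)
    pts : Λ → Vec (F2^ r) (suc κ) → List (F2^ n)
    pts (Y , X) ℓ = tileOf A B Y ℓ
    pat : Λ → Vec (F2^ r) (suc κ) → F2^ n → Bool
    pat (Y , X) ℓ = Pattern.patOf (lift A B ℓ) (B ⊙ Y) (λ c v → X (c ++ᵛ v))
    len-pts : ∀ l ℓ → length (pts l ℓ) ≡ tile-size (suc κ) D
    len-pts (Y , X) ℓ = length-config (lift A B ℓ) (B ⊙ Y) nz
    nodup-pts : ∀ l ℓ → Inj (proj₁ l) → NoDup (pts l ℓ)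
    nodup-pts (Y , X) ℓ iY = config-NoDup (lift A B ℓ) (B ⊙ Y) nz (Indep⇒Inj (lift A B ℓ) (B ⊙ Y) (lift-indep A B ℓ Y (Split.indep sp) iY))
    open Shattered {b = tile-size (suc κ) D} (1≤tile-size κ D) labels (λ l → Inj (proj₁ l)) (allTuples r (suc κ)) pts pat (λ l → Inj? (proj₁ l)) len-pts nodup-pts
    fewLabels : length labels < 2 ^ suc (r * D + 2 ^ (suc κ + D))
    fewLabels = ≤-<-trans (≤-trans (length-concatMap (λ Y → L.map (Y ,_) tables) (2 ^ (2 ^ (suc κ + D))) (allTuples r D)
        (λ Y → ≤-trans (≤-reflexive (length-map (Y ,_) tables)) (length-allFuns (suc κ + D) (false ∷ true ∷ []))))
        (≤-trans (*-monoˡ-≤ (2 ^ (2 ^ (suc κ + D))) (length-allTuples r D)) (≤-reflexive (sym (^-distribˡ-+-* 2 (r * D) (2 ^ (suc κ + D)))))))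
      (2^<2^suc (r * D + 2 ^ (suc κ + D)))
    hF : ∀ M → F M → ¬ ¬ Any (λ l → Miss l M) labels
    hF M FM no' = h M FM λ (Y , X , iY , ¬PX , eX) → no' (any-concatMap (λ Y → L.map (Y ,_) tables) (lose (∈-tuples ∈-allVecs Y)
        (AnyP.map⁺ (any-weaken (λ {X'} e → missing Y X iY ¬PX eX X' e) (allFuns-complete (suc κ + D) {P = λ u b → X u ≡ b} λ u → either (X u))))))
      where
      either : ∀ b → b ∈ false ∷ true ∷ []
      either false = here refl
      either true = there (here refl)
      missing : ∀ Y X → Inj Y → ¬ P (suc κ + D) X → (∀ v → NonZero v → X (zeros {suc κ} ++ᵛ v) ≡ M (lin B (lin Y v))) →
        ∀ X' → (∀ u → X u ≡ X' u) → Miss (Y , X') M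
      missing Y X iY ¬PX eX X' e = iY , λ ℓ _ agree → ¬PX (ext (same ℓ agree) (restrict (lift A B ℓ ++ᵛ (B ⊙ Y)) (Indep⇒Inj (lift A B ℓ) (B ⊙ Y) (ind ℓ)) (F⊆P M FM)))
        where
        ind : ∀ ℓ → Indep (lift A B ℓ) (B ⊙ Y)
        ind ℓ = lift-indep A B ℓ Y (Split.indep sp) iY
        same : ∀ ℓ → (∀ w → w ∈ tileOf A B Y ℓ → M w ≡ pat (Y , X') ℓ w) → ∀ w → NonZero w → M (lin (lift A B ℓ ++ᵛ (B ⊙ Y)) w) ≡ X w
        same ℓ agree w nzw = go (V.splitAt (suc κ) w)
          where
          go : (∃₂ λ c v → w ≡ c ++ᵛ v) → M (lin (lift A B ℓ ++ᵛ (B ⊙ Y)) w) ≡ X w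
          go (c , v , w≡) = trans (cong M (trans (cong (lin (lift A B ℓ ++ᵛ (B ⊙ Y))) w≡) (lin-++ (lift A B ℓ) (B ⊙ Y) c v))) (trans (cases (c ≟V zeros)) (cong X (sym w≡)))
            where
            cases : Dec (c ≡ zeros) → M (lin (lift A B ℓ) c ⊕ lin (B ⊙ Y) v) ≡ X (c ++ᵛ v)
            cases (no ne) = trans (agree _ (config-intro (lift A B ℓ) (B ⊙ Y) nz c v (nz-intro ne)))
              (trans (Pattern.patOf-pt (lift A B ℓ) (B ⊙ Y) (λ c v → X' (c ++ᵛ v)) (ind ℓ) c v) (sym (e (c ++ᵛ v))))
            cases (yes c≡0) = trans (cong M (trans (cong (λ t → lin (lift A B ℓ) t ⊕ lin (B ⊙ Y) v) c≡0) (trans (cong (_⊕ lin (B ⊙ Y) v) (lin-zero (lift A B ℓ))) (trans (⊕-idˡ _) (lin-⊙ B Y v)))))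
                (trans (sym (eX v v≢0)) (cong (λ t → X (t ++ᵛ v)) (sym c≡0)))
              where
              v≢0 : v ≢ zeros
              v≢0 v≡0 = nzw (trans w≡ (trans (cong₂ _++ᵛ_ c≡0 v≡0) (zeros-++ (suc κ))))

-- A forbidden extension of a restriction to a subspace U of codimension k gives
-- one of a restriction to any subspace of U of larger codimension k + e.
module Amalgam {k e r D : ℕ} (ψ : Vec (F2^ (e + r)) (suc D)) (iψ : Inj ψ) where

  p : F2^ (suc D) → F2^ r
  p y = V.drop e (lin ψ y)
  q : F2^ (suc D) → F2^ e
  q y = V.take e (lin ψ y)

  p-⊕ : Additive p
  p-⊕ u v = trans (cong (V.drop e) (lin-⊕ ψ u v)) (aux (lin ψ u) (lin ψ v))
    where
    aux : ∀ (a b : F2^ (e + r)) → V.drop e (a ⊕ b) ≡ V.drop e a ⊕ V.drop e b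
    aux a b with V.splitAt e a | V.splitAt e b
    ... | a₁ , a₂ , refl | b₁ , b₂ , refl = trans (cong (V.drop e) (⊕-++ a₁ b₁ a₂ b₂)) (drop-++ (a₁ ⊕ b₁) (a₂ ⊕ b₂))

  q-⊕ : Additive q
  q-⊕ u v = trans (cong (V.take e) (lin-⊕ ψ u v)) (aux (lin ψ u) (lin ψ v))
    where
    aux : ∀ (a b : F2^ (e + r)) → V.take e (a ⊕ b) ≡ V.take e a ⊕ V.take e b
    aux a b with V.splitAt e a | V.splitAt e b
    ... | a₁ , a₂ , refl | b₁ , b₂ , refl = trans (cong (V.take e) (⊕-++ a₁ b₁ a₂ b₂)) (take-++ (a₁ ⊕ b₁) (a₂ ⊕ b₂))

  q++p : ∀ y → lin ψ y ≡ q y ++ᵛ p y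
  q++p y = aux (lin ψ y)
    where
    aux : ∀ (a : F2^ (e + r)) → a ≡ V.take e a ++ᵛ V.drop e a
    aux a with V.splitAt e a
    ... | a₁ , a₂ , refl = refl

  image? : ∀ w → Dec (∃ λ y → w ≡ p y)
  image? w = ∃-dec enumV λ y → w ≟V p y

  image : F2^ r → Bool
  image w = does (image? w)

  image-sub : Subgroup image
  image-sub = does-intro (image? zeros) (zeros , sym (additive-zero p p-⊕)) ,
    λ u v iu iv → let (y , e₁) = does-true (image? u) iu; (y' , e₂) = does-true (image? v) iv in
      does-intro (image? (u ⊕ v)) (y ⊕ y' , trans (cong₂ _⊕_ e₁ e₂) (sym (p-⊕ y y')))

  Cover : ℕ → Set
  Cover D' = Σ (Vec (F2^ r) D') λ Y → Inj Y × Σ (F2^ (suc D) → F2^ D') λ h → Additive h × (∀ y → lin Y (h y) ≡ p y)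

  -- The image of `p` has dimension at most `D + 1`; its basis is padded from a complement, so that
  -- restrictions found at different `D` can all be brought to the same dimension `D'`.
  cover : ∀ D' → suc D ≤ D' → D' ≤ r → Cover D'
  cover D' D<D' D'≤r = go (subgroup-basis image image-sub)
    where
    go : (Σ ℕ λ j → Σ (Vec (F2^ r) j) λ B → Inj B × In B image × (∀ w → image w ≡ true → ∃ λ v → w ≡ lin B v) × # image ≡ 2 ^ j) → Cover D'
    go (j , B , iB , inI , spans , size) = go' (splitting B iB)
      where
      j≤D' : j ≤ D'
      j≤D' = ≤-trans (≮⇒≥ λ l → <⇒≱ (^-monoʳ-< 2 (s≤s (s≤s z≤n)) l) (≤-trans (≤-reflexive (sym size)) (#-image p image (λ w i → does-true (image? w) i)))) D<D'
      coord : F2^ (suc D) → F2^ j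
      coord y = proj₁ (spans (p y) (does-intro (image? (p y)) (y , refl)))
      coord-eq : ∀ y → lin B (coord y) ≡ p y
      coord-eq y = sym (proj₂ (spans (p y) (does-intro (image? (p y)) (y , refl))))
      coord-⊕ : Additive coord
      coord-⊕ u v = Inj⇒≡ B iB _ _ (trans (coord-eq (u ⊕ v)) (trans (p-⊕ u v) (trans (cong₂ _⊕_ (sym (coord-eq u)) (sym (coord-eq v))) (sym (lin-⊕ B _ _)))))
      go' : (Σ ℕ λ j' → Σ (Vec (F2^ r) j') λ bs → Split bs B) → Cover D'
      go' (j' , bs , sp) = cast D' (D' ∸ j) (sym (m∸n+n≡m j≤D')) (+-cancelʳ-≤ j (D' ∸ j) j' (≤-trans (≤-reflexive (m∸n+n≡m j≤D')) (≤-trans D'≤r (≤-reflexive (split-dims sp)))))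
        where
        cast : ∀ D' t → D' ≡ t + j → t ≤ j' → Cover D'
        cast .(t + j) t refl t≤ = (bs ⊙ emb t≤) ++ᵛ B , Indep⇒Inj (bs ⊙ emb t≤) B ind , (λ y → zeros {t} ++ᵛ coord y) , h-⊕ ,
            λ y → trans (lin-++ (bs ⊙ emb t≤) B zeros (coord y)) (trans (cong (_⊕ lin B (coord y)) (lin-zero (bs ⊙ emb t≤))) (trans (⊕-idˡ _) (coord-eq y)))
          where
          ind : Indep (bs ⊙ emb t≤) B
          ind a v e' with Split.indep sp (lin (emb t≤) a) v (trans (cong (_⊕ lin B v) (sym (lin-⊙ bs (emb t≤) a))) e')
          ... | a0 , v0 = emb-Inj t≤ a a0 , v0
          h-⊕ : Additive (λ y → zeros {t} ++ᵛ coord y)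
          h-⊕ u v = trans (cong (zeros {t} ++ᵛ_) (coord-⊕ u v)) (sym (trans (⊕-++ (zeros {t}) zeros (coord u) (coord v)) (cong (_++ᵛ (coord u ⊕ coord v)) (⊕-self (zeros {t})))))

  module _ {n} (M : Matroid n) (A₂ : Vec (F2^ n) e) (B : Vec (F2^ n) r) (F : Matroid (k + suc D))
    (extF : ∀ y → NonZero y → F (zeros {k} ++ᵛ y) ≡ M (lin (A₂ ++ᵛ B) (lin ψ y))) (P : Property) (isP : IsProperty P) (her : Hereditary P)
    {D' : ℕ} (Y : Vec (F2^ r) D') (iY : Inj Y) (h : F2^ (suc D) → F2^ D') (h-⊕ : Additive h) (Yh : ∀ y → lin Y (h y) ≡ p y) where

    private
      -- The directions of `ψ` transversal to ⟨B⟩, read off by `q`, are counted among the `k + e`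
      -- generators. Injectivity of `ψ` makes the embedding injective.
      θ : F2^ (k + suc D) → F2^ ((k + e) + D')
      θ z = (V.take k z ++ᵛ q (V.drop k z)) ++ᵛ h (V.drop k z)

      θ-++ : ∀ c y → θ (c ++ᵛ y) ≡ (c ++ᵛ q y) ++ᵛ h y
      θ-++ c y = cong₂ (λ a b → (a ++ᵛ q b) ++ᵛ h b) (take-++ c y) (drop-++ c y)

      θ-⊕ : Additive θ
      θ-⊕ z z' with V.splitAt k z | V.splitAt k z'
      ... | c , y , refl | c' , y' , refl = trans (cong θ (⊕-++ c c' y y')) (trans (θ-++ (c ⊕ c') (y ⊕ y'))
        (trans (cong₂ (λ a b → ((c ⊕ c') ++ᵛ a) ++ᵛ b) (q-⊕ y y') (h-⊕ y y'))
          (sym (trans (⊕-++ (c ++ᵛ q y) (c' ++ᵛ q y') (h y) (h y')) (cong (_++ᵛ (h y ⊕ h y')) (⊕-++ c c' (q y) (q y')))))))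

      zero-parts : ∀ c y v → (c ++ᵛ q y) ++ᵛ h y ≡ zeros {k + e} ++ᵛ v → c ≡ zeros × q y ≡ zeros × h y ≡ v
      zero-parts c y v eq = let (a , b) = ++-zeros c (q y) (trans (sym (take-++ (c ++ᵛ q y) (h y))) (trans (cong (V.take (k + e)) eq) (take-++ zeros v))) in
        a , b , trans (sym (drop-++ (c ++ᵛ q y) (h y))) (trans (cong (V.drop (k + e)) eq) (drop-++ (zeros {k + e}) v))

      iθ : Inj (columns θ)
      iθ z eq with V.splitAt k z
      ... | c , y , refl with zero-parts c y zeros (trans (sym (trans (lin-columns θ θ-⊕ (c ++ᵛ y)) (θ-++ c y))) (trans eq (sym (zeros-++ (k + e)))))
      ...   | c0 , q0 , h0 = trans (cong₂ _++ᵛ_ c0 (iψ y (trans (q++p y) (trans (cong₂ _++ᵛ_ q0 (trans (sym (Yh y)) (trans (cong (lin Y) h0) (lin-zero Y)))) (zeros-++ e))))) (zeros-++ k)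

      rep? : ∀ x → Dec (∃ λ z → x ≡ θ z)
      rep? x = ∃-dec enumV λ z → x ≟V θ z

      choose : ∀ x → Dec (∃ λ z → x ≡ θ z) → Bool
      choose x (yes (z , _)) = F z
      choose x (no _) = M (lin B (lin Y (V.drop (k + e) x)))

    -- Carries `F` along `θ` and continues by the values of `M` on the centre. The two agree where
    -- they meet: a point of the centre in the image of `θ` has zero generator part, and there `F`
    -- extends `M`.
    F* : Matroid ((k + e) + D')
    F* x = choose x (rep? x)

    θ-inj : ∀ z z' → θ z ≡ θ z' → z ≡ z'
    θ-inj z z' eq = Inj⇒≡ (columns θ) iθ z z' (trans (lin-columns θ θ-⊕ z) (trans eq (sym (lin-columns θ θ-⊕ z'))))

    F*θ : ∀ z → F* (θ z) ≡ F z
    F*θ z = aux (rep? (θ z))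
      where
      aux : (d : Dec (∃ λ z' → θ z ≡ θ z')) → choose (θ z) d ≡ F z
      aux (yes (z' , eq)) = cong F (sym (θ-inj z z' eq))
      aux (no ¬r) = ⊥-elim (¬r (z , refl))

    F*-P : P ((k + e) + D') F* → P (k + suc D) F
    F*-P pF = ext (λ z _ → trans (cong F* (lin-columns θ θ-⊕ z)) (F*θ z)) (restrict (columns θ) iθ pF)
      where open Prop P isP her

    F*-ext : ∀ v → NonZero v → F* (zeros {k + e} ++ᵛ v) ≡ M (lin B (lin Y v))
    F*-ext v v≢0 = aux (rep? (zeros {k + e} ++ᵛ v))
      where
      aux : (d : Dec (∃ λ z → zeros {k + e} ++ᵛ v ≡ θ z)) → choose (zeros {k + e} ++ᵛ v) d ≡ M (lin B (lin Y v))
      aux (no _) = cong (λ t → M (lin B (lin Y t))) (drop-++ (zeros {k + e}) v)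
      aux (yes (z , eq)) = go (V.splitAt k z)
        where
        go : (∃₂ λ c y → z ≡ c ++ᵛ y) → F z ≡ M (lin B (lin Y v))
        go (c , y , z≡) = trans (cong F (trans z≡ (cong (_++ᵛ y) c0))) (trans (extF y y≢0) (cong M (begin
            lin (A₂ ++ᵛ B) (lin ψ y) ≡⟨ cong (lin (A₂ ++ᵛ B)) (q++p y) ⟩
            lin (A₂ ++ᵛ B) (q y ++ᵛ p y) ≡⟨ lin-++ A₂ B (q y) (p y) ⟩
            lin A₂ (q y) ⊕ lin B (p y) ≡⟨ cong (_⊕ lin B (p y)) (trans (cong (lin A₂) q0) (lin-zero A₂)) ⟩
            zeros ⊕ lin B (p y) ≡⟨ ⊕-idˡ _ ⟩
            lin B (p y) ≡⟨ cong (lin B) (trans (sym (Yh y)) (cong (lin Y) hv)) ⟩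
            lin B (lin Y v) ∎)))
          where
          open ≡-Reasoning
          parts : c ≡ zeros × q y ≡ zeros × h y ≡ v
          parts = zero-parts c y v (trans (sym (θ-++ c y)) (trans (cong θ (sym z≡)) (sym eq)))
          c0 : c ≡ zeros
          c0 = proj₁ parts
          q0 : q y ≡ zeros
          q0 = proj₁ (proj₂ parts)
          hv : h y ≡ v
          hv = proj₂ (proj₂ parts)
          y≢0 : y ≢ zeros
          y≢0 y0 = v≢0 (trans (sym hv) (trans (cong h y0) (additive-zero h h-⊕)))

    amalgam : ¬ P (k + suc D) F → ∃₂ λ (Y : Vec (F2^ r) D') (X : Matroid ((k + e) + D')) → Inj Y × ¬ P ((k + e) + D') X ×
      (∀ v → NonZero v → X (zeros {k + e} ++ᵛ v) ≡ M (lin B (lin Y v)))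
    amalgam ¬pF = Y , F* , iY , (λ pF* → ¬pF (F*-P pF*)) , F*-ext

-- Counting matroids

module Counting {A : Set} {Q R : A → Set} where

  chosen : ∀ {xs a} → Count Q xs a → Σ (List A) λ ys → length ys ≡ a × (∀ {x} → x ∈ xs → Q x → x ∈ ys)
  chosen cnil = [] , refl , λ ()
  chosen (cyes {a} q c) = let (ys , l , h) = chosen c in a ∷ ys , cong suc l , λ { (here refl) _ → here refl ; (there m) q' → there (h m q') }
  chosen (cno ¬q c) = let (ys , l , h) = chosen c in ys , l , λ { (here refl) q → ⊥-elim (¬q q) ; (there m) q' → h m q' }

  -- A count records for each entry whether `Q` holds. This is the only source of decidability for
  -- `P` and `Ext k T`.
  decided : ∀ {xs a} → Count Q xs a → ∀ {x} → x ∈ xs → Dec (Q x)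
  decided (cyes q c) (here refl) = yes q
  decided (cyes q c) (there m) = decided c m
  decided (cno ¬q c) (here refl) = no ¬q
  decided (cno ¬q c) (there m) = decided c m

  -- The list collects the entries that are not in `Q` outside `R`, so the difference of the two
  -- counts appears as a difference of list lengths.
  others : ∀ {xs a b} → Count Q xs a → Count (λ x → Q x × R x) xs b →
    Σ (List A) λ zs → length zs + a ≡ length xs + b × (∀ {x} → x ∈ xs → x ∈ zs ⊎ (Q x × ¬ R x))
  others cnil cnil = [] , refl , λ ()
  others (cyes {x} q c) (cyes _ c') = let (zs , l , h) = others c c' in x ∷ zs , cong suc (trans (+-suc _ _) (trans (cong suc l) (sym (+-suc _ _)))) ,
    λ { (here refl) → inj₁ (here refl) ; (there m) → [ (λ p → inj₁ (there p)) , inj₂ ]′ (h m) }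
  others (cyes q c) (cno ¬qr c') = let (zs , l , h) = others c c' in zs , trans (+-suc _ _) (cong suc l) ,
    λ { (here refl) → inj₂ (q , λ r → ¬qr (q , r)) ; (there m) → h m }
  others (cno ¬q c) (cyes (q , _) c') = ⊥-elim (¬q q)
  others (cno {x} ¬q c) (cno _ c') = let (zs , l , h) = others c c' in x ∷ zs , cong suc l ,
    λ { (here refl) → inj₁ (here refl) ; (there m) → [ (λ p → inj₁ (there p)) , inj₂ ]′ (h m) }

  compare : ∀ {xs a b} → Count Q xs a → Count (λ x → Q x × R x) xs b → a ≤ b ⊎ (∃ λ x → Q x × ¬ R x)
  compare cnil cnil = inj₁ z≤n
  compare (cyes q c) (cyes _ c') = [ (λ l → inj₁ (s≤s l)) , inj₂ ]′ (compare c c')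
  compare (cyes {x} q c) (cno ¬qr c') = inj₂ (x , q , λ r → ¬qr (q , r))
  compare (cno ¬q c) (cyes (q , _) c') = ⊥-elim (¬q q)
  compare (cno ¬q c) (cno _ c') = compare c c'

funsOn≡assigns : ∀ {n} (as : List (F2^ n)) → funsOn as ≡ assigns as (λ _ → false)
funsOn≡assigns [] = refl
funsOn≡assigns (a ∷ as) = cong (L.concatMap (λ f → update a false f ∷ update a true f ∷ [])) (funsOn≡assigns as)

nonzero : ∀ {n} → F2^ n → Bool
nonzero v = not (eqV v zeros)

allMatroids-complete : ∀ {n} (M : Matroid n) → M zeros ≡ false → Any (M ≗_) (allMatroids n)
allMatroids-complete {n} M m0 = subst (Any (M ≗_)) (sym (funsOn≡assigns (nonzeroVecs n))) (any-weaken same (assigns-complete (nonzeroVecs n) (λ _ → false) M))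
  where
  same : ∀ {h} → (∀ v → v ∈ nonzeroVecs n → M v ≡ h v) × (∀ v → v ∉ nonzeroVecs n → h v ≡ false) → M ≗ h
  same {h} (p , q) v with v ≟V zeros
  ... | yes refl = trans m0 (sym (q zeros λ m → filter-elim (λ v → ¬? (v ≟V zeros)) {allVecs n} m refl))
  ... | no ne = p v (any-filter (λ v → ¬? (v ≟V zeros)) (any-weaken (λ { refl → refl , ne }) (∈-allVecs v)))

length-allMatroids : ∀ n → length (allMatroids n) ≤ 2 ^ # (nonzero {n})
length-allMatroids n = ≤-trans (≤-reflexive (cong length (funsOn≡assigns (nonzeroVecs n)))) (≤-trans (length-assigns (nonzeroVecs n) (λ _ → false))
  (2^-mono (≤-trans (#-NoDup (nonzeroVecs n) (NoDup-filter (λ v → ¬? (v ≟V zeros)) (NoDup-allVecs n)))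
    (#-mono λ v p → not-intro (does-intro-¬ (v ≟V zeros) (filter-elim (λ v → ¬? (v ≟V zeros)) {allVecs n} (inList-elim {W = nonzeroVecs n} p)))))))

-- Double negation commutes with finite quantifiers

¬¬-∀∈ : ∀ {A : Set} {Q : A → Set} (xs : List A) → (∀ x → x ∈ xs → ¬ ¬ Q x) → ¬ ¬ (∀ x → x ∈ xs → Q x)
¬¬-∀∈ [] h k = k λ x ()
¬¬-∀∈ (x ∷ xs) h k = h x (here refl) λ q → ¬¬-∀∈ xs (λ y m → h y (there m)) λ qs → k λ { y (here refl) → q ; y (there m) → qs y m }

¬¬-∀ : ∀ {A : Set} {Q : A → Set} → Enum A → (∀ x → ¬ ¬ Q x) → ¬ ¬ (∀ x → Q x)
¬¬-∀ E h k = ¬¬-∀∈ (elems E) (λ x _ → h x) λ q → k λ x → q x (complete E x)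

¬¬-∀F : ∀ {r} {Q : Matroid r → Set} → (∀ {F G} → F ≗ G → Q F → Q G) → (∀ F → ¬ ¬ Q F) → ¬ ¬ (∀ F → Q F)
¬¬-∀F {r} {Q} ext h k = ¬¬-∀∈ tables (λ F _ → h F) λ q → k λ F →
    let (G , m , e) = find (allFuns-complete r {L = false ∷ true ∷ []} {P = λ u b → F u ≡ b} (λ u → either (F u))) in ext (λ u → sym (e u)) (q G m)
  where
  tables : List (Matroid r)
  tables = allFuns r (false ∷ true ∷ [])
  either : ∀ b → b ∈ false ∷ true ∷ []
  either false = here refl
  either true = there (here refl)

¬¬-em : ∀ {A : Set} → ¬ ¬ (A ⊎ ¬ A)
¬¬-em k = k (inj₂ λ a → k (inj₁ a))

greatest : ∀ {Q : ℕ → Set} (Q? : ∀ D → Dec (Q D)) b → (∀ D → Q D → D ≤ b) → ∀ D₀ → Q D₀ → ∃ λ Dm → Q Dm × (∀ D → Q D → D ≤ Dm)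
greatest Q? zero h D₀ q₀ = D₀ , q₀ , λ D q → ≤-trans (h D q) z≤n
greatest {Q} Q? (suc b) h D₀ q₀ with Q? (suc b)
... | yes q = suc b , q , h
... | no ¬q = greatest Q? b (λ D q → ≤-pred (≤∧≢⇒< (h D q) λ e → ¬q (subst Q e q))) D₀ q₀

miss-coeff : ℕ → ℕ → ℕ
miss-coeff κ D = 2 ^ tile-size κ D * tile-size κ D * (D + D + suc (2 ^ (κ + D)))

miss-poly : ∀ κ D n → suc n * miss-bound n κ D ≤ miss-coeff κ D * (n * n) + miss-coeff κ D
miss-poly κ D n = begin
  suc n * (P * suc ((n ∸ κ) * D + Y) * t) ≤⟨ *-monoʳ-≤ (suc n) (*-monoˡ-≤ t (*-monoʳ-≤ P (s≤s (+-monoˡ-≤ Y (*-monoˡ-≤ D (m∸n≤m n κ)))))) ⟩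
  suc n * (P * suc (n * D + Y) * t) ≡⟨ solve 5 (λ n P D Y t → (con 1 :+ n) :* (P :* (con 1 :+ (n :* D :+ Y)) :* t) := P :* t :* (D :* (n :* n) :+ D :* n :+ (con 1 :+ Y) :* (con 1 :+ n))) refl n P D Y t ⟩
  P * t * (D * (n * n) + D * n + suc Y * suc n) ≤⟨ *-monoʳ-≤ (P * t) (+-mono-≤ (+-monoʳ-≤ (D * (n * n)) (*-monoʳ-≤ D (nn n))) (*-monoʳ-≤ (suc Y) (s≤s (nn n)))) ⟩
  P * t * (D * (n * n) + D * (n * n) + suc Y * suc (n * n)) ≤⟨ *-monoʳ-≤ (P * t) (m≤m+n _ (D + D)) ⟩
  P * t * (D * (n * n) + D * (n * n) + suc Y * suc (n * n) + (D + D)) ≡⟨ solve 5 (λ q P D Y t → P :* t :* (D :* q :+ D :* q :+ (con 1 :+ Y) :* (con 1 :+ q) :+ (D :+ D)) := P :* t :* (D :+ D :+ (con 1 :+ Y)) :* q :+ P :* t :* (D :+ D :+ (con 1 :+ Y))) refl (n * n) P D Y t ⟩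
  P * t * (D + D + suc Y) * (n * n) + P * t * (D + D + suc Y) ∎
  where
  open ≤-Reasoning
  open +-*-Solver
  P t Y : ℕ
  P = 2 ^ tile-size κ D
  t = tile-size κ D
  Y = 2 ^ (κ + D)
  nn : ∀ n → n ≤ n * n
  nn zero = z≤n
  nn (suc n) = m≤m+n (suc n) (n * suc n)

module Threshold (k : ℕ) where

  start : ∀ κ d D → Σ ℕ λ n₀ → ∀ n → n₀ ≤ n →
    Cov (GoodSet (suc κ) (centre-dim (suc κ) d) (suc D) (miss-bound n (suc κ) (suc D)) n) (2 ^ ((2 ^ n ∸ 2 ^ (n ∸ suc κ)) ∸ n))
  start κ d D = set-count κ (centre-dim (suc κ) d) (suc D) (λ n → miss-bound n (suc κ) (suc D)) (miss-coeff (suc κ) (suc D)) (miss-poly (suc κ) (suc D))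

  abstract
    -- A bound for the finitely many thresholds that can occur for a level `D`, over `κ` up to
    -- `k + D` and `d` up to `D`; the first summand leaves room for the dimensions of the
    -- configurations.
    f : ℕ → ℕ
    f D = (suc k + suc k + (D + D)) + sum (L.concatMap (λ κ → L.map (λ d → proj₁ (start κ d D)) (L.upTo (suc D))) (L.upTo (suc (k + D))))

    f≥ : ∀ D → suc k + suc k + (D + D) ≤ f D
    f≥ D = m≤m+n _ _

    start≤f : ∀ κ d D → κ ≤ k + D → d ≤ D → proj₁ (start κ d D) ≤ f D
    start≤f κ d D κ≤ d≤ = ≤-trans (∈⇒≤sum _ (any-concatMap (λ κ → L.map (λ d → proj₁ (start κ d D)) (L.upTo (suc D)))
      (any-weaken (λ { refl → ∈-map⁺ (λ d → proj₁ (start κ d D)) (∈-upTo⁺ (s≤s d≤)) }) (∈-upTo⁺ (s≤s κ≤))))) (m≤n+m _ (suc k + suc k + (D + D)))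

  f>D : ∀ D → D ≤ f D
  f>D D = ≤-trans (≤-trans (m≤m+n D D) (m≤n+m (D + D) (suc k + suc k))) (f≥ D)

-- The typical structure theorem

module Ratio (P : Property) (isP : IsProperty P) (her : Hereditary P) (k₀ : ℕ) where
  k : ℕ
  k = suc k₀
  open Threshold k
  open Prop P isP her
  open Target P isP her k f

  Forbidden : ∀ {m} → Matroid m → ℕ → Set
  Forbidden {m} N D = f D ≤ m × Σ (Vec (F2^ m) (suc D)) λ ψ → Inj ψ × Σ (Matroid (k + suc D)) λ F →
    (∀ v → NonZero v → F (zeros {k} ++ᵛ v) ≡ N (lin ψ v)) × ¬ P (k + suc D) F × ¬ Escape D m

  -- All quantifiers of `T` are finite: `D` is bounded because `D ≤ f D ≤ m`, and matroids count
  -- only up to pointwise equality. So a failure yields a counterexample up to double negation.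
  ¬T⇒Forbidden : ∀ {m} (N : Matroid m) → ¬ T m N → ¬ ¬ (∃ (Forbidden N))
  ¬T⇒Forbidden {m} N ¬t none = ¬¬-∀∈ (L.upTo (suc m)) (λ D _ → levels D) λ t → ¬t λ D le → t D (∈-upTo⁺ (s≤s (≤-trans (f>D D) le))) le
    where
    Level : ℕ → Set
    Level D = f D ≤ m → (ψ : LinMap (suc D) m) → Injective ψ → Ext⊆ m D (λ v → N (apply ψ v))
    levels : ∀ D → ¬ ¬ Level D
    levels D with f D ≤? m
    ... | no ¬l = λ k → k λ l → ⊥-elim (¬l l)
    ... | yes l = λ k → ¬¬-∀ (enumVT {suc D} {m}) each λ t → k λ _ → t
      where
      each : ∀ ψ → ¬ ¬ (Injective ψ → Ext⊆ m D (λ v → N (apply ψ v)))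
      each ψ k' = ¬¬-em λ { (inj₂ ¬i) → k' λ i → ⊥-elim (¬i i)
                          ; (inj₁ i) → ¬¬-∀F respF (λ F k'' → ¬¬-em λ { (inj₂ ¬e) → k'' λ e → ⊥-elim (¬e e)
                                                                        ; (inj₁ e) → k'' λ e' → ⊥-elim (none (D , l , colsOf ψ , columns-Inj ψ i , F ,
                                                                            (λ v nzv → trans (e v nzv) (cong N (sym (lin-colsOf ψ v)))) ,
                                                                            (λ p → k'' λ _ → inj₁ p) , λ s → k'' λ _ → inj₂ s)) }) λ t → k' λ _ → t }
        where
        respF : ∀ {F G : Matroid (k + suc D)} → F ≗ G → ((∀ v → NonZero v → F (zeros {k} ++ᵛ v) ≡ N (apply ψ v)) → P (k + suc D) F ⊎ Escape D m) →
          ((∀ v → NonZero v → G (zeros {k} ++ᵛ v) ≡ N (apply ψ v)) → P (k + suc D) G ⊎ Escape D m)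
        respF eq t e = [ (λ p → inj₁ (ext (λ v _ → eq v) p)) , inj₂ ]′ (t λ v nzv → trans (eq _) (e v nzv))

  ¬Full⇒∃ : ∀ κ i d → ¬ Full κ i d → ¬ ¬ (∃ λ (F : Matroid (κ + suc d)) → (∀ v → NonZero v → F (zeros {κ} ++ᵛ (false ∷ v)) ≡ i) × ¬ P (κ + suc d) F)
  ¬Full⇒∃ κ i d ¬full none = ¬¬-∀F {Q = λ F → (∀ v → NonZero v → F (zeros {κ} ++ᵛ (false ∷ v)) ≡ i) → P (κ + suc d) F}
    (λ eq t c → ext (λ v _ → eq v) (t λ v nzv → trans (eq _) (c v nzv)))
    (λ F k' → ¬¬-em λ { (inj₂ ¬c) → k' λ c → ⊥-elim (¬c c) ; (inj₁ c) → none (F , c , λ p → k' λ _ → p) }) ¬full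

  Ext-≗ : ∀ {n} {M M' : Matroid n} → M ≗ M' → Ext k T n M → Ext k T n M'
  Ext-≗ eq (m , N , t , le , ψ , inj , agree) = m , N , t , le , ψ , inj , λ v nzv → trans (agree v nzv) (eq _)

  LowI : ℕ → Bool → ℕ → Set
  LowI κ i n = (M : Matroid n) → (∀ v → NonZero v → inSpan (emb (m∸n≤m n κ)) v ≡ true → M v ≡ i) → P n M

  -- One of 𝓜(κ,0) and 𝓜(κ,1) lies in `P` at dimension `n`, tested on matroids that are constant on
  -- a standard subspace.
  Low : ℕ → ℕ → Set
  Low κ n = ∃ λ i → LowI κ i n

  codim≤ : ∀ n κ → n ≤ (n ∸ κ) + κ
  codim≤ n κ = ≤-trans (m≤n+m∸n n κ) (≤-reflexive (+-comm κ (n ∸ κ)))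

  InExt-emb : ∀ n κ i (M : Matroid n) → (∀ v → NonZero v → inSpan (emb (m∸n≤m n κ)) v ≡ true → M v ≡ i) → InExtOf κ (λ (_ : F2^ (n ∸ κ)) → i) M
  InExt-emb n κ i M c = codim≤ n κ , matrix B , matrix-injective B iB , λ v nzv → sym (trans (cong M (apply-matrix B v))
      (c (lin B v) (λ e → nzv (iB v e)) (does-intro (inSpan? B (lin B v)) (v , refl))))
    where
    B : Vec (F2^ n) (n ∸ κ)
    B = emb (m∸n≤m n κ)
    iB : Inj B
    iB = emb-Inj (m∸n≤m n κ)

  Full⇒LowI : ∀ κ i n → Full κ i (n ∸ suc κ) → LowI (suc κ) i n
  Full⇒LowI κ i n full M c = full⇒ext (suc κ) i (n ∸ suc κ) (full-shift κ i (n ∸ suc κ) full) (λ _ → i) M (λ _ _ → refl) (InExt-emb n (suc κ) i M c)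

  low-k : CriticalNumber P k → ∀ n → Low k n
  low-k ((i , sub) , _) n = i , λ M c → sub n M (n ∸ k , (λ _ → i) , (λ _ _ → refl) , InExt-emb n k i M c)

  -- F is placed in a complement of the subspace on which the matroid is constant.
  low-all : ∀ κ n r → Low κ n → r ≤ κ → r ≤ n → (F : Matroid r) → P r F
  low-all κ n r (i , low) r≤κ r≤n F = go (splitting B iB)
    where
    B : Vec (F2^ n) (n ∸ κ)
    B = emb (m∸n≤m n κ)
    iB : Inj B
    iB = emb-Inj (m∸n≤m n κ)
    go : (Σ ℕ λ j → Σ (Vec (F2^ n) j) λ A → Split A B) → P r F
    go (j , A , sp) = ext same (restrict θ iθ (low M^ λ v _ e → cong (λ b → if b then i else pick v (rep? v)) e))
      where
      r≤j : r ≤ j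
      r≤j = +-cancelʳ-≤ (n ∸ κ) r j (≤-trans lem (≤-reflexive (split-dims sp)))
        where
        lem : r + (n ∸ κ) ≤ n
        lem with κ ≤? n
        ... | yes l = ≤-trans (+-monoˡ-≤ (n ∸ κ) r≤κ) (≤-reflexive (m+[n∸m]≡n l))
        ... | no ¬l = ≤-trans (≤-reflexive (trans (cong (r +_) (m≤n⇒m∸n≡0 (<⇒≤ (≰⇒> ¬l)))) (+-identityʳ r))) r≤n
      θ : Vec (F2^ n) r
      θ = A ⊙ emb r≤j
      indθ : ∀ y u → lin θ y ≡ lin B u → y ≡ zeros
      indθ y u e = emb-Inj r≤j y (proj₁ (Split.to-inj sp {lin (emb r≤j) y} {zeros} {zeros} {u} (trans (cong (lin A (lin (emb r≤j) y) ⊕_) (lin-zero B))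
        (trans (⊕-idʳ _) (trans (sym (lin-⊙ A (emb r≤j) y)) (trans e (sym (trans (cong (_⊕ lin B u) (lin-zero A)) (⊕-idˡ _)))))))))
      iθ : Inj θ
      iθ y e = indθ y zeros (trans e (sym (lin-zero B)))
      rep? : ∀ w → Dec (∃ λ y → w ≡ lin θ y)
      rep? = inSpan? θ
      pick : ∀ w → Dec (∃ λ y → w ≡ lin θ y) → Bool
      pick w (yes (y , _)) = F y
      pick w (no _) = false
      M^ : Matroid n
      M^ w = if inSpan B w then i else pick w (rep? w)
      same : ∀ y → NonZero y → M^ (lin θ y) ≡ F y
      same y nzy = trans (cong (λ b → if b then i else pick (lin θ y) (rep? (lin θ y))) (does-intro-¬ (inSpan? B (lin θ y)) λ (u , e) → nzy (indθ y u e))) (aux (rep? (lin θ y)))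
        where
        aux : (d : Dec (∃ λ y' → lin θ y ≡ lin θ y')) → pick (lin θ y) d ≡ F y
        aux (yes (y' , e)) = cong F (sym (Inj⇒≡ θ iθ y y' e))
        aux (no ¬r) = ⊥-elim (¬r (y , refl))

  -- The largest `κ` at dimension `n` is reached by climbing from `k`. The climb stops below `r`: at
  -- `κ ≥ r` every matroid of dimension `r` would be in `P`, including `F`.
  top : ∀ n r → r ≤ n → (F : Matroid r) → ¬ P r F → ∀ t κ → k ≤ κ → r ≤ κ + t → Low κ n →
    ¬ ¬ (∃ λ κ → k ≤ κ × κ < r × Low κ n × ¬ Low (suc κ) n)
  top n r r≤n F ¬p zero κ k≤ r≤ low none = ¬p (low-all κ n r low (≤-trans r≤ (≤-reflexive (+-identityʳ κ))) r≤n F)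
  top n r r≤n F ¬p (suc t) κ k≤ r≤ low none = ¬¬-em λ
    { (inj₁ low') → top n r r≤n F ¬p t (suc κ) (m≤n⇒m≤1+n k≤) (≤-trans r≤ (≤-reflexive (+-suc κ t))) low' none
    ; (inj₂ ¬low) → none (κ , k≤ , ≰⇒> (λ r≤κ → ¬p (low-all κ n r low r≤κ r≤n F)) , low , ¬low) }

  low-count : ∀ κ n {a} → Low κ n → Count (P n) (allMatroids n) a → 2 ^ (2 ^ n ∸ 2 ^ (n ∸ κ)) ≤ a
  low-count κ n (i , low) cnt = ≤-trans (≤-reflexive (cong (2 ^_) (sym size))) (cov-free-lower (# D) D g refl (ys , ≤-reflexive len , cover))
    where
    B : Vec (F2^ n) (n ∸ κ)
    B = emb (m∸n≤m n κ)
    D g : F2^ n → Bool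
    D = not ∘ inSpan B
    g v = if eqV v zeros then false else i
    size : # D ≡ 2 ^ n ∸ 2 ^ (n ∸ κ)
    size = trans (sym (m+n∸m≡n (2 ^ (n ∸ κ)) (# D))) (cong (_∸ 2 ^ (n ∸ κ)) (trans (cong (_+ # D) (sym (#-inSpan B (emb-Inj (m∸n≤m n κ))))) (#-not (inSpan B))))
    open Counting {Q = P n} {R = P n}
    ys : List (Matroid n)
    ys = proj₁ (chosen cnt)
    len : length ys ≡ _
    len = proj₁ (proj₂ (chosen cnt))
    cover : ∀ M → Free D g M → Any (M ≗_) ys
    cover M fr = let (M' , mem , eq) = find (allMatroids-complete M m0) in
        lose (proj₂ (proj₂ (chosen cnt)) mem (ext (λ v _ → eq v) pM)) eq
      where
      m0 : M zeros ≡ false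
      m0 = trans (fr zeros (cong not (does-intro (inSpan? B zeros) (zeros , sym (lin-zero B))))) (cong (λ b → if b then false else i) (does-intro (zeros {n} ≟V zeros) refl))
      pM : P n M
      pM = low M λ v nzv e → trans (fr v (cong not e)) (cong (λ b → if b then false else i) (does-intro-¬ (v ≟V zeros) nzv))

  -- The entries outside the bad class together with a cover of the bad class cover all matroids,
  -- whose number is known; comparing lengths bounds `a` by `b + K`.
  bad-count : ∀ n {a b K} → Count (P n) (allMatroids n) a → Count (λ M → P n M × Ext k T n M) (allMatroids n) b →
    Cov (λ M → M zeros ≡ false × P n M × ¬ Ext k T n M) K → a ≤ b + K
  bad-count n {a} {b} {K} ca cb (L , len , cov) = +-cancelˡ-≤ N _ _ (begin
      N + a ≤⟨ +-monoˡ-≤ a lower ⟩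
      length zs + K + a ≡⟨ solve 3 (λ z K a → z :+ K :+ a := (z :+ a) :+ K) refl (length zs) K a ⟩
      length zs + a + K ≡⟨ cong (_+ K) (proj₁ (proj₂ oth)) ⟩
      length (allMatroids n) + b + K ≤⟨ +-monoˡ-≤ K (+-monoˡ-≤ b (length-allMatroids n)) ⟩
      N + b + K ≡⟨ +-assoc N b K ⟩
      N + (b + K) ∎)
    where
    open ≤-Reasoning
    open +-*-Solver
    open Counting {Q = P n} {R = Ext k T n}
    N : ℕ
    N = 2 ^ # (nonzero {n})
    oth : Σ (List (Matroid n)) λ zs → length zs + a ≡ length (allMatroids n) + b × (∀ {x} → x ∈ allMatroids n → x ∈ zs ⊎ (P n x × ¬ Ext k T n x))
    oth = others ca cb
    zs : List (Matroid n)
    zs = proj₁ oth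
    lower : N ≤ length zs + K
    lower = cov-free-lower (# (nonzero {n})) nonzero (λ _ → false) refl (zs ++ L , ≤-trans (≤-reflexive (length-++ zs)) (+-monoʳ-≤ (length zs) len) , cover)
      where
      cover : ∀ M → Free nonzero (λ _ → false) M → Any (M ≗_) (zs ++ L)
      cover M fr = let (M' , mem , eq) = find (allMatroids-complete M m0) in
          [ (λ z → AnyP.++⁺ˡ (lose z eq)) , (λ (p , ¬e) → AnyP.++⁺ʳ zs (cov M (m0 , ext (λ v _ → sym (eq v)) p , λ e → ¬e (Ext-≗ eq e)))) ]′ (proj₂ (proj₂ oth) mem)
        where
        m0 : M zeros ≡ false
        m0 = fr zeros (cong not (does-intro (zeros {n} ≟V zeros) refl))

  module At (n : ℕ) (ca : ∃ (Count (P n) (allMatroids n))) (cb : ∃ (Count (λ M → P n M × Ext k T n M) (allMatroids n))) where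

    Bad : Class n
    Bad M = M zeros ≡ false × P n M × ¬ Ext k T n M

    Bad? : ∀ M → Dec (Bad M)
    Bad? M with M zeros in m0
    ... | true = no λ ()
    ... | false = let (M' , mem , eq) = find (allMatroids-complete M m0) in
        decide M' eq (Counting.decided {Q = P n} {R = P n} (proj₂ ca) mem) (Counting.decided {Q = λ M → P n M × Ext k T n M} {R = P n} (proj₂ cb) mem)
      where
      decide : ∀ M' → M ≗ M' → Dec (P n M') → Dec (P n M' × Ext k T n M') → Dec (false ≡ false × P n M × ¬ Ext k T n M)
      decide M' eq (no ¬p) _ = no λ (_ , p , _) → ¬p (ext (λ v _ → eq v) p)
      decide M' eq (yes p) (yes (_ , e)) = no λ (_ , _ , ¬e) → ¬e (Ext-≗ (λ v → sym (eq v)) e)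
      decide M' eq (yes p) (no ¬pe) = yes (refl , ext (λ v _ → sym (eq v)) p , λ e → ¬pe (p , Ext-≗ eq e))

    Bad-≗ : ∀ {M M'} → M ≗ M' → Bad M → Bad M'
    Bad-≗ eq (m0 , p , ¬e) = trans (sym (eq zeros)) m0 , ext (λ v _ → eq v) p , λ e → ¬e (Ext-≗ (λ v → sym (eq v)) e)

    forbidden : ∀ {m} (B : Vec (F2^ n) m) → Inj B → n ≤ m + k → ∀ M → ¬ Ext k T n M → ¬ ¬ (∃ (Forbidden (M ∘ lin B)))
    forbidden {m} B iB le M ¬e = ¬T⇒Forbidden (M ∘ lin B) λ t → ¬e (m , M ∘ lin B , t , le , matrix B , matrix-injective B iB , λ v _ → cong M (sym (apply-matrix B v)))

    -- Bad matroids may fail `T` at different levels `D`. The greatest level `Dm` active at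
    -- dimension `n - k` bounds them all, also the size `d` of the omitted matroids, and its
    -- threshold is already below `n`.
    module _ (e d Dm : ℕ) (fDm : f Dm ≤ n ∸ k) (e≤ : e ≤ Dm) (d≤ : d ≤ Dm) (max : ∀ D → f D ≤ n ∸ k → D ≤ Dm) where

      room : suc k + suc k + (Dm + Dm) ≤ n ∸ k
      room = ≤-trans (f≥ Dm) fDm

      ke≤n : k + e ≤ n
      ke≤n = ≤-trans (+-mono-≤ (≤-trans (n≤1+n k) (m≤m+n (suc k) (suc k))) (≤-trans e≤ (m≤m+n Dm Dm))) (≤-trans room (m∸n≤m n k))

      k≤n : k ≤ n
      k≤n = ≤-trans (m≤m+n k e) ke≤n

      dim≡ : e + (n ∸ (k + e)) ≡ n ∸ k
      dim≡ = trans (cong (e +_) (sym (∸-+-assoc n k e))) (m+[n∸m]≡n (m+n≤o⇒m≤o∸n e (≤-trans (≤-reflexive (+-comm e k)) ke≤n)))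

      D'≤r : suc Dm ≤ n ∸ (k + e)
      D'≤r = +-cancelˡ-≤ e (suc Dm) (n ∸ (k + e)) (≤-trans (≤-trans (+-monoˡ-≤ (suc Dm) e≤) (≤-trans (≤-reflexive (+-suc Dm Dm)) (+-monoˡ-≤ (Dm + Dm) {1} {suc k + suc k} (s≤s z≤n)))) (≤-trans room (≤-reflexive (sym dim≡))))

      starved : (A : Vec (F2^ n) (k + e)) (B : Vec (F2^ n) (n ∸ (k + e))) → Split A B → ∀ M → Bad M →
        ¬ ¬ (∃₂ λ (Y : Vec (F2^ (n ∸ (k + e))) (suc Dm)) (X : Matroid ((k + e) + suc Dm)) → Inj Y × ¬ P ((k + e) + suc Dm) X ×
          (∀ v → NonZero v → X (zeros {k + e} ++ᵛ v) ≡ M (lin B (lin Y v))))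
      starved A B sp M (_ , _ , ¬ext) none with V.splitAt k A
      -- The span of `A₂` and `B` has codimension `k`, so the restriction of `M` to it cannot lie in
      -- `T`; amalgamation moves the resulting forbidden extension down to ⟨B⟩.
      ... | A₁ , A₂ , refl = forbidden (A₂ ++ᵛ B) iU le M ¬ext λ (D , fD , ψ , iψ , F , eF , ¬pF , _) →
          let (Y , iY , h , h-⊕ , Yh) = Amalgam.cover {k} {e} {n ∸ (k + e)} {D} ψ iψ (suc Dm) (s≤s (max D (≤-trans fD (≤-reflexive dim≡)))) D'≤r in
          none (Amalgam.amalgam {k} {e} {n ∸ (k + e)} {D} ψ iψ M A₂ B F eF P isP her Y iY h h-⊕ Yh ¬pF)
        where
        iU : Inj (A₂ ++ᵛ B)
        iU = Indep⇒Inj A₂ B λ c v eq → aux c v (Split.indep sp (zeros {k} ++ᵛ c) v (trans (cong (_⊕ lin B v) (trans (lin-++ A₁ A₂ zeros c) (trans (cong (_⊕ lin A₂ c) (lin-zero A₁)) (⊕-idˡ _)))) eq))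
          where
          aux : ∀ c v → zeros {k} ++ᵛ c ≡ zeros × v ≡ zeros → c ≡ zeros × v ≡ zeros
          aux c v (p , q) = proj₂ (++-zeros (zeros {k}) c p) , q
        le : n ≤ (e + (n ∸ (k + e))) + k
        le = ≤-trans (codim≤ n k) (+-monoˡ-≤ k (≤-reflexive (sym dim≡)))

      cov-bad : (X : Bool → Matroid ((k + e) + suc d)) → (∀ i v → NonZero v → X i (zeros {k + e} ++ᵛ (false ∷ v)) ≡ i) → (∀ i → ¬ P ((k + e) + suc d) (X i)) →
        Cov Bad (2 ^ ((2 ^ n ∸ 2 ^ (n ∸ (k + e))) ∸ n))
      cov-bad X constX ¬PX = pajor (# (nonzero {n})) nonzero Bad refl Bad? Bad-≗ supp (cov-⊆ good (proj₂ (start (k₀ + e) d Dm) n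
          (≤-trans (start≤f (k₀ + e) d Dm (+-mono-≤ (n≤1+n k₀) e≤) d≤) (≤-trans fDm (m∸n≤m n k)))))
        where
        open Shattering P isP her {n} Bad (λ M b → proj₁ (proj₂ b))
        supp : ∀ M → Bad M → Supp nonzero M
        supp M (m0 , _) v ev = trans (cong M (decidable-stable (v ≟V zeros) λ ne → true≢false (not-intro (does-intro-¬ (v ≟V zeros) ne)) ev)) m0
        good : ∀ S → Supp nonzero S × Shatters Bad S → GoodSet (k + e) (centre-dim (k + e) d) (suc Dm) (miss-bound n (k + e) (suc Dm)) n S
        good S (sup , sh) = s0 , shattered-avoids (k + e) d (ramsey-dim d) (lift-dim (k + e) d) (proj₂ (ramsey d d)) (<-≤-trans (n<2^n (lift-dim (k + e) d)) (2^-mono (m≤m+n (lift-dim (k + e) d) (ramsey-dim d)))) X constX ¬PX S s0 sh ,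
            λ A B sp → shattered-starved (k₀ + e) (suc Dm) A B sp (starved A B sp) S sh
          where
          s0 : S zeros ≡ false
          s0 = sup zeros (cong not (does-intro (zeros {n} ≟V zeros) refl))

  n≤E : ∀ n κ → suc κ ≤ n → n ≤ 2 ^ n ∸ 2 ^ (n ∸ suc κ)
  n≤E (suc n) κ (s≤s le) = m+n≤o⇒m≤o∸n (suc n) (≤-trans (+-mono-≤ (n<2^n n) (2^-mono (m∸n≤m n κ))) (≤-reflexive (2*2^ n)))

  ratio : CriticalNumber P k → RatioTendsToOne P (Ext k T)
  -- At `n ≥ j + 1` the saved factor 2^n exceeds `j + 1`. If every counted matroid of `P` is in
  -- `Ext k T` the difference is zero; otherwise a bad one supplies the level `D₀` that starts the
  -- argument.
  ratio crit j = suc j , λ n j<n a b ca cb → decidable-stable (suc j * (a ∸ b) ≤? a) λ fail → contra n j<n a b ca cb fail (Counting.compare {Q = P n} {R = Ext k T n} ca cb)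
    where
    contra : ∀ n → suc j ≤ n → ∀ a b → Count (P n) (allMatroids n) a → Count (λ M → P n M × Ext k T n M) (allMatroids n) b →
      ¬ (suc j * (a ∸ b) ≤ a) → a ≤ b ⊎ (∃ λ M → P n M × ¬ Ext k T n M) → ⊥
    contra n j<n a b ca cb fail (inj₁ a≤b) = fail (≤-trans (≤-reflexive (trans (cong (suc j *_) (m≤n⇒m∸n≡0 a≤b)) (*-zeroʳ (suc j)))) z≤n)
    contra n j<n a b ca cb fail (inj₂ (M , _ , ¬e)) = forbidden (emb (m∸n≤m n k)) (emb-Inj (m∸n≤m n k)) (codim≤ n k) M ¬e step₁
      where
      open At n (a , ca) (b , cb)
      step₁ : ¬ ∃ (Forbidden (M ∘ lin (emb (m∸n≤m n k))))
      step₁ (D₀ , fD₀ , _ , _ , F , _ , ¬pF , ¬esc) = top n r r≤n F ¬pF r k ≤-refl (m≤n+m r k) (low-k crit n) step₂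
        where
        r : ℕ
        r = k + suc D₀
        r≤n : r ≤ n
        r≤n = ≤-trans (≤-trans (≤-trans (≤-reflexive (+-suc k D₀)) (+-mono-≤ (m≤m+n (suc k) (suc k)) (m≤m+n D₀ D₀))) (≤-trans (f≥ D₀) fD₀)) (m∸n≤m n k)
        step₂ : ¬ (∃ λ κ → k ≤ κ × κ < r × Low κ n × ¬ Low (suc κ) n)
        step₂ (κ , k≤κ , κ<r , low , ¬low) = step₃ (κ ∸ k) (sym (m+[n∸m]≡n k≤κ))
          where
          step₃ : ∀ e → κ ≡ k + e → ⊥
          step₃ e refl = ¬¬MinWit (k + e) (n ∸ suc (k + e)) ((λ fl → ¬low (false , Full⇒LowI (k + e) false n fl)) , λ fl → ¬low (true , Full⇒LowI (k + e) true n fl)) step₄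
            where
            κ≤ : k + e ≤ k + D₀
            κ≤ = ≤-pred (≤-trans κ<r (≤-reflexive (+-suc k D₀)))
            step₄ : ¬ (∃ λ d → MinWit (k + e) d)
            step₄ (d , mw) = step₅ (greatest (λ D → f D ≤? n ∸ k) (n ∸ k) (λ D l → ≤-trans (f>D D) l) D₀ fD₀)
              where
              fd : f d ≤ n ∸ k
              -- A least witness with `f d` beyond the dimension would be an escape, which the
              -- forbidden restriction rules out.
              fd = ≮⇒≥ λ l → ¬esc (k + e , k≤κ , κ≤ , d , mw , l)
              step₅ : (∃ λ Dm → f Dm ≤ n ∸ k × (∀ D → f D ≤ n ∸ k → D ≤ Dm)) → ⊥
              step₅ (Dm , fDm , max) = ¬Full⇒∃ (k + e) false d (proj₁ (proj₁ mw)) λ (X₀ , c₀ , ¬p₀) → ¬Full⇒∃ (k + e) true d (proj₂ (proj₁ mw)) λ (X₁ , c₁ , ¬p₁) →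
                  finish (cov-bad e d Dm fDm (≤-trans (+-cancelˡ-≤ k e D₀ κ≤) (max D₀ fD₀)) (max d fd) max
                    (λ { false → X₀ ; true → X₁ }) (λ { false → c₀ ; true → c₁ }) (λ { false → ¬p₀ ; true → ¬p₁ }))
                where
                E : ℕ
                E = 2 ^ n ∸ 2 ^ (n ∸ (k + e))
                nE : n ≤ E
                nE = n≤E n (k₀ + e) (≤-trans κ≤ (≤-trans (+-monoʳ-≤ k (n≤1+n D₀)) r≤n))
                finish : Cov Bad (2 ^ (E ∸ n)) → ⊥
                finish cov = fail (begin
                  suc j * (a ∸ b) ≤⟨ *-mono-≤ (≤-trans j<n (<⇒≤ (n<2^n n))) (≤-trans (∸-monoˡ-≤ b (bad-count n ca cb cov)) (≤-reflexive (m+n∸m≡n b (2 ^ (E ∸ n))))) ⟩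
                  2 ^ n * 2 ^ (E ∸ n) ≡⟨ trans (*-comm (2 ^ n) _) (2^-split nE) ⟩
                  2 ^ E ≤⟨ low-count (k + e) n low ca ⟩
                  a ∎)
                  where open ≤-Reasoning

theorem1p8 : (P : Property) → IsProperty P → Hereditary P → NonTrivial P →
    (k : ℕ) → CriticalNumber P k →
    Σ Property (λ T → IsProperty T × Thin T × RatioTendsToOne P (Ext k T))
theorem1p8 P isP her nt zero crit = P , isP , (her , nt , crit) , λ j → 0 , λ n _ a b ca cb →
    [ (λ a≤b → ≤-trans (≤-reflexive (trans (cong (suc j *_) (m≤n⇒m∸n≡0 a≤b)) (*-zeroʳ (suc j)))) z≤n) , (λ (M , p , ¬e) → ⊥-elim (¬e (inExt n M p))) ]′
      (Counting.compare {Q = P n} {R = Ext 0 P n} ca cb)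
  where
  inExt : ∀ n M → P n M → Ext 0 P n M
  inExt n M p = n , M , p , ≤-reflexive (sym (+-identityʳ n)) , matrix idCols , matrix-injective idCols (λ v e → trans (sym (lin-id v)) e) ,
    λ v _ → cong M (sym (trans (apply-matrix idCols v) (lin-id v)))
theorem1p8 P isP her nt (suc k₀) crit = T , T-isProperty , T-thin crit , ratio crit
  where
  open Ratio P isP her k₀
  open Target P isP her (suc k₀) (Threshold.f (suc k₀))
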